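{- Let $T$ be a subdivided star with $\alpha(T)\ge 3$. Then almost every $T$-free graph $G$ has a partition of $V(G)$ either into $\alpha(T)-1$ cliques, or into $\alpha(T)-2$ cliques and one stable set.
   Context: Graphs are finite, simple, labeled on $[n]$. $\alpha(\cdot)$ is the stability number. A graph is $T$-free if it has no induced subgraph isomorphic to $T$. "Almost every $T$-free graph" means the proportion of $T$-free graphs on $[n]$ failing the property tends to $0$ as $n\to\infty$. A star is a tree in which all but one vertex are leaves; a subdivided star is a tree obtained from a star by subdividing each edge exactly once. -}

module Defs where

open import Data.Nat using (ℕ; zero; suc; _*_; _∸_; _≤_)
open import Data.Bool using (Bool; true; false)
open import Data.Bool.Properties using () renaming (_≟_ to _≟B_)
open import Data.Fin using (Fin; zero; suc)
open import Data.Fin.Properties using (any?; all?) renaming (_≟_ to _≟F_)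
open import Data.Fin.Subset using (Subset; _∈_; ∣_∣)
open import Data.Vec using (Vec; []; _∷_; lookup)
open import Data.Maybe using (Maybe; just; nothing)
open import Data.List using (List; []; _∷_; concatMap; map; filter; length)
open import Data.Product using (Σ; ∃; _×_; _,_; proj₁; proj₂)
open import Data.Sum using (inj₁; inj₂)
open import Data.Unit using (⊤; tt)
open import Relation.Nullary using (Dec; yes; no; ¬_; _×-dec_; _→-dec_; ¬?)

open import Relation.Binary.PropositionalEquality using (_≡_; refl)
open import Function.Definitions using (Bijective)

-- Labelled simple graphs on [n] = Fin n.
-- A graph on n+1 vertices is a graph on the vertices suc i (i : Fin n)
-- together with the neighbourhood (a Vec Bool n) of the vertex zero.
-- This is a bijective encoding of all simple graphs on a labelled
-- n-element vertex set (each graph is represented exactly once).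

Graph : ℕ → Set
Graph zero    = ⊤
Graph (suc n) = Graph n × Vec Bool n

adj : ∀ {n} → Graph n → Fin n → Fin n → Bool
adj {suc n} (G , v) zero    zero    = false
adj {suc n} (G , v) zero    (suc j) = lookup v j
adj {suc n} (G , v) (suc i) zero    = lookup v i
adj {suc n} (G , v) (suc i) (suc j) = adj G i j

allVecBool : ∀ n → List (Vec Bool n)
allVecBool zero    = [] ∷ []
allVecBool (suc n) = concatMap (λ v → (true ∷ v) ∷ (false ∷ v) ∷ []) (allVecBool n)

allGraphs : ∀ n → List (Graph n)
allGraphs zero    = tt ∷ []
allGraphs (suc n) = concatMap (λ G → map (λ v → G , v) (allVecBool n)) (allGraphs n)

count : ∀ n (P : Graph n → Set) → (∀ G → Dec (P G)) → ℕ
count n P P? = length (filter P? (allGraphs n))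

Searchable : Set → Set₁
Searchable A = (P : A → Set) → (∀ x → Dec (P x)) → Dec (∃ P)

searchFin : ∀ k → Searchable (Fin k)
searchFin k P P? = any? P?

searchMaybe : ∀ {A} → Searchable A → Searchable (Maybe A)
searchMaybe sA P P? with P? nothing
... | yes p = yes (nothing , p)
... | no ¬p with sA (λ a → P (just a)) (λ a → P? (just a))
...   | yes (a , p) = yes (just a , p)
...   | no ¬q = no λ { (nothing , p) → ¬p p ; (just a , p) → ¬q (a , p) }

searchVec : ∀ {A} → Searchable A → ∀ n → Searchable (Vec A n)
searchVec sA zero P P? with P? []
... | yes p = yes ([] , p)
... | no ¬p = no λ { ([] , p) → ¬p p }
searchVec sA (suc n) P P?
  with sA (λ a → ∃ λ w → P (a ∷ w))
          (λ a → searchVec sA n (λ w → P (a ∷ w)) (λ w → P? (a ∷ w)))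
... | yes (a , w , p) = yes (a ∷ w , p)
... | no ¬q = no λ { (a ∷ w , p) → ¬q (a , w , p) }

IsInducedCopy : ∀ {m n} → Graph m → Graph n → Vec (Fin n) m → Set
IsInducedCopy {m} T G f =
  (∀ (i j : Fin m) → lookup f i ≡ lookup f j → i ≡ j) ×
  (∀ (i j : Fin m) → adj G (lookup f i) (lookup f j) ≡ adj T i j)

isInducedCopy? : ∀ {m n} (T : Graph m) (G : Graph n) f → Dec (IsInducedCopy T G f)
isInducedCopy? T G f =
  all? (λ i → all? (λ j → (lookup f i ≟F lookup f j) →-dec (i ≟F j)))
  ×-dec all? (λ i → all? (λ j → adj G (lookup f i) (lookup f j) ≟B adj T i j))

ContainsInduced : ∀ {m n} → Graph m → Graph n → Set
ContainsInduced {m} {n} T G = ∃ λ (f : Vec (Fin n) m) → IsInducedCopy T G f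

Free : ∀ {m n} → Graph m → Graph n → Set
Free T G = ¬ ContainsInduced T G

free? : ∀ {m n} (T : Graph m) (G : Graph n) → Dec (Free T G)
free? {m} {n} T G = ¬? (searchVec (searchFin n) m (IsInducedCopy T G) (isInducedCopy? T G))

-- Partitions of V(G) into cliques / a stable set.
-- A partition into k cliques is given by an assignment c : V(G) → Fin k
-- such that each class c⁻¹(x) is a clique.  A partition into k cliques and
-- one stable set is an assignment c : V(G) → Maybe (Fin k); the class of
-- nothing is the stable set, the class of just x is a clique.
-- (Parts are allowed to be empty.)

IsCliquePartition : ∀ {n} (k : ℕ) → Graph n → Vec (Fin k) n → Set
IsCliquePartition {n} k G c =
  ∀ (i j : Fin n) → ¬ (i ≡ j) → lookup c i ≡ lookup c j → adj G i j ≡ true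

IsCliqueStablePartition : ∀ {n} (k : ℕ) → Graph n → Vec (Maybe (Fin k)) n → Set
IsCliqueStablePartition {n} k G c =
  ∀ (i j : Fin n) → ¬ (i ≡ j) →
    (lookup c i ≡ nothing → lookup c j ≡ nothing → adj G i j ≡ false) ×
    (∀ (x : Fin k) → lookup c i ≡ just x → lookup c j ≡ just x → adj G i j ≡ true)

CliquePartitionable : ∀ {n} (k : ℕ) → Graph n → Set
CliquePartitionable {n} k G = ∃ λ (c : Vec (Fin k) n) → IsCliquePartition k G c

CliqueStablePartitionable : ∀ {n} (k : ℕ) → Graph n → Set
CliqueStablePartitionable {n} k G =
  ∃ λ (c : Vec (Maybe (Fin k)) n) → IsCliqueStablePartition k G c

GoodPartition : ∀ {n} (a : ℕ) → Graph n → Set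
GoodPartition a G =
  Data.Sum._⊎_ (CliquePartitionable (a ∸ 1) G) (CliqueStablePartitionable (a ∸ 2) G)

private
  eqM? : ∀ {k} (x y : Maybe (Fin k)) → Dec (x ≡ y)
  eqM? nothing nothing = yes refl
  eqM? nothing (just y) = no λ ()
  eqM? (just x) nothing = no λ ()
  eqM? (just x) (just y) with x ≟F y
  ... | yes refl = yes refl
  ... | no ne = no λ { refl → ne refl }

goodPartition? : ∀ {n} a (G : Graph n) → Dec (GoodPartition a G)
goodPartition? {n} a G with searchVec (searchFin (a ∸ 1)) n _
       (λ c → all? (λ i → all? (λ j →
          ¬? (i ≟F j) →-dec ((lookup c i ≟F lookup c j) →-dec (adj G i j ≟B true)))))
... | yes p = yes (inj₁ p)
... | no ¬p with searchVec (searchMaybe (searchFin (a ∸ 2))) n _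
       (λ c → all? (λ i → all? (λ j → ¬? (i ≟F j) →-dec
          (((eqM? (lookup c i) nothing) →-dec ((eqM? (lookup c j) nothing) →-dec (adj G i j ≟B false)))
           ×-dec all? (λ x → (eqM? (lookup c i) (just x)) →-dec
                 ((eqM? (lookup c j) (just x)) →-dec (adj G i j ≟B true)))))))
...   | yes q = yes (inj₂ q)
...   | no ¬q = no λ { (inj₁ p) → ¬p p ; (inj₂ q) → ¬q q }

IsStable : ∀ {m} → Graph m → Subset m → Set
IsStable {m} T S = ∀ (i j : Fin m) → i ∈ S → j ∈ S → adj T i j ≡ false

IsStabilityNumber : ∀ {m} → Graph m → ℕ → Set
IsStabilityNumber T a =
  (∃ λ S → IsStable T S × ∣ S ∣ ≡ a) × (∀ S → IsStable T S → ∣ S ∣ ≤ a)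

-- Subdivided stars.
-- The subdivided star with s branches: the star K_{1,s} (centre, leaves
-- ℓ₁..ℓ_s) with each edge centre–ℓᵢ subdivided once by a new vertex mᵢ.

data SVert (s : ℕ) : Set where
  centre : SVert s
  mid    : Fin s → SVert s
  leaf   : Fin s → SVert s

data SAdj {s : ℕ} : SVert s → SVert s → Set where
  c-m : ∀ i → SAdj centre (mid i)
  m-c : ∀ i → SAdj (mid i) centre
  m-l : ∀ i → SAdj (mid i) (leaf i)
  l-m : ∀ i → SAdj (leaf i) (mid i)

IsSubdividedStar : ∀ {m} → Graph m → Set
IsSubdividedStar {m} T =
  ∃ λ (s : ℕ) → Σ (Fin m → SVert s) λ φ →
    Bijective _≡_ _≡_ φ ×
    (∀ (i j : Fin m) → (adj T i j ≡ true → SAdj (φ i) (φ j)) ×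
                       (SAdj (φ i) (φ j) → adj T i j ≡ true))

numFree : ∀ {m} → Graph m → ℕ → ℕ
numFree T n = count n (Free T) (free? T)

numBad : ∀ {m} → Graph m → ℕ → ℕ → ℕ
numBad T a n = count n (λ G → Free T G × ¬ GoodPartition a G)
                       (λ G → free? T G ×-dec ¬? (goodPartition? a G))

{-# OPTIONS --safe #-}
module Submission where

-- Let s = α(T) − 1, the number of branches of T. A vertex can be added to a good graph on n vertices so that
-- it is homogeneous to its smallest class and arbitrary to the others, hence the number g of good graphs
-- satisfies g (n + 1) ≥ 2^((1 − 1/s) n) g n. On the other hand a graph is determined by its restriction to
-- the complement of a bounded set Q, by its restriction to Q and by the adjacencies between the two. If these
-- adjacencies can be described by slightly fewer than (1 − 1/s) |Q| n bits, such graphs are negligible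
-- against g, and they can be discarded repeatedly.
--
-- Pajor's lemma and Ramsey's theorem thus give s homogeneous parts of constant size with a dense and co-dense
-- pattern between any two of them. A vertex which is mixed to all parts would complete a copy of T, so all
-- vertices are almost constant on some part; up to few exceptions this part is unique, and it defines the
-- class of the vertex. Discarding more graphs, the classes become balanced, up to three vertices of one class
-- split every other class evenly, and there are many edges and non-edges between large subsets of different
-- classes. Now two vertices of a class which relate differently to a third one complete a copy of T, and so do
-- two stable classes.

open import Defs
open import Data.Nat using (ℕ; zero; suc; _+_; _*_; _∸_; _^_; _≤_; _<_; z≤n; s≤s; s≤s⁻¹; _≤?_; _<?_; _<ᵇ_; NonZero; >-nonZero)
open import Data.Nat.Properties
open import Data.Nat.DivMod using (_/_; m/n*n≤m; m*n/n≡m; m≡m%n+[m/n]*n; m%n<n; /-monoˡ-≤)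
open import Data.Nat.Tactic.RingSolver using (solve-∀)
open import Data.Bool using (Bool; true; false; _∧_; _∨_; not; if_then_else_)
open import Data.Bool.Properties using () renaming (_≟_ to _≟ᵇ_)
open import Data.Fin using (Fin; zero; suc; toℕ; _↑ˡ_; _↑ʳ_; splitAt; combine; quotient; remainder; punchIn; punchOut; fromℕ<; finToFun; funToFin)
open import Data.Fin.Properties using (any?; all?; splitAt-↑ˡ; splitAt-↑ʳ; join-splitAt; remQuot-combine; combine-remQuot; punchInᵢ≢i; punchIn-injective; punchOut-injective; punchIn-punchOut; pigeonhole; finToFun-funToFin; toℕ-injective) renaming (_≟_ to _≟ᶠ_; suc-injective to sucᶠ-injective)
open import Data.Fin.Permutation using (Permutation′; _⟨$⟩ʳ_; _⟨$⟩ˡ_; inverseˡ; inverseʳ; lift₀; transpose; _∘ₚ_) renaming (id to idₚ)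
open import Data.Fin.Subset using (Subset; ∣_∣)
open import Data.Vec using (Vec; []; _∷_; lookup; tabulate)
open import Data.Vec.Properties using (lookup∘tabulate; tabulate∘lookup; tabulate-cong; ≡-dec; lookup⇒[]=; []=⇒lookup)
open import Data.Maybe using (Maybe; just; nothing)
open import Data.List using (List; []; _∷_; map; concatMap; filter; length; _++_; allFin)
open import Data.List.Properties using (length-map; length-++; length-filter; length-tabulate)
open import Data.List.Membership.Propositional using (_∈_; _∉_; find; lose)
open import Data.List.Membership.Propositional.Properties using (∈-map⁺; ∈-map⁻; ∈-++⁺ˡ; ∈-++⁺ʳ; ∈-++⁻; ∈-filter⁺; ∈-filter⁻; ∈-concat⁺′; ∈-allFin; ∈-∃++)
open import Data.List.Relation.Unary.Any using (here; there) renaming (any? to anyL?)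
open import Data.List.Relation.Unary.All using ([]; _∷_) renaming (lookup to lookupAll; tabulate to tabulateAll)
open import Data.List.Relation.Unary.AllPairs using ([]; _∷_)
open import Data.List.Relation.Unary.Unique.Propositional using (Unique)
import Data.List.Relation.Unary.Unique.Propositional.Properties as UniqueP
open import Data.Product using (∃; _×_; _,_; proj₁; proj₂)
open import Data.Sum using (_⊎_; inj₁; inj₂; [_,_]′)
open import Data.Unit using (⊤; tt)
open import Data.Empty using (⊥; ⊥-elim)
open import Function using (_∘_; id; case_of_)
open import Relation.Nullary using (Dec; yes; no; ¬_; does; _×-dec_; _→-dec_; _⊎-dec_; ¬?)
open import Relation.Nullary.Decidable using (dec-false; map′; decidable-stable; toSum)
open import Relation.Binary.Definitions using (DecidableEquality)
open import Relation.Binary.PropositionalEquality using (_≡_; _≢_; refl; sym; trans; cong; cong₂; subst; subst₂)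

-- Two obstacles shape the proof. Deleting `Q` leaves an arbitrary T-free graph, which is counted by
-- the unknown `f` and not by `g`. So `Mostly` measures exceptional graphs against `M * g n`, where
-- `M` bounds the ratio f / g below n, and `mostly-conclude` closes the induction on the order.
-- Moreover 1 - 1/s is exactly the rate of a vertex that is homogeneous to its own balanced class
-- and arbitrary elsewhere. Such vertices leave no slack, so every step has to exhibit a linear
-- saving of bits that beats all its errors: deviations from homogeneity, imbalance of the classes,
-- the names of the deleted vertices. Listing the classes would itself cost linearly many bits; they
-- are read off from the remaining graph through the constantly many vertices of the structured set,
-- at logarithmic cost (`Classes.describe`). Copies of T arise because two branches and the centre
-- form a path on five vertices: when three of its vertices are given with one or two edges among
-- them, their roles can be chosen so that the other two are adjacent or not, as the type of a part
-- demands.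

∧-split : ∀ {a b} → a ∧ b ≡ true → a ≡ true × b ≡ true
∧-split {true} {true} _ = refl , refl

∧-join : ∀ {a b} → a ≡ true → b ≡ true → a ∧ b ≡ true
∧-join refl refl = refl

∨-split : ∀ {a b} → a ∨ b ≡ true → a ≡ true ⊎ b ≡ true
∨-split {true}  _ = inj₁ refl
∨-split {false} e = inj₂ e

∨-left : ∀ {a b} → a ≡ true → a ∨ b ≡ true
∨-left refl = refl

∨-right : ∀ {a b} → b ≡ true → a ∨ b ≡ true
∨-right {true}  _ = refl
∨-right {false} e = e

not-true : ∀ {a} → not a ≡ true → a ≢ true
not-true {false} _ ()

≢true⇒not : ∀ {a} → a ≢ true → not a ≡ true
≢true⇒not {true}  h = ⊥-elim (h refl)
≢true⇒not {false} _ = refl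

≢false⇒true : ∀ {a} → a ≢ false → a ≡ true
≢false⇒true {true}  _ = refl
≢false⇒true {false} h = ⊥-elim (h refl)

not-false : ∀ {a} → not a ≡ false → a ≡ true
not-false {true} _ = refl

not-true⇒false : ∀ {a} → not a ≡ true → a ≡ false
not-true⇒false {false} _ = refl

bool-cases : ∀ b → b ≡ true ⊎ b ≡ false
bool-cases true  = inj₁ refl
bool-cases false = inj₂ refl

does-sound : ∀ {P : Set} (d : Dec P) → does d ≡ true → P
does-sound (yes p) _ = p

does-complete : ∀ {P : Set} (d : Dec P) → P → does d ≡ true
does-complete (yes _) _ = refl
does-complete (no ¬p) p = ⊥-elim (¬p p)

_==_ : ∀ {n} → Fin n → Fin n → Bool
i == j = does (i ≟ᶠ j)

==-refl : ∀ {n} (i : Fin n) → (i == i) ≡ true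
==-refl i = does-complete (i ≟ᶠ i) refl

==-sound : ∀ {n} {i j : Fin n} → (i == j) ≡ true → i ≡ j
==-sound {i = i} {j} = does-sound (i ≟ᶠ j)

_==ᵇ_ : Bool → Bool → Bool
a ==ᵇ b = does (a ≟ᵇ b)

_≤ᵗ_ : ℕ → ℕ → Bool
m ≤ᵗ n = does (m ≤? n)

-- Sums and counts over Fin n

opaque
  sumF : ∀ {n} → (Fin n → ℕ) → ℕ
  sumF {zero}  f = 0
  sumF {suc n} f = f zero + sumF (f ∘ suc)

bit : Bool → ℕ
bit true  = 1
bit false = 0

opaque
  # : ∀ {n} → (Fin n → Bool) → ℕ
  # p = sumF (bit ∘ p)

opaque
  unfolding sumF #

  sumF-bit : ∀ {n} (p : Fin n → Bool) → sumF (λ x → bit (p x)) ≡ # p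
  sumF-bit p = refl

  sumF-cong : ∀ {n} {f g : Fin n → ℕ} → (∀ i → f i ≡ g i) → sumF f ≡ sumF g
  sumF-cong {zero}  h = refl
  sumF-cong {suc n} h = cong₂ _+_ (h zero) (sumF-cong (h ∘ suc))

  sumF-mono : ∀ {n} {f g : Fin n → ℕ} → (∀ i → f i ≤ g i) → sumF f ≤ sumF g
  sumF-mono {zero}  h = z≤n
  sumF-mono {suc n} h = +-mono-≤ (h zero) (sumF-mono (h ∘ suc))

  +-interchange : ∀ a b c d → (a + b) + (c + d) ≡ (a + c) + (b + d)
  +-interchange = solve-∀

  sumF-+ : ∀ {n} (f g : Fin n → ℕ) → sumF (λ i → f i + g i) ≡ sumF f + sumF g
  sumF-+ {zero}  f g = refl
  sumF-+ {suc n} f g = trans (cong (f zero + g zero +_) (sumF-+ (f ∘ suc) (g ∘ suc)))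
    (+-interchange (f zero) (g zero) _ _)

  sumF-const : ∀ n c → sumF {n} (λ _ → c) ≡ n * c
  sumF-const zero    c = refl
  sumF-const (suc n) c = cong (c +_) (sumF-const n c)

  sumF-*ˡ : ∀ {n} c (f : Fin n → ℕ) → sumF (λ i → c * f i) ≡ c * sumF f
  sumF-*ˡ {zero}  c f = sym (*-zeroʳ c)
  sumF-*ˡ {suc n} c f = trans (cong (c * f zero +_) (sumF-*ˡ c (f ∘ suc))) (sym (*-distribˡ-+ c (f zero) _))

  sumF-swap : ∀ {m n} (f : Fin m → Fin n → ℕ) →
    sumF (λ i → sumF (f i)) ≡ sumF (λ j → sumF (λ i → f i j))
  sumF-swap {zero}  {n} f = sym (trans (sumF-const n 0) (*-zeroʳ n))
  sumF-swap {suc m} {n} f = trans (cong (sumF (f zero) +_) (sumF-swap (f ∘ suc)))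
    (sym (sumF-+ (f zero) _))

  bit-mono : ∀ {a b} → (a ≡ true → b ≡ true) → bit a ≤ bit b
  bit-mono {false} h = z≤n
  bit-mono {true}  h rewrite h refl = ≤-refl

  #-mono : ∀ {n} {p q : Fin n → Bool} → (∀ x → p x ≡ true → q x ≡ true) → # p ≤ # q
  #-mono h = sumF-mono (λ i → bit-mono (h i))

  #-cong : ∀ {n} {p q : Fin n → Bool} → (∀ x → p x ≡ q x) → # p ≡ # q
  #-cong h = sumF-cong (λ i → cong bit (h i))

  #-all : ∀ n → # {n} (λ _ → true) ≡ n
  #-all n = trans (sumF-const n 1) (*-identityʳ n)

  #-none : ∀ n → # {n} (λ _ → false) ≡ 0
  #-none n = trans (sumF-const n 0) (*-zeroʳ n)

  #≤n : ∀ {n} (p : Fin n → Bool) → # p ≤ n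
  #≤n {n} p = ≤-trans (#-mono {p = p} {q = λ _ → true} (λ _ _ → refl)) (≤-reflexive (#-all n))

  bit-∨ : ∀ a b → bit (a ∨ b) ≤ bit a + bit b
  bit-∨ true  b = s≤s z≤n
  bit-∨ false b = ≤-refl

  #-∨ : ∀ {n} (p q : Fin n → Bool) → # (λ x → p x ∨ q x) ≤ # p + # q
  #-∨ p q = ≤-trans (sumF-mono (λ i → bit-∨ (p i) (q i))) (≤-reflexive (sumF-+ (bit ∘ p) (bit ∘ q)))

  #-cover : ∀ {n} (p q r : Fin n → Bool) → (∀ x → p x ≡ true → q x ≡ true ⊎ r x ≡ true) → # p ≤ # q + # r
  #-cover p q r h = ≤-trans (#-mono (λ x e → [ ∨-left , ∨-right {q x} ]′ (h x e))) (#-∨ q r)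

  bit-split : ∀ a b → bit a ≡ bit (a ∧ b) + bit (a ∧ not b)
  bit-split false _     = refl
  bit-split true  true  = refl
  bit-split true  false = refl

  #-split : ∀ {n} (p q : Fin n → Bool) → # p ≡ # (λ x → p x ∧ q x) + # (λ x → p x ∧ not (q x))
  #-split p q = trans (sumF-cong (λ i → bit-split (p i) (q i))) (sumF-+ (λ x → bit (p x ∧ q x)) (λ x → bit (p x ∧ not (q x))))

  #-exists : ∀ {n} (p : Fin n → Bool) → 1 ≤ # p → ∃ λ x → p x ≡ true
  #-exists {suc n} p h with p zero in eq
  ... | true  = zero , eq
  ... | false with #-exists (p ∘ suc) h
  ...   | x , e = suc x , e

  #-pos : ∀ {n} (p : Fin n → Bool) x → p x ≡ true → 1 ≤ # p
  #-pos {suc n} p zero    e rewrite e = s≤s z≤n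
  #-pos {suc n} p (suc x) e = ≤-trans (#-pos (p ∘ suc) x e) (m≤n+m _ _)

  #-zero : ∀ {n} (p : Fin n → Bool) → (∀ x → p x ≢ true) → # p ≡ 0
  #-zero p h = n≤0⇒n≡0 (≮⇒≥ (λ lt → case #-exists p lt of λ { (x , e) → h x e }))

  #-unique : ∀ {n} (p : Fin n → Bool) → (∀ x y → p x ≡ true → p y ≡ true → x ≡ y) → # p ≤ 1
  #-unique {zero}  p h = z≤n
  #-unique {suc n} p h with p zero in eq
  ... | false = #-unique (p ∘ suc) (λ x y ex ey → sucᶠ-injective (h (suc x) (suc y) ex ey))
  ... | true  = s≤s (≤-reflexive (#-zero (p ∘ suc) (λ x e → case h zero (suc x) eq e of λ ())))

  #-singleton : ∀ {n} (y : Fin n) → # (λ x → x == y) ≡ 1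
  #-singleton y = ≤-antisym
    (#-unique (λ x → x == y) (λ a b ea eb → trans (==-sound ea) (sym (==-sound eb))))
    (#-pos (λ x → x == y) y (==-refl y))

  sum-indicator : ∀ {n} (y : Fin n) → sumF (λ j → bit (y == j)) ≡ 1
  sum-indicator y = ≤-antisym
    (#-unique (λ j → y == j) (λ a b ea eb → trans (sym (==-sound {i = y} ea)) (==-sound {i = y} eb)))
    (#-pos (λ j → y == j) y (==-refl y))

  #-injection : ∀ {m n} (p : Fin m → Bool) (q : Fin n → Bool) (f : Fin m → Fin n) →
    (∀ x → p x ≡ true → q (f x) ≡ true) →
    (∀ x y → p x ≡ true → p y ≡ true → f x ≡ f y → x ≡ y) → # p ≤ # q
  #-injection {m} {n} p q f into inj = begin
    sumF (λ x → bit (p x))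
      ≡⟨ sumF-cong (λ x → sym (expand x)) ⟩
    sumF (λ x → sumF (λ y → bit (p x ∧ (f x == y))))
      ≡⟨ sumF-swap (λ x y → bit (p x ∧ (f x == y))) ⟩
    sumF (λ y → # (λ x → p x ∧ (f x == y)))
      ≤⟨ sumF-mono fibre ⟩
    # q ∎
    where
    open ≤-Reasoning
    expand : ∀ x → sumF (λ y → bit (p x ∧ (f x == y))) ≡ bit (p x)
    expand x with p x
    ... | true  = sum-indicator (f x)
    ... | false = #-none n
    fibre : ∀ y → # (λ x → p x ∧ (f x == y)) ≤ bit (q y)
    fibre y with q y in eq
    ... | true  = #-unique (λ x → p x ∧ (f x == y)) λ a b ea eb → inj a b (proj₁ (∧-split ea)) (proj₁ (∧-split eb))
          (trans (==-sound (proj₂ (∧-split {p a} ea))) (sym (==-sound (proj₂ (∧-split {p b} eb)))))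
    ... | false = ≤-reflexive (#-zero (λ x → p x ∧ (f x == y)) λ a ea →
          case trans (sym (trans (cong q (sym (==-sound (proj₂ (∧-split {p a} ea))))) (into a (proj₁ (∧-split ea))))) eq of λ ())

  #-union : ∀ {n r} (p : Fin n → Bool) (q : Fin r → Fin n → Bool) →
    (∀ x → p x ≡ true → ∃ λ i → q i x ≡ true) → # p ≤ sumF (λ i → # (q i))
  #-union {n} {r} p q h = ≤-trans (sumF-mono step) (≤-reflexive (sumF-swap (λ x i → bit (q i x))))
    where
    step : ∀ x → bit (p x) ≤ # (λ i → q i x)
    step x with p x in eq
    ... | false = z≤n
    ... | true with h x eq
    ...   | i , e = #-pos (λ i → q i x) i e

  sumF-bound : ∀ {n} (f : Fin n → ℕ) c → (∀ i → f i ≤ c) → sumF f ≤ n * c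
  sumF-bound {n} f c h = ≤-trans (sumF-mono h) (≤-reflexive (sumF-const n c))

-- Union bound by induction on the list: each `bad x` removes at most `c` elements of `A`, and the
-- same bound holds for what is left of `A`.
avoid : ∀ {n} {X : Set} (A : Fin n → Bool) (bad : X → Fin n → Bool) c (xs : List X) →
  (∀ x → x ∈ xs → # (λ v → A v ∧ bad x v) ≤ c) → length xs * c < # A →
  ∃ λ v → A v ≡ true × (∀ x → x ∈ xs → bad x v ≡ false)
avoid A bad c [] h lt = case #-exists A lt of λ { (v , e) → v , e , λ _ () }
avoid A bad c (x ∷ xs) h lt
  with avoid (λ v → A v ∧ not (bad x v)) bad c xs
    (λ y y∈ → ≤-trans (#-mono (λ v e → ∧-join (proj₁ (∧-split {A v} (proj₁ (∧-split e)))) (proj₂ (∧-split {A v ∧ _} e)))) (h y (there y∈)))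
    (+-cancelˡ-< c _ _ (begin-strict
      c + length xs * c <⟨ lt ⟩
      # A ≡⟨ #-split A (bad x) ⟩
      # (λ v → A v ∧ bad x v) + # (λ v → A v ∧ not (bad x v)) ≤⟨ +-monoˡ-≤ _ (h x (here refl)) ⟩
      c + # (λ v → A v ∧ not (bad x v)) ∎))
  where open ≤-Reasoning
... | v , e , f = v , proj₁ (∧-split e) , λ
  { y (here refl) → not-true⇒false (proj₂ (∧-split {A v} e))
  ; y (there y∈) → f y y∈ }

opaque
  allB : ∀ {n} → (Fin n → Bool) → Bool
  allB p = does (all? (λ i → p i ≟ᵇ true))

  allB-sound : ∀ {n} {p : Fin n → Bool} → allB p ≡ true → ∀ i → p i ≡ true
  allB-sound {p = p} = does-sound (all? (λ i → p i ≟ᵇ true))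

  allB-complete : ∀ {n} {p : Fin n → Bool} → (∀ i → p i ≡ true) → allB p ≡ true
  allB-complete {p = p} = does-complete (all? (λ i → p i ≟ᵇ true))

  anyB : ∀ {n} → (Fin n → Bool) → Bool
  anyB p = does (any? (λ i → p i ≟ᵇ true))

  anyB-sound : ∀ {n} {p : Fin n → Bool} → anyB p ≡ true → ∃ λ i → p i ≡ true
  anyB-sound {p = p} = does-sound (any? (λ i → p i ≟ᵇ true))

  anyB-complete : ∀ {n} {p : Fin n → Bool} i → p i ≡ true → anyB p ≡ true
  anyB-complete {p = p} i e = does-complete (any? (λ i → p i ≟ᵇ true)) (i , e)

searchBool : Searchable Bool
searchBool P P? with P? true | P? false
... | yes p | _     = yes (true , p)
... | no _  | yes p = yes (false , p)
... | no ¬p | no ¬q = no λ { (true , p) → ¬p p ; (false , p) → ¬q p }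

-- Subsets are searched as Boolean vectors, because functions are not extensional.
searchSet : ∀ n (P : (Fin n → Bool) → Set) → (∀ p → Dec (P p)) →
  (∀ {p q} → (∀ x → p x ≡ q x) → P p → P q) → Dec (∃ P)
searchSet n P P? ext with searchVec searchBool n (P ∘ lookup) (P? ∘ lookup)
... | yes (v , p) = yes (lookup v , p)
... | no ¬q = no λ { (p , h) → ¬q (tabulate p , ext (λ x → sym (lookup∘tabulate p x)) h) }

-- Lists as counting devices

-- Every count of graphs goes through this: the graphs in question form a list without repetitions,
-- and it suffices to place each of them in a candidate list of known length.
unique-length : ∀ {A : Set} {xs ys : List A} → Unique xs → (∀ {x} → x ∈ xs → x ∈ ys) → length xs ≤ length ys
unique-length {xs = []} u sub = z≤n
unique-length {xs = x ∷ xs} {ys} (x∉ ∷ u) sub with ∈-∃++ (sub (here refl))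
... | as , bs , refl = begin
  suc (length xs) ≤⟨ s≤s (unique-length u sub′) ⟩
  suc (length (as ++ bs)) ≡⟨ cong suc (length-++ as) ⟩
  suc (length as + length bs) ≡⟨ sym (+-suc (length as) (length bs)) ⟩
  length as + length (x ∷ bs) ≡⟨ sym (length-++ as) ⟩
  length (as ++ x ∷ bs) ∎
  where
  open ≤-Reasoning
  sub′ : ∀ {y} → y ∈ xs → y ∈ as ++ bs
  sub′ {y} y∈ with ∈-++⁻ as (sub (there y∈))
  ... | inj₁ p = ∈-++⁺ˡ p
  ... | inj₂ (here refl) = ⊥-elim (lookupAll x∉ y∈ refl)
  ... | inj₂ (there p) = ∈-++⁺ʳ as p

∈-concatMap : ∀ {A B : Set} (f : A → List B) {xs x y} → x ∈ xs → y ∈ f x → y ∈ concatMap f xs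
∈-concatMap f x∈ y∈ = ∈-concat⁺′ y∈ (∈-map⁺ f x∈)

∈-concatMap⁻′ : ∀ {A B : Set} (f : A → List B) xs {y} → y ∈ concatMap f xs → ∃ λ x → x ∈ xs × y ∈ f x
∈-concatMap⁻′ f (x ∷ xs) y∈ with ∈-++⁻ (f x) y∈
... | inj₁ p = x , here refl , p
... | inj₂ p with ∈-concatMap⁻′ f xs p
...   | z , z∈ , q = z , there z∈ , q

length-concatMap : ∀ {A B : Set} (f : A → List B) c xs → (∀ x → x ∈ xs → length (f x) ≤ c) →
  length (concatMap f xs) ≤ length xs * c
length-concatMap f c [] h = z≤n
length-concatMap f c (x ∷ xs) h = ≤-trans (≤-reflexive (length-++ (f x)))
  (+-mono-≤ (h x (here refl)) (length-concatMap f c xs (λ y y∈ → h y (there y∈))))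

length-concatMap-≥ : ∀ {A B : Set} (f : A → List B) c xs → (∀ x → x ∈ xs → c ≤ length (f x)) →
  length xs * c ≤ length (concatMap f xs)
length-concatMap-≥ f c [] h = z≤n
length-concatMap-≥ f c (x ∷ xs) h = ≤-trans
  (+-mono-≤ (h x (here refl)) (length-concatMap-≥ f c xs (λ y y∈ → h y (there y∈))))
  (≤-reflexive (sym (length-++ (f x))))

concatMap-unique : ∀ {A B : Set} (f : A → List B) {xs} → Unique xs → (∀ x → Unique (f x)) →
  (∀ {x y z} → z ∈ f x → z ∈ f y → x ≡ y) → Unique (concatMap f xs)
concatMap-unique f [] uf inj = []
concatMap-unique f {x ∷ xs} (x∉ ∷ u) uf inj = UniqueP.++⁺ (uf x) (concatMap-unique f u uf inj)
  (λ { (p , q) → case ∈-concatMap⁻′ f xs q of λ { (y , y∈ , r) → lookupAll x∉ y∈ (inj p r) } })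

record Enumeration (A : Set) (n : ℕ) : Set where
  constructor enumeration
  field
    elements : List A
    complete : ∀ a → a ∈ elements
    size     : length elements ≤ n
open Enumeration public

opaque
  enumFin : ∀ n → Enumeration (Fin n) n
  enumFin n = enumeration (allFin n) ∈-allFin (≤-reflexive (length-tabulate {n = n} id))

  enumBool : Enumeration Bool 2
  enumBool = enumeration (true ∷ false ∷ []) (λ { true → here refl ; false → there (here refl) }) ≤-refl

  enum× : ∀ {A B : Set} {m n} → Enumeration A m → Enumeration B n → Enumeration (A × B) (m * n)
  enum× {n = n} α β = enumeration (concatMap (λ a → map (a ,_) (elements β)) (elements α))
    (λ { (a , b) → ∈-concatMap _ (complete α a) (∈-map⁺ _ (complete β b)) })
    (≤-trans (length-concatMap (λ a → map (a ,_) (elements β)) n (elements α) (λ a _ → ≤-trans (≤-reflexive (length-map (a ,_) (elements β))) (size β)))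
      (*-monoˡ-≤ n (size α)))

allVecBool-complete : ∀ {n} (v : Vec Bool n) → v ∈ allVecBool n
allVecBool-complete [] = here refl
allVecBool-complete (true ∷ v)  = ∈-concatMap _ (allVecBool-complete v) (here refl)
allVecBool-complete (false ∷ v) = ∈-concatMap _ (allVecBool-complete v) (there (here refl))

allVecBool-unique : ∀ n → Unique (allVecBool n)
allVecBool-unique zero = [] ∷ []
allVecBool-unique (suc n) = concatMap-unique _ (allVecBool-unique n)
  (λ v → ((λ ()) ∷ []) ∷ [] ∷ [])
  (λ { (here refl) (here refl) → refl ; (here refl) (there (here ()))
     ; (there (here refl)) (here ()) ; (there (here refl)) (there (here refl)) → refl })

allVecBool-length : ∀ n → length (allVecBool n) ≤ 2 ^ n
allVecBool-length zero = ≤-refl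
allVecBool-length (suc n) = ≤-trans (length-concatMap _ 2 (allVecBool n) (λ _ _ → ≤-refl))
  (≤-trans (*-monoˡ-≤ 2 (allVecBool-length n)) (≤-reflexive (*-comm (2 ^ n) 2)))

allGraphs-complete : ∀ {n} (G : Graph n) → G ∈ allGraphs n
allGraphs-complete {zero}  tt = here refl
allGraphs-complete {suc n} (G , v) = ∈-concatMap _ (allGraphs-complete G) (∈-map⁺ _ (allVecBool-complete v))

allGraphs-unique : ∀ n → Unique (allGraphs n)
allGraphs-unique zero = [] ∷ []
allGraphs-unique (suc n) = concatMap-unique _ (allGraphs-unique n)
  (λ G → UniqueP.map⁺ ,-injectiveʳ-simple (allVecBool-unique n))
  (λ p q → case ∈-map⁻ _ p of λ { (_ , _ , refl) → case ∈-map⁻ _ q of λ { (_ , _ , refl) → refl } })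
  where
  ,-injectiveʳ-simple : ∀ {G : Graph n} {v w : Vec Bool n} → (G , v) ≡ (G , w) → v ≡ w
  ,-injectiveʳ-simple refl = refl

length-pow : ∀ {A B : Set} (f : A → List B) xs a b → length xs ≤ 2 ^ a → (∀ x → x ∈ xs → length (f x) ≤ 2 ^ b) →
  length (concatMap f xs) ≤ 2 ^ (a + b)
length-pow f xs a b ha hb = ≤-trans (length-concatMap f (2 ^ b) xs hb)
  (≤-trans (*-monoˡ-≤ (2 ^ b) ha) (≤-reflexive (sym (^-distribˡ-+-* 2 a b))))

allGraphs-length : ∀ n → length (allGraphs n) ≤ 2 ^ (n * n)
allGraphs-length zero = ≤-refl
allGraphs-length (suc n) = ≤-trans
  (length-pow _ (allGraphs n) (n * n) n (allGraphs-length n)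
    (λ G _ → ≤-trans (≤-reflexive (length-map _ (allVecBool n))) (allVecBool-length n)))
  (^-monoʳ-≤ 2 (≤-trans (m≤n+m (n * n + n) (suc n)) (≤-reflexive (expand n))))
  where
  expand : ∀ n → suc n + (n * n + n) ≡ suc n * suc n
  expand = solve-∀

prodL : ∀ {A : Set} {m} → (Fin m → List A) → List (Vec A m)
prodL {m = zero}  Ls = [] ∷ []
prodL {m = suc m} Ls = concatMap (λ a → map (a ∷_) (prodL (Ls ∘ suc))) (Ls zero)

∈-prodL : ∀ {A : Set} {m} (Ls : Fin m → List A) (v : Vec A m) → (∀ i → lookup v i ∈ Ls i) → v ∈ prodL Ls
∈-prodL Ls [] h = here refl
∈-prodL Ls (a ∷ v) h = ∈-concatMap _ (h zero) (∈-map⁺ (a ∷_) (∈-prodL (Ls ∘ suc) v (h ∘ suc)))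

opaque
  unfolding sumF

  prodL-length : ∀ {A : Set} {m} (Ls : Fin m → List A) (x : Fin m → ℕ) →
    (∀ i → length (Ls i) ≤ 2 ^ x i) → length (prodL Ls) ≤ 2 ^ sumF x
  prodL-length {m = zero}  Ls x h = ≤-refl
  prodL-length {m = suc m} Ls x h = length-pow _ (Ls zero) (x zero) _ (h zero)
    (λ a _ → ≤-trans (≤-reflexive (length-map _ (prodL (Ls ∘ suc)))) (prodL-length (Ls ∘ suc) (x ∘ suc) (h ∘ suc)))

-- W N k is the number of vectors of length N with at most k ones.
W : ℕ → ℕ → ℕ
W zero    k       = 1
W (suc N) zero    = W N zero
W (suc N) (suc k) = W N (suc k) + W N k

W-zero : ∀ N → W N 0 ≡ 1
W-zero zero    = refl
W-zero (suc N) = W-zero N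

W≤2^ : ∀ N k → W N k ≤ 2 ^ N
W≤2^ zero    k       = ≤-refl
W≤2^ (suc N) zero    = ≤-trans (W≤2^ N 0) (m≤m+n _ _)
W≤2^ (suc N) (suc k) = +-mono-≤ (W≤2^ N (suc k)) (≤-trans (W≤2^ N k) (m≤m+n _ _))

W-shift : ∀ b N k → W (b + N) k ≤ 2 ^ b * W N k
W-shift zero    N k = ≤-reflexive (sym (*-identityˡ _))
W-shift (suc b) N zero = ≤-trans (W-shift b N zero) (*-monoˡ-≤ (W N 0) (m≤m+n (2 ^ b) _))
W-shift (suc b) N (suc k) = ≤-trans (+-mono-≤ (W-shift b N (suc k)) (W-shift b N k))
  (≤-trans (+-monoʳ-≤ _ (*-monoʳ-≤ (2 ^ b) (mono N k)))
    (≤-reflexive (double (2 ^ b) (W N (suc k)))))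
  where
  mono : ∀ N k → W N k ≤ W N (suc k)
  mono zero    k       = ≤-refl
  mono (suc N) zero    = ≤-trans (mono N zero) (m≤m+n _ _)
  mono (suc N) (suc k) = +-mono-≤ (mono N (suc k)) (mono N k)
  double : ∀ p w → p * w + p * w ≡ (2 * p) * w
  double = solve-∀

-- In a block of length b either all entries vanish, or at least one of the k + 1 ones is used up.
W-block : ∀ b N k → W (b + N) (suc k) ≤ W N (suc k) + 2 ^ b * W N k
W-block zero    N k = m≤m+n _ _
W-block (suc b) N k = ≤-trans (+-mono-≤ (W-block b N k) (W-shift b N k))
  (≤-reflexive (regroup (W N (suc k)) (2 ^ b) (W N k)))
  where
  regroup : ∀ u p w → (u + p * w) + p * w ≡ u + (2 * p) * w
  regroup = solve-∀

-- An encoding bound in place of an entropy estimate: `M` bits tell which blocks of length `b`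
-- vanish, and at most `k` blocks do not, at `b` bits each. If `b * k` is about `M`, the exponent is
-- about 2N / b, a small fraction of N.
W-bound : ∀ b M N k → N ≤ b * M → W N k ≤ 2 ^ (M + b * k)
W-bound b M N zero h = subst (_≤ _) (sym (W-zero N)) (m^n>0 2 (M + b * 0))
W-bound b zero N (suc k) h rewrite *-zeroʳ b | n≤0⇒n≡0 h = m^n>0 2 (b * suc k)
W-bound b (suc M) N (suc k) h with b ≤? N
-- Less than one block is left, and the `b` bits for a single one already cover it.
... | no b≰N = ≤-trans (W≤2^ N (suc k)) (^-monoʳ-≤ 2 (≤-trans (<⇒≤ (≰⇒> b≰N))
        (≤-trans (≤-reflexive (sym (*-identityʳ b))) (≤-trans (*-monoʳ-≤ b (s≤s z≤n)) (m≤n+m (b * suc k) (suc M))))))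
... | yes b≤N with m+[n∸m]≡n b≤N
...   | eq = begin
  W N (suc k) ≡⟨ cong (λ x → W x (suc k)) (sym eq) ⟩
  W (b + N′) (suc k) ≤⟨ W-block b N′ k ⟩
  W N′ (suc k) + 2 ^ b * W N′ k ≤⟨ +-mono-≤ (W-bound b M N′ (suc k) h′) (*-monoʳ-≤ (2 ^ b) (W-bound b M N′ k h′)) ⟩
  2 ^ (M + b * suc k) + 2 ^ b * 2 ^ (M + b * k) ≡⟨ cong (2 ^ (M + b * suc k) +_) (sym (^-distribˡ-+-* 2 b _)) ⟩
  2 ^ (M + b * suc k) + 2 ^ (b + (M + b * k)) ≡⟨ cong (λ e → 2 ^ (M + b * suc k) + 2 ^ e) (expo b M k) ⟩
  2 ^ (M + b * suc k) + 2 ^ (M + b * suc k) ≡⟨ cong (2 ^ (M + b * suc k) +_) (sym (+-identityʳ _)) ⟩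
  2 ^ (suc M + b * suc k) ∎
  where
  open ≤-Reasoning
  N′ = N ∸ b
  h′ : N′ ≤ b * M
  h′ = +-cancelˡ-≤ b _ _ (≤-trans (≤-reflexive eq) (≤-trans h (≤-reflexive (*-suc b M))))
  expo : ∀ b M k → b + (M + b * k) ≡ M + b * suc k
  expo = solve-∀

rowStep : ∀ {m} (d₁ d₂ u : Bool) (rest : ℕ → ℕ → List (Vec Bool m)) → ℕ → ℕ → List (Vec Bool (suc m))
rowStep true  _     u rest zero    k₂      = map (not u ∷_) (rest zero k₂)
rowStep true  _     u rest (suc k) k₂      = map (not u ∷_) (rest (suc k) k₂) ++ map (u ∷_) (rest k k₂)
rowStep false true  u rest k₁      zero    = map (not u ∷_) (rest k₁ zero)
rowStep false true  u rest k₁      (suc k) = map (not u ∷_) (rest k₁ (suc k)) ++ map (u ∷_) (rest k₁ k)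
rowStep false false u rest k₁      k₂      = map (not u ∷_) (rest k₁ k₂) ++ map (u ∷_) (rest k₁ k₂)

-- The vectors taking the value u at most k₁ times on D₁ and at most k₂ times on D₂ outside D₁.
rowList : ∀ {m} (D₁ D₂ u : Fin m → Bool) (k₁ k₂ : ℕ) → List (Vec Bool m)
rowList {zero}  D₁ D₂ u k₁ k₂ = [] ∷ []
rowList {suc m} D₁ D₂ u k₁ k₂ =
  rowStep (D₁ zero) (D₂ zero) (u zero) (rowList (D₁ ∘ suc) (D₂ ∘ suc) (u ∘ suc)) k₁ k₂

hits : ∀ {m} (D u : Fin m → Bool) → Vec Bool m → Fin m → Bool
hits D u v x = D x ∧ (lookup v x ==ᵇ u x)

∈-rowStep-miss : ∀ {m} d₁ d₂ u {rest : ℕ → ℕ → List (Vec Bool m)} {v} k₁ k₂ → v ∈ rest k₁ k₂ →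
  (not u ∷ v) ∈ rowStep d₁ d₂ u rest k₁ k₂
∈-rowStep-miss true  _     u zero    k₂      h = ∈-map⁺ _ h
∈-rowStep-miss true  _     u (suc _) k₂      h = ∈-++⁺ˡ (∈-map⁺ _ h)
∈-rowStep-miss false true  u k₁      zero    h = ∈-map⁺ _ h
∈-rowStep-miss false true  u k₁      (suc _) h = ∈-++⁺ˡ (∈-map⁺ _ h)
∈-rowStep-miss false false u k₁      k₂      h = ∈-++⁺ˡ (∈-map⁺ _ h)

∈-rowStep-hit : ∀ {m} d₁ d₂ u {rest : ℕ → ℕ → List (Vec Bool m)} {v} n₁ n₂ k₁ k₂ →
  (∀ j₁ j₂ → n₁ ≤ j₁ → n₂ ≤ j₂ → v ∈ rest j₁ j₂) →
  bit d₁ + n₁ ≤ k₁ → bit (d₂ ∧ not d₁) + n₂ ≤ k₂ → (u ∷ v) ∈ rowStep d₁ d₂ u rest k₁ k₂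
∈-rowStep-hit true  true  u n₁ n₂ (suc k) k₂ h (s≤s h₁) h₂ = ∈-++⁺ʳ _ (∈-map⁺ _ (h k k₂ h₁ h₂))
∈-rowStep-hit true  false u n₁ n₂ (suc k) k₂ h (s≤s h₁) h₂ = ∈-++⁺ʳ _ (∈-map⁺ _ (h k k₂ h₁ h₂))
∈-rowStep-hit false true  u n₁ n₂ k₁ (suc k) h h₁ (s≤s h₂) = ∈-++⁺ʳ _ (∈-map⁺ _ (h k₁ k h₁ h₂))
∈-rowStep-hit false false u n₁ n₂ k₁ k₂ h h₁ h₂ = ∈-++⁺ʳ _ (∈-map⁺ _ (h k₁ k₂ h₁ h₂))

data Hit (u : Bool) : Bool → Set where
  hit  : Hit u u
  miss : Hit u (not u)

hit? : ∀ u a → Hit u a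
hit? true  true  = hit
hit? true  false = miss
hit? false true  = miss
hit? false false = hit

opaque
  unfolding sumF #

  ∈-rowList : ∀ {m} (D₁ D₂ u : Fin m → Bool) k₁ k₂ (v : Vec Bool m) →
    # (hits D₁ u v) ≤ k₁ → # (hits (λ x → D₂ x ∧ not (D₁ x)) u v) ≤ k₂ → v ∈ rowList D₁ D₂ u k₁ k₂
  ∈-rowList D₁ D₂ u k₁ k₂ [] h₁ h₂ = here refl
  ∈-rowList {suc m} D₁ D₂ u k₁ k₂ (a ∷ v) h₁ h₂ with hit? (u zero) a
  ... | miss = ∈-rowStep-miss (D₁ zero) (D₂ zero) (u zero) k₁ k₂
        (∈-rowList (D₁ ∘ suc) (D₂ ∘ suc) (u ∘ suc) k₁ k₂ v (≤-trans (m≤n+m _ _) h₁) (≤-trans (m≤n+m _ _) h₂))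
  ... | hit = ∈-rowStep-hit (D₁ zero) (D₂ zero) (u zero) _ _ k₁ k₂
        (λ j₁ j₂ → ∈-rowList (D₁ ∘ suc) (D₂ ∘ suc) (u ∘ suc) j₁ j₂ v)
        (≤-trans (+-monoˡ-≤ _ (bit-mono {D₁ zero} λ e → ∧-join e same)) h₁)
        (≤-trans (+-monoˡ-≤ _ (bit-mono {D₂ zero ∧ not (D₁ zero)} λ e → ∧-join e same)) h₂)
    where
    same : (u zero ==ᵇ u zero) ≡ true
    same = does-complete (u zero ≟ᵇ u zero) refl

  length-rowStep : ∀ {m} d₁ d₂ u (rest : ℕ → ℕ → List (Vec Bool m)) f n₁ n₂ →
    (∀ k₁ k₂ → length (rest k₁ k₂) ≤ 2 ^ f * (W n₁ k₁ * W n₂ k₂)) → ∀ k₁ k₂ →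
    length (rowStep d₁ d₂ u rest k₁ k₂) ≤
      2 ^ (bit (not d₁ ∧ not d₂) + f) * (W (bit d₁ + n₁) k₁ * W (bit (d₂ ∧ not d₁) + n₂) k₂)
  length-rowStep {m} d₁ d₂ u rest f n₁ n₂ IH = go d₁ d₂
    where
    one : ∀ a (xs : List (Vec Bool m)) c → length xs ≤ c → length (map (a ∷_) xs) ≤ c
    one a xs c h = ≤-trans (≤-reflexive (length-map _ xs)) h
    both : ∀ a b (xs ys : List (Vec Bool m)) c d e → length xs ≤ c → length ys ≤ d → c + d ≡ e →
      length (map (a ∷_) xs ++ map (b ∷_) ys) ≤ e
    both a b xs ys c d e hx hy eq = ≤-trans (≤-reflexive (length-++ (map (a ∷_) xs)))
      (≤-trans (+-mono-≤ (one a xs c hx) (one b ys d hy)) (≤-reflexive eq))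
    split₁ : ∀ f a b c → f * (a * c) + f * (b * c) ≡ f * ((a + b) * c)
    split₁ = solve-∀
    split₂ : ∀ f a b c → f * (c * a) + f * (c * b) ≡ f * (c * (a + b))
    split₂ = solve-∀
    split₃ : ∀ f c → f * c + f * c ≡ (f + (f + 0)) * c
    split₃ = solve-∀
    go : ∀ d₁ d₂ k₁ k₂ → length (rowStep d₁ d₂ u rest k₁ k₂) ≤
      2 ^ (bit (not d₁ ∧ not d₂) + f) * (W (bit d₁ + n₁) k₁ * W (bit (d₂ ∧ not d₁) + n₂) k₂)
    go true true zero k₂ = one _ (rest zero k₂) _ (IH zero k₂)
    go true false zero k₂ = one _ (rest zero k₂) _ (IH zero k₂)
    go true true (suc k) k₂ = both _ _ (rest (suc k) k₂) (rest k k₂) _ _ _ (IH (suc k) k₂) (IH k k₂) (split₁ (2 ^ f) (W n₁ (suc k)) (W n₁ k) (W n₂ k₂))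
    go true false (suc k) k₂ = both _ _ (rest (suc k) k₂) (rest k k₂) _ _ _ (IH (suc k) k₂) (IH k k₂) (split₁ (2 ^ f) (W n₁ (suc k)) (W n₁ k) (W n₂ k₂))
    go false true k₁ zero = one _ (rest k₁ zero) _ (IH k₁ zero)
    go false true k₁ (suc k) = both _ _ (rest k₁ (suc k)) (rest k₁ k) _ _ _ (IH k₁ (suc k)) (IH k₁ k) (split₂ (2 ^ f) (W n₂ (suc k)) (W n₂ k) (W n₁ k₁))
    go false false k₁ k₂ = both _ _ (rest k₁ k₂) (rest k₁ k₂) _ _ _ (IH k₁ k₂) (IH k₁ k₂) (split₃ (2 ^ f) _)

  length-rowList : ∀ {m} (D₁ D₂ u : Fin m → Bool) k₁ k₂ → length (rowList D₁ D₂ u k₁ k₂) ≤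
    2 ^ # (λ x → not (D₁ x) ∧ not (D₂ x)) * (W (# D₁) k₁ * W (# (λ x → D₂ x ∧ not (D₁ x))) k₂)
  length-rowList {zero} D₁ D₂ u k₁ k₂ = ≤-refl
  length-rowList {suc m} D₁ D₂ u k₁ k₂ = length-rowStep (D₁ zero) (D₂ zero) (u zero) _ _ _ _
    (length-rowList (D₁ ∘ suc) (D₂ ∘ suc) (u ∘ suc)) k₁ k₂

-- Pajor's form of the Sauer–Shelah lemma

count? : ∀ {n} → (Vec Bool n → Bool) → ℕ
count? {zero}  p = bit (p [])
count? {suc n} p = count? (p ∘ (true ∷_)) + count? (p ∘ (false ∷_))

count?-∧∨ : ∀ {n} (p q : Vec Bool n → Bool) →
  count? (λ v → p v ∧ q v) + count? (λ v → p v ∨ q v) ≡ count? p + count? q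
count?-∧∨ {zero} p q with p [] | q []
... | true  | true  = refl
... | true  | false = refl
... | false | true  = refl
... | false | false = refl
count?-∧∨ {suc n} p q = trans (+-interchange (count? (λ v → p (true ∷ v) ∧ q (true ∷ v))) _ _ _)
  (trans (cong₂ _+_ (count?-∧∨ (p ∘ (true ∷_)) (q ∘ (true ∷_))) (count?-∧∨ (p ∘ (false ∷_)) (q ∘ (false ∷_))))
    (+-interchange (count? (p ∘ (true ∷_))) _ _ _))

-- For a coordinate outside `J` one of the two halves must shatter `J` on its own. This is stronger
-- than shattering by the projection, but it turns the induction in `pajor` into inclusion-exclusion
-- for `∧` and `∨`.
shattered : ∀ {n} → (Vec Bool n → Bool) → Vec Bool n → Bool
shattered p []          = p []
shattered p (true ∷ J)  = shattered (p ∘ (true ∷_)) J ∧ shattered (p ∘ (false ∷_)) J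
shattered p (false ∷ J) = shattered (p ∘ (true ∷_)) J ∨ shattered (p ∘ (false ∷_)) J

pajor : ∀ {n} (p : Vec Bool n → Bool) → count? p ≤ count? (shattered p)
pajor {zero}  p = ≤-refl
pajor {suc n} p = ≤-trans (+-mono-≤ (pajor (p ∘ (true ∷_))) (pajor (p ∘ (false ∷_))))
  (≤-reflexive (sym (count?-∧∨ (shattered (p ∘ (true ∷_))) (shattered (p ∘ (false ∷_))))))

shattered-sound : ∀ {n} (p : Vec Bool n → Bool) J → shattered p J ≡ true → ∀ (x : Fin n → Bool) →
  ∃ λ y → p y ≡ true × (∀ i → lookup J i ≡ true → lookup y i ≡ x i)
shattered-sound p [] h x = [] , h , λ ()
shattered-sound p (true ∷ J) h x with x zero in eq | ∧-split h
... | true  | h₁ , h₂ with shattered-sound (p ∘ (true ∷_)) J h₁ (x ∘ suc)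
...   | y , py , ag = true ∷ y , py , λ { zero _ → sym eq ; (suc i) e → ag i e }
shattered-sound p (true ∷ J) h x | false | h₁ , h₂ with shattered-sound (p ∘ (false ∷_)) J h₂ (x ∘ suc)
...   | y , py , ag = false ∷ y , py , λ { zero _ → sym eq ; (suc i) e → ag i e }
shattered-sound p (false ∷ J) h x with ∨-split h
... | inj₁ h₁ with shattered-sound (p ∘ (true ∷_)) J h₁ (x ∘ suc)
...   | y , py , ag = true ∷ y , py , λ { zero () ; (suc i) e → ag i e }
shattered-sound p (false ∷ J) h x | inj₂ h₂ with shattered-sound (p ∘ (false ∷_)) J h₂ (x ∘ suc)
...   | y , py , ag = false ∷ y , py , λ { zero () ; (suc i) e → ag i e }

listOf : ∀ {n} → (Vec Bool n → Bool) → List (Vec Bool n)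
listOf {zero}  p = if p [] then [] ∷ [] else []
listOf {suc n} p = map (true ∷_) (listOf (p ∘ (true ∷_))) ++ map (false ∷_) (listOf (p ∘ (false ∷_)))

listOf-length : ∀ {n} (p : Vec Bool n → Bool) → length (listOf p) ≡ count? p
listOf-length {zero} p with p []
... | true  = refl
... | false = refl
listOf-length {suc n} p = trans (length-++ (map (true ∷_) (listOf (p ∘ (true ∷_)))))
  (cong₂ _+_ (trans (length-map _ (listOf (p ∘ (true ∷_)))) (listOf-length (p ∘ (true ∷_))))
             (trans (length-map _ (listOf (p ∘ (false ∷_)))) (listOf-length (p ∘ (false ∷_)))))

∈-listOf : ∀ {n} (p : Vec Bool n → Bool) v → p v ≡ true → v ∈ listOf p
∈-listOf p [] e rewrite e = here refl
∈-listOf p (true ∷ v)  e = ∈-++⁺ˡ (∈-map⁺ _ (∈-listOf (p ∘ (true ∷_)) v e))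
∈-listOf p (false ∷ v) e = ∈-++⁺ʳ _ (∈-map⁺ _ (∈-listOf (p ∘ (false ∷_)) v e))

listOf-unique : ∀ {n} (p : Vec Bool n → Bool) → Unique (listOf p)
listOf-unique {zero} p with p []
... | true  = [] ∷ []
... | false = []
listOf-unique {suc n} p = UniqueP.++⁺ (UniqueP.map⁺ inj (listOf-unique (p ∘ (true ∷_)))) (UniqueP.map⁺ inj (listOf-unique (p ∘ (false ∷_))))
  (λ { (a , b) → case ∈-map⁻ _ a of λ { (_ , _ , refl) → case ∈-map⁻ _ b of λ { (_ , _ , ()) } } })
  where
  inj : ∀ {b : Bool} {v w : Vec Bool n} → b ∷ v ≡ b ∷ w → v ≡ w
  inj refl = refl

listOf-sound : ∀ {n} (p : Vec Bool n → Bool) {v} → v ∈ listOf p → p v ≡ true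
listOf-sound {zero} p {[]} v∈ with p []
... | true = refl
listOf-sound {zero} p {[]} () | false
listOf-sound {suc n} p v∈ with ∈-++⁻ (map (true ∷_) (listOf (p ∘ (true ∷_)))) v∈
... | inj₁ a = case ∈-map⁻ _ a of λ { (_ , w∈ , refl) → listOf-sound (p ∘ (true ∷_)) w∈ }
... | inj₂ a = case ∈-map⁻ _ a of λ { (_ , w∈ , refl) → listOf-sound (p ∘ (false ∷_)) w∈ }

-- Relabelling and assembling graphs

adj-irrefl : ∀ {n} (G : Graph n) i → adj G i i ≡ false
adj-irrefl {suc n} (G , v) zero    = refl
adj-irrefl {suc n} (G , v) (suc i) = adj-irrefl G i

adj-sym : ∀ {n} (G : Graph n) i j → adj G i j ≡ adj G j i
adj-sym {suc n} (G , v) zero    zero    = refl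
adj-sym {suc n} (G , v) zero    (suc j) = refl
adj-sym {suc n} (G , v) (suc i) zero    = refl
adj-sym {suc n} (G , v) (suc i) (suc j) = adj-sym G i j

lookup-ext : ∀ {A : Set} {n} {v w : Vec A n} → (∀ i → lookup v i ≡ lookup w i) → v ≡ w
lookup-ext {v = v} {w} h = trans (sym (tabulate∘lookup v)) (trans (tabulate-cong h) (tabulate∘lookup w))

graph-ext : ∀ {n} (G H : Graph n) → (∀ i j → adj G i j ≡ adj H i j) → G ≡ H
graph-ext {zero}  tt tt h = refl
graph-ext {suc n} (G , v) (H , w) h =
  cong₂ _,_ (graph-ext G H (λ i j → h (suc i) (suc j))) (lookup-ext (λ j → h zero (suc j)))

mkGraph : ∀ n → (Fin n → Fin n → Bool) → Graph n
mkGraph zero    f = tt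
mkGraph (suc n) f = mkGraph n (λ i j → f (suc i) (suc j)) , tabulate (λ j → f zero (suc j))

adj-mkGraph : ∀ {n} (f : Fin n → Fin n → Bool) → (∀ i j → f i j ≡ f j i) → (∀ i → f i i ≡ false) →
  ∀ i j → adj (mkGraph n f) i j ≡ f i j
adj-mkGraph {suc n} f s r zero    zero    = sym (r zero)
adj-mkGraph {suc n} f s r zero    (suc j) = lookup∘tabulate _ j
adj-mkGraph {suc n} f s r (suc i) zero    = trans (lookup∘tabulate _ i) (s zero (suc i))
adj-mkGraph {suc n} f s r (suc i) (suc j) =
  adj-mkGraph (λ i j → f (suc i) (suc j)) (λ i j → s (suc i) (suc j)) (λ i → r (suc i)) i j

relabel : ∀ {m n} → (Fin m → Fin n) → Graph n → Graph m
relabel f G = mkGraph _ (λ i j → adj G (f i) (f j))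

adj-relabel : ∀ {m n} (f : Fin m → Fin n) (G : Graph n) i j → adj (relabel f G) i j ≡ adj G (f i) (f j)
adj-relabel f G = adj-mkGraph (λ i j → adj G (f i) (f j)) (λ i j → adj-sym G (f i) (f j)) (λ i → adj-irrefl G (f i))

Injective : ∀ {m n} → (Fin m → Fin n) → Set
Injective f = ∀ i j → f i ≡ f j → i ≡ j

free-relabel : ∀ {k m n} (T : Graph k) (f : Fin m → Fin n) → Injective f → ∀ G → Free T G → Free T (relabel f G)
free-relabel T f inj G fr (φ , φ-inj , φ-adj) = fr (tabulate (f ∘ lookup φ) ,
  (λ i j e → φ-inj i j (inj _ _ (trans (sym (at i)) (trans e (at j))))) ,
  (λ i j → trans (cong₂ (adj G) (at i) (at j)) (trans (sym (adj-relabel f G _ _)) (φ-adj i j))))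
  where
  at : ∀ i → lookup (tabulate (f ∘ lookup φ)) i ≡ f (lookup φ i)
  at = lookup∘tabulate (f ∘ lookup φ)

Table : ℕ → ℕ → Set
Table q m = Vec (Vec Bool m) q

entry : ∀ {q m} → Table q m → Fin q → Fin m → Bool
entry X i v = lookup (lookup X i) v

block : ∀ {q m} → Graph m → Graph q → Table q m → Fin q ⊎ Fin m → Fin q ⊎ Fin m → Bool
block G I X (inj₁ i) (inj₁ j) = adj I i j
block G I X (inj₁ i) (inj₂ v) = entry X i v
block G I X (inj₂ v) (inj₁ i) = entry X i v
block G I X (inj₂ v) (inj₂ w) = adj G v w

block-sym : ∀ {q m} (G : Graph m) (I : Graph q) X a b → block G I X a b ≡ block G I X b a
block-sym G I X (inj₁ i) (inj₁ j) = adj-sym I i j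
block-sym G I X (inj₁ i) (inj₂ v) = refl
block-sym G I X (inj₂ v) (inj₁ i) = refl
block-sym G I X (inj₂ v) (inj₂ w) = adj-sym G v w

block-irrefl : ∀ {q m} (G : Graph m) (I : Graph q) X a → block G I X a a ≡ false
block-irrefl G I X (inj₁ i) = adj-irrefl I i
block-irrefl G I X (inj₂ v) = adj-irrefl G v

assemble : ∀ q {m} → Graph m → Graph q → Table q m → Graph (q + m)
assemble q G I X = mkGraph _ (λ x y → block G I X (splitAt q x) (splitAt q y))

adj-assemble : ∀ q {m} (G : Graph m) (I : Graph q) X x y →
  adj (assemble q G I X) x y ≡ block G I X (splitAt q x) (splitAt q y)
adj-assemble q G I X = adj-mkGraph (λ x y → block G I X (splitAt q x) (splitAt q y))
  (λ x y → block-sym G I X (splitAt q x) (splitAt q y)) (λ x → block-irrefl G I X (splitAt q x))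

tableOf : ∀ {q m n} → Graph n → (Fin q → Fin n) → (Fin m → Fin n) → Table q m
tableOf G Q out = tabulate (λ i → tabulate (λ v → adj G (Q i) (out v)))

entry-tableOf : ∀ {q m n} (G : Graph n) (Q : Fin q → Fin n) (out : Fin m → Fin n) i v →
  entry (tableOf G Q out) i v ≡ adj G (Q i) (out v)
entry-tableOf G Q out i v = trans (cong (λ r → lookup r v) (lookup∘tabulate _ i)) (lookup∘tabulate _ v)

front : ∀ {q m} → Permutation′ (q + m) → Fin q → Fin (q + m)
front {m = m} π i = π ⟨$⟩ʳ (i ↑ˡ m)

back : ∀ {q m} → Permutation′ (q + m) → Fin m → Fin (q + m)
back {q} π v = π ⟨$⟩ʳ (q ↑ʳ v)

perm-injective : ∀ {n} (π : Permutation′ n) → Injective (π ⟨$⟩ʳ_)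
perm-injective π i j e = trans (sym (inverseˡ π)) (trans (cong (π ⟨$⟩ˡ_) e) (inverseˡ π))

back-injective : ∀ {q m} (π : Permutation′ (q + m)) → Injective (back {q} π)
back-injective {q} π i j e = ↑ʳ-inj (perm-injective π _ _ e)
  where
  ↑ʳ-inj : ∀ {i j} → q ↑ʳ i ≡ q ↑ʳ j → i ≡ j
  ↑ʳ-inj {i} {j} e = case trans (sym (splitAt-↑ʳ q _ i)) (trans (cong (splitAt q) e) (splitAt-↑ʳ q _ j)) of λ { refl → refl }

front≢back : ∀ {q m} (π : Permutation′ (q + m)) i v → front {q} {m} π i ≢ back {q} {m} π v
front≢back {q} {m} π i v e =
  case trans (sym (splitAt-↑ˡ q i m)) (trans (cong (splitAt q) (perm-injective π _ _ e)) (splitAt-↑ʳ q m v)) of λ ()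

front-or-back : ∀ {q m} (π : Permutation′ (q + m)) x → (∃ λ i → x ≡ front {q} {m} π i) ⊎ (∃ λ v → x ≡ back {q} {m} π v)
front-or-back {q} {m} π x with splitAt q (π ⟨$⟩ˡ x) | join-splitAt q m (π ⟨$⟩ˡ x)
... | inj₁ i | e = inj₁ (i , trans (sym (inverseʳ π)) (cong (π ⟨$⟩ʳ_) (sym e)))
... | inj₂ v | e = inj₂ (v , trans (sym (inverseʳ π)) (cong (π ⟨$⟩ʳ_) (sym e)))

disassemble : ∀ q {m} (π : Permutation′ (q + m)) (G : Graph (q + m)) →
  G ≡ relabel (π ⟨$⟩ˡ_) (assemble q (relabel (back {q} π) G) (relabel (front {q} {m} π) G) (tableOf G (front {q} {m} π) (back {q} π)))
disassemble q {m} π G = graph-ext _ _ λ x y → sym (trans (adj-relabel (π ⟨$⟩ˡ_) _ x y)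
    (trans (adj-assemble q _ _ _ (π ⟨$⟩ˡ x) (π ⟨$⟩ˡ y)) (core (view x) (view y))))
  where
  data View (x : Fin (q + m)) : Fin q ⊎ Fin m → Set where
    isFront : ∀ i → x ≡ front {q} {m} π i → View x (inj₁ i)
    isBack  : ∀ v → x ≡ back {q} π v → View x (inj₂ v)
  view : ∀ x → View x (splitAt q (π ⟨$⟩ˡ x))
  view x with splitAt q (π ⟨$⟩ˡ x) | join-splitAt q m (π ⟨$⟩ˡ x)
  ... | inj₁ i | e = isFront i (trans (sym (inverseʳ π)) (cong (π ⟨$⟩ʳ_) (sym e)))
  ... | inj₂ v | e = isBack v (trans (sym (inverseʳ π)) (cong (π ⟨$⟩ʳ_) (sym e)))
  core : ∀ {x y a b} → View x a → View y b →
    block (relabel (back {q} π) G) (relabel (front {q} {m} π) G) (tableOf G (front {q} {m} π) (back {q} π)) a b ≡ adj G x y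
  core (isFront i refl) (isFront j refl) = adj-relabel _ G i j
  core (isFront i refl) (isBack v refl)  = entry-tableOf G _ _ i v
  core (isBack v refl)  (isFront i refl) = trans (entry-tableOf G _ _ i v) (adj-sym G _ _)
  core (isBack v refl)  (isBack w refl)  = adj-relabel _ G v w

-- Enough permutations to move any q given vertices to the front.
permList : ∀ q m → List (Permutation′ (q + m))
permList zero    m = idₚ ∷ []
permList (suc q) m = concatMap (λ v → map (λ π → lift₀ π ∘ₚ transpose zero v) (permList q m)) (allFin (suc (q + m)))

permList-length : ∀ q m → length (permList q m) ≤ (q + m) ^ q
permList-length zero    m = ≤-refl
permList-length (suc q) m = ≤-trans
  (length-concatMap (λ v → map (λ π → lift₀ π ∘ₚ transpose zero v) (permList q m)) ((q + m) ^ q) (allFin (suc (q + m)))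
    (λ v _ → ≤-trans (≤-reflexive (length-map _ (permList q m))) (permList-length q m)))
  (≤-trans (≤-reflexive (cong (_* (q + m) ^ q) (length-tabulate {n = suc (q + m)} id)))
    (*-monoʳ-≤ (suc (q + m)) (^-monoˡ-≤ q (n≤1+n (q + m)))))

permList-complete : ∀ q m (Q : Fin q → Fin (q + m)) → Injective Q →
  ∃ λ π → π ∈ permList q m × (∀ i → front {q} {m} π i ≡ Q i)
permList-complete zero    m Q inj = idₚ , here refl , λ ()
permList-complete (suc q) m Q inj with permList-complete q m Q′ Q′-inj
  where
  τ = transpose zero (Q zero)
  nonzero : ∀ i → zero ≢ τ ⟨$⟩ˡ Q (suc i)
  nonzero i e = case inj zero (suc i) (trans (cong (τ ⟨$⟩ʳ_) e) (inverseʳ τ)) of λ ()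
  Q′ : Fin q → Fin (q + m)
  Q′ i = punchOut (nonzero i)
  Q′-inj : Injective Q′
  Q′-inj i j e = sucᶠ-injective (inj _ _ (trans (sym (inverseʳ τ)) (trans
    (cong (τ ⟨$⟩ʳ_) (punchOut-injective (nonzero i) (nonzero j) e)) (inverseʳ τ))))
... | π , π∈ , hπ = lift₀ π ∘ₚ τ , ∈-concatMap _ (∈-allFin (Q zero)) (∈-map⁺ _ π∈) , λ
  { zero → refl
  ; (suc i) → trans (cong (λ z → τ ⟨$⟩ʳ suc z) (hπ i))
      (trans (cong (τ ⟨$⟩ʳ_) (punchIn-punchOut (nonzero′ i))) (inverseʳ τ)) }
  where
  τ = transpose zero (Q zero)
  nonzero′ : ∀ i → zero ≢ τ ⟨$⟩ˡ Q (suc i)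
  nonzero′ i e = case inj zero (suc i) (trans (cong (τ ⟨$⟩ʳ_) e) (inverseʳ τ)) of λ ()

-- The enumeration `out` of the remaining vertices is dictated by a permutation chosen inside the
-- counting argument. A removal step has to work for every enumeration with these three properties.
record Complement {q m n} (Q : Fin q → Fin n) (out : Fin m → Fin n) : Set where
  field
    out-inj  : Injective out
    Q≢out    : ∀ i v → Q i ≢ out v
    Q-or-out : ∀ x → (∃ λ i → x ≡ Q i) ⊎ (∃ λ v → x ≡ out v)

opaque
  -- `adj` is false on the diagonal, so by itself it would count a vertex among its own
  -- non-neighbours. Requiring distinct ends also makes maps that respect links injective.
  link : ∀ {n} → Graph n → Bool → Fin n → Fin n → Bool
  link G b x y = not (x == y) ∧ (adj G x y ==ᵇ b)

  link-adj : ∀ {n} (G : Graph n) b x y → link G b x y ≡ true → adj G x y ≡ b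
  link-adj G b x y e = does-sound (adj G x y ≟ᵇ b) (proj₂ (∧-split {not (x == y)} e))

  link-≢ : ∀ {n} (G : Graph n) b x y → link G b x y ≡ true → x ≢ y
  link-≢ G b x y e refl = not-true (proj₁ (∧-split {not (x == x)} e)) (==-refl x)

  link-intro : ∀ {n} (G : Graph n) b x y → x ≢ y → adj G x y ≡ b → link G b x y ≡ true
  link-intro G b x y ne e = ∧-join (≢true⇒not (ne ∘ ==-sound)) (does-complete (adj G x y ≟ᵇ b) e)

  link-sym : ∀ {n} (G : Graph n) b x y → link G b x y ≡ true → link G b y x ≡ true
  link-sym G b x y e = link-intro G b y x (link-≢ G b x y e ∘ sym) (trans (adj-sym G y x) (link-adj G b x y e))

  link-or : ∀ {n} (G : Graph n) x y → x ≢ y → link G true x y ≡ true ⊎ link G false x y ≡ true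
  link-or G x y ne with bool-cases (adj G x y)
  ... | inj₁ e = inj₁ (link-intro G true x y ne e)
  ... | inj₂ e = inj₂ (link-intro G false x y ne e)

-- Logarithms of polynomials

n≤2^n : ∀ n → n ≤ 2 ^ n
n≤2^n zero    = z≤n
n≤2^n (suc n) = ≤-trans (+-mono-≤ (m^n>0 2 n) (n≤2^n n)) (+-monoʳ-≤ (2 ^ n) (m≤m+n _ 0))

m<[m/d+1]*d : ∀ m d → m ≤ suc d + suc d * (m / suc d)
m<[m/d+1]*d m d = ≤-trans (≤-reflexive (m≡m%n+[m/n]*n m (suc d)))
  (+-mono-≤ (<⇒≤ (m%n<n m (suc d))) (≤-reflexive (*-comm (m / suc d) (suc d))))

d*[m/d]≤m : ∀ m d → suc d * (m / suc d) ≤ m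
d*[m/d]≤m m d = ≤-trans (≤-reflexive (*-comm (suc d) (m / suc d))) (m/n*n≤m m (suc d))

-- An integer substitute for e log(m + b): linear in m, with slope below 1/D. Writing m as about suc
-- (D e) times a quotient, both factors are bounded by n ≤ 2^n; no better estimate of a logarithm is
-- used.
polylog : (e b D m : ℕ) → ℕ
polylog e b D m = e * (3 + (D * e + b + m / suc (D * e)))

polylog-pow : ∀ e b D m → (m + b) ^ e ≤ 2 ^ polylog e b D m
polylog-pow e b D m = begin
  (m + b) ^ e ≤⟨ ^-monoˡ-≤ e base ⟩
  (2 ^ X) ^ e ≡⟨ ^-*-assoc 2 X e ⟩
  2 ^ (X * e) ≡⟨ cong (2 ^_) (*-comm X e) ⟩
  2 ^ (e * X) ∎
  where
  open ≤-Reasoning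
  d = D * e
  X = 3 + (d + b + m / suc d)
  base : m + b ≤ 2 ^ X
  base = begin
    m + b ≤⟨ +-mono-≤ (m<[m/d+1]*d m d) (n≤2^n b) ⟩
    (suc d + suc d * (m / suc d)) + 2 ^ b ≡⟨ cong (_+ 2 ^ b) (sym (*-suc (suc d) (m / suc d))) ⟩
    suc d * suc (m / suc d) + 2 ^ b
      ≤⟨ +-monoˡ-≤ (2 ^ b) (*-mono-≤ (n≤2^n (suc d)) (≤-trans (s≤s (n≤2^n (m / suc d))) (+-monoˡ-≤ (2 ^ (m / suc d)) (m^n>0 2 (m / suc d))))) ⟩
    2 ^ suc d * (2 ^ (m / suc d) + 2 ^ (m / suc d)) + 2 ^ b
      ≡⟨ cong (λ z → 2 ^ suc d * (2 ^ (m / suc d) + z) + 2 ^ b) (sym (+-identityʳ _)) ⟩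
    2 ^ suc d * 2 ^ suc (m / suc d) + 2 ^ b ≡⟨ cong (_+ 2 ^ b) (sym (^-distribˡ-+-* 2 (suc d) (suc (m / suc d)))) ⟩
    2 ^ (suc d + suc (m / suc d)) + 2 ^ b ≤⟨ +-mono-≤ (^-monoʳ-≤ 2 h₁) (^-monoʳ-≤ 2 h₂) ⟩
    2 ^ Y + 2 ^ Y ≡⟨ cong (2 ^ Y +_) (sym (+-identityʳ _)) ⟩
    2 ^ X ∎
    where
    Y = 2 + (d + b + m / suc d)
    h₁ : suc d + suc (m / suc d) ≤ Y
    h₁ = ≤-trans (≤-reflexive (cong suc (+-suc d _))) (s≤s (s≤s (+-monoˡ-≤ (m / suc d) (m≤m+n d b))))
    h₂ : b ≤ Y
    h₂ = ≤-trans (m≤n+m b d) (≤-trans (m≤m+n (d + b) _) (m≤n+m _ 2))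

-- A Positivstellensatz certificate for a linear inequality: the hypothesis X ≤ Y is a combination of
-- known inequalities, and a + Y + r = b + X is a semiring identity.
certificate : ∀ {X Y a b} r → X ≤ Y → a + Y + r ≡ b + X → a ≤ b
certificate {X} {Y} {a} {b} r h e = +-cancelʳ-≤ Y a b (≤-trans (m≤m+n (a + Y) r)
  (≤-trans (≤-reflexive e) (+-monoʳ-≤ b h)))

polylog-const : (e b D : ℕ) → ℕ
polylog-const e b D = D * e * (3 + D * e + b)

polylog-bound : ∀ e b D m → D * polylog e b D m ≤ m + polylog-const e b D
polylog-bound e b D m = begin
  D * (e * (3 + (d + b + q))) ≡⟨ expand D e b q ⟩
  d * q + d * (3 + d + b) ≤⟨ +-monoˡ-≤ _ (≤-trans (*-monoˡ-≤ q (n≤1+n d)) (d*[m/d]≤m m d)) ⟩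
  m + d * (3 + d + b) ∎
  where
  open ≤-Reasoning
  d = D * e
  q = m / suc d
  expand : ∀ D e b q → D * (e * (3 + (D * e + b + q))) ≡ D * e * q + D * e * (3 + D * e + b)
  expand = solve-∀

-- Candidate lists are emptied when the hypotheses of their length bound fail. The bound then holds
-- for all parameters, and those coming from an actual graph pass the test.
keepIf : ∀ {P A : Set} → Dec P → List A → List A
keepIf (yes _) xs = xs
keepIf (no _)  xs = []

keepIf-yes : ∀ {P A : Set} (d : Dec P) {xs : List A} → P → keepIf d xs ≡ xs
keepIf-yes (yes _) p = refl
keepIf-yes (no ¬p) p = ⊥-elim (¬p p)

length-keepIf : ∀ {P A : Set} (d : Dec P) (xs : List A) {c} → (P → length xs ≤ c) → length (keepIf d xs) ≤ c
length-keepIf (yes p) xs h = h p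
length-keepIf (no _)  xs h = z≤n

-- Counting T-free graphs up to a small proportion

-- With s = suc r this is growth by a factor of at least 2^((1 - 1/s) m), written without division.
Extends : ℕ → (ℕ → ℕ) → Set
Extends r g = ∀ m → ∃ λ E → r * m ≤ suc r * E × 2 ^ E * g m ≤ g (suc m)

-- g is a lower bound for the number f of T-free graphs; "mostly" allows to discard sets of graphs that are
-- negligible against g as soon as f is at most a multiple of g for all smaller orders.
module Typical {k₀ : ℕ} (T : Graph k₀) (r : ℕ) (g : ℕ → ℕ) (ext : Extends r g) where

  s : ℕ
  s = suc r

  f : ℕ → ℕ
  f = numFree T

  freeList : ∀ n → List (Graph n)
  freeList n = filter (free? T) (allGraphs n)

  ∈-freeList : ∀ {n} (G : Graph n) → Free T G → G ∈ freeList n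
  ∈-freeList G fr = ∈-filter⁺ (free? T) (allGraphs-complete G) fr

  Property : Set₁
  Property = ∀ {n} → Graph n → Set

  -- The order of the quantifiers matters: `N` is fixed before `M`, because `mostly-conclude` reads
  -- `M` off from the orders below `N`. The list `L` contains the graphs that are discarded.
  Mostly : Property → Property → Set
  Mostly P Q = ∀ k → ∃ λ N → ∀ n → N ≤ n → ∀ M → (∀ m → m < n → f m ≤ M * g m) →
    ∃ λ (L : List (Graph n)) → (∀ G → Free T G → P G → G ∈ L ⊎ Q G) × k * length L ≤ M * g n

  mostly-trans : ∀ {P Q R : Property} → Mostly P Q → Mostly Q R → Mostly P R
  mostly-trans h₁ h₂ k with h₁ (2 * k) | h₂ (2 * k)
  ... | N₁ , c₁ | N₂ , c₂ = N₁ + N₂ , λ n N≤n M hyp →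
    let (L₁ , cov₁ , len₁) = c₁ n (≤-trans (m≤m+n N₁ N₂) N≤n) M hyp
        (L₂ , cov₂ , len₂) = c₂ n (≤-trans (m≤n+m N₂ N₁) N≤n) M hyp
    in L₁ ++ L₂
     , (λ G fr p → case cov₁ G fr p of λ
         { (inj₁ ∈₁) → inj₁ (∈-++⁺ˡ ∈₁)
         ; (inj₂ q) → case cov₂ G fr q of λ { (inj₁ ∈₂) → inj₁ (∈-++⁺ʳ L₁ ∈₂) ; (inj₂ r) → inj₂ r } })
     , *-cancelˡ-≤ 2 (begin
         2 * (k * length (L₁ ++ L₂)) ≡⟨ cong (λ l → 2 * (k * l)) (length-++ L₁) ⟩
         2 * (k * (length L₁ + length L₂)) ≡⟨ distr k (length L₁) (length L₂) ⟩
         2 * k * length L₁ + 2 * k * length L₂ ≤⟨ +-mono-≤ len₁ len₂ ⟩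
         M * g n + M * g n ≡⟨ cong (M * g n +_) (sym (+-identityʳ _)) ⟩
         2 * (M * g n) ∎)
    where
    open ≤-Reasoning
    distr : ∀ k a b → 2 * (k * (a + b)) ≡ 2 * k * a + 2 * k * b
    distr = solve-∀

  mostly-pure : ∀ {P Q : Property} N → (∀ {n} → N ≤ n → (G : Graph n) → Free T G → P G → Q G) → Mostly P Q
  mostly-pure N h k = N , λ n N≤n M _ → [] , (λ G fr p → inj₂ (h N≤n G fr p)) ,
    ≤-trans (≤-reflexive (*-zeroʳ k)) z≤n

  ext-iterate : ∀ q m → ∃ λ E → r * (q * m) ≤ s * E × 2 ^ E * g m ≤ g (q + m)
  ext-iterate zero m = 0 , ≤-trans (≤-reflexive (*-zeroʳ r)) z≤n , ≤-reflexive (*-identityˡ (g m))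
  ext-iterate (suc q) m with ext-iterate q m | ext (q + m)
  ... | E₁ , a₁ , b₁ | E₂ , a₂ , b₂ = E₂ + E₁
    , (begin
        r * (suc q * m) ≡⟨ *-distribˡ-+ r m (q * m) ⟩
        r * m + r * (q * m) ≤⟨ +-mono-≤ (≤-trans (*-monoʳ-≤ r (m≤n+m m q)) a₂) a₁ ⟩
        s * E₂ + s * E₁ ≡⟨ sym (*-distribˡ-+ s E₂ E₁) ⟩
        s * (E₂ + E₁) ∎)
    , (begin
        2 ^ (E₂ + E₁) * g m ≡⟨ cong (_* g m) (^-distribˡ-+-* 2 E₂ E₁) ⟩
        2 ^ E₂ * 2 ^ E₁ * g m ≡⟨ *-assoc (2 ^ E₂) _ _ ⟩
        2 ^ E₂ * (2 ^ E₁ * g m) ≤⟨ *-monoʳ-≤ (2 ^ E₂) b₁ ⟩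
        2 ^ E₂ * g (q + m) ≤⟨ b₂ ⟩
        g (suc q + m) ∎)
    where open ≤-Reasoning

  -- G can be reconstructed from the induced subgraph on the complement of Q, the graph on Q, and the
  -- table of adjacencies between them; few admissible tables make such G rare.
  record Removal (P Q : Property) : Set₁ where
    field
      q D c N₀ : ℕ
      D≥1 : 1 ≤ D
      q≥1 : 1 ≤ q
      Info : ℕ → Set
      infos : ∀ m → List (Info m)
      y : ℕ → ℕ
      x : ∀ {m} → Info m → Graph m → ℕ
      tab : ∀ {m} → Info m → Graph m → List (Table q m)
      infos-length : ∀ m → N₀ ≤ m → length (infos m) ≤ 2 ^ y m
      tab-length : ∀ {m} (ι : Info m) G → length (tab ι G) ≤ 2 ^ x ι G
      covers : ∀ {m} → N₀ ≤ m → (G : Graph (q + m)) → Free T G → P G →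
        (∃ λ (V : Fin q → Fin (q + m)) → Injective V × (∀ out → Complement V out → ∃ λ ι → ι ∈ infos m ×
          tableOf G V out ∈ tab ι (relabel out G) ×
          -- Divided by `D * s`: the bits spent stay below (1 - 1/s) q m by 2m / (D s). One of the
          -- two `m` pays for the polynomially many permutations, the other for all constants and
          -- for `k`.
          D * s * (x ι (relabel out G) + y m) + 2 * m ≤ D * r * q * m + c)) ⊎ Q G

  mostly-removal : ∀ {P Q : Property} → Removal P Q → Mostly P Q
  mostly-removal {P} {Q} R k = q + N , λ n N≤n M hyp →
      subst (Goal M) (m+[n∸m]≡n (≤-trans (m≤m+n q N) N≤n))
        (main (n ∸ q) (+-cancelˡ-≤ q N _ (≤-trans N≤n (≤-reflexive (sym (m+[n∸m]≡n (≤-trans (m≤m+n q N) N≤n)))))) M)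
        hyp
    where
    open Removal R
    open ≤-Reasoning
    Ds = D * s
    pc = polylog-const q q Ds
    N = suc (N₀ + (c + pc + Ds * (q * q) + Ds * k))
    Goal : ℕ → ℕ → Set
    Goal M n = (∀ m → m < n → f m ≤ M * g m) →
      ∃ λ (L : List (Graph n)) → (∀ G → Free T G → P G → G ∈ L ⊎ Q G) × k * length L ≤ M * g n
    -- The exponent `x ι G` varies with `ι` and `G`, so tables are listed only for those pairs that
    -- keep the budget.
    guard? : ∀ {m} (ι : Info m) (G : Graph m) → Dec (D * s * (x ι G + y m) + 2 * m ≤ D * r * q * m + c)
    guard? ι G = _ ≤? _
    guarded : ∀ {m} → Graph m → Info m → List (Table q m)
    guarded G ι = keepIf (guard? ι G) (tab ι G)
    module _ (m : ℕ) (N≤m : N ≤ m) (E : ℕ) (hE : r * (q * m) ≤ s * E) where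
      p = polylog q q Ds m
      o = p + (q * q + y m)
      passes : ∀ (ι : Info m) G → D * s * (x ι G + y m) + 2 * m ≤ D * r * q * m + c → x ι G + (o + k) ≤ E
      passes ι G le = *-cancelˡ-≤ Ds {{Ds≢0}} (certificate (suc N₀)
        (+-mono-≤ (+-mono-≤ le (polylog-bound q q Ds m)) (+-mono-≤ (*-monoʳ-≤ D hE) N≤m))
        (identity D s r q m (x ι G) (y m) p c pc k E N₀))
        where
        Ds≢0 : NonZero Ds
        Ds≢0 = >-nonZero (*-mono-≤ D≥1 (s≤s z≤n))
        identity : ∀ D s r q m x y p c pc k E N₀ →
          D * s * (x + (p + (q * q + y) + k)) + ((D * r * q * m + c + (m + pc)) + (D * (s * E) + m)) + suc N₀
          ≡ D * s * E + ((D * s * (x + y) + 2 * m + D * s * p) + (D * (r * (q * m)) + suc (N₀ + (c + pc + D * s * (q * q) + D * s * k))))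
        identity = solve-∀
      candidates : Permutation′ (q + m) → Graph m → Graph q → List (Graph (q + m))
      candidates π G I = map (λ X → relabel (π ⟨$⟩ˡ_) (assemble q G I X)) (concatMap (guarded G) (infos m))
      L₁ : Permutation′ (q + m) → Graph m → List (Graph (q + m))
      L₁ π G = concatMap (candidates π G) (allGraphs q)
      L₂ : Permutation′ (q + m) → List (Graph (q + m))
      L₂ π = concatMap (L₁ π) (freeList m)
      L : List (Graph (q + m))
      L = concatMap L₂ (permList q m)
      L-covers : ∀ G → Free T G → P G → (o + k ≤ E × G ∈ L) ⊎ Q G
      L-covers G fr PG with covers (≤-trans (≤-trans (m≤m+n N₀ _) (n≤1+n _)) N≤m) G fr PG
      ... | inj₂ QG = inj₂ QG
      ... | inj₁ (V , V-inj , cov) with permList-complete q m V V-inj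
      ... | π , π∈ , hπ with cov (back {q} π) record
            { out-inj = back-injective {q} π
            ; Q≢out = λ i v e → front≢back {q} π i v (trans (hπ i) e)
            ; Q-or-out = λ z → case front-or-back {q} π z of λ
                { (inj₁ (i , e)) → inj₁ (i , trans e (hπ i)) ; (inj₂ b) → inj₂ b } }
      ... | ι , ι∈ , X∈ , le = inj₁ (≤-trans (m≤n+m (o + k) (x ι (relabel (back {q} π) G))) (passes ι (relabel (back {q} π) G) le) ,
            subst (_∈ L) (sym (disassemble q π G))
              (∈-concatMap L₂ π∈ (∈-concatMap (L₁ π) (∈-freeList _ (free-relabel T _ (back-injective {q} π) G fr))
                (∈-concatMap (candidates π _) (allGraphs-complete _) (∈-map⁺ _
                  (∈-concatMap (guarded _) ι∈ (subst (_ ∈_) (sym (keepIf-yes (guard? ι _) le)) (subst (_∈ tab ι _) same X∈))))))))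
        where
        same : tableOf G V (back {q} π) ≡ tableOf G (front {q} {m} π) (back {q} π)
        same = tabulate-cong (λ i → cong (λ z → tabulate (λ v → adj G z (back {q} π v))) (sym (hπ i)))
      L-length : o + k ≤ E → length L ≤ 2 ^ (E ∸ k) * f m
      L-length le = begin
        length L ≤⟨ length-concatMap L₂ B₂ (permList q m) (λ π _ →
                      length-concatMap (L₁ π) B₁ (freeList m) (λ G _ →
                        length-pow (candidates π G) (allGraphs q) (q * q) (y m + h) (allGraphs-length q) (λ I _ →
                          ≤-trans (≤-reflexive (length-map _ (concatMap (guarded G) (infos m))))
                            (length-pow (guarded G) (infos m) (y m) h (infos-length m (≤-trans (≤-trans (m≤m+n N₀ _) (n≤1+n _)) N≤m))
                              (λ ι _ → guarded-length G ι))))) ⟩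
        length (permList q m) * B₂ ≤⟨ *-monoˡ-≤ B₂ (≤-trans (permList-length q m)
                                        (subst (λ z → z ^ q ≤ 2 ^ p) (+-comm m q) (polylog-pow q q Ds m))) ⟩
        2 ^ p * (f m * 2 ^ (q * q + (y m + h))) ≡⟨ regroup (2 ^ p) (f m) _ ⟩
        2 ^ p * 2 ^ (q * q + (y m + h)) * f m ≡⟨ cong (_* f m) (sym (^-distribˡ-+-* 2 p _)) ⟩
        2 ^ (p + (q * q + (y m + h))) * f m ≡⟨ cong (λ e → 2 ^ e * f m) expo ⟩
        2 ^ (E ∸ k) * f m ∎
        where
        h = E ∸ (o + k)
        B₁ = 2 ^ (q * q + (y m + h))
        B₂ = f m * B₁
        regroup : ∀ a b c → a * (b * c) ≡ a * c * b
        regroup = solve-∀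
        expo : p + (q * q + (y m + h)) ≡ E ∸ k
        expo = +-cancelʳ-≡ k _ _ (trans (assoc4 p (q * q) (y m) h k)
          (trans (m∸n+n≡m le) (sym (m∸n+n≡m (≤-trans (m≤n+m k o) le)))))
          where
          assoc4 : ∀ p qq y h k → p + (qq + (y + h)) + k ≡ h + (p + (qq + y) + k)
          assoc4 = solve-∀
        guarded-length : ∀ G ι → length (guarded G ι) ≤ 2 ^ h
        guarded-length G ι = length-keepIf (guard? ι G) (tab ι G) (λ pass →
          ≤-trans (tab-length ι G) (^-monoʳ-≤ 2 (m+n≤o⇒m≤o∸n (x ι G) (passes ι G pass))))
    main : ∀ m → N ≤ m → ∀ M → Goal M (q + m)
    main m N≤m M hyp with ext-iterate q m
    ... | E , hE , gE with o m N≤m E hE + k ≤? E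
    -- If the overhead alone exceeds `E`, no graph can keep the budget and there is nothing to list.
    ...   | no ¬le = [] , (λ G fr PG → case L-covers m N≤m E hE G fr PG of λ
              { (inj₁ (le , _)) → ⊥-elim (¬le le) ; (inj₂ QG) → inj₂ QG }) ,
              ≤-trans (≤-reflexive (*-zeroʳ k)) z≤n
    ...   | yes le = L m N≤m E hE , (λ G fr PG → case L-covers m N≤m E hE G fr PG of λ
              { (inj₁ (_ , G∈)) → inj₁ G∈ ; (inj₂ QG) → inj₂ QG }) , (begin
        k * length (L m N≤m E hE) ≤⟨ *-mono-≤ (n≤2^n k) (L-length m N≤m E hE le) ⟩
        2 ^ k * (2 ^ (E ∸ k) * f m) ≡⟨ sym (*-assoc (2 ^ k) _ _) ⟩
        2 ^ k * 2 ^ (E ∸ k) * f m ≡⟨ cong (_* f m) (sym (^-distribˡ-+-* 2 k (E ∸ k))) ⟩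
        2 ^ (k + (E ∸ k)) * f m ≡⟨ cong (λ e → 2 ^ e * f m) (m+[n∸m]≡n (≤-trans (m≤n+m k _) le)) ⟩
        2 ^ E * f m ≤⟨ *-monoʳ-≤ (2 ^ E) (hyp m (+-monoˡ-≤ m q≥1)) ⟩
        2 ^ E * (M * g m) ≡⟨ swap (2 ^ E) M (g m) ⟩
        M * (2 ^ E * g m) ≤⟨ *-monoʳ-≤ M gE ⟩
        M * g (q + m) ∎)
      where
      swap : ∀ a b c → a * (b * c) ≡ b * (a * c)
      swap = solve-∀

  -- A bootstrap. Take `M` at least 2 and at least every `f m` with m below the threshold for k = 2.
  -- Inductively f ≤ M g: the discarded graphs are at most half of M g, and g itself is at most the
  -- other half. Once the ratio is bounded at all orders, the factor `k * M` in place of 2 makes the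
  -- bad graphs negligible against `g`.
  mostly-conclude : ∀ {Q : Property} → Mostly (λ _ → ⊤) Q → (bad : ℕ → ℕ) →
    (∀ n (L : List (Graph n)) → (∀ G → Free T G → G ∈ L ⊎ Q G) → bad n ≤ length L) →
    (∀ n → f n ≤ g n + bad n) → (∀ n → 1 ≤ g n) → ∀ k → ∃ λ N → ∀ n → N ≤ n → k * bad n ≤ g n
  mostly-conclude most bad bad≤ f≤ g≥1 k with most 2
  ... | N , hN = proj₁ late , λ n N≤n → *-cancelˡ-≤ M {{>-nonZero (≤-trans (s≤s z≤n) M≥2)}} (begin
      M * (k * bad n) ≡⟨ shuffle M k (bad n) ⟩
      k * M * bad n ≤⟨ (let (L , cov , len) = proj₂ late n N≤n M (λ m _ → ratio m) in
          ≤-trans (*-monoʳ-≤ (k * M) (bad≤ n L (λ G fr → cov G fr tt))) len) ⟩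
      M * g n ∎)
    where
    open ≤-Reasoning
    shuffle : ∀ a b c → a * (b * c) ≡ b * a * c
    shuffle = solve-∀
    below : ∀ N → ∃ λ M → 2 ≤ M × (∀ m → m < N → f m ≤ M)
    below zero = 2 , ≤-refl , λ m ()
    below (suc N) with below N
    ... | M , M≥2 , h = M + f N , ≤-trans M≥2 (m≤m+n M _) , λ m m<sN → case m <? N of λ
      { (yes m<N) → ≤-trans (h m m<N) (m≤m+n M _)
      ; (no m≮N) → subst (λ z → f z ≤ M + f N) (≤-antisym (≮⇒≥ m≮N) (s≤s⁻¹ m<sN)) (m≤n+m (f N) M) }
    M = proj₁ (below N)
    M≥2 = proj₁ (proj₂ (below N))
    late = most (k * M)
    upTo-ratio : ∀ n m → m < n → f m ≤ M * g m
    upTo-ratio (suc n) m m<sn with m <? N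
    ... | yes m<N = ≤-trans (proj₂ (proj₂ (below N)) m m<N)
          (≤-trans (≤-reflexive (sym (*-identityʳ M))) (*-monoʳ-≤ M (g≥1 m)))
    ... | no m≮N = *-cancelˡ-≤ 2 (begin
        2 * f m ≤⟨ *-monoʳ-≤ 2 (f≤ m) ⟩
        2 * (g m + bad m) ≡⟨ *-distribˡ-+ 2 (g m) (bad m) ⟩
        2 * g m + 2 * bad m ≤⟨ +-mono-≤ (*-monoˡ-≤ (g m) M≥2) few ⟩
        M * g m + M * g m ≡⟨ cong (M * g m +_) (sym (+-identityʳ _)) ⟩
        2 * (M * g m) ∎)
      where
      few : 2 * bad m ≤ M * g m
      few = let (L , cov , len) = hN m (≮⇒≥ m≮N) M (λ l l<m → upTo-ratio n l (≤-trans l<m (s≤s⁻¹ m<sn))) in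
        ≤-trans (*-monoʳ-≤ 2 (bad≤ m L (λ G fr → cov G fr tt))) len
    ratio : ∀ m → f m ≤ M * g m
    ratio m = upTo-ratio (suc m) m ≤-refl

-- Subdivided stars

sadj : ∀ {s} → SVert s → SVert s → Bool
sadj centre   (mid _)  = true
sadj (mid _)  centre   = true
sadj (mid i)  (leaf j) = i == j
sadj (leaf i) (mid j)  = j == i
sadj _        _        = false

sadj-sym : ∀ {s} (v w : SVert s) → sadj v w ≡ sadj w v
sadj-sym centre   centre   = refl
sadj-sym centre   (mid _)  = refl
sadj-sym centre   (leaf _) = refl
sadj-sym (mid _)  centre   = refl
sadj-sym (mid _)  (mid _)  = refl
sadj-sym (mid _)  (leaf _) = refl
sadj-sym (leaf _) centre   = refl
sadj-sym (leaf _) (mid _)  = refl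
sadj-sym (leaf _) (leaf _) = refl

sadj-sound : ∀ {s} (v w : SVert s) → sadj v w ≡ true → SAdj v w
sadj-sound centre   (mid i)  e = c-m i
sadj-sound (mid i)  centre   e = m-c i
sadj-sound (mid i)  (leaf j) e with ==-sound {i = i} {j} e
... | refl = m-l i
sadj-sound (leaf i) (mid j)  e with ==-sound {i = j} {i} e
... | refl = l-m i

sadj-complete : ∀ {s} {v w : SVert s} → SAdj v w → sadj v w ≡ true
sadj-complete (c-m i) = refl
sadj-complete (m-c i) = refl
sadj-complete (m-l i) = ==-refl i
sadj-complete (l-m i) = ==-refl i

_≟ˢ_ : ∀ {s} → DecidableEquality (SVert s)
centre   ≟ˢ centre   = yes refl
centre   ≟ˢ (mid _)  = no λ ()
centre   ≟ˢ (leaf _) = no λ ()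
(mid _)  ≟ˢ centre   = no λ ()
(mid i)  ≟ˢ (mid j)  = map′ (cong mid) (λ { refl → refl }) (i ≟ᶠ j)
(mid _)  ≟ˢ (leaf _) = no λ ()
(leaf _) ≟ˢ centre   = no λ ()
(leaf _) ≟ˢ (mid _)  = no λ ()
(leaf i) ≟ˢ (leaf j) = map′ (cong leaf) (λ { refl → refl }) (i ≟ᶠ j)

vertices : ∀ s → List (SVert s)
vertices s = centre ∷ map mid (allFin s) ++ map leaf (allFin s)

vertices-complete : ∀ {s} (v : SVert s) → v ∈ vertices s
vertices-complete centre   = here refl
vertices-complete (mid i)  = there (∈-++⁺ˡ (∈-map⁺ mid (∈-allFin i)))
vertices-complete {s} (leaf i) = there (∈-++⁺ʳ (map mid (allFin s)) (∈-map⁺ leaf (∈-allFin i)))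

vertices-unique : ∀ s → Unique (vertices s)
vertices-unique s = tabulateAll centre∉
  ∷ UniqueP.++⁺ (UniqueP.map⁺ (λ { refl → refl }) (UniqueP.allFin⁺ s)) (UniqueP.map⁺ (λ { refl → refl }) (UniqueP.allFin⁺ s))
      (λ { (p , q) → case ∈-map⁻ mid p of λ { (_ , _ , refl) → case ∈-map⁻ leaf q of λ { (_ , _ , ()) } } })
  where
  centre∉ : ∀ {v} → v ∈ map mid (allFin s) ++ map leaf (allFin s) → centre ≢ v
  centre∉ v∈ refl with ∈-++⁻ (map mid (allFin s)) v∈
  ... | inj₁ p = case ∈-map⁻ mid p of λ { (_ , _ , ()) }
  ... | inj₂ p = case ∈-map⁻ leaf p of λ { (_ , _ , ()) }

vertices-length : ∀ s → length (vertices s) ≡ suc (s + s)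
vertices-length s = cong suc (trans (length-++ (map mid (allFin s)))
  (cong₂ _+_ (trans (length-map mid (allFin s)) (length-tabulate {n = s} id)) (trans (length-map leaf (allFin s)) (length-tabulate {n = s} id))))

-- Indexing by labels instead of vertices of T lets roles be assigned by name; injectivity is
-- contained in `link`.
HasStar : ∀ s {n} → Graph n → Set
HasStar s {n} G = ∃ λ (e : SVert s → Fin n) → ∀ v w → v ≢ w → link G (sadj v w) (e v) (e w) ≡ true

adj-star : ∀ {m s} (T : Graph m) (φ : Fin m → SVert s) →
  (∀ i j → (adj T i j ≡ true → SAdj (φ i) (φ j)) × (SAdj (φ i) (φ j) → adj T i j ≡ true)) →
  ∀ i j → adj T i j ≡ sadj (φ i) (φ j)
adj-star T φ h i j with sadj (φ i) (φ j) in e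
... | true  = proj₂ (h i j) (sadj-sound (φ i) (φ j) e)
... | false with adj T i j in e′
...   | false = refl
...   | true  = case trans (sym e) (sadj-complete (proj₁ (h i j) e′)) of λ ()

star⇒contains : ∀ {m s} (T : Graph m) (φ : Fin m → SVert s) → (∀ {i j} → φ i ≡ φ j → i ≡ j) →
  (∀ i j → adj T i j ≡ sadj (φ i) (φ j)) → ∀ {n} (G : Graph n) → HasStar s G → ContainsInduced T G
star⇒contains T φ φ-inj φ-adj G (e , h) = tabulate (e ∘ φ) , inj , adj-ok
  where
  at : ∀ i → lookup (tabulate (e ∘ φ)) i ≡ e (φ i)
  at = lookup∘tabulate (e ∘ φ)
  inj : ∀ i j → lookup (tabulate (e ∘ φ)) i ≡ lookup (tabulate (e ∘ φ)) j → i ≡ j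
  inj i j eq with φ i ≟ˢ φ j
  ... | yes p = φ-inj p
  ... | no ¬p = ⊥-elim (link-≢ G _ _ _ (h (φ i) (φ j) ¬p) (trans (sym (at i)) (trans eq (at j))))
  adj-ok : ∀ i j → adj G (lookup (tabulate (e ∘ φ)) i) (lookup (tabulate (e ∘ φ)) j) ≡ adj T i j
  adj-ok i j with i ≟ᶠ j
  ... | yes refl = trans (adj-irrefl G _) (sym (adj-irrefl T i))
  ... | no i≢j = trans (cong₂ (adj G) (at i) (at j))
        (trans (link-adj G _ _ _ (h (φ i) (φ j) (i≢j ∘ φ-inj))) (sym (φ-adj i j)))

-- Frames: almost homogeneous parts with dense and co-dense bipartite graphs between large subsets

opaque
  -- By `W-half`, a row that takes a value on at most 1/32 of a set can be listed there with about
  -- half of the bits. The remaining factor 2 absorbs deleted and exceptional vertices when a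
  -- statement about `G` is transferred to the remaining graph.
  κ : ℕ
  κ = 64

  κ≡64 : κ ≡ 64
  κ≡64 = refl

κ≥2 : 2 ≤ κ
κ≥2 = subst (2 ≤_) (sym κ≡64) (s≤s (s≤s z≤n))

κ≥1 : 1 ≤ κ
κ≥1 = ≤-trans (s≤s z≤n) κ≥2

κ≢0 : NonZero κ
κ≢0 = >-nonZero κ≥1

≤-mul : ∀ {c} x → 1 ≤ c → x ≤ c * x
≤-mul x c≥1 = ≤-trans (≤-reflexive (sym (*-identityˡ x))) (*-monoˡ-≤ x c≥1)

≤-κ* : ∀ x → x ≤ κ * x
≤-κ* x = ≤-mul x κ≥1

_⊆_ : ∀ {n} → (Fin n → Bool) → (Fin n → Bool) → Set
p ⊆ q = ∀ x → p x ≡ true → q x ≡ true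

-- Two instances are intended: parts of constant size, where `X` is everything and `pt` lists the
-- points, and classes of linear size, where `pt` is the identity and `X` is the class. Inside one
-- part only the value `ty` can be asked for.
record Frame {n} (G : Graph n) (r N γ : ℕ) : Set where
  field
    pt : Fin r → Fin N → Fin n
    X  : Fin r → Fin N → Bool
    ty : Fin r → Bool
    dense : ∀ i j b → (i ≡ j → b ≡ ty i) → ∀ A B → A ⊆ X i → B ⊆ X j → γ ≤ # A → γ ≤ # B →
      ∃ λ a → A a ≡ true × # B ≤ κ * # (λ p → B p ∧ link G b (pt i a) (pt j p))

subFrame : ∀ {n} {G : Graph n} {r r′ N γ} (ρ : Fin r′ → Fin r) → Injective ρ → Frame G r N γ → Frame G r′ N γ
subFrame ρ ρ-inj F = record
  { pt = pt ∘ ρ ; X = X ∘ ρ ; ty = ty ∘ ρ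
  ; dense = λ i j b h → dense (ρ i) (ρ j) b (λ e → h (ρ-inj i j e)) }
  where open Frame F

-- A set of this size still has more than γ elements after p shrinkings by the factor κ.
bound : ℕ → ℕ → ℕ
bound γ p = κ ^ p * suc γ

bound-mono : ∀ γ {p q} → p ≤ q → bound γ p ≤ bound γ q
bound-mono γ h = *-monoˡ-≤ (suc γ) (^-monoʳ-≤ κ {{κ≢0}} h)

module _ {n} {G : Graph n} {r N γ : ℕ} (F : Frame G r N γ) where
  open Frame F

  Demand : Set
  Demand = Fin r × Bool × (Fin N → Bool)

  met : Fin r → Fin N → Demand → ℕ
  met i a (j , b , B) = # (λ p → B p ∧ link G b (pt i a) (pt j p))

  Admissible : Fin r → Demand → Set
  Admissible i (j , b , B) = (i ≡ j → b ≡ ty i) × B ⊆ X j × γ ≤ # B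

  -- All but at most γ elements of a part meet a given demand.
  select : ∀ {D : Set} i A → A ⊆ X i → (ds : List D) (δ : D → Demand) →
    (∀ d → d ∈ ds → Admissible i (δ d)) → length ds * γ < # A →
    ∃ λ a → A a ≡ true × (∀ d → d ∈ ds → # (proj₂ (proj₂ (δ d))) ≤ κ * met i a (δ d))
  select {D} i A A⊆X ds δ ok lt with avoid A bad γ ds few lt
    where
    bad : D → Fin N → Bool
    bad d a = not (# (proj₂ (proj₂ (δ d))) ≤ᵗ (κ * met i a (δ d)))
    few : ∀ d → d ∈ ds → # (λ v → A v ∧ bad d v) ≤ γ
    few d d∈ with # (λ v → A v ∧ bad d v) ≤? γ
    ... | yes le = le
    ... | no ¬le with ok d d∈
    ...   | h , B⊆X , γ≤B with dense i (proj₁ (δ d)) (proj₁ (proj₂ (δ d))) h (λ v → A v ∧ bad d v) (proj₂ (proj₂ (δ d)))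
              (λ v e → A⊆X v (proj₁ (∧-split e))) B⊆X (<⇒≤ (≰⇒> ¬le)) γ≤B
    ...     | a , e , le = ⊥-elim (not-true (proj₂ (∧-split {A a} e)) (does-complete (# (proj₂ (proj₂ (δ d))) ≤? _) le))
  ... | a , Aa , good = a , Aa , λ d d∈ → does-sound (# (proj₂ (proj₂ (δ d))) ≤? κ * met i a (δ d)) (flip-not (good d d∈))
    where
    flip-not : ∀ {b} → not b ≡ false → b ≡ true
    flip-not {true} _ = refl

  module Greedy {K : Set} (_≟ᵏ_ : DecidableEquality K) (part : K → Fin r) (tgt : K → K → Bool)
    (tgt-sym : ∀ k l → tgt k l ≡ tgt l k) (p₀ : Fin N) where

    shrink : K → Fin N → (K → Fin N → Bool) → K → Fin N → Bool
    shrink k a C l p = C l p ∧ link G (tgt k l) (pt (part k) a) (pt (part l) p)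

    -- By `select` a position for the first key can be chosen so that every other candidate set
    -- keeps a 1/κ fraction of the right kind. This uses up one factor κ of `bound` per key.
    greedy : (ks : List K) → Unique ks → (C : K → Fin N → Bool) → (∀ k → C k ⊆ X (part k)) →
      (∀ k l → k ∈ ks → l ∈ ks → k ≢ l → part k ≡ part l → tgt k l ≡ ty (part k)) →
      (∀ k → k ∈ ks → bound γ (length ks) ≤ # (C k)) →
      ∃ λ (x : K → Fin N) → (∀ k → k ∈ ks → C k (x k) ≡ true) ×
        (∀ k l → k ∈ ks → l ∈ ks → k ≢ l → link G (tgt k l) (pt (part k) (x k)) (pt (part l) (x l)) ≡ true)
    greedy [] u C C⊆X okty big = (λ _ → p₀) , (λ _ ()) , λ _ _ ()
    greedy (k ∷ ks) (k∉ ∷ u) C C⊆X okty big with select (part k) (C k) (C⊆X k) ks (λ l → part l , tgt k l , C l) demands room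
      where
      κ^≥ : ∀ p → suc p ≤ κ ^ suc p
      κ^≥ p = ≤-trans (n≤2^n (suc p)) (^-monoˡ-≤ (suc p) κ≥2)
      demands : ∀ l → l ∈ ks → Admissible (part k) (part l , tgt k l , C l)
      demands l l∈ = okty k l (here refl) (there l∈) (lookupAll k∉ l∈) , C⊆X l ,
            ≤-trans (≤-trans (n≤1+n γ) (≤-trans (≤-reflexive (sym (*-identityˡ (suc γ))))
              (*-monoˡ-≤ (suc γ) (≤-trans (s≤s z≤n) (κ^≥ (length ks)))))) (big l (there l∈))
      room : length ks * γ < # (C k)
      room = ≤-trans (s≤s (*-monoʳ-≤ (length ks) (n≤1+n γ)))
        (≤-trans (+-monoˡ-≤ (length ks * suc γ) (s≤s (z≤n {γ}))) (≤-trans (*-monoˡ-≤ (suc γ) (κ^≥ (length ks))) (big k (here refl))))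
    ... | a , Ca , meets with greedy ks u (shrink k a C) (λ l p e → C⊆X l p (proj₁ (∧-split e)))
            (λ l l′ l∈ l′∈ → okty l l′ (there l∈) (there l′∈)) big′
      where
      big′ : ∀ l → l ∈ ks → bound γ (length ks) ≤ # (shrink k a C l)
      big′ l l∈ = *-cancelˡ-≤ κ {{κ≢0}}
        (≤-trans (≤-reflexive (sym (*-assoc κ (κ ^ length ks) (suc γ))))
          (≤-trans (big l (there l∈)) (meets l l∈)))
    ... | x , inC , links = x′ , inC′ , links′
      where
      x′ : K → Fin N
      x′ l with k ≟ᵏ l
      ... | yes _ = a
      ... | no _  = x l
      at-k : x′ k ≡ a
      at-k with k ≟ᵏ k
      ... | yes _ = refl
      ... | no ne = ⊥-elim (ne refl)
      at-l : ∀ l → l ∈ ks → x′ l ≡ x l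
      at-l l l∈ with k ≟ᵏ l
      ... | yes e = ⊥-elim (lookupAll k∉ l∈ e)
      ... | no _  = refl
      inC′ : ∀ l → l ∈ k ∷ ks → C l (x′ l) ≡ true
      inC′ l (here refl) = trans (cong (C k) at-k) Ca
      inC′ l (there l∈)  = trans (cong (C l) (at-l l l∈)) (proj₁ (∧-split (inC l l∈)))
      toK : ∀ l → l ∈ ks → link G (tgt k l) (pt (part k) (x′ k)) (pt (part l) (x′ l)) ≡ true
      toK l l∈ = trans (cong₂ (λ u v → link G (tgt k l) (pt (part k) u) (pt (part l) v)) at-k (at-l l l∈))
        (proj₂ (∧-split {C l (x l)} (inC l l∈)))
      links′ : ∀ l l′ → l ∈ k ∷ ks → l′ ∈ k ∷ ks → l ≢ l′ →
        link G (tgt l l′) (pt (part l) (x′ l)) (pt (part l′) (x′ l′)) ≡ true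
      links′ l l′ (here refl) (here refl) ne = ⊥-elim (ne refl)
      links′ l l′ (here refl) (there m)   ne = toK l′ m
      links′ l l′ (there m)   (here refl) ne = subst (λ b → link G b (pt (part l) (x′ l)) (pt (part l′) (x′ l′)) ≡ true) (tgt-sym k l)
        (link-sym G _ _ _ (toK l m))
      links′ l l′ (there m) (there m′) ne = trans
        (cong₂ (λ u v → link G (tgt l l′) (pt (part l) u) (pt (part l′) v)) (at-l l m) (at-l l′ m′)) (links l l′ m m′ ne)

  atom : ∀ {k} → (Fin k → Fin n) → (Fin k → Bool) → Fin r → Fin N → Bool
  atom w τ j p = X j p ∧ allB (λ a → link G (τ a) (w a) (pt j p))

  -- The vertices `w a` are given in the roles `ℓ a`. All other vertices of the star are placed
  -- greedily, each in the atom prescribed by its adjacencies to the `w a`; two of them may share a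
  -- part only if its type agrees with their adjacency in the star.
  embed-star : ∀ {s k} (w : Fin k → Fin n) (ℓ : Fin k → SVert s) → (part : SVert s → Fin r) → Fin N →
    (∀ a b → a ≢ b → link G (sadj (ℓ a) (ℓ b)) (w a) (w b) ≡ true) →
    (∀ v v′ → v ≢ v′ → (∀ a → v ≢ ℓ a) → (∀ a → v′ ≢ ℓ a) → part v ≡ part v′ → sadj v v′ ≡ ty (part v)) →
    (∀ j τ → bound γ (suc (s + s)) ≤ # (atom w τ j)) → HasStar s G
  embed-star {s} {k} w ℓ part p₀ triple parts big = e , links
    where
    special? : ∀ v → Dec (∃ λ a → v ≡ ℓ a)
    special? v = any? (λ a → v ≟ˢ ℓ a)
    ks : List (SVert s)
    ks = filter (λ v → ¬? (special? v)) (vertices s)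
    C : SVert s → Fin N → Bool
    C v = atom w (λ a → sadj (ℓ a) v) (part v)
    open Greedy _≟ˢ_ part sadj sadj-sym p₀
    found = greedy ks (UniqueP.filter⁺ (λ v → ¬? (special? v)) (vertices-unique s)) C (λ v p eq → proj₁ (∧-split eq))
      (λ v v′ v∈ v′∈ ne → parts v v′ ne
        (λ a eq → proj₂ (∈-filter⁻ (λ v → ¬? (special? v)) {xs = vertices s} v∈) (a , eq))
        (λ a eq → proj₂ (∈-filter⁻ (λ v → ¬? (special? v)) {xs = vertices s} v′∈) (a , eq)))
      (λ v _ → ≤-trans (bound-mono γ (≤-trans (length-filter (λ v → ¬? (special? v)) (vertices s)) (≤-reflexive (vertices-length s))))
        (big (part v) _))
    x = proj₁ found
    in-ks : ∀ v → ¬ (∃ λ a → v ≡ ℓ a) → v ∈ ks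
    in-ks v ns = ∈-filter⁺ (λ v → ¬? (special? v)) (vertices-complete v) ns
    e : SVert s → Fin n
    e v with special? v
    ... | yes (a , _) = w a
    ... | no _ = pt (part v) (x v)
    to-special : ∀ a v → ¬ (∃ λ a → v ≡ ℓ a) → link G (sadj (ℓ a) v) (w a) (pt (part v) (x v)) ≡ true
    to-special a v ns = allB-sound (proj₂ (∧-split {X (part v) (x v)} (proj₁ (proj₂ found) v (in-ks v ns)))) a
    links : ∀ v v′ → v ≢ v′ → link G (sadj v v′) (e v) (e v′) ≡ true
    links v v′ ne with special? v | special? v′
    ... | yes (a , refl) | yes (b , refl) = triple a b (λ eq → ne (cong ℓ eq))
    ... | yes (a , refl) | no ns = to-special a v′ ns
    ... | no ns | yes (b , refl) = subst (λ c → link G c _ _ ≡ true) (sadj-sym (ℓ b) v) (link-sym G _ _ _ (to-special b v ns))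
    ... | no ns | no ns′ = proj₂ (proj₂ found) v v′ (in-ks v ns) (in-ks v′ ns′) ne

tri : ∀ {A : Set} → A → A → A → Fin 3 → A
tri x y z zero             = x
tri x y z (suc zero)       = y
tri x y z (suc (suc zero)) = z

-- The path on the first branch, the centre and the branch suc z.
five : ∀ {r} → Fin r → Fin 5 → SVert (suc r)
five z zero                         = leaf zero
five z (suc zero)                   = mid zero
five z (suc (suc zero))             = centre
five z (suc (suc (suc zero)))       = mid (suc z)
five z (suc (suc (suc (suc zero)))) = leaf (suc z)

-- There is one part fewer than there are branches. Away from `z` each part is a clique and takes
-- the edge between middle and leaf of one branch. The path `five z` falls to part `z`; three of its
-- vertices will be given ones, so that only two have to fit the type of `z`, which may be the
-- single stable part.
branchPart : ∀ {r} → Fin r → SVert (suc r) → Fin r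
branchPart z centre         = z
branchPart z (mid zero)     = z
branchPart z (mid (suc j))  = j
branchPart z (leaf zero)    = z
branchPart z (leaf (suc j)) = j

branchPart-five : ∀ {r} (z : Fin r) a → branchPart z (five z a) ≡ z
branchPart-five z zero                         = refl
branchPart-five z (suc zero)                   = refl
branchPart-five z (suc (suc zero))             = refl
branchPart-five z (suc (suc (suc zero)))       = refl
branchPart-five z (suc (suc (suc (suc zero)))) = refl

data Five {r} (z : Fin r) : SVert (suc r) → Set where
  inFive    : ∀ a → Five z (five z a)
  otherMid  : ∀ j → j ≢ z → Five z (mid (suc j))
  otherLeaf : ∀ j → j ≢ z → Five z (leaf (suc j))

five? : ∀ {r} (z : Fin r) v → Five z v
five? z centre     = inFive (suc (suc zero))
five? z (mid zero) = inFive (suc zero)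
five? z (mid (suc j)) with j ≟ᶠ z
... | yes refl = inFive (suc (suc (suc zero)))
... | no ne    = otherMid j ne
five? z (leaf zero) = inFive zero
five? z (leaf (suc j)) with j ≟ᶠ z
... | yes refl = inFive (suc (suc (suc (suc zero))))
... | no ne    = otherLeaf j ne

module _ {r} (z : Fin r) (ty : Fin r → Bool) (others : ∀ j → j ≢ z → ty j ≡ true)
  (t : Fin 3 → Fin 5) (c d : Fin 5) (cover : ∀ a → (∃ λ i → a ≡ t i) ⊎ (a ≡ c ⊎ a ≡ d))
  (cd : sadj (five z c) (five z d) ≡ ty z) where

  parts-ok : ∀ v v′ → v ≢ v′ → (∀ a → v ≢ five z (t a)) → (∀ a → v′ ≢ five z (t a)) →
    branchPart z v ≡ branchPart z v′ → sadj v v′ ≡ ty (branchPart z v)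
  parts-ok v v′ ne ns ns′ same with five? z v | five? z v′
  ... | inFive a | inFive b with cover a | cover b
  ...   | inj₁ (i , refl) | _ = ⊥-elim (ns i refl)
  ...   | inj₂ _ | inj₁ (i , refl) = ⊥-elim (ns′ i refl)
  ...   | inj₂ (inj₁ refl) | inj₂ (inj₁ refl) = ⊥-elim (ne refl)
  ...   | inj₂ (inj₁ refl) | inj₂ (inj₂ refl) = trans cd (cong ty (sym (branchPart-five z c)))
  ...   | inj₂ (inj₂ refl) | inj₂ (inj₁ refl) = trans (trans (sadj-sym (five z d) (five z c)) cd) (cong ty (sym (branchPart-five z d)))
  ...   | inj₂ (inj₂ refl) | inj₂ (inj₂ refl) = ⊥-elim (ne refl)
  parts-ok v v′ ne ns ns′ same | inFive a | otherMid j j≢z  = ⊥-elim (j≢z (trans (sym same) (branchPart-five z a)))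
  parts-ok v v′ ne ns ns′ same | inFive a | otherLeaf j j≢z = ⊥-elim (j≢z (trans (sym same) (branchPart-five z a)))
  parts-ok v v′ ne ns ns′ same | otherMid j j≢z  | inFive a = ⊥-elim (j≢z (trans same (branchPart-five z a)))
  parts-ok v v′ ne ns ns′ same | otherLeaf j j≢z | inFive a = ⊥-elim (j≢z (trans same (branchPart-five z a)))
  parts-ok v v′ ne ns ns′ refl | otherMid j j≢z  | otherMid _ _  = ⊥-elim (ne refl)
  parts-ok v v′ ne ns ns′ refl | otherLeaf j j≢z | otherLeaf _ _ = ⊥-elim (ne refl)
  parts-ok v v′ ne ns ns′ refl | otherMid j j≢z  | otherLeaf _ _ = trans (==-refl (suc j)) (sym (others j j≢z))
  parts-ok v v′ ne ns ns′ refl | otherLeaf j j≢z | otherMid _ _  = trans (==-refl (suc j)) (sym (others j j≢z))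

coverDec : (t : Fin 3 → Fin 5) (c d : Fin 5) → Dec (∀ a → (∃ λ i → a ≡ t i) ⊎ (a ≡ c ⊎ a ≡ d))
coverDec t c d = all? (λ a → any? (λ i → a ≟ᶠ t i) ⊎-dec ((a ≟ᶠ c) ⊎-dec (a ≟ᶠ d)))

i0 i1 i2 i3 i4 : Fin 5
i0 = zero
i1 = suc zero
i2 = suc (suc zero)
i3 = suc (suc (suc zero))
i4 = suc (suc (suc (suc zero)))

sidePart : ∀ {r s} → Fin r → Fin r → SVert s → Fin r
sidePart i j centre   = i
sidePart i j (mid _)  = j
sidePart i j (leaf _) = i

module _ {n} {G : Graph n} {ρ N γ : ℕ} (F : Frame G ρ N γ) (p₀ : Fin N) {S : ℕ} where
  open Frame F

  -- The star is bipartite: the centre and the leaves go to part `i`, the middle vertices to part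
  -- `j`.
  two-stable : ∀ i j → i ≢ j → ty i ≡ false → ty j ≡ false → (∀ k → bound γ (suc (S + S)) ≤ # (X k)) → HasStar S G
  two-stable i j i≢j tyi tyj h = embed-star F {k = 0} (λ ()) (λ ()) (sidePart i j) p₀ (λ ())
    (λ v v′ _ _ _ → same v v′)
    (λ k τ → ≤-trans (h k) (#-mono (λ p e → ∧-join e (allB-complete {0} (λ ())))))
    where
    same : ∀ (v v′ : SVert S) → sidePart i j v ≡ sidePart i j v′ → sadj v v′ ≡ ty (sidePart i j v)
    same centre   centre   e = sym tyi
    same centre   (mid _)  e = ⊥-elim (i≢j e)
    same centre   (leaf _) e = sym tyi
    same (mid _)  centre   e = ⊥-elim (i≢j (sym e))
    same (mid _)  (mid _)  e = sym tyj
    same (mid _)  (leaf _) e = ⊥-elim (i≢j (sym e))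
    same (leaf _) centre   e = sym tyi
    same (leaf _) (mid _)  e = ⊥-elim (i≢j e)
    same (leaf _) (leaf _) e = sym tyi

module _ {n} {G : Graph n} {r N γ : ℕ} (F : Frame G (suc r) N γ) (p₀ : Fin N) where
  open Frame F

  private
    S : ℕ
    S = suc (suc r)
    big : ℕ
    big = bound γ (suc (S + S))

  BigAtoms : (w : Fin 3 → Fin n) → Set
  BigAtoms w = ∀ j τ → big ≤ # (atom F w τ j)

  triple-star : ∀ z → (∀ j → j ≢ z → ty j ≡ true) → (t : Fin 3 → Fin 5) (c d : Fin 5) →
    (∀ a → (∃ λ i → a ≡ t i) ⊎ (a ≡ c ⊎ a ≡ d)) → sadj (five z c) (five z d) ≡ ty z →
    ∀ x y w → link G (sadj (five z (t zero)) (five z (t (suc zero)))) x y ≡ true →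
    link G (sadj (five z (t zero)) (five z (t (suc (suc zero))))) x w ≡ true →
    link G (sadj (five z (t (suc zero))) (five z (t (suc (suc zero))))) y w ≡ true →
    BigAtoms (tri x y w) → HasStar S G
  triple-star z others t c d cover cd x y w xy xw yw atoms =
    embed-star F (tri x y w) (five z ∘ t) (branchPart z) p₀ links (parts-ok z ty others t c d cover cd) atoms
    where
    flip-link : ∀ a b {u v} → link G (sadj (five z a) (five z b)) u v ≡ true → link G (sadj (five z b) (five z a)) v u ≡ true
    flip-link a b {u} {v} e = subst (λ q → link G q v u ≡ true) (sadj-sym (five z a) (five z b)) (link-sym G _ u v e)
    links : ∀ a b → a ≢ b → link G (sadj (five z (t a)) (five z (t b))) (tri x y w a) (tri x y w b) ≡ true
    links zero             zero             ne = ⊥-elim (ne refl)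
    links zero             (suc zero)       ne = xy
    links zero             (suc (suc zero)) ne = xw
    links (suc zero)       zero             ne = flip-link (t zero) (t (suc zero)) xy
    links (suc zero)       (suc zero)       ne = ⊥-elim (ne refl)
    links (suc zero)       (suc (suc zero)) ne = yw
    links (suc (suc zero)) zero             ne = flip-link (t zero) (t (suc (suc zero))) xw
    links (suc (suc zero)) (suc zero)       ne = flip-link (t (suc zero)) (t (suc (suc zero))) yw
    links (suc (suc zero)) (suc (suc zero)) ne = ⊥-elim (ne refl)

  -- x is the middle vertex of a path on three vertices (b = true) or of the complement of one (b = false).
  cherry-star : ∀ b x y w → link G b x y ≡ true → link G b x w ≡ true → link G (not b) y w ≡ true →
    BigAtoms (tri x y w) → HasStar S G
  cherry-star b x y w xy xw yw atoms with any? (λ i → any? (λ j → ¬? (i ≟ᶠ j) ×-dec ((ty i ≟ᵇ false) ×-dec (ty j ≟ᵇ false))))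
  ... | yes (i , j , i≢j , ei , ej) = two-stable F p₀ i j i≢j ei ej
        (λ k → ≤-trans (atoms k (λ _ → true)) (#-mono (λ p e → proj₁ (∧-split e))))
  ... | no none = go (any? (λ i → ty i ≟ᵇ false))
    where
    -- Each of the four cases gives `x`, `y`, `w` three roles on the path of five vertices with the
    -- adjacencies required by `b`, such that the two roles left over are adjacent exactly when
    -- `ty z` is true.
    fin : ∀ b → link G b x y ≡ true → link G b x w ≡ true → link G (not b) y w ≡ true →
      ∀ z → (∀ j → j ≢ z → ty j ≡ true) → HasStar S G
    fin true xy xw yw z others with bool-cases (ty z)
    ... | inj₁ e = triple-star z others (tri i1 i2 i0) i3 i4 (does-sound (coverDec (tri i1 i2 i0) i3 i4) refl)
            (trans (==-refl (suc z)) (sym e)) x y w xy xw yw atoms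
    ... | inj₂ e = triple-star z others (tri i2 i1 i3) i0 i4 (does-sound (coverDec (tri i2 i1 i3) i0 i4) refl)
            (sym e) x y w xy xw yw atoms
    fin false xy xw yw z others with bool-cases (ty z)
    ... | inj₁ e = triple-star z others (tri i0 i3 i4) i1 i2 (does-sound (coverDec (tri i0 i3 i4) i1 i2) refl)
            (sym e) x y w xy xw (subst (λ q → link G q y w ≡ true) (sym (==-refl (suc z))) yw) atoms
    ... | inj₂ e = triple-star z others (tri i3 i0 i1) i2 i4 (does-sound (coverDec (tri i3 i0 i1) i2 i4) refl)
            (sym e) x y w xy xw yw atoms
    go : Dec (∃ λ i → ty i ≡ false) → HasStar S G
    go (yes (z , e)) = fin b xy xw yw z (λ j j≢z → case bool-cases (ty j) of λ
      { (inj₁ t) → t ; (inj₂ f) → ⊥-elim (none (j , z , j≢z , f , e)) })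
    go (no ¬f) = fin b xy xw yw zero (λ j _ → case bool-cases (ty j) of λ
      { (inj₁ t) → t ; (inj₂ f) → ⊥-elim (¬f (j , f)) })

  cell : (u a b : Fin n) (τ₀ τ₁ τ₂ : Bool) → Fin (suc r) → Fin N → Bool
  cell u a b τ₀ τ₁ τ₂ j p = X j p ∧ (link G τ₀ u (pt j p) ∧ (link G τ₁ a (pt j p) ∧ link G τ₂ b (pt j p)))

  cell-parts : ∀ u a b τ₀ τ₁ τ₂ j p → cell u a b τ₀ τ₁ τ₂ j p ≡ true →
    X j p ≡ true × link G τ₀ u (pt j p) ≡ true × link G τ₁ a (pt j p) ≡ true × link G τ₂ b (pt j p) ≡ true
  cell-parts u a b τ₀ τ₁ τ₂ j p = split4
    where
    split4 : ∀ {a b c d} → a ∧ (b ∧ (c ∧ d)) ≡ true → a ≡ true × b ≡ true × c ≡ true × d ≡ true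
    split4 {true} {true} {true} e = refl , refl , refl , e

  -- Whether or not `a` and `b` are adjacent, the triple has one or two edges: either `a` is the
  -- middle of an induced path, or `b` is isolated from the edge `u a`. Both are cases of
  -- `cherry-star`.
  mixed-star : ∀ u a b → link G true u a ≡ true → link G false u b ≡ true →
    (∀ j τ₀ τ₁ τ₂ → big ≤ # (cell u a b τ₀ τ₁ τ₂ j)) → HasStar S G
  mixed-star u a b ua ub cells with link-or G a b (λ { refl → case trans (sym (link-adj G true u a ua)) (link-adj G false u b ub) of λ () })
  ... | inj₁ ab = cherry-star true a u b (link-sym G true u a ua) ab ub
        (λ j τ → ≤-trans (cells j (τ (suc zero)) (τ zero) (τ (suc (suc zero)))) (#-mono (λ p e →
          let (x , y , z , w) = cell-parts u a b _ _ _ j p e in ∧-join {X j p} x (allB-complete λ { zero → z ; (suc zero) → y ; (suc (suc zero)) → w }))))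
  ... | inj₂ ab = cherry-star false b u a (link-sym G false u b ub) (link-sym G false a b ab) ua
        (λ j τ → ≤-trans (cells j (τ (suc zero)) (τ (suc (suc zero))) (τ zero)) (#-mono (λ p e →
          let (x , y , z , w) = cell-parts u a b _ _ _ j p e in ∧-join {X j p} x (allB-complete λ { zero → w ; (suc zero) → y ; (suc (suc zero)) → z }))))

module _ {n} {G : Graph n} {r N γ : ℕ} (F : Frame G (suc (suc r)) N γ) where
  open Frame F

  private
    S : ℕ
    S = suc (suc r)
    big : ℕ
    big = bound γ (suc (S + S))
    F′ : Frame G (suc r) N γ
    F′ = subFrame suc (λ i j → sucᶠ-injective) F
    γ≤big : γ ≤ big
    γ≤big = ≤-trans (n≤1+n γ) (≤-trans (≤-reflexive (sym (*-identityˡ (suc γ))))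
           (*-monoˡ-≤ (suc γ) (m^n>0 κ {{κ≢0}} (suc (S + S)))))

  module _ (u : Fin n) (large : ∀ i b → κ * (κ * big) ≤ # (λ p → X i p ∧ link G b u (pt i p)))
    (room : suc r * 8 * γ < κ * (κ * big)) where

    private
      Near : Bool → Fin N → Bool
      Near b p = X zero p ∧ link G b u (pt zero p)

      D₁ : Fin (suc r) × Bool → Fin N → Bool
      D₁ (j , τ) p = X (suc j) p ∧ link G τ u (pt (suc j) p)

      E₁ : Enumeration ((Fin (suc r) × Bool) × Bool) (suc r * 2 * 2)
      E₁ = enum× (enum× (enumFin (suc r)) enumBool) enumBool

      δ₁ : (Fin (suc r) × Bool) × Bool → Demand F
      δ₁ (jτ , b) = suc (proj₁ jτ) , b , D₁ jτ

      size₁ : length (elements E₁) * γ < # (Near true)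
      size₁ = ≤-trans (s≤s (*-monoˡ-≤ γ (≤-trans (size E₁) (≤-trans (≤-reflexive (*-assoc (suc r) 2 2)) (*-monoʳ-≤ (suc r) (m≤m+n 4 4))))))
        (≤-trans room (large zero true))

      pickA : ∃ λ a → Near true a ≡ true × (∀ d → d ∈ elements E₁ → # (D₁ (proj₁ d)) ≤ κ * met F zero a (δ₁ d))
      pickA = select F zero (Near true) (λ p e → proj₁ (∧-split e)) (elements E₁) δ₁
        (λ { ((j , τ) , b) _ → (λ ()) , (λ p e → proj₁ (∧-split e)) ,
          ≤-trans γ≤big (≤-trans (≤-trans (≤-κ* big) (≤-κ* (κ * big))) (large (suc j) τ)) })
        size₁

      a₀ : Fin N
      a₀ = proj₁ pickA

      D₂ : (Fin (suc r) × Bool) × Bool → Fin N → Bool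
      D₂ (jτ , b) p = D₁ jτ p ∧ link G b (pt zero a₀) (pt (suc (proj₁ jτ)) p)

      E₂ : Enumeration (((Fin (suc r) × Bool) × Bool) × Bool) (suc r * 2 * 2 * 2)
      E₂ = enum× E₁ enumBool

      δ₂ : ((Fin (suc r) × Bool) × Bool) × Bool → Demand F
      δ₂ (d , c) = suc (proj₁ (proj₁ d)) , c , D₂ d

      large₂ : ∀ j τ b → κ * big ≤ # (D₂ ((j , τ) , b))
      large₂ j τ b = *-cancelˡ-≤ κ {{κ≢0}} (≤-trans (large (suc j) τ) (proj₂ (proj₂ pickA) ((j , τ) , b) (complete E₁ _)))

      size₂ : length (elements E₂) * γ < # (Near false)
      size₂ = ≤-trans (s≤s (*-monoˡ-≤ γ (≤-trans (size E₂) (≤-reflexive (trans (cong (_* 2) (*-assoc (suc r) 2 2)) (*-assoc (suc r) 4 2))))))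
        (≤-trans room (large zero false))

      pickB : ∃ λ b → Near false b ≡ true × (∀ d → d ∈ elements E₂ → # (D₂ (proj₁ d)) ≤ κ * met F zero b (δ₂ d))
      pickB = select F zero (Near false) (λ p e → proj₁ (∧-split e)) (elements E₂) δ₂
        (λ { (((j , τ) , b) , c) _ → (λ ()) , (λ p e → proj₁ (∧-split (proj₁ (∧-split e)))) ,
          ≤-trans γ≤big (≤-trans (≤-κ* big) (large₂ j τ b)) })
        size₂

      b₀ : Fin N
      b₀ = proj₁ pickB

      reassoc : ∀ {a b c d} → ((a ∧ b) ∧ c) ∧ d ≡ true → a ∧ (b ∧ (c ∧ d)) ≡ true
      reassoc {true} {true} {true} e = e

      cells : ∀ j τ₀ τ₁ τ₂ → big ≤ # (cell F′ a₀ u (pt zero a₀) (pt zero b₀) τ₀ τ₁ τ₂ j)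
      cells j τ₀ τ₁ τ₂ = ≤-trans
        (*-cancelˡ-≤ κ {{κ≢0}} (≤-trans (large₂ j τ₀ τ₁) (proj₂ (proj₂ pickB) (((j , τ₀) , τ₁) , τ₂) (complete E₂ _))))
        (#-mono (λ p e → reassoc {X (suc j) p} {link G τ₀ u (pt (suc j) p)} {link G τ₁ (pt zero a₀) (pt (suc j) p)} e))

    -- Part `zero` is spent on a neighbour and a non-neighbour of `u` that split the relevant
    -- subsets of the other parts; these parts then serve as the frame for `mixed-star`. The two
    -- choices cost a factor κ each, and `room` allows for the at most 8 (r + 1) demands to be met
    -- at once.
    mixed-everywhere-star : HasStar S G
    mixed-everywhere-star = mixed-star F′ a₀ u (pt zero a₀) (pt zero b₀)
      (proj₂ (∧-split {X zero a₀} (proj₁ (proj₂ pickA)))) (proj₂ (∧-split {X zero b₀} (proj₁ (proj₂ pickB)))) cells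

-- Ramsey's theorem

Monochromatic : ∀ {A : Set} → (A → A → Bool) → Bool → ∀ {t} → Vec A t → Set
Monochromatic c b v = ∀ p q → p ≢ q → lookup v p ≢ lookup v q × c (lookup v p) (lookup v q) ≡ b

module _ {A : Set} (c : A → A → Bool) (c-sym : ∀ x y → c x y ≡ c y x) where

  mono-cons : ∀ {b t y} {v : Vec A t} → Monochromatic c b v → (∀ i → y ≢ lookup v i × c y (lookup v i) ≡ b) →
    Monochromatic c b (y ∷ v)
  mono-cons mv h zero    zero    ne = ⊥-elim (ne refl)
  mono-cons mv h zero    (suc q) ne = h q
  mono-cons {y = y} mv h (suc p) zero ne = (λ e → proj₁ (h p) (sym e)) , trans (c-sym _ y) (proj₂ (h p))
  mono-cons mv h (suc p) (suc q) ne = mv p q (ne ∘ cong suc)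

  length-partition : ∀ y xs → length xs ≡
    length (filter (λ z → c y z ≟ᵇ true) xs) + length (filter (λ z → c y z ≟ᵇ false) xs)
  length-partition y [] = refl
  length-partition y (x ∷ xs) with c y x
  ... | true  = cong suc (length-partition y xs)
  ... | false = trans (cong suc (length-partition y xs)) (sym (+-suc _ _))

  ramsey : ∀ a b (ys : List A) → Unique ys → 2 ^ (a + b) ≤ length ys →
    (∃ λ (v : Vec A a) → (∀ i → lookup v i ∈ ys) × Monochromatic c true v) ⊎
    (∃ λ (v : Vec A b) → (∀ i → lookup v i ∈ ys) × Monochromatic c false v)
  ramsey zero    b       ys u h = inj₁ ([] , (λ ()) , λ ())
  ramsey (suc a) zero    ys u h = inj₂ ([] , (λ ()) , λ ())
  ramsey (suc a) (suc b) [] u h = ⊥-elim (<⇒≱ (m^n>0 2 (suc a + suc b)) h)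
  ramsey (suc a) (suc b) (y ∷ ys) (y∉ ∷ u) h with 2 ^ (a + suc b) ≤? length (filter (λ z → c y z ≟ᵇ true) ys)
  ... | yes le with ramsey a (suc b) (filter (λ z → c y z ≟ᵇ true) ys) (UniqueP.filter⁺ (λ z → c y z ≟ᵇ true) u) le
  ...   | inj₁ (v , v∈ , mv) = inj₁ (y ∷ v , (λ { zero → here refl ; (suc i) → there (proj₁ (∈-filter⁻ (λ z → c y z ≟ᵇ true) (v∈ i))) }) ,
            mono-cons mv (λ i → lookupAll y∉ (proj₁ (∈-filter⁻ (λ z → c y z ≟ᵇ true) (v∈ i))) , proj₂ (∈-filter⁻ (λ z → c y z ≟ᵇ true) {xs = ys} (v∈ i))))
  ...   | inj₂ (v , v∈ , mv) = inj₂ (v , (λ i → there (proj₁ (∈-filter⁻ (λ z → c y z ≟ᵇ true) (v∈ i)))) , mv)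
  ramsey (suc a) (suc b) (y ∷ ys) (y∉ ∷ u) h | no ¬le
    with ramsey (suc a) b (filter (λ z → c y z ≟ᵇ false) ys) (UniqueP.filter⁺ (λ z → c y z ≟ᵇ false) u) enough
    where
    n₁ = length (filter (λ z → c y z ≟ᵇ true) ys)
    n₂ = length (filter (λ z → c y z ≟ᵇ false) ys)
    enough : 2 ^ (suc a + b) ≤ n₂
    enough = subst (λ e → 2 ^ e ≤ n₂) (+-suc a b) (certificate {b = n₂} 0 (+-mono-≤ h (≰⇒> ¬le))
      (identity (2 ^ (a + suc b)) n₁ n₂ (length ys) (length-partition y ys)))
      where
      identity : ∀ P n₁ n₂ l → l ≡ n₁ + n₂ → P + (suc l + P) + 0 ≡ n₂ + (2 * P + suc n₁)
      identity P n₁ n₂ _ refl = eq P n₁ n₂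
        where
        eq : ∀ P n₁ n₂ → P + (suc (n₁ + n₂) + P) + 0 ≡ n₂ + (2 * P + suc n₁)
        eq = solve-∀
  ...   | inj₁ (v , v∈ , mv) = inj₁ (v , (λ i → there (proj₁ (∈-filter⁻ (λ z → c y z ≟ᵇ false) (v∈ i)))) , mv)
  ...   | inj₂ (v , v∈ , mv) = inj₂ (y ∷ v , (λ { zero → here refl ; (suc i) → there (proj₁ (∈-filter⁻ (λ z → c y z ≟ᵇ false) (v∈ i))) }) ,
            mono-cons mv (λ i → lookupAll y∉ (proj₁ (∈-filter⁻ (λ z → c y z ≟ᵇ false) (v∈ i))) , proj₂ (∈-filter⁻ (λ z → c y z ≟ᵇ false) {xs = ys} (v∈ i))))

-- Dense and co-dense bipartite patterns exist, by counting

-- `W-bound` with blocks of length 8 gives N / 8 + 1 + 8k bits, and 8k ≤ N / 4.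
W-half : ∀ N k → 32 * k ≤ N → ∃ λ h → W N k ≤ 2 ^ h × 2 * h ≤ N + 2
W-half N k le = suc (N / 8) + 8 * k , W-bound 8 (suc (N / 8)) N k
    (≤-trans (m<[m/d+1]*d N 7) (≤-reflexive (sym (*-suc 8 (N / 8))))) ,
  *-cancelˡ-≤ 4 (certificate N (+-mono-≤ (d*[m/d]≤m N 7) (*-monoʳ-≤ 2 le)) (identity N k (N / 8)))
  where
  identity : ∀ N k q → 4 * (2 * (suc q + 8 * k)) + (N + 2 * N) + N ≡ 4 * (N + 2) + (8 * q + 2 * (32 * k))
  identity = solve-∀

Dense : ∀ {t} → (Fin t → Fin t → Bool) → ℕ → Set
Dense {t} Γ γ = ∀ b (A B : Fin t → Bool) → γ ≤ # A → γ ≤ # B →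
  ∃ λ a → A a ≡ true × # B ≤ κ * # (λ p → B p ∧ (Γ a p ==ᵇ b))

-- Density is asymmetric, since one vertex `a` on the first side must serve a large part of the
-- second. Between two parts it is needed from either side.
record Pattern (t γ : ℕ) : Set where
  field
    Γ : Fin t → Fin t → Bool
    rows : Dense Γ γ
    cols : Dense (λ p q → Γ q p) γ

allVecBool-length-≥ : ∀ n → 2 ^ n ≤ length (allVecBool n)
allVecBool-length-≥ zero = ≤-refl
allVecBool-length-≥ (suc n) = ≤-trans (≤-trans (≤-reflexive (*-comm 2 (2 ^ n))) (*-monoˡ-≤ 2 (allVecBool-length-≥ n)))
  (length-concatMap-≥ (λ v → (true ∷ v) ∷ (false ∷ v) ∷ []) 2 (allVecBool n) (λ _ _ → ≤-refl))

opaque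
  enumVecBool : ∀ n → Enumeration (Vec Bool n) (2 ^ n)
  enumVecBool n = enumeration (allVecBool n) allVecBool-complete (allVecBool-length n)

_≟ᵛ_ : ∀ {n} → DecidableEquality (Vec Bool n)
_≟ᵛ_ = ≡-dec _≟ᵇ_

_∈?_ : ∀ {n} (v : Vec Bool n) xs → Dec (v ∈ xs)
v ∈? xs = anyL? (v ≟ᵛ_) xs

missed : ∀ n (xs : List (Vec Bool n)) → length xs < 2 ^ n → ∃ λ v → v ∉ xs
missed n xs lt with anyL? (λ v → ¬? (v ∈? xs)) (allVecBool n)
... | yes some = let (v , _ , v∉) = find some in v , v∉
... | no none = ⊥-elim (<⇒≱ lt (≤-trans (allVecBool-length-≥ n) (unique-length (allVecBool-unique n)
      (λ {v} v∈ → decidable-stable (v ∈? xs) (λ v∉ → none (lose v∈ v∉))))))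

choose : ∀ {A : Set} → Bool → A → A → A
choose true  x y = x
choose false x y = y

opaque
  unfolding sumF #
  sumF-choose : ∀ {n} (A : Fin n → Bool) y g → g ≤ y → sumF (λ i → choose (A i) (y ∸ g) y) + # A * g ≡ n * y
  sumF-choose {zero}  A y g le = refl
  sumF-choose {suc n} A y g le with A zero
  ... | true  = trans (regroup (y ∸ g) _ g (# (A ∘ suc))) (cong₂ _+_ (m∸n+n≡m le) (sumF-choose (A ∘ suc) y g le))
    where
    regroup : ∀ a s g k → (a + s) + suc k * g ≡ (a + g) + (s + k * g)
    regroup = solve-∀
  ... | false = trans (+-assoc y _ _) (cong (y +_) (sumF-choose (A ∘ suc) y g le))

module _ (t γ g : ℕ) (hg : 2 * g + 2 ≤ γ) where

  Row : Bool → Vec Bool t → List (Vec Bool t)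
  Row b B = keepIf (γ ≤? # (lookup B)) (rowList (lookup B) (λ _ → false) (λ _ → b) (# (lookup B) / 64) 0)

  Row-length : ∀ b B → length (Row b B) ≤ 2 ^ (t ∸ g)
  Row-length b B = length-keepIf (γ ≤? # (lookup B)) _ λ γ≤B →
    let (h , Wh , hh) = W-half (# (lookup B)) (# (lookup B) / 64) (≤-trans (*-monoˡ-≤ (# (lookup B) / 64) (m≤m+n 32 32)) (d*[m/d]≤m (# (lookup B)) 63))
    in begin
      length (rowList (lookup B) (λ _ → false) (λ _ → b) (# (lookup B) / 64) 0)
        ≤⟨ length-rowList (lookup B) (λ _ → false) (λ _ → b) (# (lookup B) / 64) 0 ⟩
      2 ^ # (λ x → not (lookup B x) ∧ true) * (W (# (lookup B)) (# (lookup B) / 64) * W (# {t} (λ x → false)) 0)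
        ≤⟨ *-monoʳ-≤ (2 ^ # (λ x → not (lookup B x) ∧ true)) (*-mono-≤ Wh (≤-reflexive (W-zero (# {t} (λ x → false))))) ⟩
      2 ^ # (λ x → not (lookup B x) ∧ true) * (2 ^ h * 1)
        ≡⟨ cong (2 ^ # (λ x → not (lookup B x) ∧ true) *_) (*-identityʳ (2 ^ h)) ⟩
      2 ^ # (λ x → not (lookup B x) ∧ true) * 2 ^ h
        ≡⟨ sym (^-distribˡ-+-* 2 (# (λ x → not (lookup B x) ∧ true)) h) ⟩
      2 ^ (# (λ x → not (lookup B x) ∧ true) + h)
        ≤⟨ ^-monoʳ-≤ 2 (m+n≤o⇒m≤o∸n (# (λ x → not (lookup B x) ∧ true) + h) {g} {t} (*-cancelˡ-≤ 2 (certificate 0 (+-mono-≤ (+-mono-≤ hh hg) (+-mono-≤ γ≤B (*-monoʳ-≤ 2 (compl B))))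
             (identity (# (λ x → not (lookup B x) ∧ true)) h g γ (# (lookup B)) t)))) ⟩
      2 ^ (t ∸ g) ∎
    where
    open ≤-Reasoning
    compl : ∀ (B : Vec Bool t) → # (λ x → not (lookup B x) ∧ true) + # (lookup B) ≤ t
    compl B = ≤-trans (≤-reflexive (trans (+-comm _ (# (lookup B)))
      (trans (cong₂ _+_ (#-cong {p = lookup B} {q = λ x → true ∧ lookup B x} (λ _ → refl))
        (#-cong {p = λ x → not (lookup B x) ∧ true} {q = λ x → true ∧ not (lookup B x)} (λ x → ∧-true (not (lookup B x)))))
        (sym (#-split (λ _ → true) (lookup B)))))) (#≤n _)
      where
      ∧-true : ∀ b → b ∧ true ≡ b
      ∧-true true  = refl
      ∧-true false = refl
    identity : ∀ c h g γ B t → 2 * (c + h + g) + ((B + 2 + γ) + (B + 2 * t)) + 0 ≡ 2 * t + ((2 * h + (2 * g + 2)) + (γ + 2 * (c + B)))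
    identity = solve-∀

  -- A failure of density is witnessed by `A`, `B` and `b`: then all rows indexed by `A` lie in
  -- `Row b B`. Each of these at least γ rows saves `g` bits, while the other rows are arbitrary.
  Sparse : (Vec Bool t × Vec Bool t) × Bool → List (Vec (Vec Bool t) t)
  Sparse ((A , B) , b) = keepIf (γ ≤? # (lookup A)) (prodL (λ i → choose (lookup A i) (Row b B) (allVecBool t)))

  sparse : List (Vec (Vec Bool t) t)
  sparse = concatMap Sparse (elements (enum× (enum× (enumVecBool t) (enumVecBool t)) enumBool))

  g≤γ : g ≤ γ
  g≤γ = ≤-trans (m≤m+n g (g + 0)) (≤-trans (m≤m+n (2 * g) 2) hg)

  sparse-length : γ ≤ t → length sparse ≤ 2 ^ (suc (t + t) + (t * t ∸ γ * g))
  sparse-length γ≤t = length-pow Sparse (elements (enum× (enum× (enumVecBool t) (enumVecBool t)) enumBool)) (suc (t + t)) (t * t ∸ γ * g)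
    (≤-trans (size (enum× (enum× (enumVecBool t) (enumVecBool t)) enumBool))
      (≤-reflexive (trans (*-comm (2 ^ t * 2 ^ t) 2) (cong (2 *_) (sym (^-distribˡ-+-* 2 t t))))))
    (λ { ((A , B) , b) _ → length-keepIf (γ ≤? # (lookup A)) _ (λ γ≤A →
      ≤-trans (prodL-length (λ i → choose (lookup A i) (Row b B) (allVecBool t)) (λ i → choose (lookup A i) (t ∸ g) t) (rowOk A B b))
        (^-monoʳ-≤ 2 (m+n≤o⇒m≤o∸n (sumF (λ i → choose (lookup A i) (t ∸ g) t)) {γ * g} {t * t} (≤-trans (+-monoʳ-≤ (sumF (λ i → choose (lookup A i) (t ∸ g) t)) (*-monoˡ-≤ g γ≤A))
          (≤-reflexive (sumF-choose (lookup A) t g (≤-trans g≤γ γ≤t))))))) })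
    where
    rowOk : ∀ A B b i → length (choose (lookup A i) (Row b B) (allVecBool t)) ≤ 2 ^ choose (lookup A i) (t ∸ g) t
    rowOk A B b i with lookup A i
    ... | true  = Row-length b B
    ... | false = allVecBool-length t

  dense-if-not-sparse : (M : Vec (Vec Bool t) t) → M ∉ sparse → Dense (λ p q → lookup (lookup M p) q) γ
  dense-if-not-sparse M M∉ b A B γ≤A γ≤B with any? (λ a → (A a ≟ᵇ true) ×-dec (# B ≤? κ * # (λ p → B p ∧ (lookup (lookup M a) p ==ᵇ b))))
  ... | yes (a , Aa , le) = a , Aa , le
  ... | no none = ⊥-elim (M∉ (∈-concatMap Sparse {x = ((tabulate A , tabulate B) , b)} (complete (enum× (enum× (enumVecBool t) (enumVecBool t)) enumBool) _)
      (subst (M ∈_) (sym (keepIf-yes (γ ≤? # (lookup (tabulate A))) (subst (γ ≤_) (#-cong (λ i → sym (lookup∘tabulate A i))) γ≤A)))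
        (∈-prodL _ M inRow))))
    where
    #B : # (lookup (tabulate B)) ≡ # B
    #B = #-cong (lookup∘tabulate B)
    inRow : ∀ i → lookup M i ∈ choose (lookup (tabulate A) i) (Row b (tabulate B)) (allVecBool t)
    inRow i with lookup (tabulate A) i in eq
    ... | false = allVecBool-complete (lookup M i)
    ... | true = subst (lookup M i ∈_) (sym (keepIf-yes (γ ≤? # (lookup (tabulate B))) (subst (γ ≤_) (sym #B) γ≤B)))
          (∈-rowList _ (λ _ → false) (λ _ → b) _ 0 (lookup M i) few (≤-reflexive (#-zero _ (λ _ ()))))
      where
      Bi = # (λ p → B p ∧ (lookup (lookup M i) p ==ᵇ b))
      few : # (hits (lookup (tabulate B)) (λ _ → b) (lookup M i)) ≤ # (lookup (tabulate B)) / 64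
      few = ≤-trans (≤-reflexive (#-cong (λ p → cong (_∧ (lookup (lookup M i) p ==ᵇ b)) (lookup∘tabulate B p))))
        (subst (λ z → Bi ≤ z / 64) (sym #B) (*-cancelˡ-≤ 64 (≤-pred-step
          (≰⇒> (λ le → none (i , trans (sym (lookup∘tabulate A i)) eq , subst (λ z → # B ≤ z * Bi) (sym κ≡64) le))))))
        where
        ≤-pred-step : 64 * Bi < # B → 64 * Bi ≤ 64 * (# B / 64)
        ≤-pred-step lt = *-monoʳ-≤ 64 (*-cancelˡ-≤-div lt)
          where
          *-cancelˡ-≤-div : 64 * Bi < # B → Bi ≤ # B / 64
          *-cancelˡ-≤-div lt = s≤s⁻¹ (*-cancelˡ-< 64 Bi (suc (# B / 64)) (<-≤-trans lt (≤-trans (m<[m/d+1]*d (# B) 63) (≤-reflexive (sym (*-suc 64 (# B / 64)))))))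

module _ (k t γ : ℕ) (t≤kγ : t ≤ k * γ) (big : 4 * k + 8 ≤ γ) (γ≤t : γ ≤ t) where

  private
    -- The saving γ g = 2kγ + 3γ is at least 2t + 3γ. It exceeds the 2t + 1 bits that name `A`, `B`
    -- and `b`, together with one bit for transposing the matrix.
    g = 2 * k + 3
    hg : 2 * g + 2 ≤ γ
    hg = ≤-trans (≤-reflexive (eq k)) big
      where
      eq : ∀ k → 2 * (2 * k + 3) + 2 ≡ 4 * k + 8
      eq = solve-∀
    flat flatᵀ : Vec (Vec Bool t) t → Vec Bool (t * t)
    flat M = tabulate (λ c → lookup (lookup M (quotient {t} t c)) (remainder {t} t c))
    flatᵀ M = tabulate (λ c → lookup (lookup M (remainder {t} t c)) (quotient {t} t c))
    few : length (map flat (sparse t γ g hg) ++ map flatᵀ (sparse t γ g hg)) < 2 ^ (t * t)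
    few = begin-strict
      length (map flat (sparse t γ g hg) ++ map flatᵀ (sparse t γ g hg)) ≡⟨ length-++ (map flat (sparse t γ g hg)) ⟩
      length (map flat (sparse t γ g hg)) + length (map flatᵀ (sparse t γ g hg))
        ≡⟨ cong₂ _+_ (length-map flat (sparse t γ g hg)) (length-map flatᵀ (sparse t γ g hg)) ⟩
      length (sparse t γ g hg) + length (sparse t γ g hg) ≤⟨ +-mono-≤ (sparse-length t γ g hg γ≤t) (sparse-length t γ g hg γ≤t) ⟩
      2 ^ E + 2 ^ E ≡⟨ cong (2 ^ E +_) (sym (+-identityʳ _)) ⟩
      2 ^ suc E <⟨ ^-monoʳ-< 2 (s≤s (s≤s z≤n)) E< ⟩
      2 ^ (t * t) ∎
      where
      open ≤-Reasoning
      E = suc (t + t) + (t * t ∸ γ * g)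
      γg≤ : γ * g ≤ t * t
      γg≤ = *-mono-≤ γ≤t (≤-trans (g≤γ t γ g hg) γ≤t)
      E< : suc E < t * t
      E< = +-cancelʳ-≤ (γ * g) _ _ (begin
        suc (suc E) + γ * g ≡⟨ +-assoc (3 + (t + t)) (t * t ∸ γ * g) (γ * g) ⟩
        3 + (t + t) + ((t * t ∸ γ * g) + γ * g) ≡⟨ cong (3 + (t + t) +_) (m∸n+n≡m γg≤) ⟩
        3 + (t + t) + t * t ≤⟨ certificate (2 * γ) (+-mono-≤ (*-monoʳ-≤ 2 t≤kγ) (≤-trans (m≤m+n 3 5) (≤-trans (m≤n+m 8 (4 * k)) big))) (identity t k γ) ⟩
        t * t + γ * g ∎)
        where
        identity : ∀ t k γ → 3 + (t + t) + t * t + (2 * (k * γ) + γ) + 2 * γ ≡ t * t + γ * (2 * k + 3) + (2 * t + 3)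
        identity = solve-∀

    M∃ : ∃ λ v → v ∉ map flat (sparse t γ g hg) ++ map flatᵀ (sparse t γ g hg)
    M∃ = missed (t * t) _ few

    v : Vec Bool (t * t)
    v = proj₁ M∃

    M Mᵀ : Vec (Vec Bool t) t
    M = tabulate (λ p → tabulate (λ q → lookup v (combine p q)))
    Mᵀ = tabulate (λ p → tabulate (λ q → lookup v (combine q p)))

    at : ∀ p q → lookup (lookup M p) q ≡ lookup v (combine p q)
    at p q = trans (cong (λ z → lookup z q) (lookup∘tabulate _ p)) (lookup∘tabulate _ q)

    atᵀ : ∀ p q → lookup (lookup Mᵀ p) q ≡ lookup v (combine q p)
    atᵀ p q = trans (cong (λ z → lookup z q) (lookup∘tabulate _ p)) (lookup∘tabulate _ q)

    flat-M : flat M ≡ v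
    flat-M = lookup-ext λ c → trans (lookup∘tabulate _ c) (trans (at _ _) (cong (lookup v) (combine-remQuot {t} t c)))

    flatᵀ-M : flatᵀ Mᵀ ≡ v
    flatᵀ-M = lookup-ext λ c → trans (lookup∘tabulate _ c) (trans (atᵀ _ _) (cong (lookup v) (combine-remQuot {t} t c)))

    transport : ∀ {Γ Γ′ : Fin t → Fin t → Bool} → (∀ p q → Γ p q ≡ Γ′ p q) → Dense Γ γ → Dense Γ′ γ
    transport h d b A B γ≤A γ≤B with d b A B γ≤A γ≤B
    ... | a , Aa , le = a , Aa , ≤-trans le (*-monoʳ-≤ κ (≤-reflexive (#-cong (λ p → cong (λ z → B p ∧ (z ==ᵇ b)) (h a p)))))

  counted-pattern : Pattern t γ
  counted-pattern = record
    { Γ = λ p q → lookup v (combine p q)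
    ; rows = transport at (dense-if-not-sparse t γ g hg M
        (λ M∈ → proj₂ M∃ (∈-++⁺ˡ (subst (_∈ map flat (sparse t γ g hg)) flat-M (∈-map⁺ flat M∈)))))
    ; cols = transport atᵀ (dense-if-not-sparse t γ g hg Mᵀ
        (λ M∈ → proj₂ M∃ (∈-++⁺ʳ (map flat (sparse t γ g hg)) (subst (_∈ map flatᵀ (sparse t γ g hg)) flatᵀ-M (∈-map⁺ flatᵀ M∈)))))
    }

pattern-exists : ∀ k t γ → t ≤ k * γ → 4 * k + 8 ≤ γ → Pattern t γ
pattern-exists k t γ t≤kγ big with γ ≤? t
... | yes γ≤t = counted-pattern k t γ t≤kγ big γ≤t
-- No subset of the `t` points has γ elements, so density holds vacuously.
... | no γ≰t = record
    { Γ = λ _ _ → true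
    ; rows = λ b A B γ≤A _ → ⊥-elim (γ≰t (≤-trans γ≤A (#≤n A)))
    ; cols = λ b A B γ≤A _ → ⊥-elim (γ≰t (≤-trans γ≤A (#≤n A))) }

-- Structured sets: homogeneous parts of constant size t with a dense pattern between them

record Structured {n} (G : Graph n) (r t γ : ℕ) : Set where
  field
    frame : Frame G r t γ
  open Frame frame public
  field
    full   : ∀ i p → X i p ≡ true
    pt-inj : ∀ i p j q → pt i p ≡ pt j q → i ≡ j × p ≡ q

bool-eq : ∀ {a b} → (a ≡ true → b ≡ true) → (b ≡ true → a ≡ true) → a ≡ b
bool-eq {true}  {b}     f g = sym (f refl)
bool-eq {false} {false} f g = refl
bool-eq {false} {true}  f g = g refl

<ᵇ-flip : ∀ m n → m ≢ n → (m <ᵇ n) ≡ not (n <ᵇ m)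
<ᵇ-flip zero    zero    ne = ⊥-elim (ne refl)
<ᵇ-flip zero    (suc n) ne = refl
<ᵇ-flip (suc m) zero    ne = refl
<ᵇ-flip (suc m) (suc n) ne = <ᵇ-flip m n (ne ∘ cong suc)

module _ {t : ℕ} (Γ : Fin t → Fin t → Bool) where

  -- The pattern Γ read from the part with the smaller index to the part with the larger one.
  orient : ∀ {m} → Fin m → Fin m → Fin t → Fin t → Bool
  orient i j p q = choose (toℕ i <ᵇ toℕ j) (Γ p q) (Γ q p)

  orient-sym : ∀ {m} (i j : Fin m) → i ≢ j → ∀ p q → orient i j p q ≡ orient j i q p
  orient-sym i j ne p q rewrite <ᵇ-flip (toℕ i) (toℕ j) (ne ∘ toℕ-injective) with toℕ j <ᵇ toℕ i
  ... | true  = refl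
  ... | false = refl

#-remove : ∀ {n} (B : Fin n → Bool) a → # B ≤ suc (# (λ p → B p ∧ not (a == p)))
#-remove B a = ≤-trans (≤-reflexive (#-split B (a ==_)))
  (+-monoˡ-≤ _ (#-unique (λ p → B p ∧ (a == p)) (λ x y ex ey →
    trans (sym (==-sound {i = a} (proj₂ (∧-split {B x} ex)))) (==-sound {i = a} (proj₂ (∧-split {B y} ey))))))

structured-from : ∀ {n} (G : Graph n) {r t γ} (Pat : Pattern t γ) → 2 ≤ γ →
  (pt : Fin r → Fin t → Fin n) → (∀ i p j q → pt i p ≡ pt j q → i ≡ j × p ≡ q) → (ty : Fin r → Bool) →
  (∀ i p q → p ≢ q → adj G (pt i p) (pt i q) ≡ ty i) →
  (∀ i j p q → i ≢ j → adj G (pt i p) (pt j q) ≡ orient (Pattern.Γ Pat) i j p q) → Structured G r t γ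
structured-from G {r} {t} {γ} Pat γ≥2 pt pt-inj ty hom cross = record
  { frame = record { pt = pt ; X = λ _ _ → true ; ty = ty ; dense = dense }
  ; full = λ _ _ → refl ; pt-inj = pt-inj }
  where
  open Pattern Pat
  dense : ∀ i j b → (i ≡ j → b ≡ ty i) → ∀ A B → A ⊆ (λ _ → true) → B ⊆ (λ _ → true) → γ ≤ # A → γ ≤ # B →
    ∃ λ a → A a ≡ true × # B ≤ κ * # (λ p → B p ∧ link G b (pt i a) (pt j p))
  dense i j b h A B _ _ γ≤A γ≤B with i ≟ᶠ j
  ... | yes refl with #-exists A (≤-trans (≤-trans (s≤s z≤n) γ≥2) γ≤A)
  ...   | a , Aa = a , Aa , ≤-trans half (*-mono-≤ κ≥2 (#-mono (λ p e → ∧-join (proj₁ (∧-split {B p} e))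
            (let a≢p = λ eq → not-true (proj₂ (∧-split {B p} e)) (trans (cong (a ==_) (sym eq)) (==-refl a)) in
             link-intro G b (pt i a) (pt i p) (λ eq → a≢p (proj₂ (pt-inj _ _ _ _ eq))) (trans (hom i a p a≢p) (sym (h refl)))))))
    where
    -- Inside a homogeneous part only `a` itself is lost, and `B` has at least two elements.
    half : # B ≤ 2 * # (λ p → B p ∧ not (a == p))
    half = certificate {X = 2 * # B + 2} 0 (+-mono-≤ (*-monoʳ-≤ 2 (#-remove B a)) (≤-trans γ≥2 γ≤B)) (identity (# B) (# (λ p → B p ∧ not (a == p))))
      where
      identity : ∀ B x → B + (2 * suc x + B) + 0 ≡ 2 * x + (2 * B + 2)
      identity = solve-∀
  dense i j b h A B _ _ γ≤A γ≤B | no i≢j with toℕ i <ᵇ toℕ j in eq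
  ... | true = let (a , Aa , le) = rows b A B γ≤A γ≤B in a , Aa , ≤-trans le (*-monoʳ-≤ κ (#-mono (λ p e →
      ∧-join (proj₁ (∧-split {B p} e)) (link-intro G b (pt i a) (pt j p) (λ q → i≢j (proj₁ (pt-inj _ _ _ _ q)))
        (trans (trans (cross i j a p i≢j) (cong (λ z → choose z (Γ a p) (Γ p a)) eq)) (does-sound (Γ a p ≟ᵇ b) (proj₂ (∧-split {B p} e))))))))
  ... | false = let (a , Aa , le) = cols b A B γ≤A γ≤B in a , Aa , ≤-trans le (*-monoʳ-≤ κ (#-mono (λ p e →
      ∧-join (proj₁ (∧-split {B p} e)) (link-intro G b (pt i a) (pt j p) (λ q → i≢j (proj₁ (pt-inj _ _ _ _ q)))
        (trans (trans (cross i j a p i≢j) (cong (λ z → choose z (Γ a p) (Γ p a)) eq)) (does-sound (Γ p a ≟ᵇ b) (proj₂ (∧-split {B p} e))))))))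

module Extend (r₀ t′ L : ℕ) where

  -- In every old part `P` counts points that are embedded before the new part is known. For each l
  -- < L a vertex `y l` with a prescribed trace on them is taken from the shattering, and Ramsey's
  -- theorem then selects t′ of these along some ρ : Fin t′ → Fin L. As ρ is not known in advance, a
  -- point is prepared for every pair of a position p and a function ρ, adjacent to `y (ρ q)`
  -- according to `Γ q p`; this makes t′ L^t′ points. The first `L` points of a part tell the `y l`
  -- apart.
  r Rest P : ℕ
  r = suc r₀
  Rest = t′ * L ^ t′
  P = r * (L + Rest)

  opaque
    part : Fin P → Fin r
    part = quotient {r} (L + Rest)

    slot : Fin P → Fin L ⊎ Fin Rest
    slot k = splitAt L (remainder {r} (L + Rest) k)

    pos : Fin Rest → Fin t′
    pos = quotient {t′} (L ^ t′)

    choice : Fin Rest → Fin t′ → Fin L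
    choice z = finToFun {L} {t′} (remainder {t′} (L ^ t′) z)

    encode : (Fin t′ → Fin L) → Fin (L ^ t′)
    encode = funToFin {t′} {L}

    idK : Fin r → Fin L → Fin P
    idK i l = combine i (l ↑ˡ Rest)

    pointK : Fin r → Fin t′ → (Fin t′ → Fin L) → Fin P
    pointK i p ρ = combine i (L ↑ʳ combine {t′} {L ^ t′} p (encode ρ))

    part-combine : ∀ i y → part (combine {r} {L + Rest} i y) ≡ i
    part-combine i y = cong proj₁ (remQuot-combine {r} {L + Rest} i y)

    part-pointK : ∀ i p ρ → part (pointK i p ρ) ≡ i
    part-pointK i p ρ = part-combine i _

    slot-combine : ∀ i y → slot (combine {r} {L + Rest} i y) ≡ splitAt L y
    slot-combine i y = cong (splitAt L) (cong proj₂ (remQuot-combine {r} {L + Rest} i y))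

    slot-idK : ∀ i l → slot (idK i l) ≡ inj₁ l
    slot-idK i l = trans (slot-combine i _) (splitAt-↑ˡ L l Rest)

    slot-pointK : ∀ i p ρ → slot (pointK i p ρ) ≡ inj₂ (combine {t′} {L ^ t′} p (encode ρ))
    slot-pointK i p ρ = trans (slot-combine i _) (splitAt-↑ʳ L Rest _)

    pos-combine : ∀ p ρ → pos (combine {t′} {L ^ t′} p (encode ρ)) ≡ p
    pos-combine p ρ = cong proj₁ (remQuot-combine {t′} {L ^ t′} p (encode ρ))

    choice-combine : ∀ p (ρ : Fin t′ → Fin L) q → choice (combine {t′} {L ^ t′} p (encode ρ)) q ≡ ρ q
    choice-combine p ρ q = trans (cong (λ z → finToFun {L} {t′} z q) (cong proj₂ (remQuot-combine {t′} {L ^ t′} p (encode ρ)))) (finToFun-funToFin ρ q)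

  module _ {n} {G : Graph n} {t γ γ′ : ℕ} (Str : Structured G r t γ) (L≥ : 2 ^ (t′ + t′) ≤ L) (Pat : Pattern t′ γ′) (γ′≥2 : 2 ≤ γ′)
    (J : Fin r → Fin t → Bool) (big : ∀ i → bound γ P ≤ # (J i))
    (shatter : ∀ (x : Fin r → Fin t → Bool) → ∃ λ v → (∀ i p → v ≢ Structured.pt Str i p) ×
      (∀ i p → J i p ≡ true → adj G v (Structured.pt Str i p) ≡ x i p)) where

    open Structured Str
    open Pattern Pat

    cross : Fin r → Fin L ⊎ Fin Rest → Fin r → Fin L ⊎ Fin Rest → Bool
    cross i (inj₂ z) j (inj₂ w) = orient Γ i j (pos z) (pos w)
    cross i _        j _        = false

    cross-sym : ∀ i a j b → i ≢ j → cross i a j b ≡ cross j b i a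
    cross-sym i (inj₁ _) j (inj₁ _) ne = refl
    cross-sym i (inj₁ _) j (inj₂ _) ne = refl
    cross-sym i (inj₂ _) j (inj₁ _) ne = refl
    cross-sym i (inj₂ z) j (inj₂ w) ne = orient-sym Γ i j ne (pos z) (pos w)

    target : Fin r → Fin L ⊎ Fin Rest → Fin r → Fin L ⊎ Fin Rest → Bool
    target i a j b with i ≟ᶠ j
    ... | yes _ = ty i
    ... | no _  = cross i a j b

    target-sym : ∀ i a j b → target i a j b ≡ target j b i a
    target-sym i a j b with i ≟ᶠ j | j ≟ᶠ i
    ... | yes refl | yes _  = refl
    ... | yes refl | no ne  = ⊥-elim (ne refl)
    ... | no ne    | yes e  = ⊥-elim (ne (sym e))
    ... | no ne    | no _   = cross-sym i a j b ne

    target-same : ∀ i a j b → i ≡ j → target i a j b ≡ ty i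
    target-same i a j b e with i ≟ᶠ j
    ... | yes _ = refl
    ... | no ne = ⊥-elim (ne e)

    target-other : ∀ i a j b → i ≢ j → target i a j b ≡ cross i a j b
    target-other i a j b ne with i ≟ᶠ j
    ... | yes e = ⊥-elim (ne e)
    ... | no _  = refl

    tgt : Fin P → Fin P → Bool
    tgt k l = target (part k) (slot k) (part l) (slot l)

    nonempty : ∃ λ p → J zero p ≡ true
    nonempty = #-exists (J zero) (≤-trans (≤-trans (s≤s z≤n) (*-mono-≤ (m^n>0 κ {{κ≢0}} P) (s≤s z≤n))) (big zero))

    open Greedy frame _≟ᶠ_ part tgt (λ k l → target-sym (part k) (slot k) (part l) (slot l)) (proj₁ nonempty)

    placed : ∃ λ (x : Fin P → Fin t) → (∀ k → k ∈ allFin P → J (part k) (x k) ≡ true) ×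
      (∀ k l → k ∈ allFin P → l ∈ allFin P → k ≢ l → link G (tgt k l) (pt (part k) (x k)) (pt (part l) (x l)) ≡ true)
    placed = greedy (allFin P) (UniqueP.allFin⁺ P) (λ k → J (part k)) (λ k p _ → full (part k) p)
      (λ k l _ _ _ e → target-same (part k) (slot k) (part l) (slot l) e)
      (λ k _ → ≤-trans (bound-mono γ (≤-reflexive (length-tabulate {n = P} id))) (big (part k)))

    x : Fin P → Fin t
    x = proj₁ placed

    point : Fin P → Fin n
    point k = pt (part k) (x k)

    linked : ∀ k l → k ≢ l → link G (tgt k l) (point k) (point l) ≡ true
    linked k l = proj₂ (proj₂ placed) k l (∈-allFin k) (∈-allFin l)

    want : Fin L → Fin L ⊎ Fin Rest → Bool
    want l (inj₁ l′) = l == l′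
    want l (inj₂ z)  = anyB (λ q → (choice z q == l) ∧ Γ q (pos z))

    trace : Fin L → Fin r → Fin t → Bool
    trace l i p = anyB (λ k → ((i == part k) ∧ (p == x k)) ∧ want l (slot k))

    trace-at : ∀ l k → trace l (part k) (x k) ≡ want l (slot k)
    trace-at l k = bool-eq
      (λ e → let (k′ , h) = anyB-sound e
                 (h₁ , h₂) = ∧-split {(part k == part k′) ∧ (x k == x k′)} h
                 (e₁ , e₂) = ∧-split {part k == part k′} h₁
             in trans (cong (want l ∘ slot) (same k k′ (==-sound e₁) (==-sound e₂))) h₂)
      (λ e → anyB-complete k (∧-join (∧-join (==-refl (part k)) (==-refl (x k))) e))
      where
      same : ∀ k k′ → part k ≡ part k′ → x k ≡ x k′ → k ≡ k′
      same k k′ e₁ e₂ = decidable-stable (k ≟ᶠ k′) (λ ne → link-≢ G _ _ _ (linked k k′ ne) (cong₂ pt e₁ e₂))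

    y : Fin L → Fin n
    y l = proj₁ (shatter (trace l))

    y-outside : ∀ l i p → y l ≢ pt i p
    y-outside l = proj₁ (proj₂ (shatter (trace l)))

    y-adj : ∀ l k → adj G (y l) (point k) ≡ want l (slot k)
    y-adj l k = trans (proj₂ (proj₂ (shatter (trace l))) (part k) (x k) (proj₁ (proj₂ placed) k (∈-allFin k))) (trace-at l k)

    -- Among the vertices `y l′`, exactly `y l` is adjacent to the point `idK zero l`.
    y-inj : ∀ l l′ → y l ≡ y l′ → l ≡ l′
    y-inj l l′ e = sym (==-sound (trans (sym (cong (want l′) (slot-idK zero l)))
      (trans (sym (y-adj l′ (idK zero l))) (trans (cong (λ v → adj G v (point (idK zero l))) (sym e))
        (trans (y-adj l (idK zero l)) (trans (cong (want l) (slot-idK zero l)) (==-refl l)))))))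

    homogeneous : ∃ λ b → ∃ λ (ρ : Vec (Fin L) t′) → Monochromatic (λ l l′ → adj G (y l) (y l′)) b ρ
    homogeneous = [ (λ { (v , _ , m) → true , v , m }) , (λ { (v , _ , m) → false , v , m }) ]′
      (ramsey (λ l l′ → adj G (y l) (y l′)) (λ l l′ → adj-sym G (y l) (y l′)) t′ t′ (allFin L) (UniqueP.allFin⁺ L)
        (≤-trans L≥ (≤-reflexive (sym (length-tabulate {n = L} id)))))

    ρ : Fin t′ → Fin L
    ρ = lookup (proj₁ (proj₂ homogeneous))

    ρ-inj : ∀ p q → ρ p ≡ ρ q → p ≡ q
    ρ-inj p q e = decidable-stable (p ≟ᶠ q) (λ ne → proj₁ (proj₂ (proj₂ homogeneous) p q ne) e)

    key : Fin r → Fin t′ → Fin P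
    key i p = pointK i p ρ

    part-key : ∀ i p → part (key i p) ≡ i
    part-key i p = part-pointK i p ρ

    key-inj : ∀ i p j q → key i p ≡ key j q → i ≡ j × p ≡ q
    key-inj i p j q e = trans (sym (part-key i p)) (trans (cong part e) (part-key j q)) ,
      (case trans (sym (slot-pointK i p ρ)) (trans (cong slot e) (slot-pointK j q ρ)) of λ eq →
        trans (sym (pos-combine p ρ)) (trans (cong pos (inj₂-inj eq)) (pos-combine q ρ)))
      where
      inj₂-inj : ∀ {a b : Fin Rest} → inj₂ {A = Fin L} a ≡ inj₂ b → a ≡ b
      inj₂-inj refl = refl

    pt⁺ : Fin (suc r) → Fin t′ → Fin n
    pt⁺ zero    q = y (ρ q)
    pt⁺ (suc i) p = point (key i p)

    ty⁺ : Fin (suc r) → Bool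
    ty⁺ zero    = proj₁ homogeneous
    ty⁺ (suc i) = ty i

    pt⁺-inj : ∀ i p j q → pt⁺ i p ≡ pt⁺ j q → i ≡ j × p ≡ q
    pt⁺-inj zero    p zero    q e = refl , ρ-inj p q (y-inj _ _ e)
    pt⁺-inj zero    p (suc j) q e = ⊥-elim (y-outside _ _ _ e)
    pt⁺-inj (suc i) p zero    q e = ⊥-elim (y-outside _ _ _ (sym e))
    pt⁺-inj (suc i) p (suc j) q e =
      let (a , b) = key-inj i p j q (decidable-stable (key i p ≟ᶠ key j q) (λ ne → link-≢ G _ _ _ (linked (key i p) (key j q) ne) e))
      in cong suc a , b

    adj-key : ∀ i p j q → key i p ≢ key j q → adj G (point (key i p)) (point (key j q)) ≡ tgt (key i p) (key j q)
    adj-key i p j q ne = link-adj G _ _ _ (linked (key i p) (key j q) ne)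

    hom⁺ : ∀ i p q → p ≢ q → adj G (pt⁺ i p) (pt⁺ i q) ≡ ty⁺ i
    hom⁺ zero    p q ne = proj₂ (proj₂ (proj₂ homogeneous) p q ne)
    hom⁺ (suc i) p q ne = trans (adj-key i p i q (ne ∘ proj₂ ∘ key-inj i p i q))
      (trans (target-same (part (key i p)) (slot (key i p)) (part (key i q)) (slot (key i q)) (trans (part-key i p) (sym (part-key i q)))) (cong ty (part-key i p)))

    want-key : ∀ i p q → want (ρ q) (slot (key i p)) ≡ Γ q p
    want-key i p q = trans (cong (want (ρ q)) (slot-pointK i p ρ)) (bool-eq
      (λ e → let (q′ , h) = anyB-sound e
                 (h₁ , h₂) = ∧-split {choice (combine {t′} {L ^ t′} p (encode ρ)) q′ == ρ q} h
                 q′≡q = ρ-inj q′ q (trans (sym (choice-combine p ρ q′)) (==-sound h₁))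
             in trans (cong₂ Γ (sym q′≡q) (sym (pos-combine p ρ))) h₂)
      (λ e → anyB-complete q (∧-join (trans (cong (_== ρ q) (choice-combine p ρ q)) (==-refl (ρ q)))
        (trans (cong (Γ q) (pos-combine p ρ)) e))))

    cross⁺ : ∀ i j p q → i ≢ j → adj G (pt⁺ i p) (pt⁺ j q) ≡ orient Γ i j p q
    cross⁺ zero    zero    p q ne = ⊥-elim (ne refl)
    cross⁺ zero    (suc j) p q ne = trans (y-adj (ρ p) (key j q)) (want-key j q p)
    cross⁺ (suc i) zero    p q ne = trans (adj-sym G _ _) (trans (y-adj (ρ q) (key i p)) (want-key i p q))
    cross⁺ (suc i) (suc j) p q ne = trans (adj-key i p j q (ne ∘ cong suc ∘ proj₁ ∘ key-inj i p j q))
      (trans (target-other (part (key i p)) (slot (key i p)) (part (key j q)) (slot (key j q))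
          (λ e → ne (cong suc (trans (sym (part-key i p)) (trans e (part-key j q))))))
        (trans (cong₂ (λ a b → cross (part (key i p)) a (part (key j q)) b) (slot-pointK i p ρ) (slot-pointK j q ρ))
          (trans (cong₂ (λ a b → orient Γ (part (key i p)) (part (key j q)) a b) (pos-combine p ρ) (pos-combine q ρ))
            (cong₂ (λ a b → orient Γ a b p q) (part-key i p) (part-key j q)))))

    extended : Structured G (suc r) t′ γ′
    extended = structured-from G Pat γ′≥2 pt⁺ pt⁺-inj ty⁺ hom⁺ cross⁺

-- Adding a part to a structured set

subs : ∀ {A : Set} → List A → List (List A)
subs []       = [] ∷ []
subs (x ∷ xs) = map (x ∷_) (subs xs) ++ subs xs

length-subs : ∀ {A : Set} (xs : List A) → length (subs xs) ≡ 2 ^ length xs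
length-subs []       = refl
length-subs (x ∷ xs) = trans (length-++ (map (x ∷_) (subs xs)))
  (cong₂ _+_ (trans (length-map _ (subs xs)) (length-subs xs)) (trans (length-subs xs) (sym (+-identityʳ _))))

filter-∈-subs : ∀ {A : Set} {P : A → Set} (P? : ∀ x → Dec (P x)) xs → filter P? xs ∈ subs xs
filter-∈-subs P? [] = here refl
filter-∈-subs P? (x ∷ xs) with does (P? x)
... | true  = ∈-++⁺ˡ (∈-map⁺ (x ∷_) (filter-∈-subs P? xs))
... | false = ∈-++⁺ʳ (map (x ∷_) (subs xs)) (filter-∈-subs P? xs)

transposeV : ∀ {q m} → Vec (Vec Bool q) m → Table q m
transposeV X = tabulate (λ i → tabulate (λ v → lookup (lookup X v) i))

entry-transposeV : ∀ {q m} (X : Vec (Vec Bool q) m) i v → entry (transposeV X) i v ≡ lookup (lookup X v) i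
entry-transposeV X i v = trans (cong (λ z → lookup z v) (lookup∘tabulate _ i)) (lookup∘tabulate _ v)

table-ext : ∀ {q m} {X Y : Table q m} → (∀ i v → entry X i v ≡ entry Y i v) → X ≡ Y
table-ext h = lookup-ext (λ i → lookup-ext (h i))

module _ {r t : ℕ} where

  opaque
    quot : Fin (r * t) → Fin r
    quot = quotient {r} t

    rem : Fin (r * t) → Fin t
    rem = remainder {r} t

    quot-combine : ∀ (i : Fin r) (p : Fin t) → quot (combine i p) ≡ i
    quot-combine i p = cong proj₁ (remQuot-combine {r} {t} i p)

    rem-combine : ∀ (i : Fin r) (p : Fin t) → rem (combine i p) ≡ p
    rem-combine i p = cong proj₂ (remQuot-combine {r} {t} i p)

    coords-inj : ∀ c c′ → quot c ≡ quot c′ → rem c ≡ rem c′ → c ≡ c′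
    coords-inj c c′ e₁ e₂ = trans (sym (combine-remQuot {r} t c)) (trans (cong₂ combine e₁ e₂) (combine-remQuot {r} t c′))

  #-part≤ : ∀ i (p : Fin (r * t) → Bool) (p′ : Fin t → Bool) → (∀ a → p (combine i a) ≡ true → p′ a ≡ true) →
    # (λ c → (quot c == i) ∧ p c) ≤ # p′
  #-part≤ i p p′ h = #-injection _ p′ rem
    (λ c e → let (e₁ , e₂) = ∧-split {quot c == i} e in h (rem c) (subst (λ z → p z ≡ true)
      (coords-inj c (combine i (rem c)) (trans (==-sound e₁) (sym (quot-combine i _))) (sym (rem-combine i _))) e₂))
    (λ c c′ e e′ → coords-inj c c′ (trans (==-sound {i = quot c} (proj₁ (∧-split {quot c == i} e))) (sym (==-sound {i = quot c′} (proj₁ (∧-split {quot c′ == i} e′))))))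

  #-part≥ : ∀ i (p : Fin (r * t) → Bool) (p′ : Fin t → Bool) → (∀ a → p′ a ≡ true → p (combine i a) ≡ true) →
    # p′ ≤ # (λ c → (quot c == i) ∧ p c)
  #-part≥ i p p′ h = #-injection p′ _ (combine i)
    (λ a e → ∧-join (trans (cong (_== i) (quot-combine i a)) (==-refl i)) (h a e))
    (λ a b _ _ e → trans (sym (rem-combine i a)) (trans (cong rem e) (rem-combine i b)))

  #-block : ∀ i → # (λ c → quot c == i) ≡ t
  #-block i = ≤-antisym
    (≤-trans (#-mono (λ c e → ∧-join e refl)) (≤-trans (#-part≤ i (λ _ → true) (λ _ → true) (λ _ _ → refl)) (≤-reflexive (#-all t))))
    (≤-trans (≤-reflexive (sym (#-all t))) (≤-trans (#-part≥ i (λ _ → true) (λ _ → true) (λ _ _ → refl)) (#-mono (λ c e → proj₁ (∧-split e)))))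

#-complement : ∀ {n} (p : Fin n → Bool) → # p + # (λ x → not (p x)) ≡ n
#-complement {n} p = trans (sym (#-split (λ _ → true) p)) (#-all n)

opaque
  flat : ∀ {n} {G : Graph n} {r t γ} → Structured G r t γ → Fin (r * t) → Fin n
  flat {r = r} Str c = Structured.pt Str (quot {r} c) (rem {r} c)

  flat-combine : ∀ {n} {G : Graph n} {r t γ} (Str : Structured G r t γ) i p → flat Str (combine i p) ≡ Structured.pt Str i p
  flat-combine {r = r} Str i p = cong₂ (Structured.pt Str) (quot-combine {r} i p) (rem-combine {r} i p)

  flat-inj : ∀ {n} {G : Graph n} {r t γ} (Str : Structured G r t γ) → Injective (flat Str)
  flat-inj {r = r} Str c c′ e = let (a , b) = Structured.pt-inj Str _ _ _ _ e in coords-inj {r} c c′ a b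

traceVec : ∀ {n q} → Graph n → (Fin q → Fin n) → Fin n → Vec Bool q
traceVec G S v = tabulate (λ c → adj G v (S c))

-- With r = suc r₀ and s = suc R, traces cost about (r - 1) t bits where (R / s) r t are allowed.
-- After scaling by s the difference is (R r - s (r - 1)) t = (R - r + 1) t ≥ t. The error s (b mm +
-- b mm) is half of t, because t = 4 s (b mm).
growth-gain : ∀ r₀ R b t mm e → suc r₀ + e ≡ R → 1 ≤ mm → b ≡ 4 * suc R → t ≡ b * (b * mm) →
  suc R * (r₀ * t + (b * mm + b * mm) + suc r₀) + 2 ≤ R * (suc r₀ * t)
growth-gain r₀ R b t mm e R≡ mm≥1 b≡ t≡ = certificate (s * (b * mm) * (1 + 4 * e) + (r₀ + e + e * (r₀ + 2 + e))) (*-monoʳ-≤ s s≤M)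
    (identity′ r₀ R b t mm e R≡ b≡ t≡)
  where
  s = suc R
  s≤M : s ≤ b * mm
  s≤M = ≤-trans (≤-trans (m≤m+n s (s + (s + (s + 0)))) (≤-reflexive (sym b≡))) (≤-trans (≤-reflexive (sym (*-identityʳ b))) (*-monoʳ-≤ b mm≥1))
  identity : ∀ r₀ e M → let s = suc (suc r₀ + e) in
    s * (r₀ * (4 * s * M) + (M + M) + suc r₀) + 2 + s * M + (s * M * (1 + 4 * e) + (r₀ + e + e * (r₀ + 2 + e)))
    ≡ (suc r₀ + e) * (suc r₀ * (4 * s * M)) + s * s
  identity = solve-∀
  identity′ : ∀ r₀ R b t mm e → suc r₀ + e ≡ R → b ≡ 4 * suc R → t ≡ b * (b * mm) →
    suc R * (r₀ * t + (b * mm + b * mm) + suc r₀) + 2 + suc R * (b * mm) + (suc R * (b * mm) * (1 + 4 * e) + (r₀ + e + e * (r₀ + 2 + e)))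
    ≡ R * (suc r₀ * t) + suc R * suc R
  identity′ r₀ _ b t mm e refl b≡ t≡ rewrite t≡ = subst (λ c → suc (suc r₀ + e) * (r₀ * (c * (b * mm)) + (b * mm + b * mm) + suc r₀) + 2 + suc (suc r₀ + e) * (b * mm) + (suc (suc r₀ + e) * (b * mm) * (1 + 4 * e) + (r₀ + e + e * (r₀ + 2 + e)))
    ≡ (suc r₀ + e) * (suc r₀ * (c * (b * mm))) + suc (suc r₀ + e) * suc (suc r₀ + e)) (sym b≡) (identity r₀ e (b * mm))

module Growth {k₀ : ℕ} (T : Graph k₀) (R : ℕ) (g : ℕ → ℕ) (ext : Extends R g) where

  open Typical T R g ext

  module Step (r₀ t γ t′ γ′ : ℕ) (Pat : Pattern t′ γ′) (γ′≥2 : 2 ≤ γ′) (b mm : ℕ)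
    (t≥1 : 1 ≤ t) (t≡ : t ≡ b * (b * mm)) (deep : bound γ (Extend.P r₀ t′ (2 ^ (t′ + t′))) ≤ mm)
    (gain : s * (r₀ * t + (b * mm + b * mm) + suc r₀) + 2 ≤ R * (suc r₀ * t)) where

    r q Y : ℕ
    r = suc r₀
    q = r * t
    Y = r₀ * t + (b * mm + b * mm) + r

    shallow : Fin r → List (Vec Bool q)
    shallow i = rowList (λ c → quot {r} c == i) (λ _ → false) (λ _ → true) mm 0

    shallow-length : length (concatMap shallow (allFin r)) ≤ 2 ^ Y
    shallow-length = ≤-trans (length-concatMap shallow (2 ^ (r₀ * t + (b * mm + b * mm))) (allFin r) (λ i _ → one i))
      (≤-trans (*-mono-≤ (≤-trans (≤-reflexive (length-tabulate {n = r} id)) (n≤2^n r)) ≤-refl)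
        (≤-trans (≤-reflexive (sym (^-distribˡ-+-* 2 r (r₀ * t + (b * mm + b * mm))))) (^-monoʳ-≤ 2 (≤-reflexive (+-comm r (r₀ * t + (b * mm + b * mm)))))))
      where
      one : ∀ i → length (shallow i) ≤ 2 ^ (r₀ * t + (b * mm + b * mm))
      one i = begin
        length (shallow i) ≤⟨ length-rowList (λ c → quot {r} c == i) (λ _ → false) (λ _ → true) mm 0 ⟩
        2 ^ # (λ c → not (quot {r} c == i) ∧ true) * (W (# (λ c → quot {r} c == i)) mm * W (# {q} (λ c → false)) 0)
          ≤⟨ *-mono-≤ (^-monoʳ-≤ 2 free≤) (*-mono-≤ (W-bound b (b * mm) _ mm (≤-reflexive (trans (#-block {r} i) t≡)))
               (≤-reflexive (W-zero (# {q} (λ c → false))))) ⟩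
        2 ^ (r₀ * t) * (2 ^ (b * mm + b * mm) * 1) ≡⟨ cong (2 ^ (r₀ * t) *_) (*-identityʳ (2 ^ (b * mm + b * mm))) ⟩
        2 ^ (r₀ * t) * 2 ^ (b * mm + b * mm) ≡⟨ sym (^-distribˡ-+-* 2 (r₀ * t) (b * mm + b * mm)) ⟩
        2 ^ (r₀ * t + (b * mm + b * mm)) ∎
        where
        open ≤-Reasoning
        free≤ : # (λ c → not (quot {r} c == i) ∧ true) ≤ r₀ * t
        free≤ = +-cancelˡ-≤ t _ _ (≤-trans (+-mono-≤ (≤-reflexive (sym (#-block {r} i))) (#-mono (λ c e → proj₁ (∧-split e))))
          (≤-reflexive (#-complement (λ c → quot {r} c == i))))

    P Q : Property
    P G = Structured G r t γ
    Q G = Structured G (suc r) t′ γ′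

    module _ {n} (G : Graph n) (Str : Structured G r t γ) where

      S : Fin q → Fin n
      S = flat Str

      outside : Fin n → Bool
      outside v = allB (λ c → not (S c == v))

      traces : Vec Bool q → Bool
      traces x = anyB (λ v → outside v ∧ does (traceVec G S v ≟ᵛ x))

      deepSet : Vec Bool q → Fin r → Fin t → Bool
      deepSet J i p = lookup J (combine i p)

      grow : ∀ J → shattered traces J ≡ true → (∀ i → mm < # (deepSet J i)) → Q G
      grow J sh large = Extend.extended r₀ t′ (2 ^ (t′ + t′)) Str ≤-refl Pat γ′≥2 (deepSet J) (λ i → ≤-trans deep (<⇒≤ (large i))) shatter
        where
        shatter : ∀ (x : Fin r → Fin t → Bool) → ∃ λ v → (∀ i p → v ≢ Structured.pt Str i p) ×
          (∀ i p → deepSet J i p ≡ true → adj G v (Structured.pt Str i p) ≡ x i p)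
        shatter x with shattered-sound traces J sh (λ c → x (quot {r} c) (rem {r} c))
        ... | y , ty , agree with anyB-sound ty
        ...   | v , e = v
              , (λ i p eq → not-true (allB-sound (proj₁ (∧-split e)) (combine i p))
                  (trans (cong (_== v) (flat-combine Str i p)) (trans (cong (_== v) (sym eq)) (==-refl v))))
              , (λ i p Jip → trans (cong (adj G v) (sym (flat-combine Str i p)))
                  (trans (sym (lookup∘tabulate (λ c → adj G v (S c)) (combine i p)))
                    (trans (cong (λ z → lookup z (combine i p)) (does-sound (traceVec G S v ≟ᵛ y) (proj₂ (∧-split {outside v} e))))
                      (trans (agree (combine i p) Jip) (cong₂ x (quot-combine {r} i p) (rem-combine {r} i p))))))

      -- By Pajor's lemma more than 2^Y sets are shattered. At most 2^Y sets have at most `mm`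
      -- elements in some part, so one of the shattered sets is large in every part and `grow`
      -- applies to it.
      many-traces : 2 ^ Y < count? traces → Q G
      many-traces lt with anyL? (λ J → all? (λ i → mm <? # (deepSet J i))) (listOf (shattered traces))
      ... | yes some = let (J , J∈ , large) = find some in grow J (listOf-sound (shattered traces) J∈) large
      ... | no none = ⊥-elim (<⇒≱ lt (≤-trans (pajor traces) (≤-trans (≤-reflexive (sym (listOf-length (shattered traces))))
            (≤-trans (unique-length (listOf-unique (shattered traces)) allShallow) shallow-length))))
        where
        allShallow : ∀ {J} → J ∈ listOf (shattered traces) → J ∈ concatMap shallow (allFin r)
        allShallow {J} J∈ with any? (λ i → # (deepSet J i) ≤? mm)
        ... | no ¬small = ⊥-elim (none (lose J∈ (λ i → ≰⇒> (λ le → ¬small (i , le)))))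
        ... | yes (i , le) = ∈-concatMap shallow (∈-allFin i) (∈-rowList _ _ _ mm 0 J
              (≤-trans (#-part≤ {r} i (λ c → lookup J c ==ᵇ true) (deepSet J i) (λ a e → does-sound (_ ≟ᵇ true) e)) le)
              (≤-reflexive (#-zero _ (λ _ ()))))

      family : List (Vec Bool q)
      family = filter (λ x → traces x ≟ᵇ true) (allVecBool q)

      family-length : count? traces ≤ 2 ^ Y → length family ≤ 2 ^ Y
      family-length le = ≤-trans (unique-length (UniqueP.filter⁺ (λ x → traces x ≟ᵇ true) (allVecBool-unique q))
        (λ {x} x∈ → ∈-listOf traces x (proj₂ (∈-filter⁻ (λ x → traces x ≟ᵇ true) {xs = allVecBool q} x∈))))
        (≤-trans (≤-reflexive (listOf-length traces)) le)

    columns : ∀ {m} → List (Vec Bool q) → List (Table q m)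
    columns {m} ι = keepIf (length ι ≤? 2 ^ Y) (map transposeV (prodL {m = m} (λ _ → ι)))

    -- If there are few traces, the set of all traces serves as information: it is one of at most
    -- 2^(2^q) sets, a constant number. Every remaining vertex then costs only `Y` bits.
    removal : Removal P Q
    removal = record
      { q = q ; D = 1 ; c = s * 2 ^ q ; N₀ = 0 ; D≥1 = ≤-refl ; q≥1 = *-mono-≤ (s≤s (z≤n {r₀})) t≥1
      ; Info = λ _ → List (Vec Bool q)
      ; infos = λ _ → subs (allVecBool q)
      ; y = λ _ → 2 ^ q
      ; x = λ {m} _ _ → m * Y
      ; tab = λ ι _ → columns ι
      ; infos-length = λ _ _ → ≤-trans (≤-reflexive (length-subs (allVecBool q))) (^-monoʳ-≤ 2 (allVecBool-length q))
      ; tab-length = λ {m} ι _ → length-keepIf (length ι ≤? 2 ^ Y) _ (λ le → ≤-trans (≤-reflexive (length-map transposeV (prodL {m = m} (λ _ → ι))))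
          (≤-trans (prodL-length {m = m} (λ _ → ι) (λ _ → Y) (λ _ → le)) (≤-reflexive (cong (2 ^_) (sumF-const m Y)))))
      ; covers = λ {m} _ G _ Str → covers {m} G Str }
      where
      covers : ∀ {m} (G : Graph (q + m)) → Structured G r t γ →
        (∃ λ (V : Fin q → Fin (q + m)) → Injective V × (∀ out → Complement V out → ∃ λ ι → ι ∈ subs (allVecBool q) ×
          tableOf G V out ∈ columns ι × 1 * s * (m * Y + 2 ^ q) + 2 * m ≤ 1 * R * q * m + s * 2 ^ q)) ⊎ Q G
      covers {m} G Str with count? (traces G Str) ≤? 2 ^ Y
      ... | no ¬le = inj₂ (many-traces G Str (≰⇒> ¬le))
      ... | yes le = inj₁ (flat Str , flat-inj Str , λ out C → family G Str , filter-∈-subs _ (allVecBool q) ,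
            subst (tableOf G (flat Str) out ∈_) (sym (keepIf-yes (length (family G Str) ≤? 2 ^ Y) (family-length G Str le)))
              (subst (_∈ map transposeV (prodL (λ _ → family G Str))) (same out) (∈-map⁺ transposeV (∈-prodL (λ _ → family G Str) (X out) (inFamily out C)))) ,
            certificate 0 (*-monoˡ-≤ m gain) (identity s m Y (2 ^ q) R q))
        where
        X : (Fin m → Fin (q + m)) → Vec (Vec Bool q) m
        X out = tabulate (λ v → traceVec G (flat Str) (out v))
        same : ∀ out → transposeV (X out) ≡ tableOf G (flat Str) out
        same out = table-ext (λ i v → trans (entry-transposeV (X out) i v)
          (trans (cong (λ z → lookup z i) (lookup∘tabulate _ v)) (trans (lookup∘tabulate _ i)
            (trans (adj-sym G (out v) (flat Str i)) (sym (entry-tableOf G (flat Str) out i v))))))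
        inFamily : ∀ out → Complement (flat Str) out → ∀ v → lookup (X out) v ∈ family G Str
        inFamily out C v = subst (_∈ family G Str) (sym (lookup∘tabulate _ v))
          (∈-filter⁺ (λ x → traces G Str x ≟ᵇ true) (allVecBool-complete _) (anyB-complete (out v)
            (∧-join (allB-complete (λ c → ≢true⇒not (λ e → Complement.Q≢out C c v (==-sound e))))
              (does-complete (traceVec G (flat Str) (out v) ≟ᵛ _) refl))))
        identity : ∀ s m Y e R q → 1 * s * (m * Y + e) + 2 * m + R * q * m + 0 ≡ 1 * R * q * m + s * e + (s * Y + 2) * m
        identity = solve-∀

    grows : Mostly P Q
    grows = mostly-removal removal

  StructuredProperty : ℕ → ℕ → ℕ → Property
  StructuredProperty r t γ G = Structured G r t γ

  module _ (r₀ : ℕ) (r≤R : suc r₀ ≤ R) {t′ γ′ : ℕ} (Pat : Pattern t′ γ′) (γ′≥2 : 2 ≤ γ′) where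

    -- The old sizes are chosen after the new ones. There is no circularity: the ratio of t to γ is
    -- at most `k`, which depends only on `b` and `kP`, and `pattern-exists` asks for γ ≥ 4k + 8.
    -- The equations keep the towers of powers symbolic.
    grow-with : ∀ {b kP k γ mm t} → b ≡ 4 * s → kP ≡ κ ^ Extend.P r₀ t′ (2 ^ (t′ + t′)) → k ≡ 2 * (b * (b * kP)) → γ ≡ 4 * k + 8 →
      mm ≡ kP * suc γ → t ≡ b * (b * mm) →
      Pattern t γ × 2 ≤ γ × Mostly (StructuredProperty (suc r₀) t γ) (StructuredProperty (suc (suc r₀)) t′ γ′)
    grow-with {b} {kP} {k} {γ} {mm} {t} b≡ kP≡ k≡ γ≡ mm≡ t≡ =
        pattern-exists k t γ t≤ (≤-reflexive (sym γ≡)) , ≤-trans (m≤m+n 2 6) γ≥8 ,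
        Step.grows r₀ t γ t′ γ′ Pat γ′≥2 b mm t≥1 t≡ (≤-reflexive (trans (cong (_* suc γ) (sym kP≡)) (sym mm≡))) gain
      where
      γ≥8 : 8 ≤ γ
      γ≥8 = ≤-trans (m≤n+m 8 (4 * k)) (≤-reflexive (sym γ≡))
      mm≥1 : 1 ≤ mm
      mm≥1 = ≤-trans (*-mono-≤ (≤-trans (m^n>0 κ {{κ≢0}} (Extend.P r₀ t′ (2 ^ (t′ + t′)))) (≤-reflexive (sym kP≡))) (s≤s (z≤n {γ})))
        (≤-reflexive (sym mm≡))
      b≥1 : 1 ≤ b
      b≥1 = ≤-trans (*-mono-≤ (s≤s (z≤n {3})) (s≤s (z≤n {R}))) (≤-reflexive (sym b≡))
      t≥1 : 1 ≤ t
      t≥1 = ≤-trans (*-mono-≤ b≥1 (*-mono-≤ b≥1 mm≥1)) (≤-reflexive (sym t≡))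
      t≤ : t ≤ k * γ
      t≤ = ≤-trans (≤-reflexive (trans t≡ (cong (λ z → b * (b * z)) mm≡)))
        (≤-trans (certificate {X = b * (b * kP) * 1} 0 (*-monoʳ-≤ (b * (b * kP)) (≤-trans (s≤s z≤n) γ≥8)) (identity b kP γ))
          (≤-reflexive (cong (_* γ) (sym k≡))))
        where
        identity : ∀ b kP γ → b * (b * (kP * suc γ)) + b * (b * kP) * γ + 0 ≡ 2 * (b * (b * kP)) * γ + b * (b * kP) * 1
        identity = solve-∀
      gain : s * (r₀ * t + (b * mm + b * mm) + suc r₀) + 2 ≤ R * (suc r₀ * t)
      gain = growth-gain r₀ R b t mm (proj₁ (m≤n⇒∃[o]m+o≡n r≤R)) (proj₂ (m≤n⇒∃[o]m+o≡n r≤R)) mm≥1 b≡ t≡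

    opaque
      grow-step : ∃ λ t → ∃ λ γ → Pattern t γ × 2 ≤ γ ×
        Mostly (StructuredProperty (suc r₀) t γ) (StructuredProperty (suc (suc r₀)) t′ γ′)
      grow-step = _ , _ , grow-with refl refl refl refl refl refl

  -- A homogeneous set is a structured set with one part; the others are added one at a time.
  mostly-structured : ∀ r₀ → r₀ ≤ R → ∀ {t γ} → Pattern t γ → 2 ≤ γ → Mostly (λ _ → ⊤) (StructuredProperty (suc r₀) t γ)
  mostly-structured (suc r₀) r≤R Pat γ≥2 with grow-step r₀ r≤R Pat γ≥2
  ... | t , γ , Pat₀ , γ₀≥2 , step = mostly-trans (mostly-structured r₀ (≤-trans (n≤1+n r₀) r≤R) Pat₀ γ₀≥2) step
  mostly-structured zero _ {t} {γ} Pat γ≥2 = mostly-pure (2 ^ (t + t)) (λ N≤n G _ _ → one N≤n G)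
    where
    one : ∀ {n} → 2 ^ (t + t) ≤ n → (G : Graph n) → Structured G 1 t γ
    one {n} N≤n G = case ramsey (adj G) (adj-sym G) t t (allFin n) (UniqueP.allFin⁺ n) (≤-trans N≤n (≤-reflexive (sym (length-tabulate {n = n} id)))) of λ
      { (inj₁ (v , _ , m)) → build true v m ; (inj₂ (v , _ , m)) → build false v m }
      where
      build : ∀ b (v : Vec (Fin n) t) → Monochromatic (adj G) b v → Structured G 1 t γ
      build b v m = structured-from G Pat γ≥2 (λ _ p → lookup v p) inj (λ _ → b) (λ _ p q ne → proj₂ (m p q ne))
          (λ { zero zero p q ne → ⊥-elim (ne refl) })
        where
        inj : ∀ (i : Fin 1) p (j : Fin 1) q → lookup v p ≡ lookup v q → i ≡ j × p ≡ q
        inj zero p zero q e with p ≟ᶠ q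
        ... | yes eq = refl , eq
        ... | no ne = ⊥-elim (proj₁ (m p q ne) e)

-- The classes of vertices defined by a structured set

-- All that later steps retain of the structured set. `K` can be taken arbitrarily large, and `k₀`
-- bounds the number of vertices that a later step deletes. `codes` is fixed independently of `G`:
-- when one vertex is deleted there is no room for a list of the classes, but there is room for
-- polynomially many codes.
record Classes {n} (G : Graph n) (s K k₀ : ℕ) (codes : ∀ m → List (Graph m → Fin s → Fin m → Bool)) : Set where
  field
    V : Fin s → Fin n → Bool
    Exc : Fin n → Bool
    cover  : ∀ v → Exc v ≡ true ⊎ ∃ λ i → V i v ≡ true
    disjV  : ∀ i j v → V i v ≡ true → V j v ≡ true → i ≡ j
    disjW  : ∀ i v → V i v ≡ true → Exc v ≢ true
    smallW : K * # Exc ≤ n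
    near   : ∀ i y → V i y ≡ true → ∃ λ b → K * # (λ x → V i x ∧ link G b y x) ≤ n
    -- After deleting few vertices, the classes are known up to Exc from the remaining graph and a short code.
    describe : ∀ {q m} (Q : Fin q → Fin n) (out : Fin m → Fin n) → Complement Q out → Injective Q → q ≤ k₀ →
      ∃ λ cl → cl ∈ codes m × (∀ i v → V i (out v) ≡ true → cl (relabel out G) i v ≡ true) ×
        (∀ i v → cl (relabel out G) i v ≡ true → V i (out v) ≡ true ⊎ Exc (out v) ≡ true)

-- A code lists the positions of the structured set in the remaining graph, zero standing for deleted vertices.
mark : ∀ {m q} → Vec (Fin (suc m)) q → Graph m → Fin m → Bool → Fin q → Bool
mark S H v b c = go (lookup S c)
  where
  go : Fin (suc _) → Bool
  go zero    = false
  go (suc z) = adj H v z ==ᵇ b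

readClass : ∀ {s t m} → ℕ → Vec (Fin (suc m)) (s * t) → Graph m → Fin s → Fin m → Bool
readClass {s} {t} h S H i v = (# (λ (p : Fin t) → mark S H v true (combine i p)) ≤ᵗ h)
  ∨ (# (λ (p : Fin t) → mark S H v false (combine i p)) ≤ᵗ h)

structureCodes : (s t h m : ℕ) → List (Graph m → Fin s → Fin m → Bool)
structureCodes s t h m = map (readClass {s} {t} h) (prodL {m = s * t} (λ _ → allFin (suc m)))

prodL-length-const : ∀ {A : Set} m (xs : List A) → length (prodL {m = m} (λ _ → xs)) ≤ length xs ^ m
prodL-length-const zero    xs = ≤-refl
prodL-length-const (suc m) xs = length-concatMap (λ a → map (a ∷_) (prodL {m = m} (λ _ → xs))) (length xs ^ m) xs
  (λ a _ → ≤-trans (≤-reflexive (length-map (a ∷_) (prodL {m = m} (λ _ → xs)))) (prodL-length-const m xs))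

structureCodes-length : ∀ s t h m → length (structureCodes s t h m) ≤ (m + 1) ^ (s * t)
structureCodes-length s t h m = ≤-trans (≤-reflexive (length-map (readClass {s} {t} h) (prodL {m = s * t} (λ _ → allFin (suc m)))))
  (≤-trans (prodL-length-const (s * t) (allFin (suc m)))
    (≤-reflexive (cong (_^ (s * t)) (trans (length-tabulate {n = suc m} id) (+-comm 1 m)))))

module _ {n s t γ : ℕ} {G : Graph n} (h : ℕ) (Str : Structured G s t γ) where
  open Structured Str

  nbrs : Bool → Fin n → Fin s → Fin t → Bool
  nbrs b v i p = link G b v (pt i p)

  opaque
    inS : Fin n → Bool
    inS v = anyB (λ c → flat Str c == v)

    inS-intro : ∀ v i p → v ≡ pt i p → inS v ≡ true
    inS-intro v i p refl = anyB-complete (combine i p) (trans (cong (_== v) (flat-combine Str i p)) (==-refl v))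

    inS-flat : ∀ c → inS (flat Str c) ≡ true
    inS-flat c = anyB-complete c (==-refl (flat Str c))

    inS-elim : ∀ v → inS v ≡ true → ∃ λ c → flat Str c ≡ v
    inS-elim v e = let (c , ec) = anyB-sound e in c , ==-sound ec

    #-inS : # inS ≤ s * t
    #-inS = ≤-trans (#-union inS (λ c v → flat Str c == v) (λ v e → anyB-sound e))
      (≤-trans (sumF-bound _ 1 (λ c → #-unique (λ v → flat Str c == v) (λ a b ea eb →
        trans (sym (==-sound {i = flat Str c} ea)) (==-sound {i = flat Str c} eb)))) (≤-reflexive (*-identityʳ (s * t))))

  opaque
    unmixed : Fin s → Fin n → Bool
    unmixed i v = (# (nbrs true v i) ≤ᵗ h) ∨ (# (nbrs false v i) ≤ᵗ h)

    unmixed-sound : ∀ i v → unmixed i v ≡ true → ∃ λ b → # (nbrs b v i) ≤ h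
    unmixed-sound i v e with ∨-split e
    ... | inj₁ a = true , does-sound (_ ≤? _) a
    ... | inj₂ a = false , does-sound (_ ≤? _) a

    unmixed-complete : ∀ i v b → # (nbrs b v i) ≤ h → unmixed i v ≡ true
    unmixed-complete i v true  le = ∨-left (does-complete (_ ≤? _) le)
    unmixed-complete i v false le = ∨-right {# (nbrs true v i) ≤ᵗ h} (does-complete (_ ≤? _) le)

  opaque
    splits : Fin s → (Fin t → Bool) → Fin n → Bool
    splits j D v = (# D ≤ᵗ (κ * # (λ p → D p ∧ nbrs true v j p))) ∧ (# D ≤ᵗ (κ * # (λ p → D p ∧ nbrs false v j p)))

    splits-sound : ∀ j D v → splits j D v ≡ true → ∀ b → # D ≤ κ * # (λ p → D p ∧ nbrs b v j p)
    splits-sound j D v e true  = does-sound (_ ≤? _) (proj₁ (∧-split e))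
    splits-sound j D v e false = does-sound (_ ≤? _) (proj₂ (∧-split {# D ≤ᵗ _} e))

    splits-complete : ∀ j D v → (∀ b → # D ≤ κ * # (λ p → D p ∧ nbrs b v j p)) → splits j D v ≡ true
    splits-complete j D v h = ∧-join (does-complete (_ ≤? _) (h true)) (does-complete (_ ≤? _) (h false))

    splits-cong : ∀ j {D D′} → (∀ p → D p ≡ D′ p) → ∀ v → splits j D v ≡ splits j D′ v
    splits-cong j h v = cong₂ _∧_
      (cong₂ _≤ᵗ_ (#-cong h) (cong (κ *_) (#-cong (λ p → cong (_∧ nbrs true v j p) (h p)))))
      (cong₂ _≤ᵗ_ (#-cong h) (cong (κ *_) (#-cong (λ p → cong (_∧ nbrs false v j p) (h p)))))

  opaque
    stubborn : Fin s → Fin s → (Fin t → Bool) → Fin n → Bool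
    stubborn i j D v = not (inS v) ∧ (unmixed i v ∧ not (splits j D v))

    stubborn-out : ∀ i j D v → stubborn i j D v ≡ true → inS v ≢ true
    stubborn-out i j D v e = not-true (proj₁ (∧-split e))

    stubborn-unmixed : ∀ i j D v → stubborn i j D v ≡ true → unmixed i v ≡ true
    stubborn-unmixed i j D v e = proj₁ (∧-split (proj₂ (∧-split {not (inS v)} e)))

    stubborn-unsplit : ∀ i j D v → stubborn i j D v ≡ true → splits j D v ≢ true
    stubborn-unsplit i j D v e = not-true (proj₂ (∧-split {unmixed i v} (proj₂ (∧-split {not (inS v)} e))))

    stubborn-intro : ∀ i j D v → inS v ≢ true → unmixed i v ≡ true → splits j D v ≢ true → stubborn i j D v ≡ true
    stubborn-intro i j D v ns u nsp = ∧-join (≢true⇒not ns) (∧-join u (≢true⇒not nsp))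

    stubborn-cong : ∀ i j {D D′} → (∀ p → D p ≡ D′ p) → ∀ v → stubborn i j D v ≡ stubborn i j D′ v
    stubborn-cong i j e v = cong (λ z → not (inS v) ∧ (unmixed i v ∧ not z)) (splits-cong j e v)

  -- Many vertices that are almost constant on part i fail to split the subset D of part j.
  Stubborn : ℕ → Fin s → Fin s → (Fin t → Bool) → Set
  Stubborn Kβ i j D = i ≢ j × t ≤ κ * (κ * # D) × n ≤ Kβ * # (stubborn i j D)

  stubborn? : ∀ Kβ → Dec (∃ λ i → ∃ λ j → ∃ λ D → Stubborn Kβ i j D)
  stubborn? Kβ = any? λ i → any? λ j → searchSet t (Stubborn Kβ i j)
    (λ D → ¬? (i ≟ᶠ j) ×-dec ((t ≤? κ * (κ * # D)) ×-dec (n ≤? Kβ * # (stubborn i j D))))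
    (λ { {D} {D′} e (a , b , c) → a , subst (λ z → t ≤ κ * (κ * z)) (#-cong e) b ,
      subst (λ z → n ≤ Kβ * z) (#-cong (stubborn-cong i j e)) c })

  opaque
    class : Fin s → Fin n → Bool
    class i v = not (inS v) ∧ (unmixed i v ∧ allB (λ j → (j == i) ∨ splits j (λ _ → true) v))

    class-out : ∀ i v → class i v ≡ true → inS v ≢ true
    class-out i v e = not-true (proj₁ (∧-split e))

    class-unmixed : ∀ i v → class i v ≡ true → unmixed i v ≡ true
    class-unmixed i v e = proj₁ (∧-split (proj₂ (∧-split {not (inS v)} e)))

    class-splits : ∀ i v j → class i v ≡ true → j ≢ i → splits j (λ _ → true) v ≡ true
    class-splits i v j e ne with ∨-split {j == i} (allB-sound (proj₂ (∧-split {unmixed i v} (proj₂ (∧-split {not (inS v)} e)))) j)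
    ... | inj₁ eq = ⊥-elim (ne (==-sound eq))
    ... | inj₂ sp = sp

    class-intro : ∀ i v → inS v ≢ true → unmixed i v ≡ true → (∀ j → j ≢ i → splits j (λ _ → true) v ≡ true) → class i v ≡ true
    class-intro i v ns u sp = ∧-join (≢true⇒not ns) (∧-join u (allB-complete go))
      where
      go : ∀ j → (j == i) ∨ splits j (λ _ → true) v ≡ true
      go j with j ≟ᶠ i
      ... | yes refl = refl
      ... | no ne = sp j ne

  splits-full : ∀ j v → splits j (λ _ → true) v ≡ true → ∀ b → t ≤ κ * # (nbrs b v j)
  splits-full j v e b = ≤-trans (≤-reflexive (sym (#-all t))) (≤-trans (splits-sound j (λ _ → true) v e b)
    (*-monoʳ-≤ κ (#-mono (λ p eq → eq))))

  not-stubborn : ∀ i j D v → class i v ≡ true → stubborn i j D v ≡ false → splits j D v ≡ true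
  not-stubborn i j D v cl ns = decidable-stable (_ ≟ᵇ true) λ nsp →
    case trans (sym ns) (stubborn-intro i j D v (class-out i v cl) (class-unmixed i v cl) nsp) of λ ()

-- Classes from a structured set without large sets of stubborn vertices

starBound : ℕ → ℕ → ℕ
starBound γ s = bound γ (suc (s + s))

-- By `h≥` and `room`, a vertex with more than `h` links of both kinds to every part completes a
-- star. By `t>`, splitting a part remains visible after the deletion of `k₀` vertices. By `t≥`, a
-- part split three times still has `starBound` points. `Kβ` allows for the s² pairs of parts on
-- which vertices may be stubborn.
record StructureConstants (r K k₀ : ℕ) : Set where
  field
    Kβ t γ h : ℕ
    Kβ≡  : Kβ ≡ 8 * ((2 + r) * (2 + r)) * K
    K≥1  : 1 ≤ K
    h≥   : κ * (κ * starBound γ (2 + r)) ≤ suc h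
    room : suc r * 8 * γ < κ * (κ * starBound γ (2 + r))
    t>   : κ * (h + k₀) < t
    t≥   : κ * (κ * (κ * starBound γ (2 + r))) ≤ t

module _ {r K k₀ : ℕ} (C : StructureConstants r K k₀) {n : ℕ} (n≥ : 8 * K * ((2 + r) * StructureConstants.t C) ≤ n)
  {G : Graph n} (Str : Structured G (2 + r) (StructureConstants.t C) (StructureConstants.γ C)) (no-star : ¬ HasStar (2 + r) G)
  (tame : ∀ i j D → ¬ Stubborn (StructureConstants.h C) Str (StructureConstants.Kβ C) i j D) where

  open StructureConstants C
  open Structured Str

  private
    s big : ℕ
    s = suc (suc r)
    big = starBound γ s
    few : ∀ i j D → i ≢ j → t ≤ κ * (κ * # D) → Kβ * # (stubborn h Str i j D) ≤ n
    few i j D i≢j le = <⇒≤ (≰⇒> (λ n≤ → tame i j D (i≢j , le , n≤)))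


    t≤full : t ≤ κ * (κ * # {t} (λ _ → true))
    t≤full = ≤-trans (≤-reflexive (sym (#-all t))) (≤-trans (≤-κ* _) (≤-κ* _))

    p₀ : Fin t
    p₀ = fromℕ< {0} (≤-trans (s≤s z≤n) t>)

  some-unmixed : ∀ v → inS h Str v ≢ true → ∃ λ i → unmixed h Str i v ≡ true
  some-unmixed v v∉S with any? (λ i → unmixed h Str i v ≟ᵇ true)
  ... | yes x = x
  ... | no none = ⊥-elim (no-star (mixed-everywhere-star frame v (λ i b → ≤-trans h≥
        (≤-trans (≰⇒> (λ le → none (i , unmixed-complete h Str i v b le))) (#-mono (λ p e → ∧-join (full i p) e)))) room))

  class-disjoint : ∀ i j v → class h Str i v ≡ true → class h Str j v ≡ true → i ≡ j
  class-disjoint i j v ci cj with i ≟ᶠ j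
  ... | yes e = e
  ... | no ne with unmixed-sound h Str i v (class-unmixed h Str i v ci)
  ...   | b , le = ⊥-elim (<⇒≱ t> (≤-trans (splits-full h Str i v (class-splits h Str j v i cj ne) b)
          (*-monoʳ-≤ κ (≤-trans le (m≤m+n h k₀)))))

  rest : Fin n → Bool
  rest v = not (anyB (λ i → class h Str i v))

  rest-covered : ∀ v → rest v ≡ true → inS h Str v ≡ true ⊎ ∃ λ i → anyB (λ j → not (j == i) ∧ stubborn h Str i j (λ _ → true) v) ≡ true
  rest-covered v e with inS h Str v ≟ᵇ true
  ... | yes v∈S = inj₁ v∈S
  ... | no v∉S with some-unmixed v v∉S
  ...   | i , u with any? (λ j → (not (j == i) ∧ stubborn h Str i j (λ _ → true) v) ≟ᵇ true)
  ...     | yes (j , ej) = inj₂ (i , anyB-complete j ej)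
  ...     | no none = ⊥-elim (not-true e (anyB-complete i (class-intro h Str i v v∉S u λ j j≢i →
              decidable-stable (_ ≟ᵇ true) (λ nsp → none (j , ∧-join (≢true⇒not (j≢i ∘ ==-sound)) (stubborn-intro h Str i j (λ _ → true) v v∉S u nsp))))))

  stubborn-sum : Kβ * # rest ≤ Kβ * (s * t) + s * (s * n)
  stubborn-sum = begin
    Kβ * # rest ≤⟨ *-monoʳ-≤ Kβ (#-cover rest (inS h Str) (λ v → anyB (λ i → bad i v))
        (λ v e → [ inj₁ , (λ { (i , e′) → inj₂ (anyB-complete i e′) }) ]′ (rest-covered v e))) ⟩
    Kβ * (# (inS h Str) + # (λ v → anyB (λ i → bad i v))) ≡⟨ *-distribˡ-+ Kβ _ _ ⟩
    Kβ * # (inS h Str) + Kβ * # (λ v → anyB (λ i → bad i v))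
      ≤⟨ +-mono-≤ (*-monoʳ-≤ Kβ (#-inS h Str)) (*-monoʳ-≤ Kβ (≤-trans (#-union (λ v → anyB (λ i → bad i v)) bad (λ v e → anyB-sound e))
           (sumF-mono (λ i → #-union (bad i) (bad₂ i) (λ v e → anyB-sound e))))) ⟩
    Kβ * (s * t) + Kβ * sumF (λ i → sumF (λ j → # (bad₂ i j)))
      ≡⟨ cong (Kβ * (s * t) +_) (trans (sym (sumF-*ˡ Kβ _)) (sumF-cong (λ i → sym (sumF-*ˡ Kβ _)))) ⟩
    Kβ * (s * t) + sumF (λ i → sumF (λ j → Kβ * # (bad₂ i j)))
      ≤⟨ +-monoʳ-≤ (Kβ * (s * t)) (sumF-bound _ (s * n) (λ i → sumF-bound _ n (λ j → each i j))) ⟩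
    Kβ * (s * t) + s * (s * n) ∎
    where
    open ≤-Reasoning
    bad₂ : Fin s → Fin s → Fin n → Bool
    bad₂ i j v = not (j == i) ∧ stubborn h Str i j (λ _ → true) v
    bad : Fin s → Fin n → Bool
    bad i v = anyB (λ j → bad₂ i j v)
    each : ∀ i j → Kβ * # (bad₂ i j) ≤ n
    each i j with j ≟ᶠ i
    ... | yes e = ≤-trans (≤-reflexive (trans (cong (Kβ *_) (#-none n)) (*-zeroʳ Kβ))) z≤n
    ... | no ne = few i j (λ _ → true) (ne ∘ sym) t≤full

  -- A vertex without a class lies in the structured set or is stubborn for one of at most s² pairs
  -- of parts. Each pair accounts for at most n / Kβ vertices, and `n≥` makes the structured set
  -- equally harmless.
  rest-small : K * # rest ≤ n
  rest-small = *-cancelˡ-≤ (8 * (s * s)) (begin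
    8 * (s * s) * (K * # rest) ≡⟨ sym (*-assoc (8 * (s * s)) K (# rest)) ⟩
    8 * (s * s) * K * # rest ≡⟨ cong (_* # rest) (sym Kβ≡) ⟩
    Kβ * # rest ≤⟨ stubborn-sum ⟩
    Kβ * (s * t) + s * (s * n) ≡⟨ cong (λ z → z * (s * t) + s * (s * n)) Kβ≡ ⟩
    8 * (s * s) * K * (s * t) + s * (s * n) ≡⟨ eq₁ (s * s) K (s * t) s n ⟩
    s * s * (8 * K * (s * t)) + s * (s * n) ≤⟨ +-monoˡ-≤ _ (*-monoʳ-≤ (s * s) n≥) ⟩
    s * s * n + s * (s * n) ≤⟨ certificate {X = 0} (6 * (s * s * n)) z≤n (eq₂ s n) ⟩
    8 * (s * s) * n ∎)
    where
    open ≤-Reasoning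
    eq₁ : ∀ ss K st s n → 8 * ss * K * st + s * (s * n) ≡ ss * (8 * K * st) + s * (s * n)
    eq₁ = solve-∀
    eq₂ : ∀ s n → s * s * n + s * (s * n) + 0 + 6 * (s * s * n) ≡ 8 * (s * s) * n + 0
    eq₂ = solve-∀

  private
    Kβ≢0 : NonZero Kβ
    Kβ≢0 = >-nonZero (≤-trans (*-mono-≤ {1} {8 * (s * s)} (s≤s z≤n) K≥1) (≤-reflexive (sym Kβ≡)))

    quota : ℕ
    quota = _/_ n Kβ {{Kβ≢0}}

    ≤quota : ∀ x → Kβ * x ≤ n → x ≤ quota
    ≤quota x le = ≤-trans (≤-reflexive (sym (m*n/n≡m x Kβ {{Kβ≢0}}))) (/-monoˡ-≤ Kβ {{Kβ≢0}} (≤-trans (≤-reflexive (*-comm x Kβ)) le))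

    enough : ∀ l A → l ≤ suc r * 2 * 2 → n < K * A → l * quota < A
    enough l A l≤ lt = *-cancelˡ-< K (l * quota) A (≤-<-trans (begin
      K * (l * quota) ≤⟨ *-monoʳ-≤ K (*-monoˡ-≤ quota (≤-trans l≤ (certificate {X = 0} (8 * (s * s) ∸ suc r * 2 * 2) z≤n
          (trans (cong (_+ (8 * (s * s) ∸ suc r * 2 * 2)) (+-identityʳ _)) (trans (m+[n∸m]≡n bound-ok) (sym (+-identityʳ _))))))) ⟩
      K * (8 * (s * s) * quota) ≡⟨ shuffle K (s * s) quota ⟩
      quota * (8 * (s * s) * K) ≡⟨ cong (quota *_) (sym Kβ≡) ⟩
      quota * Kβ ≤⟨ m/n*n≤m n Kβ {{Kβ≢0}} ⟩
      n ∎) lt)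
      where
      open ≤-Reasoning
      shuffle : ∀ K ss q → K * (8 * ss * q) ≡ q * (8 * ss * K)
      shuffle = solve-∀
      bound-ok : suc r * 2 * 2 ≤ 8 * (s * s)
      bound-ok = certificate {X = 0} (8 * (r * r) + 28 * r + 28) z≤n (identity r)
        where
        identity : ∀ r → suc r * 2 * 2 + 0 + (8 * (r * r) + 28 * r + 28) ≡ 8 * (suc (suc r) * suc (suc r)) + 0
        identity = solve-∀

  -- Otherwise `y` has many neighbours and many non-neighbours in its class. One of each can be
  -- chosen outside at most 4 (r + 1) sets of stubborn vertices, each of size at most `quota`.
  -- Together with `y` they then split all other parts into eight large cells, and `mixed-star`
  -- gives a star in these parts.
  class-near : ∀ i y → class h Str i y ≡ true → ∃ λ b → K * # (λ x → class h Str i x ∧ link G b y x) ≤ n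
  class-near i y cy with K * # (λ x → class h Str i x ∧ link G true y x) ≤? n | K * # (λ x → class h Str i x ∧ link G false y x) ≤? n
  ... | yes le | _      = true , le
  ... | no _   | yes le = false , le
  ... | no ¬a  | no ¬b  = ⊥-elim (no-star (mixed-star F′ p₀ y a₀ b₀ (proj₂ (∧-split {class h Str i a₀} (proj₁ (proj₂ pickA))))
        (proj₂ (∧-split {class h Str i b₀} (proj₁ (proj₂ pickB)))) cells))
    where
    other : Fin (suc r) → Fin s
    other = punchIn i
    other≢ : ∀ j → other j ≢ i
    other≢ j = punchInᵢ≢i i j
    F′ : Frame G (suc r) t γ
    F′ = subFrame other (punchIn-injective i) frame
    D₁ : Fin (suc r) × Bool → Fin t → Bool
    D₁ (j , τ) = nbrs h Str τ y (other j)
    large₁ : ∀ d → t ≤ κ * # (D₁ d)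
    large₁ (j , τ) = splits-full h Str (other j) y (class-splits h Str i y (other j) cy (other≢ j)) τ
    E₁ : Enumeration (Fin (suc r) × Bool) (suc r * 2)
    E₁ = enum× (enumFin (suc r)) enumBool
    bad₁ : Fin (suc r) × Bool → Fin n → Bool
    bad₁ d = stubborn h Str i (other (proj₁ d)) (D₁ d)
    few-in : ∀ (A : Fin n → Bool) j D → t ≤ κ * (κ * # D) → # (λ v → A v ∧ stubborn h Str i (other j) D v) ≤ quota
    few-in A j D le = ≤quota _ (≤-trans (*-monoʳ-≤ Kβ (#-mono (λ v e → proj₂ (∧-split {A v} e)))) (few i (other j) D (other≢ j ∘ sym) le))
    pickA : ∃ λ a → class h Str i a ∧ link G true y a ≡ true × (∀ d → d ∈ elements E₁ → bad₁ d a ≡ false)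
    pickA = avoid (λ x → class h Str i x ∧ link G true y x) bad₁ quota (elements E₁)
      (λ d _ → few-in (λ x → class h Str i x ∧ link G true y x) (proj₁ d) (D₁ d) (≤-trans (large₁ d) (≤-κ* _)))
      (enough (length (elements E₁)) _ (≤-trans (size E₁) (m≤m*n (suc r * 2) 2)) (≰⇒> ¬a))
    a₀ : Fin n
    a₀ = proj₁ pickA
    D₂ : (Fin (suc r) × Bool) × Bool → Fin t → Bool
    D₂ (d , β) p = D₁ d p ∧ nbrs h Str β a₀ (other (proj₁ d)) p
    large₂ : ∀ e → t ≤ κ * (κ * # (D₂ e))
    large₂ (d , β) = ≤-trans (large₁ d) (*-monoʳ-≤ κ (splits-sound h Str (other (proj₁ d)) (D₁ d) a₀
      (not-stubborn h Str i (other (proj₁ d)) (D₁ d) a₀ (proj₁ (∧-split (proj₁ (proj₂ pickA)))) (proj₂ (proj₂ pickA) d (complete E₁ d))) β))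
    E₂ : Enumeration ((Fin (suc r) × Bool) × Bool) (suc r * 2 * 2)
    E₂ = enum× E₁ enumBool
    bad₂ : (Fin (suc r) × Bool) × Bool → Fin n → Bool
    bad₂ e = stubborn h Str i (other (proj₁ (proj₁ e))) (D₂ e)
    pickB : ∃ λ b → class h Str i b ∧ link G false y b ≡ true × (∀ e → e ∈ elements E₂ → bad₂ e b ≡ false)
    pickB = avoid (λ x → class h Str i x ∧ link G false y x) bad₂ quota (elements E₂)
      (λ e _ → few-in (λ x → class h Str i x ∧ link G false y x) (proj₁ (proj₁ e)) (D₂ e) (large₂ e))
      (enough (length (elements E₂)) _ (size E₂) (≰⇒> ¬b))
    b₀ : Fin n
    b₀ = proj₁ pickB
    reassoc : ∀ {a b c} → (a ∧ b) ∧ c ≡ true → true ∧ (a ∧ (b ∧ c)) ≡ true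
    reassoc {true} {true} e = e
    cells : ∀ j τ₀ τ₁ τ₂ → big ≤ # (cell F′ p₀ y a₀ b₀ τ₀ τ₁ τ₂ j)
    cells j τ₀ τ₁ τ₂ = ≤-trans (*-cancelˡ-≤ κ {{κ≢0}} (*-cancelˡ-≤ κ {{κ≢0}} (*-cancelˡ-≤ κ {{κ≢0}} (≤-trans t≥ (≤-trans (large₂ ((j , τ₀) , τ₁))
      (*-monoʳ-≤ κ (*-monoʳ-≤ κ (splits-sound h Str (other j) (D₂ ((j , τ₀) , τ₁)) b₀
        (not-stubborn h Str i (other j) (D₂ ((j , τ₀) , τ₁)) b₀ (proj₁ (∧-split (proj₁ (proj₂ pickB)))) (proj₂ (proj₂ pickB) ((j , τ₀) , τ₁) (complete E₂ _))) τ₂))))))))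
      (#-mono (λ p e → let (e₁ , e₂) = ∧-split {D₁ (j , τ₀) p ∧ nbrs h Str τ₁ a₀ (other j) p} e
                           (e₃ , e₄) = ∧-split {D₁ (j , τ₀) p} e₁ in
        ∧-join (full (other j) p) (∧-join e₃ (∧-join e₄ e₂))))

  -- Deleted points only lower the counts, so members of a class are still recognised. A vertex of
  -- another class has more than h + k₀ links of each kind to part `i`, hence more than `h` after
  -- the deletion. Only vertices of `rest` can be misread.
  class-describe : ∀ {q m} (Q : Fin q → Fin n) (out : Fin m → Fin n) → Complement Q out → Injective Q → q ≤ k₀ →
    ∃ λ cl → cl ∈ structureCodes s t h m × (∀ i v → class h Str i (out v) ≡ true → cl (relabel out G) i v ≡ true) ×
      (∀ i v → cl (relabel out G) i v ≡ true → class h Str i (out v) ≡ true ⊎ rest (out v) ≡ true)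
  class-describe {q} {m} Q out C Q-inj q≤k₀ = readClass {s} {t} h pos , ∈-map⁺ (readClass {s} {t} h) (∈-prodL _ pos (λ c → ∈-allFin _)) , forth , back′
    where
    open Complement C
    where-is : Fin n → Fin (suc m)
    where-is x = [ (λ _ → zero) , (λ { (v , _) → suc v }) ]′ (Q-or-out x)
    pos : Vec (Fin (suc m)) (s * t)
    pos = tabulate (λ c → where-is (flat Str c))
    H : Graph m
    H = relabel out G
    at : ∀ v b i p → (∃ λ z → out z ≡ pt i p × mark pos H v b (combine i p) ≡ (adj G (out v) (pt i p) ==ᵇ b)) ⊎
      ((∃ λ a → pt i p ≡ Q a) × mark pos H v b (combine i p) ≡ false)
    at v b i p with lookup pos (combine i p) | lookup∘tabulate (λ c → where-is (flat Str c)) (combine i p)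
    ... | w | eq with Q-or-out (flat Str (combine i p)) | flat-combine Str i p
    at v b i p | _ | refl | inj₁ (a , e) | e′ = inj₂ ((a , trans (sym e′) e) , refl)
    at v b i p | _ | refl | inj₂ (z , e) | e′ = inj₁ (z , trans (sym e) e′ ,
      cong (_==ᵇ b) (trans (adj-relabel out G v z) (cong (adj G (out v)) (trans (sym e) e′))))
    forth : ∀ i v → class h Str i (out v) ≡ true → readClass {s} {t} h pos H i v ≡ true
    forth i v cl with unmixed-sound h Str i (out v) (class-unmixed h Str i (out v) cl)
    ... | b , le = finish b (≤-trans (#-mono marked) le)
      where
      marked : ∀ p → mark pos H v b (combine i p) ≡ true → nbrs h Str b (out v) i p ≡ true
      marked p e with at v b i p
      ... | inj₁ (z , ez , eq) = link-intro G b _ _ (λ same → class-out h Str i (out v) cl (inS-intro h Str (out v) i p same))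
              (does-sound (_ ≟ᵇ b) (trans (sym eq) e))
      ... | inj₂ (_ , eq) = case trans (sym e) eq of λ ()
      finish : ∀ b → # (λ p → mark pos H v b (combine i p)) ≤ h → readClass {s} {t} h pos H i v ≡ true
      finish true  le = ∨-left (does-complete (_ ≤? h) le)
      finish false le = ∨-right {# (λ (p : Fin t) → mark pos H v true (combine i p)) ≤ᵗ h} (does-complete (_ ≤? h) le)
    few-marks : ∀ i v → readClass {s} {t} h pos H i v ≡ true → ∃ λ b → # (λ (p : Fin t) → mark pos H v b (combine i p)) ≤ h
    few-marks i v e with ∨-split {# (λ (p : Fin t) → mark pos H v true (combine i p)) ≤ᵗ h} e
    ... | inj₁ a = true , does-sound (_ ≤? h) a
    ... | inj₂ a = false , does-sound (_ ≤? h) a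
    back′ : ∀ i v → readClass {s} {t} h pos H i v ≡ true → class h Str i (out v) ≡ true ⊎ rest (out v) ≡ true
    back′ i v e with bool-cases (rest (out v))
    ... | inj₁ re = inj₂ re
    ... | inj₂ re with anyB-sound (not-false re)
    ...   | j , cj with i ≟ᶠ j
    ...     | yes refl = inj₁ cj
    ...     | no i≢j with few-marks i v e
    ...       | b , le = ⊥-elim (<⇒≱ t> (≤-trans (splits-full h Str i (out v) (class-splits h Str j (out v) i cj i≢j) b)
                (*-monoʳ-≤ κ (≤-trans (#-cover (nbrs h Str b (out v) i) (λ p → mark pos H v b (combine i p)) inQ covered)
                  (+-mono-≤ le (≤-trans inQ-few q≤k₀))))))
      where
      inQ : Fin t → Bool
      inQ p = anyB (λ a → pt i p == Q a)
      covered : ∀ p → nbrs h Str b (out v) i p ≡ true → mark pos H v b (combine i p) ≡ true ⊎ inQ p ≡ true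
      covered p lk with at v b i p
      ... | inj₁ (z , ez , eq) = inj₁ (trans eq (does-complete (_ ≟ᵇ b) (link-adj G b (out v) (pt i p) lk)))
      ... | inj₂ ((a , ea) , _) = inj₂ (anyB-complete a (trans (cong (_== Q a) ea) (==-refl (Q a))))
      inQ-few : # inQ ≤ q
      inQ-few = ≤-trans (#-union inQ (λ a p → pt i p == Q a) (λ p ep → anyB-sound ep))
        (≤-trans (sumF-bound _ 1 (λ a → #-unique (λ p → pt i p == Q a) (λ x y ex ey →
          proj₂ (pt-inj i x i y (trans (==-sound {i = pt i x} ex) (sym (==-sound {i = pt i y} ey))))))) (≤-reflexive (*-identityʳ q)))

  structured-classes : Classes G s K k₀ (structureCodes s t h)
  structured-classes = record
    { V = class h Str ; Exc = rest
    ; cover = λ v → case bool-cases (rest v) of λ { (inj₁ e) → inj₁ e ; (inj₂ e) → inj₂ (anyB-sound (not-false e)) }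
    ; disjV = class-disjoint
    ; disjW = λ i v ci re → not-true re (anyB-complete i ci)
    ; smallW = rest-small
    ; near = class-near
    ; describe = class-describe }

#-restrict : ∀ {q m n} {Q : Fin q → Fin n} {out : Fin m → Fin n} → Complement Q out → (p : Fin n → Bool) →
  # p ≤ # (p ∘ out) + # (p ∘ Q)
#-restrict {q} {m} {n} {Q} {out} C p = ≤-trans (#-cover p inOut inQ covered) (+-mono-≤ (image out) (image Q))
  where
  inOut inQ : Fin n → Bool
  inOut x = anyB (λ v → p (out v) ∧ (x == out v))
  inQ x = anyB (λ i → p (Q i) ∧ (x == Q i))
  covered : ∀ x → p x ≡ true → inOut x ≡ true ⊎ inQ x ≡ true
  covered x e with Complement.Q-or-out C x
  ... | inj₁ (i , refl) = inj₂ (anyB-complete i (∧-join e (==-refl (Q i))))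
  ... | inj₂ (v , refl) = inj₁ (anyB-complete v (∧-join e (==-refl (out v))))
  image : ∀ {k} (φ : Fin k → Fin n) → # (λ x → anyB (λ v → p (φ v) ∧ (x == φ v))) ≤ # (p ∘ φ)
  image φ = ≤-trans (#-union _ (λ v x → p (φ v) ∧ (x == φ v)) (λ x e → anyB-sound e))
    (≤-trans (sumF-mono one) (≤-reflexive (sumF-bit (p ∘ φ))))
    where
    one : ∀ v → # (λ x → p (φ v) ∧ (x == φ v)) ≤ bit (p (φ v))
    one v with p (φ v)
    ... | true  = ≤-reflexive (#-singleton (φ v))
    ... | false = ≤-reflexive (#-none n)

-- Structured sets with many stubborn vertices are rare

record TameConstants (r K k₀ : ℕ) : Set where
  field
    structure : StructureConstants r K k₀
  open StructureConstants structure public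
  field
    b gn : ℕ
    t≡   : t ≡ b * (b * h)
    t≡′  : t ≡ κ * (κ * (2 * gn + 2))
    gain : Kβ * (b * h + b * h + (4 + r)) + 1 ≤ gn

module Tame {k* : ℕ} (T : Graph k*) (r : ℕ) (g : ℕ → ℕ) (ext : Extends (suc r) g)
  (star : ∀ {n} (G : Graph n) → HasStar (2 + r) G → ContainsInduced T G) where

  open Typical T (suc r) g ext
  open Growth T (suc r) g ext

  module _ {K k₀ : ℕ} (C : TameConstants r K k₀) where

    open TameConstants C

    q Y : ℕ
    q = s * t
    Y = suc r * t + (b * h + b * h) + suc s

    Kβ≥1 : 1 ≤ Kβ
    Kβ≥1 = ≤-trans (*-mono-≤ {1} {8 * ((2 + r) * (2 + r))} (s≤s z≤n) K≥1) (≤-reflexive (sym Kβ≡))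

    block≟ : Fin s → Fin q → Bool
    block≟ i c = quot {s} {t} c == i

    almostConstant : Fin s × Bool → List (Vec Bool q)
    almostConstant (i , β) = rowList (block≟ i) (λ _ → false) (λ _ → β) h 0

    unmixedL : List (Vec Bool q)
    unmixedL = concatMap almostConstant (elements (enum× (enumFin s) enumBool))

    unmixedL-length : length unmixedL ≤ 2 ^ Y
    unmixedL-length = ≤-trans (length-pow almostConstant (elements (enum× (enumFin s) enumBool)) (suc s) (suc r * t + (b * h + b * h))
        (≤-trans (size (enum× (enumFin s) enumBool)) (≤-trans (*-monoˡ-≤ 2 (n≤2^n s)) (≤-reflexive (*-comm (2 ^ s) 2)))) (λ d _ → one d))
      (^-monoʳ-≤ 2 (≤-reflexive (+-comm (suc s) (suc r * t + (b * h + b * h)))))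
      where
      open ≤-Reasoning
      one : ∀ d → length (almostConstant d) ≤ 2 ^ (suc r * t + (b * h + b * h))
      one (i , β) = begin
        length (almostConstant (i , β)) ≤⟨ length-rowList (block≟ i) (λ _ → false) (λ _ → β) h 0 ⟩
        2 ^ # (λ c → not (block≟ i c) ∧ true) * (W (# (block≟ i)) h * W (# {q} (λ c → false)) 0)
          ≤⟨ *-mono-≤ (^-monoʳ-≤ 2 free≤) (*-mono-≤ (W-bound b (b * h) _ h (≤-reflexive (trans (#-block {s} {t} i) t≡)))
               (≤-reflexive (W-zero (# {q} (λ c → false))))) ⟩
        2 ^ (suc r * t) * (2 ^ (b * h + b * h) * 1) ≡⟨ cong (2 ^ (suc r * t) *_) (*-identityʳ (2 ^ (b * h + b * h))) ⟩
        2 ^ (suc r * t) * 2 ^ (b * h + b * h) ≡⟨ sym (^-distribˡ-+-* 2 (suc r * t) (b * h + b * h)) ⟩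
        2 ^ (suc r * t + (b * h + b * h)) ∎
        where
        free≤ : # (λ c → not (block≟ i c) ∧ true) ≤ suc r * t
        free≤ = +-cancelˡ-≤ t _ _ (≤-trans (+-mono-≤ (≤-reflexive (sym (#-block {s} {t} i))) (#-mono (λ c e → proj₁ (∧-split e))))
          (≤-reflexive (#-complement (block≟ i))))

    module _ (i j : Fin s) (D : Fin t → Bool) where

      colour : Bool × Bool → Fin q → Bool
      colour (β , β′) c = choose (block≟ i c) β β′

      spot : Fin q → Bool
      spot c = block≟ j c ∧ D (rem {s} {t} c)

      stubbornRows : Bool × Bool → List (Vec Bool q)
      stubbornRows ββ = rowList (block≟ i) spot (colour ββ) h (# D / 64)

      stubbornL : List (Vec Bool q)
      stubbornL = concatMap stubbornRows (elements (enum× enumBool enumBool))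

      #-spot : i ≢ j → # (λ c → spot c ∧ not (block≟ i c)) ≡ # D
      #-spot i≢j = ≤-antisym
        (≤-trans (#-mono (λ c e → proj₁ (∧-split {spot c} e))) (#-part≤ {s} {t} j (λ c → D (rem {s} {t} c)) D (λ a e → subst (λ z → D z ≡ true) (rem-combine {s} {t} j a) e)))
        (≤-trans (#-part≥ {s} {t} j (λ c → D (rem {s} {t} c) ∧ not (block≟ i c)) D (λ a e → ∧-join (trans (cong D (rem-combine {s} {t} j a)) e)
            (≢true⇒not (λ eq → i≢j (trans (sym (==-sound eq)) (quot-combine {s} {t} j a))))))
          (#-mono (λ c e → let (e₁ , e₂) = ∧-split {block≟ j c} e ; (e₃ , e₄) = ∧-split {D (rem {s} {t} c)} e₂ in ∧-join (∧-join e₁ e₃) e₄)))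

      free-count : i ≢ j → # (λ c → not (block≟ i c) ∧ not (spot c)) + # D ≤ suc r * t
      free-count i≢j = +-cancelˡ-≤ t _ _ (begin
        t + (# (λ c → not (block≟ i c) ∧ not (spot c)) + # D)
          ≡⟨ cong₂ _+_ (sym (#-block {s} {t} i)) (+-comm _ (# D)) ⟩
        # (block≟ i) + (# D + # (λ c → not (block≟ i c) ∧ not (spot c)))
          ≤⟨ +-monoʳ-≤ (# (block≟ i)) (+-monoˡ-≤ _ (≤-trans (≤-reflexive (sym (#-spot i≢j)))
               (#-mono (λ c e → ∧-join (proj₂ (∧-split {spot c} e)) (proj₁ (∧-split {spot c} e)))))) ⟩
        # (block≟ i) + (# (λ c → not (block≟ i c) ∧ spot c) + # (λ c → not (block≟ i c) ∧ not (spot c)))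
          ≡⟨ cong (# (block≟ i) +_) (sym (#-split (λ c → not (block≟ i c)) spot)) ⟩
        # (block≟ i) + # (λ c → not (block≟ i c)) ≡⟨ #-complement (block≟ i) ⟩
        q ∎)
        where open ≤-Reasoning

      -- A stubborn vertex takes one of the values at most |D| / 64 times on `D`, so by `W-half`
      -- about half of the |D| bits are saved. The hypothesis and `t≡′` give |D| ≥ 2 gn + 2.
      stubbornL-length : i ≢ j → t ≤ κ * (κ * # D) → length stubbornL ≤ 2 ^ (Y ∸ gn)
      stubbornL-length i≢j t≤ = ≤-trans
        (length-pow stubbornRows (elements (enum× enumBool enumBool)) 2 (# free + (b * h + b * h + hD)) (size (enum× enumBool enumBool)) (λ d _ → one d))
        (^-monoʳ-≤ 2 (m+n≤o⇒m≤o∸n (2 + (# free + (b * h + b * h + hD))) {gn} {Y}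
          (*-cancelˡ-≤ 2 (certificate (2 + 2 * r) (+-mono-≤ (+-mono-≤ 2hD≤ 2gn≤) (*-monoʳ-≤ 2 (free-count i≢j)))
            (identity (# free) (b * h) hD gn (# D) r t)))))
        where
        open ≤-Reasoning
        free : Fin q → Bool
        free c = not (block≟ i c) ∧ not (spot c)
        two : Fin q → Bool
        two c = spot c ∧ not (block≟ i c)
        half : ∃ λ hD → W (# two) (# D / 64) ≤ 2 ^ hD × 2 * hD ≤ # two + 2
        half = W-half (# two) (# D / 64) (≤-trans (*-monoˡ-≤ (# D / 64) (m≤m+n 32 32)) (≤-trans (d*[m/d]≤m (# D) 63) (≤-reflexive (sym (#-spot i≢j)))))
        hD : ℕ
        hD = proj₁ half
        2hD≤ : 2 * hD ≤ # D + 2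
        2hD≤ = ≤-trans (proj₂ (proj₂ half)) (≤-reflexive (cong (_+ 2) (#-spot i≢j)))
        2gn≤ : 2 * gn + 2 ≤ # D
        2gn≤ = *-cancelˡ-≤ κ {{κ≢0}} (*-cancelˡ-≤ κ {{κ≢0}} (≤-trans (≤-reflexive (sym t≡′)) t≤))
        identity : ∀ f M hD gn D r t → 2 * (2 + (f + (M + M + hD)) + gn) + ((D + 2 + D) + 2 * (suc r * t)) + (2 + 2 * r)
          ≡ 2 * (suc r * t + (M + M) + suc (suc (suc r))) + ((2 * hD + (2 * gn + 2)) + 2 * (f + D))
        identity = solve-∀
        one : ∀ d → length (stubbornRows d) ≤ 2 ^ (# free + (b * h + b * h + hD))
        one d = begin
          length (stubbornRows d) ≤⟨ length-rowList (block≟ i) spot (colour d) h (# D / 64) ⟩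
          2 ^ # free * (W (# (block≟ i)) h * W (# two) (# D / 64))
            ≤⟨ *-monoʳ-≤ (2 ^ # free) (*-mono-≤ (W-bound b (b * h) _ h (≤-reflexive (trans (#-block {s} {t} i) t≡))) (proj₁ (proj₂ half))) ⟩
          2 ^ # free * (2 ^ (b * h + b * h) * 2 ^ hD) ≡⟨ cong (2 ^ # free *_) (sym (^-distribˡ-+-* 2 (b * h + b * h) hD)) ⟩
          2 ^ # free * 2 ^ (b * h + b * h + hD) ≡⟨ sym (^-distribˡ-+-* 2 (# free) (b * h + b * h + hD)) ⟩
          2 ^ (# free + (b * h + b * h + hD)) ∎

    Info : ℕ → Set
    Info m = ((Fin s × Fin s) × Vec Bool t) × Vec Bool m

    infoE : ∀ m → Enumeration (Info m) (s * s * 2 ^ t * 2 ^ m)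
    infoE m = enum× (enum× (enum× (enumFin s) (enumFin s)) (enumVecBool t)) (enumVecBool m)

    column : ∀ {m} → Info m → Fin m → List (Vec Bool q)
    column (((i , j) , D) , C) v = choose (lookup C v) (stubbornL i j (lookup D)) unmixedL

    admissible? : ∀ {m} (ι : Info m) → Dec (proj₁ (proj₁ (proj₁ ι)) ≢ proj₂ (proj₁ (proj₁ ι)) × t ≤ κ * (κ * # (lookup (proj₂ (proj₁ ι)))))
    admissible? (((i , j) , D) , C) = ¬? (i ≟ᶠ j) ×-dec (t ≤? κ * (κ * # (lookup D)))

    tables : ∀ {m} → Info m → List (Table q m)
    tables ι = keepIf (admissible? ι) (map transposeV (prodL (column ι)))

    expo : ∀ {m} → Info m → ℕ
    expo (_ , C) = sumF (λ v → choose (lookup C v) (Y ∸ gn) Y)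

    tables-length : ∀ {m} (ι : Info m) → length (tables ι) ≤ 2 ^ expo ι
    tables-length ι@(((i , j) , D) , C) = length-keepIf (admissible? ι) _ (λ { (i≢j , t≤) →
      ≤-trans (≤-reflexive (length-map transposeV (prodL (column ι)))) (prodL-length (column ι) (λ v → choose (lookup C v) (Y ∸ gn) Y) (col i≢j t≤)) })
      where
      col : i ≢ j → t ≤ κ * (κ * # (lookup D)) → ∀ v → length (column ι v) ≤ 2 ^ choose (lookup C v) (Y ∸ gn) Y
      col i≢j t≤ v with lookup C v
      ... | true  = stubbornL-length i j (lookup D) i≢j t≤
      ... | false = unmixedL-length

    gn≤Y : gn ≤ Y
    gn≤Y = ≤-trans (≤-trans (m≤m+n gn (gn + 0)) (m≤m+n (2 * gn) 2)) (≤-trans (≤-κ* (2 * gn + 2)) (≤-trans (≤-κ* _) (≤-trans (≤-reflexive (sym t≡′))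
      (≤-trans (m≤m+n t (r * t)) (≤-trans (m≤m+n (suc r * t) _) (m≤m+n _ (suc s)))))))

    P Q : Property
    P G = Structured G s t γ
    Q G = Classes G s K k₀ (structureCodes s t h)

    row : ∀ {n} {G : Graph n} → Structured G s t γ → Fin n → Vec Bool q
    row {G = G} Str v = traceVec G (flat Str) v

    module _ {n} {G : Graph n} (Str : Structured G s t γ) where
      open Structured Str

      row-at : ∀ v i p b → inS h Str v ≢ true → (lookup (row Str v) (combine i p) ==ᵇ b) ≡ true → nbrs h Str b v i p ≡ true
      row-at v i p b ns e = link-intro G b v (pt i p)
        (λ eq → ns (inS-intro h Str v i p eq))
        (trans (sym (trans (lookup∘tabulate _ (combine i p)) (cong (adj G v) (flat-combine Str i p)))) (does-sound (_ ≟ᵇ b) e))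

      row-unmixed : ∀ v → inS h Str v ≢ true → ∀ i → unmixed h Str i v ≡ true → row Str v ∈ unmixedL
      row-unmixed v ns i u with unmixed-sound h Str i v u
      ... | β , le = ∈-concatMap almostConstant (complete (enum× (enumFin s) enumBool) (i , β))
        (∈-rowList (block≟ i) (λ _ → false) (λ _ → β) h 0 (row Str v)
          (≤-trans (#-part≤ {s} {t} i (λ c → lookup (row Str v) c ==ᵇ β) (nbrs h Str β v i) (λ p e → row-at v i p β ns e)) le)
          (≤-reflexive (#-zero _ (λ _ ()))))

      row-stubborn : ∀ v i j D → i ≢ j → stubborn h Str i j D v ≡ true → row Str v ∈ stubbornL i j D
      row-stubborn v i j D i≢j e with unmixed-sound h Str i v (stubborn-unmixed h Str i j D v e)
      ... | β , le = ∈-concatMap (stubbornRows i j D) (complete (enum× enumBool enumBool) (β , proj₁ unsplit))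
            (∈-rowList (block≟ i) (spot i j D) (colour i j D (β , proj₁ unsplit)) h (# D / 64) (row Str v)
              (≤-trans (#-part≤ {s} {t} i (λ c → lookup (row Str v) c ==ᵇ colour i j D (β , proj₁ unsplit) c) (nbrs h Str β v i)
                (λ p ep → row-at v i p β ns (subst (λ z → (lookup (row Str v) (combine i p) ==ᵇ z) ≡ true) (at-i p) ep))) le)
              (≤-trans (#-mono (λ c ec → let (a , d) = ∧-split {spot i j D c ∧ not (block≟ i c)} ec ; (a₁ , a₂) = ∧-split {spot i j D c} a
                                             (a₃ , a₄) = ∧-split {block≟ j c} a₁ in ∧-join a₃ (∧-join a₄ (∧-join a₂ d))))
                (≤-trans (#-part≤ {s} {t} j (λ c → D (rem {s} {t} c) ∧ (not (block≟ i c) ∧ (lookup (row Str v) c ==ᵇ colour i j D (β , proj₁ unsplit) c)))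
                    (λ p → D p ∧ nbrs h Str (proj₁ unsplit) v j p) at-j)
                  (proj₂ unsplit))))
        where
        ns : inS h Str v ≢ true
        ns = stubborn-out h Str i j D v e
        small : ∀ {x} → κ * x < # D → x ≤ # D / 64
        small {x} lt = s≤s⁻¹ (*-cancelˡ-< 64 x (suc (# D / 64)) (<-≤-trans (subst (λ k → k * x < # D) κ≡64 lt)
          (≤-trans (m<[m/d+1]*d (# D) 63) (≤-reflexive (sym (*-suc 64 (# D / 64)))))))
        unsplit : ∃ λ β′ → # (λ p → D p ∧ nbrs h Str β′ v j p) ≤ # D / 64
        unsplit with # D ≤? κ * # (λ p → D p ∧ nbrs h Str true v j p) | # D ≤? κ * # (λ p → D p ∧ nbrs h Str false v j p)
        ... | no ¬le | _ = true , small (≰⇒> ¬le)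
        ... | yes _ | no ¬le = false , small (≰⇒> ¬le)
        ... | yes a | yes b = ⊥-elim (stubborn-unsplit h Str i j D v e (splits-complete h Str j D v (λ { true → a ; false → b })))
        at-i : ∀ p → colour i j D (β , proj₁ unsplit) (combine i p) ≡ β
        at-i p = cong (λ z → choose z β (proj₁ unsplit)) (trans (cong (_== i) (quot-combine {s} {t} i p)) (==-refl i))
        at-j : ∀ p → D (rem {s} {t} (combine j p)) ∧ (not (block≟ i (combine j p)) ∧ (lookup (row Str v) (combine j p) ==ᵇ colour i j D (β , proj₁ unsplit) (combine j p))) ≡ true →
          D p ∧ nbrs h Str (proj₁ unsplit) v j p ≡ true
        at-j p ep with ∧-split {D (rem {s} {t} (combine j p))} ep
        ... | d , rest′ with ∧-split {not (block≟ i (combine j p))} rest′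
        ...   | nb , ag = ∧-join (subst (λ z → D z ≡ true) (rem-combine {s} {t} j p) d)
              (row-at v j p (proj₁ unsplit) ns (subst (λ z → (lookup (row Str v) (combine j p) ==ᵇ choose z β (proj₁ unsplit)) ≡ true) (not-true⇒false nb) ag))

    -- A row that is almost constant on one of s parts already uses the allowed (s - 1) t bits, up
    -- to an excess of 2bh + r + 3. One more bit per vertex names the set of stubborn vertices. That
    -- set has at least m / Kβ members saving `gn` bits each; `gain` says that this pays for
    -- everything and leaves m / Kβ.
    exponent-bound : ∀ m x C → x + C * gn ≤ m * Y → m ≤ Kβ * C →
      Kβ * s * (x + (s + s + t + m)) + 2 * m ≤ Kβ * suc r * q * m + Kβ * s * (s + s + t)
    exponent-bound m x C h₁ h₂ = certificate (r * m) (+-mono-≤ (*-monoʳ-≤ (Kβ * s) h₁) (+-mono-≤ (*-monoʳ-≤ (s * gn) h₂) (*-monoʳ-≤ (s * m) gain)))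
      (identity Kβ r x C gn m (b * h) t)
      where
      identity : ∀ Kβ r x C gn m M t → let s = suc (suc r) in
        Kβ * s * (x + (s + s + t + m)) + 2 * m + (Kβ * s * (m * (suc r * t + (M + M) + suc s)) + (s * gn * (Kβ * C) + s * m * gn)) + r * m
        ≡ Kβ * suc r * (s * t) * m + Kβ * s * (s + s + t) + (Kβ * s * (x + C * gn) + (s * gn * m + s * m * (Kβ * (M + M + (4 + r)) + 1)))
      identity = solve-∀

    removal : Removal P Q
    removal = record
      { q = q ; D = Kβ ; c = Kβ * s * (s + s + t) ; N₀ = 8 * K * (s * t) ; D≥1 = Kβ≥1
      ; q≥1 = *-mono-≤ (s≤s (z≤n {suc r})) (≤-trans (s≤s z≤n) t>)
      ; Info = Info ; infos = λ m → elements (infoE m) ; y = λ m → s + s + t + m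
      ; x = λ ι _ → expo ι ; tab = λ ι _ → tables ι
      ; infos-length = λ m _ → ≤-trans (size (infoE m)) (infos≤ m)
      ; tab-length = λ ι _ → tables-length ι
      ; covers = covers }
      where
      infos≤ : ∀ m → s * s * 2 ^ t * 2 ^ m ≤ 2 ^ (s + s + t + m)
      infos≤ m = ≤-trans (*-monoˡ-≤ (2 ^ m) (≤-trans (*-monoˡ-≤ (2 ^ t) (≤-trans (*-mono-≤ (n≤2^n s) (n≤2^n s)) (≤-reflexive (sym (^-distribˡ-+-* 2 s s)))))
        (≤-reflexive (sym (^-distribˡ-+-* 2 (s + s) t))))) (≤-reflexive (sym (^-distribˡ-+-* 2 (s + s + t) m)))
      covers : ∀ {m} → 8 * K * (s * t) ≤ m → (G : Graph (q + m)) → Free T G → Structured G s t γ →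
        (∃ λ (V : Fin q → Fin (q + m)) → Injective V × (∀ out → Complement V out → ∃ λ ι → ι ∈ elements (infoE m) ×
          tableOf G V out ∈ tables ι × Kβ * s * (expo ι + (s + s + t + m)) + 2 * m ≤ Kβ * suc r * q * m + Kβ * s * (s + s + t))) ⊎ Q G
      covers {m} m≥ G fr Str with stubborn? h Str Kβ
      ... | no tame = inj₂ (structured-classes structure (≤-trans m≥ (m≤n+m m q)) Str (fr ∘ star G)
              (λ i j D st → tame (i , j , D , st)))
      ... | yes (i , j , D , i≢j , t≤ , many) = inj₁ (flat Str , flat-inj Str , λ out C → info out , complete (infoE m) _ ,
            subst (tableOf G (flat Str) out ∈_) (sym (keepIf-yes (admissible? (info out)) (i≢j , subst (λ z → t ≤ κ * (κ * z)) (#-cong (λ p → sym (lookup∘tabulate D p))) t≤)))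
              (subst (_∈ map transposeV (prodL (column (info out)))) (same out) (∈-map⁺ transposeV (∈-prodL (column (info out)) (X out) (inColumn out C)))) ,
            exponent-bound m (expo (info out)) (# (lookup (chosen out)))
              (≤-reflexive (sumF-choose (lookup (chosen out)) Y gn gn≤Y))
              (≤-trans (≤-trans (m≤n+m m q) many) (*-monoʳ-≤ Kβ (chosen-count out C))))
        where
        chosen : (Fin m → Fin (q + m)) → Vec Bool m
        chosen out = tabulate (λ v → stubborn h Str i j D (out v))
        info : (Fin m → Fin (q + m)) → Info m
        info out = ((i , j) , tabulate D) , chosen out
        X : (Fin m → Fin (q + m)) → Vec (Vec Bool q) m
        X out = tabulate (λ v → row Str (out v))
        same : ∀ out → transposeV (X out) ≡ tableOf G (flat Str) out
        same out = table-ext (λ c v → trans (entry-transposeV (X out) c v)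
          (trans (cong (λ z → lookup z c) (lookup∘tabulate _ v)) (trans (lookup∘tabulate _ c)
            (trans (adj-sym G (out v) (flat Str c)) (sym (entry-tableOf G (flat Str) out c v))))))
        outside : ∀ out → Complement (flat Str) out → ∀ v → inS h Str (out v) ≢ true
        outside out C v e = let (c , ec) = inS-elim h Str (out v) e in Complement.Q≢out C c v ec
        chosen-count : ∀ out → Complement (flat Str) out → # (stubborn h Str i j D) ≤ # (lookup (chosen out))
        chosen-count out C = ≤-trans (#-restrict C (stubborn h Str i j D)) (≤-trans (+-mono-≤
            (≤-reflexive (#-cong (λ v → sym (lookup∘tabulate (λ v → stubborn h Str i j D (out v)) v))))
            (≤-reflexive (#-zero _ (λ c e → stubborn-out h Str i j D (flat Str c) e (inS-flat h Str c)))))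
          (≤-reflexive (+-identityʳ _)))
        stubbornL-cong : ∀ v → stubborn h Str i j D v ≡ stubborn h Str i j (lookup (tabulate D)) v
        stubbornL-cong v = stubborn-cong h Str i j (λ p → sym (lookup∘tabulate D p)) v
        inColumn : ∀ out → Complement (flat Str) out → ∀ v → lookup (X out) v ∈ column (info out) v
        inColumn out C v with lookup (chosen out) v | lookup∘tabulate (λ v → stubborn h Str i j D (out v)) v
        ... | true | eq = subst (_∈ stubbornL i j (lookup (tabulate D))) (sym (lookup∘tabulate _ v))
              (row-stubborn Str (out v) i j (lookup (tabulate D)) i≢j (trans (sym (stubbornL-cong (out v))) (sym eq)))
        ... | false | eq with any? (λ i → unmixed h Str i (out v) ≟ᵇ true)
        ...   | yes (i′ , u) = subst (_∈ unmixedL) (sym (lookup∘tabulate _ v)) (row-unmixed Str (out v) (outside out C v) i′ u)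
        -- A vertex mixed to every part would complete a star, so every column occurs in one of the
        -- two lists.
        ...   | no none = ⊥-elim (fr (star G (mixed-everywhere-star (Structured.frame Str) (out v) (λ i b → ≤-trans h≥
                  (≤-trans (≰⇒> (λ le → none (i , unmixed-complete h Str i (out v) b le))) (#-mono (λ p e → ∧-join (Structured.full Str i p) e)))) room)))

    mostly-classes : Mostly P Q
    mostly-classes = mostly-removal removal

-- Choosing the constants of the structured set

module Constants (r K k₀ : ℕ) (K≥1 : 1 ≤ K) {Kβ β b P k γ h t gn : ℕ}
  (Kβ≡ : Kβ ≡ 8 * ((2 + r) * (2 + r)) * K) (β≡ : β ≡ 3 * Kβ + 2) (b≡ : b ≡ 2 * (κ * κ) * β)
  (P≡ : P ≡ κ ^ suc ((2 + r) + (2 + r))) (k≡ : k ≡ 2 * (b * (b * (κ * (κ * P))))) (γ≡ : γ ≡ 4 * k + 8 + k₀)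
  (h≡ : h ≡ κ * (κ * (P * suc γ))) (t≡ : t ≡ b * (b * h)) (gn∸ : gn ≡ β * (b * h) ∸ 1) where

  starBound≡ : starBound γ (2 + r) ≡ P * suc γ
  starBound≡ = cong (_* suc γ) (sym P≡)

  h≡′ : h ≡ κ * (κ * starBound γ (2 + r))
  h≡′ = trans h≡ (cong (λ z → κ * (κ * z)) (sym starBound≡))

  P≥ : suc ((2 + r) + (2 + r)) ≤ P
  P≥ = ≤-trans (≤-trans (n≤2^n _) (^-monoˡ-≤ (suc ((2 + r) + (2 + r))) κ≥2)) (≤-reflexive (sym P≡))

  h≥ : κ * (κ * starBound γ (2 + r)) ≤ suc h
  h≥ = ≤-trans (≤-reflexive (sym h≡′)) (n≤1+n h)

  P*γ≤h : P * suc γ ≤ h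
  P*γ≤h = ≤-trans (≤-trans (≤-mul _ κ≥1) (≤-mul _ κ≥1)) (≤-reflexive (sym h≡))

  r<P : 4 + r ≤ P
  r<P = ≤-trans (certificate {X = 0} (1 + r) z≤n (eq r)) P≥
    where
    eq : ∀ r → 4 + r + 0 + (1 + r) ≡ suc ((2 + r) + (2 + r)) + 0
    eq = solve-∀

  room : suc r * 8 * γ < κ * (κ * starBound γ (2 + r))
  room = ≤-trans (s≤s (*-monoˡ-≤ γ (*-mono-≤ (≤-trans (m≤n+m (suc r) 3) r<P) 8≤κ)))
    (≤-trans (certificate 0 one (identity P κ γ))
      (≤-trans (≤-mul (κ * (P * suc γ)) κ≥1) (≤-reflexive (cong (λ z → κ * (κ * z)) (sym starBound≡)))))
    where
    8≤κ : 8 ≤ κ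
    8≤κ = ≤-trans (m≤m+n 8 56) (≤-reflexive (sym κ≡64))
    one : 1 ≤ P * κ
    one = *-mono-≤ (≤-trans (s≤s z≤n) r<P) κ≥1
    identity : ∀ P κ γ → suc (P * κ * γ) + P * κ + 0 ≡ κ * (P * suc γ) + 1
    identity = solve-∀

  β≥2 : 2 ≤ β
  β≥2 = ≤-trans (m≤n+m 2 (3 * Kβ)) (≤-reflexive (sym β≡))

  h≥1 : 1 ≤ h
  h≥1 = ≤-trans (*-mono-≤ (≤-trans (s≤s z≤n) r<P) (s≤s (z≤n {γ}))) P*γ≤h

  b≥2κ : 2 * κ ≤ b
  b≥2κ = ≤-trans (≤-trans (≤-mul (2 * κ) (*-mono-≤ κ≥1 (≤-trans (s≤s z≤n) β≥2))) (≤-reflexive (eq κ β))) (≤-reflexive (sym b≡))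
    where
    eq : ∀ κ β → κ * β * (2 * κ) ≡ 2 * (κ * κ) * β
    eq = solve-∀

  b≥2 : 2 ≤ b
  b≥2 = ≤-trans (≤-trans (≤-reflexive (sym (*-identityʳ 2))) (*-monoʳ-≤ 2 κ≥1)) b≥2κ

  gn≡ : suc gn ≡ β * (b * h)
  gn≡ = trans (cong suc gn∸) (m+[n∸m]≡n (*-mono-≤ (≤-trans (s≤s z≤n) β≥2) (*-mono-≤ (≤-trans (s≤s z≤n) b≥2) h≥1)))

  b≥κ : κ ≤ b
  b≥κ = ≤-trans (m≤m+n κ (κ + 0)) b≥2κ

  -- The summand `k₀` of `γ` is there for this: deleting `k₀` vertices changes counts by no more
  -- than the threshold `h` itself.
  k₀≤h : k₀ ≤ h
  k₀≤h = ≤-trans (≤-trans (≤-trans (m≤n+m k₀ (4 * k + 8)) (≤-reflexive (sym γ≡))) (n≤1+n γ))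
    (≤-trans (≤-mul (suc γ) (≤-trans (s≤s z≤n) r<P)) P*γ≤h)

  t> : κ * (h + k₀) < t
  t> = ≤-trans (s≤s (≤-trans (*-monoʳ-≤ κ (+-monoʳ-≤ h k₀≤h)) (≤-trans (≤-reflexive (eq κ h)) (*-monoˡ-≤ h b≥2κ))))
    (≤-trans (+-mono-≤ (*-mono-≤ (≤-trans (s≤s z≤n) b≥2) h≥1) (≤-reflexive (sym (+-identityʳ (b * h))))) (≤-trans (*-monoˡ-≤ (b * h) b≥2) (≤-reflexive (sym t≡))))
    where
    eq : ∀ κ h → κ * (h + h) ≡ 2 * κ * h
    eq = solve-∀

  t≥ : κ * (κ * (κ * starBound γ (2 + r))) ≤ t
  t≥ = ≤-trans (≤-reflexive (cong (κ *_) (sym h≡′))) (≤-trans (*-mono-≤ b≥κ (≤-mul h (≤-trans (s≤s z≤n) b≥2))) (≤-reflexive (sym t≡)))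

  -- The choice of `b`: t = b (b h) = 2κ²β (b h), and β (b h) is `suc gn`.
  t≡′ : t ≡ κ * (κ * (2 * gn + 2))
  t≡′ = trans t≡ (trans (cong (_* (b * h)) b≡) (trans (eq₁ κ β (b * h)) (trans (cong (λ z → κ * (κ * (2 * z))) (sym gn≡)) (eq₂ κ gn))))
    where
    eq₁ : ∀ κ β M → 2 * (κ * κ) * β * M ≡ κ * (κ * (2 * (β * M)))
    eq₁ = solve-∀
    eq₂ : ∀ κ g → κ * (κ * (2 * suc g)) ≡ κ * (κ * (2 * g + 2))
    eq₂ = solve-∀

  M≥ : 4 + r ≤ b * h
  M≥ = ≤-trans r<P (≤-trans (≤-trans (≤-trans (≤-reflexive (sym (*-identityʳ P))) (*-monoʳ-≤ P (s≤s (z≤n {γ})))) P*γ≤h) (≤-mul h (≤-trans (s≤s z≤n) b≥2)))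

  -- The choice of `β`: as 4 + r ≤ b h, the left side plus 1 is at most (3 Kβ + 2) (b h).
  gain : Kβ * (b * h + b * h + (4 + r)) + 1 ≤ gn
  gain = s≤s⁻¹ (≤-trans (certificate (6 + 2 * r) (+-mono-≤ (*-monoʳ-≤ Kβ M≥) (*-monoʳ-≤ 2 M≥)) (identity Kβ r (b * h)))
      (≤-reflexive (trans (cong (_* (b * h)) (sym β≡)) (sym gn≡))))
    where
    identity : ∀ Kβ r M → suc (Kβ * (M + M + (4 + r)) + 1) + (Kβ * M + 2 * M) + (6 + 2 * r) ≡ (3 * Kβ + 2) * M + (Kβ * (4 + r) + 2 * (4 + r))
    identity = solve-∀

  pattern′ : Pattern t γ
  pattern′ = pattern-exists k t γ t≤ (≤-trans (m≤m+n (4 * k + 8) k₀) (≤-reflexive (sym γ≡)))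
    where
    γ≥1 : 1 ≤ γ
    γ≥1 = ≤-trans (≤-trans (s≤s z≤n) (m≤n+m 8 (4 * k))) (≤-trans (m≤m+n (4 * k + 8) k₀) (≤-reflexive (sym γ≡)))
    t≤ : t ≤ k * γ
    t≤ = ≤-trans (≤-reflexive (trans t≡ (cong (λ z → b * (b * z)) h≡)))
      (≤-trans (certificate {X = b * (b * (κ * (κ * P))) * 1} 0 (*-monoʳ-≤ (b * (b * (κ * (κ * P)))) γ≥1) (identity b κ P γ))
        (≤-reflexive (cong (_* γ) (sym k≡))))
      where
      identity : ∀ b κ P γ → b * (b * (κ * (κ * (P * suc γ)))) + b * (b * (κ * (κ * P))) * γ + 0
        ≡ 2 * (b * (b * (κ * (κ * P)))) * γ + b * (b * (κ * (κ * P))) * 1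
      identity = solve-∀

  γ≥2 : 2 ≤ γ
  γ≥2 = ≤-trans (≤-trans (m≤m+n 2 6) (m≤n+m 8 (4 * k))) (≤-trans (m≤m+n (4 * k + 8) k₀) (≤-reflexive (sym γ≡)))

-- Most T-free graphs have classes

Codes : ℕ → Set
Codes s = ∀ m → List (Graph m → Fin s → Fin m → Bool)

Short : ∀ {s} → Codes s → ℕ → Set
Short codes e = ∀ m → length (codes m) ≤ (m + 1) ^ e

module StageOne {k* : ℕ} (T : Graph k*) (r : ℕ) (g : ℕ → ℕ) (ext : Extends (suc r) g)
  (star : ∀ {n} (G : Graph n) → HasStar (2 + r) G → ContainsInduced T G) where

  open Typical T (suc r) g ext
  open Growth T (suc r) g ext
  open Tame T r g ext star

  ClassesProperty : ℕ → ℕ → Codes (2 + r) → Property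
  ClassesProperty K k₀ codes G = Classes G (2 + r) K k₀ codes

  module _ (K k₀ : ℕ) (K≥1 : 1 ≤ K) where

    classes-with : ∀ {Kβ β b P k γ h t gn} → Kβ ≡ 8 * ((2 + r) * (2 + r)) * K → β ≡ 3 * Kβ + 2 → b ≡ 2 * (κ * κ) * β →
      P ≡ κ ^ suc ((2 + r) + (2 + r)) → k ≡ 2 * (b * (b * (κ * (κ * P)))) → γ ≡ 4 * k + 8 + k₀ →
      h ≡ κ * (κ * (P * suc γ)) → t ≡ b * (b * h) → gn ≡ β * (b * h) ∸ 1 →
      ∃ λ codes → ∃ λ e → Short codes e × Mostly (λ _ → ⊤) (ClassesProperty K k₀ codes)
    classes-with {Kβ} {β} {b} {P} {k} {γ} {h} {t} {gn} e₁ e₂ e₃ e₄ e₅ e₆ e₇ e₈ e₉ =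
      structureCodes (2 + r) t h , (2 + r) * t , structureCodes-length (2 + r) t h ,
      mostly-trans (mostly-structured (suc r) ≤-refl pattern′ γ≥2)
        (mostly-classes record
          { structure = record { Kβ = Kβ ; t = t ; γ = γ ; h = h ; Kβ≡ = e₁ ; K≥1 = K≥1 ; h≥ = h≥ ; room = room ; t> = t> ; t≥ = t≥ }
          ; b = b ; gn = gn ; t≡ = e₈ ; t≡′ = t≡′ ; gain = gain })
      where open Constants r K k₀ K≥1 e₁ e₂ e₃ e₄ e₅ e₆ e₇ e₈ e₉

    opaque
      stage-one : ∃ λ codes → ∃ λ e → Short codes e × Mostly (λ _ → ⊤) (ClassesProperty K k₀ codes)
      stage-one = classes-with refl refl refl refl refl refl refl refl refl

-- Rows of vertices that are almost constant on one class

floor-≤ : ∀ d x m → suc d * x ≤ m → x ≤ m / suc d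
floor-≤ d x m le = ≤-trans (≤-reflexive (sym (m*n/n≡m x (suc d)))) (/-monoˡ-≤ (suc d) (≤-trans (≤-reflexive (*-comm x (suc d))) le))

module Rows (b′ : ℕ) where

  b : ℕ
  b = suc b′

  -- At most m / b² deviations from a constant are tolerated. By `W-bound` they cost about 2m / b
  -- bits, which is linear in m but as small as desired through `b`.
  slack : ℕ → ℕ
  slack m = m / b / b

  cost : ℕ → ℕ
  cost m = 3 + (m / b + m / b)

  cost-bound : ∀ m → b * cost m ≤ 3 * b + 2 * m
  cost-bound m = certificate 0 (*-monoʳ-≤ 2 (d*[m/d]≤m m b′)) (identity b (m / b) m)
    where
    identity : ∀ b x m → b * (3 + (x + x)) + 2 * m + 0 ≡ 3 * b + 2 * m + 2 * (b * x)
    identity = solve-∀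

  slack-≥ : ∀ m x → b * (b * x) ≤ m → x ≤ slack m
  slack-≥ m x le = floor-≤ b′ x (m / b) (floor-≤ b′ (b * x) m le)

  W-slack : ∀ m N → N ≤ m → W N (slack m) ≤ 2 ^ (suc (m / b) + m / b)
  W-slack m N le = ≤-trans (W-bound b (suc (m / b)) N (slack m)
      (≤-trans le (≤-trans (m<[m/d+1]*d m b′) (≤-reflexive (sym (*-suc b (m / b)))))))
    (^-monoʳ-≤ 2 (+-monoʳ-≤ (suc (m / b)) (d*[m/d]≤m (m / b) b′)))

  module _ {m : ℕ} (c : Fin m → Bool) where

    off : ℕ
    off = # (λ x → not (c x))

    plainRow : Bool → List (Vec Bool m)
    plainRow β = rowList c (λ _ → false) (λ _ → β) (slack m) 0

    plainRows : List (Vec Bool m)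
    plainRows = concatMap plainRow (elements enumBool)

    plainRows-length : length plainRows ≤ 2 ^ (off + cost m)
    plainRows-length = ≤-trans (length-pow plainRow (elements enumBool) 1 (off + (suc (m / b) + m / b)) (size enumBool) (λ β _ → one β))
      (^-monoʳ-≤ 2 (certificate {X = 0} {Y = 0} {a = 1 + (off + (suc (m / b) + m / b))} {b = off + cost m} 1 z≤n (identity off (m / b))))
      where
      open ≤-Reasoning
      identity : ∀ o x → 1 + (o + (suc x + x)) + 0 + 1 ≡ o + (3 + (x + x)) + 0
      identity = solve-∀
      one : ∀ β → length (plainRow β) ≤ 2 ^ (off + (suc (m / b) + m / b))
      one β = begin
        length (plainRow β) ≤⟨ length-rowList c (λ _ → false) (λ _ → β) (slack m) 0 ⟩
        2 ^ # (λ x → not (c x) ∧ true) * (W (# c) (slack m) * W (# {m} (λ x → false)) 0)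
          ≤⟨ *-mono-≤ (^-monoʳ-≤ 2 (#-mono (λ x e → proj₁ (∧-split e))))
               (*-mono-≤ (W-slack m (# c) (#≤n c)) (≤-reflexive (W-zero (# {m} (λ x → false))))) ⟩
        2 ^ off * (2 ^ (suc (m / b) + m / b) * 1) ≡⟨ cong (2 ^ off *_) (*-identityʳ (2 ^ (suc (m / b) + m / b))) ⟩
        2 ^ off * 2 ^ (suc (m / b) + m / b) ≡⟨ sym (^-distribˡ-+-* 2 off (suc (m / b) + m / b)) ⟩
        2 ^ (off + (suc (m / b) + m / b)) ∎

    ∈-plainRows : ∀ v β → b * (b * # (λ x → c x ∧ (lookup v x ==ᵇ β))) ≤ m → v ∈ plainRows
    ∈-plainRows v β le = ∈-concatMap plainRow (complete enumBool β)
      (∈-rowList c (λ _ → false) (λ _ → β) (slack m) 0 v (slack-≥ m _ le) (≤-reflexive (#-zero _ (λ _ ()))))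

    module _ (E : ℕ) (D : Fin m → Bool) where

      extra : Fin m → Bool
      extra x = D x ∧ not (c x)

      tone : Bool × Bool → Fin m → Bool
      tone (β , β′) x = choose (c x) β β′

      gainRow : Bool × Bool → List (Vec Bool m)
      gainRow d = rowList c D (tone d) (slack m) (# extra / 32)

      big? : Dec (m ≤ E * # extra)
      big? = m ≤? E * # extra

      gainRows : List (Vec Bool m)
      gainRows = keepIf big? (concatMap gainRow (elements (enum× enumBool enumBool)))

      off-split : # (λ x → not (c x) ∧ not (D x)) + # extra ≡ off
      off-split = trans (+-comm _ (# extra)) (trans (cong (_+ # (λ x → not (c x) ∧ not (D x)))
        (#-cong (λ x → swap (D x) (c x)))) (sym (#-split (λ x → not (c x)) D)))
        where
        swap : ∀ d c → d ∧ not c ≡ not c ∧ d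
        swap true  true  = refl
        swap true  false = refl
        swap false true  = refl
        swap false false = refl

      -- On `extra` the row is described with half of the bits by `W-half`; this is a saving of `gn`
      -- compared with `plainRows`.
      gainRows-length : ∀ gn → 1 ≤ E → E * (2 * gn + 2) ≤ m → length gainRows ≤ 2 ^ (off + cost m ∸ gn)
      gainRows-length gn E≥1 gn≤ = length-keepIf big? _ λ big →
        let two = # extra
            free = # (λ x → not (c x) ∧ not (D x))
            (h , Wh , hh) = W-half two (two / 32) (d*[m/d]≤m two 31)
            2gn≤ : 2 * gn + 2 ≤ two
            2gn≤ = *-cancelˡ-≤ E {{>-nonZero E≥1}} (≤-trans gn≤ big)
        in ≤-trans (length-pow gainRow (elements (enum× enumBool enumBool)) 2 (free + (suc (m / b) + m / b + h)) (size (enum× enumBool enumBool))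
            (λ d _ → one d h Wh))
          (^-monoʳ-≤ 2 (m+n≤o⇒m≤o∸n (2 + (free + (suc (m / b) + m / b + h))) {gn} {off + cost m}
            (subst (λ z → 2 + (free + (suc (m / b) + m / b + h)) + gn ≤ z + cost m) off-split
              (*-cancelˡ-≤ 2 (certificate 0 (+-mono-≤ hh 2gn≤) (identity free (m / b) h gn two))))))
        where
        open ≤-Reasoning
        identity : ∀ f x h gn two → 2 * (2 + (f + (suc x + x + h)) + gn) + (two + 2 + two) + 0
          ≡ 2 * (f + two + (3 + (x + x))) + (2 * h + (2 * gn + 2))
        identity = solve-∀
        one : ∀ d h → W (# extra) (# extra / 32) ≤ 2 ^ h →
          length (gainRow d) ≤ 2 ^ (# (λ x → not (c x) ∧ not (D x)) + (suc (m / b) + m / b + h))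
        one d h Wh = begin
          length (gainRow d) ≤⟨ length-rowList c D (tone d) (slack m) (# extra / 32) ⟩
          2 ^ # (λ x → not (c x) ∧ not (D x)) * (W (# c) (slack m) * W (# extra) (# extra / 32))
            ≤⟨ *-monoʳ-≤ (2 ^ # (λ x → not (c x) ∧ not (D x))) (*-mono-≤ (W-slack m (# c) (#≤n c)) Wh) ⟩
          2 ^ # (λ x → not (c x) ∧ not (D x)) * (2 ^ (suc (m / b) + m / b) * 2 ^ h)
            ≡⟨ cong (2 ^ # (λ x → not (c x) ∧ not (D x)) *_) (sym (^-distribˡ-+-* 2 (suc (m / b) + m / b) h)) ⟩
          2 ^ # (λ x → not (c x) ∧ not (D x)) * 2 ^ (suc (m / b) + m / b + h)
            ≡⟨ sym (^-distribˡ-+-* 2 (# (λ x → not (c x) ∧ not (D x))) (suc (m / b) + m / b + h)) ⟩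
          2 ^ (# (λ x → not (c x) ∧ not (D x)) + (suc (m / b) + m / b + h)) ∎

      ∈-gainRows : ∀ v β β′ → m ≤ E * # extra → b * (b * # (λ x → c x ∧ (lookup v x ==ᵇ β))) ≤ m →
        32 * # (λ x → extra x ∧ (lookup v x ==ᵇ β′)) ≤ # extra → v ∈ gainRows
      ∈-gainRows v β β′ big le₁ le₂ = subst (v ∈_) (sym (keepIf-yes big? big))
        (∈-concatMap gainRow (complete (enum× enumBool enumBool) (β , β′))
          (∈-rowList c D (tone (β , β′)) (slack m) (# extra / 32) v
            (≤-trans (≤-reflexive (#-cong (λ x → on-c (c x) (lookup v x)))) (slack-≥ m _ le₁))
            (≤-trans (≤-reflexive (#-cong (λ x → off-c (D x) (c x) (lookup v x)))) (floor-≤ 31 _ (# extra) le₂))))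
        where
        on-c : ∀ d a → d ∧ (a ==ᵇ choose d β β′) ≡ d ∧ (a ==ᵇ β)
        on-c true  a = refl
        on-c false a = refl
        off-c : ∀ e d a → (e ∧ not d) ∧ (a ==ᵇ choose d β β′) ≡ (e ∧ not d) ∧ (a ==ᵇ β′)
        off-c true  true  a = refl
        off-c true  false a = refl
        off-c false true  a = refl
        off-c false false a = refl

  -- A set `extra` of at least m / E vertices saves nearly half of its size. The denominator leaves
  -- enough room to absorb the additive constants once m ≥ 4E.
  gainOf : ℕ → ℕ → ℕ
  gainOf E m = m / suc (4 * E)

  gainOf-≤ : ∀ E m → 4 * E ≤ m → E * (2 * gainOf E m + 2) ≤ m
  gainOf-≤ E m big = *-cancelˡ-≤ 2 (certificate {Y = m + m} (gainOf E m) (+-mono-≤ (d*[m/d]≤m m (4 * E)) big) (identity E (gainOf E m) m))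
    where
    identity : ∀ E x m → 2 * (E * (2 * x + 2)) + (m + m) + x ≡ 2 * m + (suc (4 * E) * x + 4 * E)
    identity = solve-∀

  gainOf-≥ : ∀ E m → m ≤ suc (4 * E) + suc (4 * E) * gainOf E m
  gainOf-≥ E m = m<[m/d+1]*d m (4 * E)

-- What remains of the classes after deleting a few vertices
module Restricted {n s K k₀ q m : ℕ} {G : Graph n} {codes : ∀ m → List (Graph m → Fin s → Fin m → Bool)}
  (Cls : Classes G s K k₀ codes) (Q : Fin q → Fin n) (out : Fin m → Fin n) (C : Complement Q out)
  (cl : Fin s → Fin m → Bool) (into : ∀ i v → Classes.V Cls i (out v) ≡ true → cl i v ≡ true)
  (from : ∀ i v → cl i v ≡ true → Classes.V Cls i (out v) ≡ true ⊎ Classes.Exc Cls (out v) ≡ true) where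

  open Classes Cls
  open Complement C

  #-out≤ : ∀ (p : Fin n → Bool) → # (p ∘ out) ≤ # p
  #-out≤ p = #-injection (p ∘ out) p out (λ _ e → e) (λ x y _ _ e → out-inj x y e)

  class-≤ : ∀ i → # (V i) ≤ # (cl i) + q
  class-≤ i = ≤-trans (#-restrict C (V i)) (+-mono-≤ (#-mono (into i)) (#≤n (V i ∘ Q)))

  link-out : ∀ l v β → (adj G (Q l) (out v) ==ᵇ β) ≡ true → link G β (Q l) (out v) ≡ true
  link-out l v β e = link-intro G β (Q l) (out v) (Q≢out l v) (does-sound (_ ≟ᵇ β) e)

  #-class-hits : ∀ i l β → # (λ v → cl i v ∧ (adj G (Q l) (out v) ==ᵇ β)) ≤ # (λ x → V i x ∧ link G β (Q l) x) + # Exc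
  #-class-hits i l β = ≤-trans
    (#-cover _ (λ v → V i (out v) ∧ link G β (Q l) (out v)) (Exc ∘ out) (λ v e → let (e₁ , e₂) = ∧-split {cl i v} e in
      case from i v e₁ of λ { (inj₁ a) → inj₁ (∧-join a (link-out l v β e₂)) ; (inj₂ x) → inj₂ x }))
    (+-mono-≤ (#-out≤ (λ x → V i x ∧ link G β (Q l) x)) (#-out≤ Exc))

  class-apart : ∀ i j v → V j (out v) ≡ true → i ≢ j → cl i v ≢ true
  class-apart i j v e ne c with from i v c
  ... | inj₁ a = ne (disjV i j (out v) a e)
  ... | inj₂ x = disjW j (out v) e x

-- Here `x₁` counts deviations inside the class and `x₂` exceptional vertices; both are at most n /
-- (4b²), and at most half of the vertices have been deleted.
minor : ∀ b Kx x x₁ x₂ n m → 4 * (b * b) ≤ Kx → Kx * x₁ ≤ n → Kx * x₂ ≤ n → x ≤ x₁ + x₂ → n ≤ 2 * m → b * (b * x) ≤ m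
minor b Kx x x₁ x₂ n m hK h₁ h₂ hx hn = *-cancelˡ-≤ 4 (begin
  4 * (b * (b * x)) ≤⟨ *-monoʳ-≤ 4 (*-monoʳ-≤ b (*-monoʳ-≤ b hx)) ⟩
  4 * (b * (b * (x₁ + x₂))) ≡⟨ eq₁ b x₁ x₂ ⟩
  4 * (b * b) * x₁ + 4 * (b * b) * x₂ ≤⟨ +-mono-≤ (≤-trans (*-monoˡ-≤ x₁ hK) h₁) (≤-trans (*-monoˡ-≤ x₂ hK) h₂) ⟩
  n + n ≤⟨ +-mono-≤ hn hn ⟩
  2 * m + 2 * m ≡⟨ eq₂ m ⟩
  4 * m ∎)
  where
  open ≤-Reasoning
  eq₁ : ∀ b x y → 4 * (b * (b * (x + y))) ≡ 4 * (b * b) * x + 4 * (b * b) * y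
  eq₁ = solve-∀
  eq₂ : ∀ m → 2 * m + 2 * m ≡ 4 * m
  eq₂ = solve-∀


sumF-except : ∀ {k} (f : Fin (suc k) → ℕ) i c → (∀ j → j ≢ i → f j ≤ c) → sumF f ≤ f i + k * c
sumF-except {k} f i c h = begin
  sumF f ≤⟨ sumF-mono pointwise ⟩
  sumF (λ j → choose (j == i) (f i) c) ≡⟨ sumF-swap-choose ⟩
  f i + k * c ∎
  where
  open ≤-Reasoning
  pointwise : ∀ j → f j ≤ choose (j == i) (f i) c
  pointwise j with j ≟ᶠ i
  ... | yes refl = ≤-refl
  ... | no ne = h j ne
  opaque
    unfolding sumF
    choose-sum : ∀ {k} (i : Fin (suc k)) a c → sumF (λ j → choose (j == i) a c) ≡ a + k * c
    choose-sum {k} zero a c = cong (a +_) (sumF-const k c)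
    choose-sum {suc k} (suc i) a c = trans (cong (c +_) (trans (sumF-cong shift) (choose-sum i a c))) (swap c a (k * c))
      where
      shift : ∀ j → choose (suc j == suc i) a c ≡ choose (j == i) a c
      shift j with j ≟ᶠ i
      ... | yes _ = refl
      ... | no _  = refl
      swap : ∀ c a x → c + (a + x) ≡ a + (c + x)
      swap = solve-∀
  sumF-swap-choose : sumF (λ j → choose (j == i) (f i) c) ≡ f i + k * c
  sumF-swap-choose = choose-sum i (f i) c

-- Balanced classes

Balanced : ∀ {n s K k₀ codes} {G : Graph n} → ℕ → Classes G s K k₀ codes → Set
Balanced {n} {s} Kb Cls = ∀ i → s * Kb * # (Classes.V Cls i) ≤ (Kb + s) * n

-- `Balanced` bounds each class by n/s + n/Kb. The other s - 1 classes and the exceptional vertices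
-- therefore leave at least n/s - s n/Kb vertices to class `i`.
balanced-below : ∀ {n r K k₀ codes} {G : Graph n} Kb (Cls : Classes G (2 + r) K k₀ codes) → Kb ≤ K → Balanced Kb Cls →
  ∀ i → Kb * n ≤ (2 + r) * Kb * # (Classes.V Cls i) + (2 + r) * (2 + r) * n
balanced-below {n} {r} {K} Kb Cls Kb≤K bal i = certificate 0 (+-mono-≤ (*-monoʳ-≤ (s * Kb) total) (+-mono-≤ (≤-trans (≤-reflexive (sym (sumF-*ˡ (s * Kb) (λ j → # (V j))))) others)
    (*-monoʳ-≤ s (≤-trans (*-monoˡ-≤ (# Exc) Kb≤K) smallW))))
    (identity r Kb n (# (V i)) (sumF (λ j → # (V j))) (# Exc))
  where
  open Classes Cls
  s = 2 + r
  total : n ≤ sumF (λ j → # (V j)) + # Exc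
  total = ≤-trans (≤-reflexive (sym (#-all n))) (≤-trans (#-cover (λ _ → true) (λ v → anyB (λ i → V i v)) Exc
      (λ v _ → case cover v of λ { (inj₁ x) → inj₂ x ; (inj₂ (i , e)) → inj₁ (anyB-complete i e) }))
    (+-monoˡ-≤ (# Exc) (#-union (λ v → anyB (λ i → V i v)) V (λ v e → anyB-sound e))))
  others : sumF (λ j → s * Kb * # (V j)) ≤ s * Kb * # (V i) + suc r * ((Kb + s) * n)
  others = sumF-except (λ j → s * Kb * # (V j)) i ((Kb + s) * n) (λ j _ → bal j)
  identity : ∀ r Kb n v S w → let s = suc (suc r) in
    Kb * n + (s * Kb * (S + w) + (s * Kb * v + suc r * ((Kb + s) * n) + s * n)) + 0
    ≡ s * Kb * v + s * s * n + (s * Kb * n + (s * Kb * S + s * (Kb * w)))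
  identity = solve-∀

module StageTwo {k* : ℕ} (T : Graph k*) (r : ℕ) (g : ℕ → ℕ) (ext : Extends (suc r) g)
  (K k₀ e : ℕ) (codes : Codes (2 + r)) (short : Short codes e) where

  open Typical T (suc r) g ext

  P₀ : Property
  P₀ G = Classes G s K k₀ codes

  -- Exponent of the number of codes together with a choice of constantly many indices.
  codeCost : ℕ → ℕ → ℕ → ℕ
  codeCost D a m = polylog e 1 (D * s) m + a

  codeInfos : ∀ {X : Set} {a} m → Enumeration X a → List ((Graph m → Fin s → Fin m → Bool) × X)
  codeInfos m En = concatMap (λ cl → map (cl ,_) (elements En)) (codes m)

  ∈-codeInfos : ∀ {X : Set} {a} {m} (En : Enumeration X a) {cl} → cl ∈ codes m → ∀ x → (cl , x) ∈ codeInfos m En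
  ∈-codeInfos En cl∈ x = ∈-concatMap (λ cl → map (cl ,_) (elements En)) cl∈ (∈-map⁺ _ (complete En x))

  codeInfos-length : ∀ {X : Set} {a} D m (En : Enumeration X a) a′ → a ≤ 2 ^ a′ → length (codeInfos m En) ≤ 2 ^ codeCost D a′ m
  codeInfos-length D m En a′ a≤ = length-pow (λ cl → map (cl ,_) (elements En)) (codes m) (polylog e 1 (D * s) m) a′
    (≤-trans (short m) (polylog-pow e 1 (D * s) m))
    (λ cl _ → ≤-trans (≤-reflexive (length-map (cl ,_) (elements En))) (≤-trans (size En) a≤))

  module Balance (Kb b′ : ℕ) (b≡ : suc b′ ≡ 4 * Kb) (Kb≥1 : 1 ≤ Kb) (K≥ : 4 * (suc b′ * suc b′) ≤ K) (k₀≥1 : 1 ≤ k₀) where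

    open Rows b′

    P₁ : Property
    P₁ G = ∃ λ (Cls : Classes G s K k₀ codes) → Balanced Kb Cls

    D c₀ : ℕ
    D = 3 * Kb
    c₀ = 12 * (s * Kb) + polylog-const e 1 (D * s) + 3 * (s * Kb * s)

    ineq : ∀ m o → s * Kb * o + (Kb + s) * m ≤ s * Kb * m + s * Kb →
      D * s * (o + cost m + codeCost D s m) + 2 * m ≤ D * suc r * 1 * m + c₀
    ineq m o h = *-cancelˡ-≤ 4 (certificate (6 * (r * m)) (+-mono-≤ (*-monoʳ-≤ 12 h) (+-mono-≤
        (*-monoʳ-≤ (3 * s) (subst (λ z → z * cost m ≤ 3 * z + 2 * m) b≡ (cost-bound m))) (*-monoʳ-≤ 4 (polylog-bound e 1 (D * s) m))))
      (identity r Kb m o (cost m) (polylog e 1 (D * s) m) (polylog-const e 1 (D * s))))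
      where
      identity : ∀ r Kb m o c p pc → let s = suc (suc r) in
        4 * (3 * Kb * s * (o + c + (p + s)) + 2 * m) + (12 * (s * Kb * m + s * Kb) + (3 * s * (3 * (4 * Kb) + 2 * m) + 4 * (m + pc))) + 6 * (r * m)
        ≡ 4 * (3 * Kb * suc r * 1 * m + (12 * (s * Kb) + pc + 3 * (s * Kb * s))) + (12 * (s * Kb * o + (Kb + s) * m) + (3 * s * (4 * Kb * c) + 4 * (3 * Kb * s * p)))
      identity = solve-∀

    -- Deleting one vertex of an oversized class is enough. Its row has fewer than (1 - 1/s - 1/Kb)
    -- n free bits up to constants, and with b = 4 Kb its deviations on the class cost only half of
    -- the surplus m / Kb.
    removal : Removal P₀ P₁
    removal = record
      { q = 1 ; D = D ; c = c₀ ; N₀ = 1 ; D≥1 = *-mono-≤ (s≤s (z≤n {2})) Kb≥1 ; q≥1 = ≤-refl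
      ; Info = λ m → (Graph m → Fin s → Fin m → Bool) × Fin s
      ; infos = λ m → codeInfos m (enumFin s)
      ; y = codeCost D s
      ; x = λ { {m} (cl , i) H → off (cl H i) + cost m }
      ; tab = λ { (cl , i) H → map (_∷ []) (plainRows (cl H i)) }
      ; infos-length = λ m _ → codeInfos-length D m (enumFin s) s (n≤2^n s)
      ; tab-length = λ { (cl , i) H → ≤-trans (≤-reflexive (length-map (_∷ []) (plainRows (cl H i)))) (plainRows-length (cl H i)) }
      ; covers = covers }
      where
      covers : ∀ {m} → 1 ≤ m → (G : Graph (1 + m)) → Free T G → P₀ G →
        (∃ λ (V : Fin 1 → Fin (1 + m)) → Injective V × (∀ out → Complement V out → ∃ λ ι → ι ∈ codeInfos m (enumFin s) ×
          tableOf G V out ∈ map (_∷ []) (plainRows (proj₁ ι (relabel out G) (proj₂ ι))) ×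
          D * s * (off (proj₁ ι (relabel out G) (proj₂ ι)) + cost m + codeCost D s m) + 2 * m ≤ D * suc r * 1 * m + c₀)) ⊎ P₁ G
      covers {m} m≥1 G fr Cls with any? (λ i → (Kb + s) * (1 + m) <? s * Kb * # (Classes.V Cls i))
      ... | no none = inj₂ (Cls , λ i → ≮⇒≥ (λ lt → none (i , lt)))
      ... | yes (i , lt) with #-exists (Classes.V Cls i) (pos (# (Classes.V Cls i)) lt)
        where
        pos : ∀ v → (Kb + s) * (1 + m) < s * Kb * v → 1 ≤ v
        pos zero    lt = ⊥-elim (n≮0 (subst ((Kb + s) * (1 + m) <_) (*-zeroʳ (s * Kb)) lt))
        pos (suc v) _  = s≤s z≤n
      ...   | u , Vu = inj₁ ((λ _ → u) , (λ { zero zero _ → refl }) , found)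
        where
        open Classes Cls
        found : ∀ out → Complement (λ _ → u) out → ∃ λ ι → ι ∈ codeInfos m (enumFin s) ×
          tableOf G (λ _ → u) out ∈ map (_∷ []) (plainRows (proj₁ ι (relabel out G) (proj₂ ι))) ×
          D * s * (off (proj₁ ι (relabel out G) (proj₂ ι)) + cost m + codeCost D s m) + 2 * m ≤ D * suc r * 1 * m + c₀
        found out C with describe (λ (_ : Fin 1) → u) out C (λ { zero zero _ → refl }) k₀≥1
        ... | cl , cl∈ , into , from = (cl , i) , ∈-codeInfos (enumFin s) cl∈ i , ∈-map⁺ (_∷ []) inRows , ineq m (off c) low
          where
          c : Fin m → Bool
          c = cl (relabel out G) i
          module Re = Restricted Cls (λ (_ : Fin 1) → u) out C (cl (relabel out G)) into from
          β : Bool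
          β = proj₁ (near i u Vu)
          inRows : tabulate (λ v → adj G u (out v)) ∈ plainRows c
          inRows = ∈-plainRows c (tabulate (λ v → adj G u (out v))) β
            (minor b K _ _ _ (1 + m) m K≥ (proj₂ (near i u Vu)) smallW
              (≤-trans (≤-reflexive (#-cong (λ v → cong (λ z → c v ∧ (z ==ᵇ β)) (lookup∘tabulate _ v)))) (Re.#-class-hits i zero β))
              (+-mono-≤ m≥1 (≤-reflexive (sym (+-identityʳ m)))))
          low : s * Kb * off c + (Kb + s) * m ≤ s * Kb * m + s * Kb
          low = certificate (Kb + s + 1) (+-mono-≤ (+-mono-≤ lt (*-monoʳ-≤ (s * Kb) (Re.class-≤ i))) (*-monoʳ-≤ (s * Kb) (≤-reflexive (#-complement c))))
            (identity s Kb m (off c) (# c) (# (V i)))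
            where
            identity : ∀ s Kb m o c v → s * Kb * o + (Kb + s) * m + (s * Kb * v + s * Kb * (c + 1) + s * Kb * m) + (Kb + s + 1)
              ≡ s * Kb * m + s * Kb + (suc ((Kb + s) * (1 + m)) + s * Kb * v + s * Kb * (c + o))
            identity = solve-∀

    mostly-balanced : Mostly P₀ P₁
    mostly-balanced = mostly-removal removal

-- Vertices that are almost constant on one class split the cells of the other classes

AlmostConstant : ∀ {n s K k₀ codes} {G : Graph n} → ℕ → Classes G s K k₀ codes → Fin s → Fin n → Set
AlmostConstant {n} {G = G} K₁ Cls i u = ∃ λ β → K₁ * # (λ x → Classes.V Cls i x ∧ link G β u x) ≤ n

opaque
  cellOf : ∀ {n s K k₀ codes k} {G : Graph n} → Classes G s K k₀ codes → Vec (Fin n) k → Vec Bool k → Fin s → Fin n → Bool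
  cellOf {G = G} Cls us τ j x = Classes.V Cls j x ∧ allB (λ l → link G (lookup τ l) (lookup us l) x)

  cellOf-intro : ∀ {n s K k₀ codes k} {G : Graph n} (Cls : Classes G s K k₀ codes) (us : Vec (Fin n) k) (τ : Vec Bool k) j x →
    Classes.V Cls j x ≡ true → (∀ l → link G (lookup τ l) (lookup us l) x ≡ true) → cellOf Cls us τ j x ≡ true
  cellOf-intro Cls us τ j x Vx links = ∧-join Vx (allB-complete links)

  cellOf-V : ∀ {n s K k₀ codes k} {G : Graph n} (Cls : Classes G s K k₀ codes) (us : Vec (Fin n) k) (τ : Vec Bool k) j x →
    cellOf Cls us τ j x ≡ true → Classes.V Cls j x ≡ true
  cellOf-V Cls us τ j x e = proj₁ (∧-split {Classes.V Cls j x} e)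

  cellOf-links : ∀ {n s K k₀ codes k} {G : Graph n} (Cls : Classes G s K k₀ codes) (us : Vec (Fin n) k) (τ : Vec Bool k) j x →
    cellOf Cls us τ j x ≡ true → ∀ l → link G (lookup τ l) (lookup us l) x ≡ true
  cellOf-links Cls us τ j x e = allB-sound (proj₂ (∧-split {Classes.V Cls j x} e))

-- The head of `us` is the vertex that fails; the tail cuts out the cell of class `j` that it fails
-- to split. With tails of length 0, 1 and 2, the negations yield that three distinct vertices split
-- every other class into eight large cells.
record Unsplit {n s K k₀ codes} {G : Graph n} (K₁ k : ℕ) (Cls : Classes G s K k₀ codes)
  (i j : Fin s) (us : Vec (Fin n) (suc k)) (τ : Vec Bool k) (β : Bool) : Set where
  constructor unsplit
  open Classes Cls
  field
    apart    : i ≢ j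
    distinct : ∀ l l′ → lookup us l ≡ lookup us l′ → l ≡ l′
    constant : ∀ l → AlmostConstant K₁ Cls i (lookup us l)
    large    : # (V j) ≤ κ ^ k * # (cellOf Cls (Data.Vec.tail us) τ j)
    few      : κ * # (λ x → cellOf Cls (Data.Vec.tail us) τ j x ∧ link G β (lookup us zero) x) < # (cellOf Cls (Data.Vec.tail us) τ j)

unsplit? : ∀ {n s K k₀ codes} {G : Graph n} K₁ k (Cls : Classes G s K k₀ codes) i j us τ β → Dec (Unsplit K₁ k Cls i j us τ β)
unsplit? {n} K₁ k Cls i j us τ β = map′ (λ { (a , b , c , d , e) → unsplit a b c d e }) (λ { (unsplit a b c d e) → a , b , c , d , e })
  (¬? (i ≟ᶠ j) ×-dec (all? (λ l → all? (λ l′ → (lookup us l ≟ᶠ lookup us l′) →-dec (l ≟ᶠ l′))) ×-dec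
    (all? (λ l → searchBool _ (λ β → _ ≤? n)) ×-dec ((_ ≤? _) ×-dec (_ <? _)))))

anyUnsplit? : ∀ {n s K k₀ codes} {G : Graph n} K₁ k (Cls : Classes G s K k₀ codes) →
  Dec (∃ λ i → ∃ λ j → ∃ λ us → ∃ λ τ → ∃ λ β → Unsplit K₁ k Cls i j us τ β)
anyUnsplit? {n} K₁ k Cls = any? λ i → any? λ j → searchVec (searchFin n) (suc k) _ λ us →
  searchVec searchBool k _ λ τ → searchBool _ λ β → unsplit? K₁ k Cls i j us τ β

Splits : ∀ {n s K k₀ codes} {G : Graph n} → ℕ → ℕ → Classes G s K k₀ codes → Set
Splits K₁ k Cls = ∀ i j us τ β → ¬ Unsplit K₁ k Cls i j us τ β

class-large : ∀ {n r K k₀ codes} {G : Graph n} Kb (Cls : Classes G (2 + r) K k₀ codes) → Kb ≤ K → Balanced Kb Cls →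
  1 ≤ Kb → 2 * ((2 + r) * (2 + r)) ≤ Kb → ∀ i → n ≤ 2 * (2 + r) * # (Classes.V Cls i)
class-large {n} {r} Kb Cls Kb≤K bal Kb≥1 big i = *-cancelˡ-≤ Kb {{>-nonZero Kb≥1}}
  (certificate 0 (+-mono-≤ (*-monoʳ-≤ 2 (balanced-below Kb Cls Kb≤K bal i)) (*-monoˡ-≤ n big)) (identity r Kb n (# (Classes.V Cls i))))
  where
  identity : ∀ r Kb n v → let s = suc (suc r) in
    Kb * n + (2 * (s * Kb * v + s * s * n) + Kb * n) + 0 ≡ Kb * (2 * s * v) + (2 * (Kb * n) + 2 * (s * s) * n)
  identity = solve-∀

-- A bound on the free bits of a row that is homogeneous to a class: (1 - 1/s) m with an error of s
-- m / Kb and a constant.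
below-off : ∀ s Kb v c o q m → Kb * (q + m) ≤ s * Kb * v + s * s * (q + m) → v ≤ c + q → c + o ≡ m →
  s * Kb * o + Kb * m ≤ s * Kb * m + s * s * m + (s * Kb * q + s * s * q)
below-off s Kb v c o q m h₁ h₂ h₃ = certificate (Kb * q) (+-mono-≤ h₁ (+-mono-≤ (*-monoʳ-≤ (s * Kb) h₂) (*-monoʳ-≤ (s * Kb) (≤-reflexive h₃))))
  (identity s Kb v c o q m)
  where
  identity : ∀ s Kb v c o q m → s * Kb * o + Kb * m + (s * Kb * v + s * s * (q + m) + (s * Kb * (c + q) + s * Kb * m)) + Kb * q
    ≡ s * Kb * m + s * s * m + (s * Kb * q + s * s * q) + (Kb * (q + m) + (s * Kb * v + s * Kb * (c + o)))
  identity = solve-∀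

record SplitConstants (r K k₀ Kb : ℕ) : Set where
  field
    -- In all uses k + j = 2, so that the same `E`, `K₁` and `b′` serve tails of every length.
    k j E K₁ b′ : ℕ
    k<k₀ : suc k ≤ k₀
    E≥   : 4 * (2 + r) * κ ^ k ≤ E
    b≡   : suc b′ ≡ 4 * suc (k + j) * suc (4 * E)
    Kb≥′ : 2 * suc (4 * E) * (suc (k + j) * (2 + r) + 3) ≤ Kb
    K≥E  : 256 * E ≤ K
    K₁≥  : 4 * (suc b′ * suc b′) ≤ K₁
    K≥K₁ : K₁ ≤ K

module StageThree {k* : ℕ} (T : Graph k*) (r : ℕ) (g : ℕ → ℕ) (ext : Extends (suc r) g)
  (K k₀ e : ℕ) (codes : Codes (2 + r)) (short : Short codes e)
  (Kb : ℕ) (Kb≤K : Kb ≤ K) (Kb≥1 : 1 ≤ Kb) (Kb≥ : 2 * ((2 + r) * (2 + r)) ≤ Kb)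
  -- The classes are only known to exist, so what was proved about them has to be carried along with
  -- the same witness.
  (Φ : ∀ {n} {G : Graph n} → Classes G (2 + r) K k₀ codes → Set) where

  open Typical T (suc r) g ext
  open StageTwo T r g ext K k₀ e codes short

  P : Property
  P G = ∃ λ (Cls : Classes G s K k₀ codes) → Balanced Kb Cls × Φ Cls

  module Split (C : SplitConstants r K k₀ Kb) where

    open SplitConstants C
    open Rows b′

    P⁺ : Property
    P⁺ G = ∃ λ (Cls : Classes G s K k₀ codes) → Balanced Kb Cls × Φ Cls × Splits K₁ k Cls

    q F c₀ a : ℕ
    q = suc k
    F = suc (4 * E)
    a = s + s + k
    c₀ = suc k * (s * Kb * q + s * s * q) + 3 * suc k * (s * Kb) + s * Kb + polylog-const e 1 (Kb * s) + s * Kb * a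

    E≥1 : 1 ≤ E
    E≥1 = ≤-trans (*-mono-≤ (s≤s (z≤n {3})) (≤-trans (m^n>0 κ {{κ≢0}} k) (≤-reflexive (sym (*-identityˡ _)))) ) (≤-trans (*-mono-≤ {4} {4 * s} (m≤m*n 4 s) (≤-reflexive (*-identityˡ (κ ^ k)))) E≥)

    -- The saving of about m / (4E + 1) in a single row must outweigh the errors of all k + 1 rows,
    -- namely s m / Kb from imbalance and 2m / b from deviations in each. `Kb≥′` and `b≡` leave
    -- about half of the saving for either kind.
    ineq : ∀ m o x → s * Kb * o + Kb * m ≤ s * Kb * m + s * s * m + (s * Kb * q + s * s * q) →
      x + gainOf E m ≡ suc k * (o + cost m) →
      Kb * s * (x + codeCost Kb a m) + 2 * m ≤ Kb * suc r * q * m + c₀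
    ineq m o x h₁ h₂ = *-cancelˡ-≤ (4 * suc (k + j) * F)
      (certificate (m * (4 * suc (k + j) * F * (s * s) * j + 12 * suc (k + j) * F * suc r + 2 * Kb * s * j))
        (+-mono-≤ (+-mono-≤ (*-monoʳ-≤ (4 * suc (k + j) * F * suc k) h₁) (*-monoʳ-≤ (suc k * (s * Kb)) (subst (λ z → z * cost m ≤ 3 * z + 2 * m) b≡ (cost-bound m))))
          (+-mono-≤ (+-mono-≤ (*-monoʳ-≤ (4 * suc (k + j) * (s * Kb)) (gainOf-≥ E m)) (*-monoʳ-≤ (4 * suc (k + j) * F) (polylog-bound e 1 (Kb * s) m)))
            (+-mono-≤ (*-monoʳ-≤ (2 * suc (k + j) * s * m) Kb≥′) (*-monoʳ-≤ (4 * suc (k + j) * F * (s * Kb)) (≤-reflexive h₂)))))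
        (identity r Kb m o x (cost m) (gainOf E m) (polylog e 1 (Kb * s) m) (polylog-const e 1 (Kb * s)) k j (suc (4 * E)) a))
      where
      identity : ∀ r Kb m o x c gn p pc k j F a → let s = suc (suc r) ; J = suc (k + j) in
        4 * J * F * (Kb * s * (x + (p + a)) + 2 * m)
          + ((4 * J * F * suc k * (s * Kb * m + s * s * m + (s * Kb * suc k + s * s * suc k)) + suc k * (s * Kb) * (3 * (4 * J * F) + 2 * m))
            + ((4 * J * (s * Kb) * (F + F * gn) + 4 * J * F * (m + pc)) + (2 * J * s * m * Kb + 4 * J * F * (s * Kb) * (suc k * (o + c)))))
          + m * (4 * J * F * (s * s) * j + 12 * J * F * suc r + 2 * Kb * s * j)
        ≡ 4 * J * F * (Kb * suc r * suc k * m + (suc k * (s * Kb * suc k + s * s * suc k) + 3 * suc k * (s * Kb) + s * Kb + pc + s * Kb * a))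
          + ((4 * J * F * suc k * (s * Kb * o + Kb * m) + suc k * (s * Kb) * (4 * J * F * c))
            + ((4 * J * (s * Kb) * m + 4 * J * F * (Kb * s * p)) + (2 * J * s * m * (2 * F * (J * s + 3)) + 4 * J * F * (s * Kb) * (x + gn))))
      identity = solve-∀

    Info : ℕ → Set
    Info m = (Graph m → Fin s → Fin m → Bool) × ((Fin s × Fin s) × Vec Bool k)

    indexE : Enumeration ((Fin s × Fin s) × Vec Bool k) (s * s * 2 ^ k)
    indexE = enum× (enum× (enumFin s) (enumFin s)) (enumVecBool k)

    module _ {m : ℕ} (c c′ : Fin m → Bool) (τ : Vec Bool k) where

      opaque
        -- The cell is recomputed from the rows of the tail, which are part of the table anyway, so
        -- naming it costs no bits beyond the constant vector `τ`.
        rowCell : Vec (Vec Bool m) k → Fin m → Bool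
        rowCell rows x = c′ x ∧ allB (λ l → lookup (lookup rows l) x ==ᵇ lookup τ l)

        rowCell-intro : ∀ rows x → c′ x ≡ true → (∀ l → lookup (lookup rows l) x ≡ lookup τ l) → rowCell rows x ≡ true
        rowCell-intro rows x e agree = ∧-join e (allB-complete (λ l → does-complete (_ ≟ᵇ _) (agree l)))

        rowCell-base : ∀ rows x → rowCell rows x ≡ true → c′ x ≡ true
        rowCell-base rows x e = proj₁ (∧-split {c′ x} e)

        rowCell-agree : ∀ rows x → rowCell rows x ≡ true → ∀ l → (lookup (lookup rows l) x ==ᵇ lookup τ l) ≡ true
        rowCell-agree rows x e = allB-sound (proj₂ (∧-split {c′ x} e))

      extend-by : Vec (Vec Bool m) k → List (Table q m)
      extend-by rows = map (_∷ rows) (gainRows c E (rowCell rows))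

      rowTables : List (Table q m)
      rowTables = keepIf (4 * E ≤? m) (concatMap extend-by (prodL (λ _ → plainRows c)))

      rowTables-length : length rowTables ≤ 2 ^ (k * (off c + cost m) + (off c + cost m ∸ gainOf E m))
      rowTables-length = length-keepIf (4 * E ≤? m) _ λ big →
        length-pow extend-by (prodL {m = k} (λ _ → plainRows c)) (k * (off c + cost m)) (off c + cost m ∸ gainOf E m)
          (≤-trans (prodL-length {m = k} (λ _ → plainRows c) (λ _ → off c + cost m) (λ _ → plainRows-length c)) (≤-reflexive (cong (2 ^_) (sumF-const k _))))
          (λ rows _ → ≤-trans (≤-reflexive (length-map (_∷ rows) (gainRows c E (rowCell rows))))
            (gainRows-length c E (rowCell rows) (gainOf E m) E≥1 (gainOf-≤ E m big)))

    removal : Removal P P⁺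
    removal = record
      { q = q ; D = Kb ; c = c₀ ; N₀ = 4 * E * q ; D≥1 = Kb≥1 ; q≥1 = s≤s z≤n
      ; Info = Info
      ; infos = λ m → codeInfos m indexE
      ; y = codeCost Kb a
      ; x = λ { {m} (cl , ((i , _) , _)) H → k * (off (cl H i) + cost m) + (off (cl H i) + cost m ∸ gainOf E m) }
      ; tab = λ { (cl , ((i , j) , τ)) H → rowTables (cl H i) (cl H j) τ }
      ; infos-length = λ m _ → codeInfos-length Kb m indexE a size-a
      ; tab-length = λ { (cl , ((i , j) , τ)) H → rowTables-length (cl H i) (cl H j) τ }
      ; covers = covers }
      where
      size-a : s * s * 2 ^ k ≤ 2 ^ a
      size-a = ≤-trans (*-monoˡ-≤ (2 ^ k) (≤-trans (*-mono-≤ (n≤2^n s) (n≤2^n s)) (≤-reflexive (sym (^-distribˡ-+-* 2 s s)))))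
        (≤-reflexive (sym (^-distribˡ-+-* 2 (s + s) k)))
      Covered : ∀ {m} → Graph (q + m) → (Fin q → Fin (q + m)) → (Fin m → Fin (q + m)) → Set
      Covered {m} G V out = ∃ λ ι → ι ∈ codeInfos m indexE ×
          tableOf G V out ∈ rowTables (proj₁ ι (relabel out G) (proj₁ (proj₁ (proj₂ ι)))) (proj₁ ι (relabel out G) (proj₂ (proj₁ (proj₂ ι)))) (proj₂ (proj₂ ι)) ×
          Kb * s * (k * (off (proj₁ ι (relabel out G) (proj₁ (proj₁ (proj₂ ι)))) + cost m) + (off (proj₁ ι (relabel out G) (proj₁ (proj₁ (proj₂ ι)))) + cost m ∸ gainOf E m) + codeCost Kb a m) + 2 * m
            ≤ Kb * suc r * q * m + c₀
      covers : ∀ {m} → 4 * E * q ≤ m → (G : Graph (q + m)) → Free T G → P G →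
        (∃ λ (V : Fin q → Fin (q + m)) → Injective V × (∀ out → Complement V out → Covered G V out)) ⊎ P⁺ G
      covers {m} m≥ G fr (Cls , bal , φ) = by-case (anyUnsplit? K₁ k Cls)
        where
        module _ (i j′ : Fin s) (u : Fin (q + m)) (us : Vec (Fin (q + m)) k) (τ : Vec Bool k) (β : Bool) (un : Unsplit K₁ k Cls i j′ (u ∷ us) τ β) where
          open Classes Cls
          open Unsplit un
          Q : Fin q → Fin (q + m)
          Q = lookup (u ∷ us)
          n : ℕ
          n = q + m
          D : Fin n → Bool
          D = cellOf Cls us τ j′
          Eq≤m : 4 * (E * q) ≤ m
          Eq≤m = ≤-trans (≤-reflexive (sym (*-assoc 4 E q))) m≥
          q≤m : q ≤ m
          q≤m = ≤-trans (≤-trans (≤-trans (≤-reflexive (sym (*-identityˡ q))) (*-monoˡ-≤ q E≥1)) (m≤n*m (E * q) 4)) Eq≤m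
          n≤2m : n ≤ 2 * m
          n≤2m = +-mono-≤ q≤m (≤-reflexive (sym (+-identityʳ m)))
          4E≤m : 4 * E ≤ m
          4E≤m = ≤-trans (≤-trans (≤-reflexive (sym (*-identityʳ (4 * E)))) (*-monoʳ-≤ (4 * E) (s≤s (z≤n {k})))) m≥
          found : ∀ out → Complement Q out → Covered G Q out
          found out C = let (cl , cl∈ , into , from) = describe Q out C distinct k<k₀ in described out C cl cl∈ into from
            where
            described : ∀ out (C : Complement Q out) cl → cl ∈ codes m → (into : ∀ i v → V i (out v) ≡ true → cl (relabel out G) i v ≡ true) →
              (∀ i v → cl (relabel out G) i v ≡ true → V i (out v) ≡ true ⊎ Exc (out v) ≡ true) → Covered G Q out
            described out C cl cl∈ into from = (cl , ((i , j′) , τ)) , ∈-codeInfos indexE cl∈ _ ,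
                subst (tableOf G Q out ∈_) (sym (keepIf-yes (4 * E ≤? m) 4E≤m))
                  (∈-concatMap (extend-by c (cl H j′) τ) (∈-prodL {m = k} (λ _ → plainRows c) rows (λ l → plain l)) (∈-map⁺ (_∷ rows) gainful)) ,
                ineq m (off c) _ low same-exponent
              where
              H : Graph m
              H = relabel out G
              c : Fin m → Bool
              c = cl H i
              module Re = Restricted Cls Q out C (cl H) into from
              rows : Vec (Vec Bool m) k
              rows = tabulate (λ l → tabulate (λ v → adj G (lookup us l) (out v)))
              row-u : Vec Bool m
              row-u = tabulate (λ v → adj G u (out v))
              entry-rows : ∀ l v → lookup (lookup rows l) v ≡ adj G (lookup us l) (out v)
              entry-rows l v = trans (cong (λ z → lookup z v) (lookup∘tabulate _ l)) (lookup∘tabulate _ v)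
              class-hits : ∀ l (row : Vec Bool m) → (∀ v → lookup row v ≡ adj G (Q l) (out v)) →
                b * (b * # (λ v → c v ∧ (lookup row v ==ᵇ proj₁ (constant l)))) ≤ m
              class-hits l row at = minor b K₁ _ _ _ n m K₁≥ (proj₂ (constant l)) (≤-trans (*-monoˡ-≤ (# Exc) K≥K₁) smallW)
                (≤-trans (≤-reflexive (#-cong (λ v → cong (λ z → c v ∧ (z ==ᵇ proj₁ (constant l))) (at v)))) (Re.#-class-hits i l (proj₁ (constant l)))) n≤2m
              plain : ∀ l → lookup rows l ∈ plainRows c
              plain l = ∈-plainRows c (lookup rows l) (proj₁ (constant (suc l))) (class-hits (suc l) (lookup rows l) (entry-rows l))
              hole : Fin m → Bool
              hole = rowCell c (cl H j′) τ rows
              two : Fin m → Bool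
              two = extra c E hole
              D⊆two : # D ≤ # two + q
              D⊆two = ≤-trans (#-restrict C D) (+-mono-≤ (#-mono (λ v ev → 
                ∧-join (rowCell-intro c (cl H j′) τ rows v (into j′ v (cellOf-V Cls us τ j′ (out v) ev)) (λ l → trans (entry-rows l v) (link-adj G _ _ _ (cellOf-links Cls us τ j′ (out v) ev l))))
                  (≢true⇒not (Re.class-apart i j′ v (cellOf-V Cls us τ j′ (out v) ev) apart)))) (#≤n (D ∘ Q)))
              2n≤ : 2 * n ≤ E * (# two + q)
              2n≤ = begin
                2 * n ≤⟨ *-monoʳ-≤ 2 (class-large Kb Cls Kb≤K bal Kb≥1 Kb≥ j′) ⟩
                2 * (2 * s * # (V j′)) ≤⟨ *-monoʳ-≤ 2 (*-monoʳ-≤ (2 * s) large) ⟩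
                2 * (2 * s * (κ ^ k * # D)) ≡⟨ assoc-2 s (κ ^ k) (# D) ⟩
                4 * s * κ ^ k * # D ≤⟨ *-mono-≤ E≥ D⊆two ⟩
                E * (# two + q) ∎
                where
                open ≤-Reasoning
                assoc-2 : ∀ s p d → 2 * (2 * s * (p * d)) ≡ 4 * s * p * d
                assoc-2 = solve-∀
              big : m ≤ E * # two
              big = certificate (2 * q) (+-mono-≤ 2n≤ (≤-trans (m≤n*m (E * q) 4) Eq≤m)) (identity′ m E q (# two))
                where
                identity′ : ∀ m E q t → m + (E * (t + q) + m) + 2 * q ≡ E * t + (2 * (q + m) + E * q)
                identity′ = solve-∀
              hits₂ : # (λ v → two v ∧ (lookup row-u v ==ᵇ β)) ≤ # (λ x → D x ∧ link G β u x) + # Exc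
              hits₂ = ≤-trans
                (#-cover (λ v → two v ∧ (lookup row-u v ==ᵇ β)) (λ v → D (out v) ∧ link G β u (out v)) (Exc ∘ out) sort)
                (+-mono-≤ (Re.#-out≤ (λ x → D x ∧ link G β u x)) (Re.#-out≤ Exc))
                where
                  sort : ∀ v → two v ∧ (lookup row-u v ==ᵇ β) ≡ true → (D (out v) ∧ link G β u (out v) ≡ true) ⊎ (Exc (out v) ≡ true)
                  sort v ev = [ (λ Vv → inj₁ (∧-join
                      (cellOf-intro Cls us τ j′ (out v) Vv (λ l → Re.link-out (suc l) v (lookup τ l)
                        (trans (cong (_==ᵇ lookup τ l) (sym (entry-rows l v))) (rowCell-agree c (cl H j′) τ rows v in-hole l))))
                      (Re.link-out zero v β (trans (cong (_==ᵇ β) (sym (lookup∘tabulate _ v))) (proj₂ (∧-split {two v} ev))))))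
                    , inj₂ ]′ (from j′ v (rowCell-base c (cl H j′) τ rows v in-hole))
                    where
                    in-hole : hole v ≡ true
                    in-hole = proj₁ (∧-split {hole v} (proj₁ (∧-split {two v} ev)))
              -- The deleted and the exceptional vertices are few compared with the cell. This is
              -- where the factor 64 in `few` drops to 32 in `few₂`.
              spare : q + 64 * # Exc ≤ # two
              spare = *-cancelˡ-≤ E {{>-nonZero E≥1}} (*-cancelˡ-≤ 4 (certificate (m) (+-mono-≤ Eq≤m (+-mono-≤ (≤-trans (*-monoˡ-≤ (# Exc) K≥E) (≤-trans smallW n≤2m)) (*-monoʳ-≤ 4 big)))
                (identity′ m E q (# two) (# Exc))))
                where
                identity′ : ∀ m E q t w → 4 * (E * (q + 64 * w)) + (m + (2 * m + 4 * (E * t))) + m ≡ 4 * (E * t) + (4 * (E * q) + (256 * E * w + 4 * m))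
                identity′ = solve-∀
              few₂ : 32 * # (λ v → two v ∧ (lookup row-u v ==ᵇ β)) ≤ # two
              few₂ = *-cancelˡ-≤ 2 (certificate 1 (+-mono-≤ (*-monoʳ-≤ 64 hits₂) (+-mono-≤ (subst (λ z → z * # (λ x → D x ∧ link G β u x) < # D) κ≡64 few) (+-mono-≤ D⊆two spare)))
                (identity′ (# (λ v → two v ∧ (lookup row-u v ==ᵇ β))) (# (λ x → D x ∧ link G β u x)) (# Exc) (# D) (# two) q))
                where
                identity′ : ∀ h x w d t q → 2 * (32 * h) + (64 * (x + w) + (d + (t + q + t))) + 1 ≡ 2 * t + (64 * h + (suc (64 * x) + (d + (q + 64 * w))))
                identity′ = solve-∀
              gainful : row-u ∈ gainRows c E hole
              gainful = ∈-gainRows c E hole row-u (proj₁ (constant zero)) β big (class-hits zero row-u (λ v → lookup∘tabulate _ v)) few₂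
              low : s * Kb * off c + Kb * m ≤ s * Kb * m + s * s * m + (s * Kb * q + s * s * q)
              low = below-off s Kb (# (V i)) (# c) (off c) q m (balanced-below Kb Cls Kb≤K bal i) (Re.class-≤ i) (#-complement c)
              gain≤ : gainOf E m ≤ off c + cost m
              gain≤ = ≤-trans (≤-trans (≤-trans (m≤m+n (gainOf E m) (gainOf E m + 0)) (m≤m+n (2 * gainOf E m) 2))
                  (*-cancelˡ-≤ E {{>-nonZero E≥1}} (≤-trans (gainOf-≤ E m 4E≤m) big)))
                (≤-trans (≤-trans (m≤n+m (# two) _) (≤-reflexive (off-split c E hole))) (m≤m+n (off c) (cost m)))
              same-exponent : k * (off c + cost m) + (off c + cost m ∸ gainOf E m) + gainOf E m ≡ suc k * (off c + cost m)
              same-exponent = trans (+-assoc (k * (off c + cost m)) _ _) (trans (cong (k * (off c + cost m) +_) (m∸n+n≡m gain≤)) (+-comm _ (off c + cost m)))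
        by-case : Dec (∃ λ i → ∃ λ j → ∃ λ us → ∃ λ τ → ∃ λ β → Unsplit K₁ k Cls i j us τ β) →
          (∃ λ (V : Fin q → Fin (q + m)) → Injective V × (∀ out → Complement V out → Covered G V out)) ⊎ P⁺ G
        by-case (yes (i , j , u ∷ us , τ , β , un)) = inj₁ (lookup (u ∷ us) , Unsplit.distinct un , found i j u us τ β un)
        by-case (no none) = inj₂ (Cls , bal , φ , λ i j us τ β un → none (i , j , us , τ , β , un))

    mostly-splits : Mostly P P⁺
    mostly-splits = mostly-removal removal

-- Between large subsets of distinct classes there are many edges and many non-edges

record Irregular {n s K k₀ codes} {G : Graph n} (Kγ : ℕ) (Cls : Classes G s K k₀ codes)
  (i j : Fin s) (β : Bool) (A B : Fin n → Bool) : Set where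
  constructor irregular
  open Classes Cls
  field
    apart  : i ≢ j
    A⊆V    : A ⊆ V i
    B⊆V    : B ⊆ V j
    A-big  : n ≤ Kγ * # A
    B-big  : n ≤ Kγ * # B
    thin   : ∀ a → A a ≡ true → κ * # (λ x → B x ∧ link G β a x) < # B

irregular? : ∀ {n s K k₀ codes} {G : Graph n} Kγ (Cls : Classes G s K k₀ codes) i j β A B → Dec (Irregular Kγ Cls i j β A B)
irregular? {n} Kγ Cls i j β A B = map′ (λ { (a , b , c , d , e , f) → irregular a b c d e f }) (λ { (irregular a b c d e f) → a , b , c , d , e , f })
  (¬? (i ≟ᶠ j) ×-dec (all? (λ x → (A x ≟ᵇ true) →-dec (_ ≟ᵇ true)) ×-dec (all? (λ x → (B x ≟ᵇ true) →-dec (_ ≟ᵇ true)) ×-dec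
    ((n ≤? _) ×-dec ((n ≤? _) ×-dec all? (λ a → (A a ≟ᵇ true) →-dec (_ <? _)))))))

irregular-cong : ∀ {n s K k₀ codes} {G : Graph n} {Kγ} {Cls : Classes G s K k₀ codes} {i j β A A′ B B′} →
  (∀ x → A x ≡ A′ x) → (∀ x → B x ≡ B′ x) → Irregular Kγ Cls i j β A B → Irregular Kγ Cls i j β A′ B′
irregular-cong {G = G} {Kγ} {β = β} {B = B} eA eB (irregular a b c d e f) = irregular a
  (λ x h → b x (trans (eA x) h)) (λ x h → c x (trans (eB x) h))
  (subst (λ z → _ ≤ Kγ * z) (#-cong eA) d) (subst (λ z → _ ≤ Kγ * z) (#-cong eB) e)
  (λ y h → subst₂ _<_ (cong (κ *_) (#-cong (λ x → cong (_∧ link G β y x) (eB x)))) (#-cong eB) (f y (trans (eA y) h)))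

anyIrregular? : ∀ {n s K k₀ codes} {G : Graph n} Kγ (Cls : Classes G s K k₀ codes) →
  Dec (∃ λ i → ∃ λ j → ∃ λ β → ∃ λ A → ∃ λ B → Irregular Kγ Cls i j β A B)
anyIrregular? {n} Kγ Cls = any? λ i → any? λ j → searchBool _ λ β →
  searchSet n _ (λ A → searchSet n _ (λ B → irregular? Kγ Cls i j β A B) (λ eB → irregular-cong (λ _ → refl) eB))
    (λ { eA (B , h) → B , irregular-cong eA (λ _ → refl) h })

Regular : ∀ {n s K k₀ codes} {G : Graph n} → ℕ → Classes G s K k₀ codes → Set
Regular Kγ Cls = ∀ i j β A B → ¬ Irregular Kγ Cls i j β A B

pick-many : ∀ {n} k (A : Fin n → Bool) → k ≤ # A → ∃ λ (Q : Fin k → Fin n) → Injective Q × (∀ l → A (Q l) ≡ true)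
pick-many zero    A le = (λ ()) , (λ ()) , λ ()
pick-many {n} (suc k) A le with #-exists A (≤-trans (s≤s z≤n) le)
... | a , Aa with pick-many k (λ p → A p ∧ not (a == p)) (s≤s⁻¹ (≤-trans le (#-remove A a)))
...   | Q , inj , QA = Q⁺ , inj⁺ , QA⁺
  where
  fresh : ∀ l → a ≢ Q l
  fresh l e = not-true (proj₂ (∧-split {A (Q l)} (QA l))) (trans (cong (a ==_) (sym e)) (==-refl a))
  Q⁺ : Fin (suc k) → Fin n
  Q⁺ zero    = a
  Q⁺ (suc l) = Q l
  inj⁺ : Injective Q⁺
  inj⁺ zero    zero    e = refl
  inj⁺ zero    (suc l) e = ⊥-elim (fresh l e)
  inj⁺ (suc l) zero    e = ⊥-elim (fresh l (sym e))
  inj⁺ (suc l) (suc m) e = cong suc (inj l m e)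
  QA⁺ : ∀ l → A (Q⁺ l) ≡ true
  QA⁺ zero    = Aa
  QA⁺ (suc l) = proj₁ (∧-split (QA l))

-- The set `B` is listed with m bits, too much for a single row. But q = 4 (4E + 1) rows save about
-- 4m bits in total: m for `B`, m for the imbalance because Kb ≥ q s, m for the deviations because b
-- = 2q, and the rest for the remaining overhead.
record RegularConstants (r K k₀ Kb : ℕ) : Set where
  field
    E b′ q : ℕ
    E≥1 : 1 ≤ E
    q≡  : q ≡ 4 * suc (4 * E)
    b≡  : suc b′ ≡ 8 * suc (4 * E)
    K≥  : 4 * (suc b′ * suc b′) ≤ K
    Kb≥ : 4 * suc (4 * E) * (2 + r) ≤ Kb
    k₀≥ : q ≤ k₀

module StageFour {k* : ℕ} (T : Graph k*) (r : ℕ) (g : ℕ → ℕ) (ext : Extends (suc r) g)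
  (K k₀ e : ℕ) (codes : Codes (2 + r)) (short : Short codes e)
  (Kb : ℕ) (Kb≤K : Kb ≤ K) (Kb≥3 : 3 ≤ Kb)
  (Φ : ∀ {n} {G : Graph n} → Classes G (2 + r) K k₀ codes → Set)
  (C : RegularConstants r K k₀ Kb) where

  open RegularConstants C
  open Typical T (suc r) g ext
  open StageTwo T r g ext K k₀ e codes short
  open Rows b′

  P P⁺ : Property
  P G = ∃ λ (Cls : Classes G s K k₀ codes) → Balanced Kb Cls × Φ Cls
  P⁺ G = ∃ λ (Cls : Classes G s K k₀ codes) → Balanced Kb Cls × Φ Cls × Regular E Cls

  F c₀ : ℕ
  F = suc (4 * E)
  c₀ = q * (s * Kb * q + s * s * q) + 16 * (F * (s * Kb)) + polylog-const e 1 (Kb * s) + s * Kb * s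

  ineq : ∀ m o x → s * Kb * o + Kb * m ≤ s * Kb * m + s * s * m + (s * Kb * q + s * s * q) →
    x + q * gainOf E m ≡ q * (o + cost m) →
    Kb * s * (x + codeCost Kb (s + m) m) + 2 * m ≤ Kb * suc r * q * m + c₀
  ineq m o x = from-q q q≡
    where
    from-q : ∀ q → q ≡ 4 * F → s * Kb * o + Kb * m ≤ s * Kb * m + s * s * m + (s * Kb * q + s * s * q) →
      x + q * gainOf E m ≡ q * (o + cost m) →
      Kb * s * (x + codeCost Kb (s + m) m) + 2 * m ≤ Kb * suc r * q * m + (q * (s * Kb * q + s * s * q) + 16 * (F * (s * Kb)) + polylog-const e 1 (Kb * s) + s * Kb * s)
    from-q _ refl h₁ h₂ = *-cancelˡ-≤ 2 (certificate (2 * Kb * suc r * m)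
      (+-mono-≤ (+-mono-≤ (*-monoʳ-≤ (2 * (4 * F)) h₁) (*-monoʳ-≤ (s * Kb) (subst (λ z → z * cost m ≤ 3 * z + 2 * m) b≡ (cost-bound m))))
        (+-mono-≤ (+-mono-≤ (*-monoʳ-≤ (8 * (s * Kb)) (gainOf-≥ E m)) (*-monoʳ-≤ 2 (polylog-bound e 1 (Kb * s) m)))
          (+-mono-≤ (+-mono-≤ (*-monoʳ-≤ (2 * s * m) Kb≥) (*-monoʳ-≤ (2 * m) Kb≥3)) (*-monoʳ-≤ (2 * (s * Kb)) (≤-reflexive h₂)))))
      (identity r Kb m o x (cost m) (gainOf E m) (polylog e 1 (Kb * s) m) (polylog-const e 1 (Kb * s)) (suc (4 * E))))
      where
      identity : ∀ r Kb m o x c gn p pc F → let s = suc (suc r) ; q = 4 * F in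
        2 * (Kb * s * (x + (p + (s + m))) + 2 * m)
          + ((2 * (4 * F) * (s * Kb * m + s * s * m + (s * Kb * q + s * s * q)) + s * Kb * (3 * (8 * F) + 2 * m))
            + ((8 * (s * Kb) * (F + F * gn) + 2 * (m + pc)) + ((2 * s * m * Kb + 2 * m * Kb) + 2 * (s * Kb) * (q * (o + c)))))
          + 2 * Kb * suc r * m
        ≡ 2 * (Kb * suc r * q * m + (q * (s * Kb * q + s * s * q) + 16 * (F * (s * Kb)) + pc + s * Kb * s))
          + ((2 * (4 * F) * (s * Kb * o + Kb * m) + s * Kb * (8 * F * c))
            + ((8 * (s * Kb) * m + 2 * (Kb * s * p)) + ((2 * s * m * (4 * F * s) + 2 * m * 3) + 2 * (s * Kb) * (x + q * gn))))
      identity = solve-∀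

  indexE : ∀ m → Enumeration (Fin s × Vec Bool m) (s * 2 ^ m)
  indexE m = enum× (enumFin s) (enumVecBool m)

  module _ {m : ℕ} (c B : Fin m → Bool) where

    rowTables : List (Table q m)
    rowTables = keepIf (4 * E ≤? m) (prodL {m = q} (λ _ → gainRows c E B))

    rowTables-length : length rowTables ≤ 2 ^ (q * (off c + cost m ∸ gainOf E m))
    rowTables-length = length-keepIf (4 * E ≤? m) _ λ big →
      ≤-trans (prodL-length {m = q} (λ _ → gainRows c E B) (λ _ → off c + cost m ∸ gainOf E m)
          (λ _ → gainRows-length c E B (gainOf E m) E≥1 (gainOf-≤ E m big)))
        (≤-reflexive (cong (2 ^_) (sumF-const q _)))

  q≥1 : 1 ≤ q
  q≥1 = ≤-trans (s≤s z≤n) (≤-reflexive (sym q≡))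

  removal : Removal P P⁺
  removal = record
    { q = q ; D = Kb ; c = c₀ ; N₀ = 4 * E * q ; D≥1 = ≤-trans (s≤s z≤n) Kb≥3 ; q≥1 = q≥1
    ; Info = λ m → (Graph m → Fin s → Fin m → Bool) × (Fin s × Vec Bool m)
    ; infos = λ m → codeInfos m (indexE m)
    ; y = λ m → codeCost Kb (s + m) m
    ; x = λ { {m} (cl , (i , _)) H → q * (off (cl H i) + cost m ∸ gainOf E m) }
    ; tab = λ { (cl , (i , B)) H → rowTables (cl H i) (lookup B) }
    ; infos-length = λ m _ → codeInfos-length Kb m (indexE m) (s + m)
        (≤-trans (*-monoˡ-≤ (2 ^ m) (n≤2^n s)) (≤-reflexive (sym (^-distribˡ-+-* 2 s m))))
    ; tab-length = λ { (cl , (i , B)) H → rowTables-length (cl H i) (lookup B) }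
    ; covers = covers }
    where
    Covered : ∀ {m} → Graph (q + m) → (Fin q → Fin (q + m)) → (Fin m → Fin (q + m)) → Set
    Covered {m} G V out = ∃ λ ι → ι ∈ codeInfos m (indexE m) ×
        tableOf G V out ∈ rowTables (proj₁ ι (relabel out G) (proj₁ (proj₂ ι))) (lookup (proj₂ (proj₂ ι))) ×
        Kb * s * (q * (off (proj₁ ι (relabel out G) (proj₁ (proj₂ ι))) + cost m ∸ gainOf E m) + codeCost Kb (s + m) m) + 2 * m
          ≤ Kb * suc r * q * m + c₀
    covers : ∀ {m} → 4 * E * q ≤ m → (G : Graph (q + m)) → Free T G → P G →
      (∃ λ (V : Fin q → Fin (q + m)) → Injective V × (∀ out → Complement V out → Covered G V out)) ⊎ P⁺ G
    covers {m} m≥ G fr (Cls , bal , φ) = by-case (anyIrregular? E Cls)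
      where
      module _ (i j : Fin s) (β : Bool) (A B : Fin (q + m) → Bool) (ir : Irregular E Cls i j β A B) where
        open Classes Cls
        open Irregular ir
        n : ℕ
        n = q + m
        Eq≤m : E * q ≤ m
        Eq≤m = ≤-trans (≤-trans (m≤n*m (E * q) 4) (≤-reflexive (sym (*-assoc 4 E q)))) m≥
        q≤m : q ≤ m
        q≤m = ≤-trans (≤-trans (≤-reflexive (sym (*-identityˡ q))) (*-monoˡ-≤ q E≥1)) Eq≤m
        n≤2m : n ≤ 2 * m
        n≤2m = +-mono-≤ q≤m (≤-reflexive (sym (+-identityʳ m)))
        4E≤m : 4 * E ≤ m
        4E≤m = ≤-trans (≤-trans (≤-reflexive (sym (*-identityʳ (4 * E)))) (*-monoʳ-≤ (4 * E) q≥1)) m≥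
        picked : ∃ λ (Q : Fin q → Fin n) → Injective Q × (∀ l → A (Q l) ≡ true)
        picked = pick-many q A (*-cancelˡ-≤ E {{>-nonZero E≥1}} (≤-trans (≤-trans Eq≤m (m≤n+m m q)) A-big))
        Q : Fin q → Fin n
        Q = proj₁ picked
        Q-inj : Injective Q
        Q-inj = proj₁ (proj₂ picked)
        QA : ∀ l → A (Q l) ≡ true
        QA = proj₂ (proj₂ picked)
        found : ∀ out → Complement Q out → Covered G Q out
        found out C = let (cl , cl∈ , into , from) = describe Q out C Q-inj k₀≥ in described out C cl cl∈ into from
          where
          described : ∀ out (C : Complement Q out) cl → cl ∈ codes m → (into : ∀ i v → V i (out v) ≡ true → cl (relabel out G) i v ≡ true) →
            (∀ i v → cl (relabel out G) i v ≡ true → V i (out v) ≡ true ⊎ Exc (out v) ≡ true) → Covered G Q out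
          described out C cl cl∈ into from = (cl , (i , B↓)) , ∈-codeInfos (indexE m) cl∈ _ ,
              subst (tableOf G Q out ∈_) (sym (keepIf-yes (4 * E ≤? m) 4E≤m)) (∈-prodL {m = q} (λ _ → gainRows c E (lookup B↓)) (tableOf G Q out) gainful) ,
              ineq m (off c) _ low same-exponent
            where
            H : Graph m
            H = relabel out G
            c : Fin m → Bool
            c = cl H i
            B↓ : Vec Bool m
            B↓ = tabulate (B ∘ out)
            module Re = Restricted Cls Q out C (cl H) into from
            two : Fin m → Bool
            two = extra c E (lookup B↓)
            B≤two : # B ≤ # two
            B≤two = ≤-trans (#-restrict C B) (≤-trans (+-mono-≤ (#-mono (λ v e → ∧-join (trans (lookup∘tabulate _ v) e)
                (≢true⇒not (Re.class-apart i j v (B⊆V _ e) apart))))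
              (≤-reflexive (#-zero _ (λ l e → apart (disjV i j (Q l) (A⊆V _ (QA l)) (B⊆V _ e)))))) (≤-reflexive (+-identityʳ _)))
            big : m ≤ E * # two
            big = ≤-trans (m≤n+m m q) (≤-trans B-big (*-monoʳ-≤ E B≤two))
            row : Fin q → Vec Bool m
            row l = lookup (tableOf G Q out) l
            row-at : ∀ l v → lookup (row l) v ≡ adj G (Q l) (out v)
            row-at l v = entry-tableOf G Q out l v
            colour : ∀ l → ∃ λ b → K * # (λ x → V i x ∧ link G b (Q l) x) ≤ n
            colour l = near i (Q l) (A⊆V _ (QA l))
            class-hits : ∀ l → b * (b * # (λ v → c v ∧ (lookup (row l) v ==ᵇ proj₁ (colour l)))) ≤ m
            class-hits l = minor b K _ _ _ n m K≥ (proj₂ (colour l)) smallW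
              (≤-trans (≤-reflexive (#-cong (λ v → cong (λ z → c v ∧ (z ==ᵇ proj₁ (colour l))) (row-at l v)))) (Re.#-class-hits i l (proj₁ (colour l)))) n≤2m
            hits₂ : ∀ l → # (λ v → two v ∧ (lookup (row l) v ==ᵇ β)) ≤ # (λ x → B x ∧ link G β (Q l) x)
            hits₂ l = ≤-trans (#-mono (λ v e → let (e₁ , e₂) = ∧-split {two v} e ; (e₃ , _) = ∧-split {lookup B↓ v} e₁ in
                ∧-join (trans (sym (lookup∘tabulate _ v)) e₃) (Re.link-out l v β (trans (cong (_==ᵇ β) (sym (row-at l v))) e₂))))
              (Re.#-out≤ (λ x → B x ∧ link G β (Q l) x))
            few₂ : ∀ l → 32 * # (λ v → two v ∧ (lookup (row l) v ==ᵇ β)) ≤ # two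
            few₂ l = ≤-trans (*-mono-≤ (m≤m+n 32 32) (hits₂ l))
              (≤-trans (<⇒≤ (subst (λ z → z * # (λ x → B x ∧ link G β (Q l) x) < # B) κ≡64 (thin (Q l) (QA l)))) B≤two)
            gainful : ∀ l → row l ∈ gainRows c E (lookup B↓)
            gainful l = ∈-gainRows c E (lookup B↓) (row l) (proj₁ (colour l)) β big (class-hits l) (few₂ l)
            low : s * Kb * off c + Kb * m ≤ s * Kb * m + s * s * m + (s * Kb * q + s * s * q)
            low = below-off s Kb (# (V i)) (# c) (off c) q m (balanced-below Kb Cls Kb≤K bal i) (Re.class-≤ i) (#-complement c)
            gain≤ : gainOf E m ≤ off c + cost m
            gain≤ = ≤-trans (≤-trans (≤-trans (m≤m+n (gainOf E m) (gainOf E m + 0)) (m≤m+n (2 * gainOf E m) 2))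
                (*-cancelˡ-≤ E {{>-nonZero E≥1}} (≤-trans (gainOf-≤ E m 4E≤m) big)))
              (≤-trans (≤-trans (m≤n+m (# two) _) (≤-reflexive (off-split c E (lookup B↓)))) (m≤m+n (off c) (cost m)))
            same-exponent : q * (off c + cost m ∸ gainOf E m) + q * gainOf E m ≡ q * (off c + cost m)
            same-exponent = trans (sym (*-distribˡ-+ q _ (gainOf E m))) (cong (q *_) (m∸n+n≡m gain≤))
      by-case : Dec (∃ λ i → ∃ λ j → ∃ λ β → ∃ λ A → ∃ λ B → Irregular E Cls i j β A B) →
        (∃ λ (V : Fin q → Fin (q + m)) → Injective V × (∀ out → Complement V out → Covered G V out)) ⊎ P⁺ G
      by-case (yes (i , j , β , A , B , ir)) = inj₁ (Q i j β A B ir , Q-inj i j β A B ir , found i j β A B ir)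
      by-case (no none) = inj₂ (Cls , bal , φ , λ i j β A B ir → none (i , j , β , A , B , ir))

  mostly-regular : Mostly P P⁺
  mostly-regular = mostly-removal removal

-- Classes are homogeneous

#-swap : ∀ {m n} (ρ : Fin m → Fin n → Bool) → sumF (λ y → # (ρ y)) ≡ sumF (λ z → # (λ y → ρ y z))
#-swap ρ = trans (sumF-cong (λ y → sym (sumF-bit (ρ y)))) (trans (sumF-swap (λ y z → bit (ρ y z))) (sumF-cong (λ z → sumF-bit (λ y → ρ y z))))

opaque
  unfolding sumF #
  sumF-select : ∀ {n} (R : Fin n → Bool) c → sumF (λ y → choose (R y) c 0) ≡ # R * c
  sumF-select {zero}  R c = refl
  sumF-select {suc n} R c with R zero
  ... | true  = cong (c +_) (sumF-select (R ∘ suc) c)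
  ... | false = sumF-select (R ∘ suc) c

-- Count the pairs in R × P. Those with an edge number at most `w` per element of `P`, those with a
-- non-edge at most `w` per element of `R`, and `suc w` makes room for the pairs on the diagonal.
few-conflicts : ∀ {n} (G : Graph n) (P R : Fin n → Bool) w →
  (∀ z → P z ≡ true → # (λ y → R y ∧ link G true y z) ≤ w) →
  (∀ y → R y ≡ true → # (λ z → P z ∧ link G false y z) ≤ w) →
  # R * # P ≤ # P * w + # R * suc w
few-conflicts G P R w hP hR = begin
  # R * # P ≡⟨ sym (sumF-select R (# P)) ⟩
  sumF (λ y → choose (R y) (# P) 0) ≤⟨ sumF-mono pointwise ⟩
  sumF (λ y → # (λ z → R y ∧ (P z ∧ link G true y z)) + choose (R y) (suc w) 0) ≡⟨ sumF-+ _ _ ⟩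
  sumF (λ y → # (λ z → R y ∧ (P z ∧ link G true y z))) + sumF (λ y → choose (R y) (suc w) 0)
    ≡⟨ cong₂ _+_ (#-swap (λ y z → R y ∧ (P z ∧ link G true y z))) (sumF-select R (suc w)) ⟩
  sumF (λ z → # (λ y → R y ∧ (P z ∧ link G true y z))) + # R * suc w
    ≤⟨ +-monoˡ-≤ _ (≤-trans (sumF-mono column) (≤-reflexive (sumF-select P w))) ⟩
  # P * w + # R * suc w ∎
  where
  open ≤-Reasoning
  pointwise : ∀ y → choose (R y) (# P) 0 ≤ # (λ z → R y ∧ (P z ∧ link G true y z)) + choose (R y) (suc w) 0
  pointwise y with R y in eq
  ... | false = z≤n
  ... | true  = ≤-trans (#-remove P y) (≤-trans (s≤s (#-cover (λ z → P z ∧ not (y == z)) (λ z → P z ∧ link G true y z) (λ z → P z ∧ link G false y z)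
        (λ z e → let (e₁ , e₂) = ∧-split {P z} e in case link-or G y z (λ eq′ → not-true e₂ (trans (cong (y ==_) (sym eq′)) (==-refl y))) of λ
          { (inj₁ a) → inj₁ (∧-join e₁ a) ; (inj₂ b) → inj₂ (∧-join e₁ b) })))
      (≤-trans (≤-reflexive (sym (+-suc _ _))) (+-monoʳ-≤ _ (s≤s (hR y eq)))))
  column : ∀ z → # (λ y → R y ∧ (P z ∧ link G true y z)) ≤ choose (P z) w 0
  column z with P z in eq
  ... | true  = hP z eq
  ... | false = ≤-reflexive (#-zero _ (λ y e → case proj₂ (∧-split {R y} e) of λ ()))

lookup₂ : ∀ {A : Set} (P : A → Set) {x y} → P x → P y → ∀ l → P (lookup (x ∷ y ∷ []) l)
lookup₂ P px py zero       = px
lookup₂ P px py (suc zero) = py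

lookup₃ : ∀ {A : Set} (P : A → Set) {x y z} → P x → P y → P z → ∀ l → P (lookup (x ∷ y ∷ z ∷ []) l)
lookup₃ P px py pz zero    = px
lookup₃ P px py pz (suc l) = lookup₂ P py pz l

lookup-∷-inj : ∀ {A : Set} {x : A} {k} {xs : Vec A k} → (∀ l → x ≢ lookup xs l) →
  (∀ l l′ → lookup xs l ≡ lookup xs l′ → l ≡ l′) → ∀ l l′ → lookup (x ∷ xs) l ≡ lookup (x ∷ xs) l′ → l ≡ l′
lookup-∷-inj new inj zero    zero     e = refl
lookup-∷-inj new inj zero    (suc l′) e = ⊥-elim (new l′ e)
lookup-∷-inj new inj (suc l) zero     e = ⊥-elim (new l (sym e))
lookup-∷-inj new inj (suc l) (suc l′) e = cong suc (inj l l′ e)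

lookup₁-inj : ∀ {A : Set} (x : A) → ∀ l l′ → lookup (x ∷ []) l ≡ lookup (x ∷ []) l′ → l ≡ l′
lookup₁-inj x zero zero _ = refl

-- One more vertex splits the cell at the cost of a factor κ. `cell` and `C` describe the same set,
-- once by vectors and once by nested conjunctions.
refine-large : ∀ {n} k v (cell C ℓ : Fin n → Bool) → (∀ z → C z ≡ true → cell z ≡ true) → (∀ z → cell z ≡ true → C z ≡ true) →
  v ≤ κ ^ k * # C → (v ≤ κ ^ k * # cell → ¬ (κ * # (λ z → cell z ∧ ℓ z) < # cell)) → v ≤ κ ^ suc k * # (λ z → C z ∧ ℓ z)
refine-large k v cell C ℓ into from large splits = begin
  v ≤⟨ large′ ⟩
  κ ^ k * # cell ≤⟨ *-monoʳ-≤ (κ ^ k) (≮⇒≥ (splits large′)) ⟩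
  κ ^ k * (κ * # (λ z → cell z ∧ ℓ z))
    ≤⟨ *-monoʳ-≤ (κ ^ k) (*-monoʳ-≤ κ (#-mono (λ z e → ∧-join (from z (proj₁ (∧-split {cell z} e))) (proj₂ (∧-split {cell z} e))))) ⟩
  κ ^ k * (κ * # (λ z → C z ∧ ℓ z)) ≡⟨ trans (sym (*-assoc (κ ^ k) κ _)) (cong (_* # (λ z → C z ∧ ℓ z)) (*-comm (κ ^ k) κ)) ⟩
  κ ^ suc k * # (λ z → C z ∧ ℓ z) ∎
  where
  open ≤-Reasoning
  large′ : v ≤ κ ^ k * # cell
  large′ = ≤-trans large (*-monoʳ-≤ (κ ^ k) (#-mono into))

-- This form of a good partition treats cliques and the stable set alike, which suits both the
-- extension by a vertex and the final argument.
record HomogeneousColouring {n} (G : Graph n) (s : ℕ) : Set where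
  field
    col : Fin n → Fin s
    ty  : Fin s → Bool
    homogeneous : ∀ u v → u ≢ v → col u ≡ col v → adj G u v ≡ ty (col u)
    one-stable  : ∀ i j → i ≢ j → ty i ≡ false → ty j ≢ false

record FinalHypotheses {n r K k₀ : ℕ} {codes : Codes (2 + r)} {G : Graph n} (Cls : Classes G (2 + r) K k₀ codes) : Set where
  field
    no-star : ¬ HasStar (2 + r) G
    Kb K₁ E′ γ P big : ℕ
    γ≡   : γ ≡ suc (n / suc E′)
    P≡   : P ≡ κ ^ suc ((2 + r) + (2 + r))
    big≡ : big ≡ P * suc γ
    Kb≤K : Kb ≤ K
    Kb≥1 : 1 ≤ Kb
    Kb≥  : 2 * ((2 + r) * (2 + r)) ≤ Kb
    K₁≤K : K₁ ≤ K
    K₁≥  : suc (2 * (2 + r) * κ) ≤ K₁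
    E≥   : 2 * (K₁ * (κ * (κ * P))) ≤ suc E′
    K≥E  : 8 * suc E′ ≤ K
    n≥   : 4 * (K₁ * (κ * (κ * P))) ≤ n
    n≥′  : 8 * suc E′ ≤ n
    bal  : Balanced Kb Cls
    split₀  : Splits K₁ 0 Cls
    split₁  : Splits K₁ 1 Cls
    split₂  : Splits K₁ 2 Cls
    regular : Regular (suc E′) Cls

module Final {n r K k₀ : ℕ} {codes : Codes (2 + r)} {G : Graph n} {Cls : Classes G (2 + r) K k₀ codes} (F : FinalHypotheses Cls) where

  open FinalHypotheses F
  open Classes Cls

  private
    s E : ℕ
    s = suc (suc r)
    E = suc E′

  starBound≡big : starBound γ s ≡ big
  starBound≡big = trans (cong (_* suc γ) (sym P≡)) (sym big≡)

  n≤Eγ : n ≤ E * γ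
  n≤Eγ = ≤-trans (m<[m/d+1]*d n E′) (≤-reflexive (trans (sym (*-suc E (n / E))) (cong (E *_) (sym γ≡))))

  K₁big≤n : K₁ * (κ * (κ * big)) ≤ n
  K₁big≤n = *-cancelˡ-≤ 2 (begin
    2 * (K₁ * (κ * (κ * big))) ≡⟨ cong (λ z → 2 * (K₁ * (κ * (κ * z)))) (trans big≡ (cong (λ z → P * suc z) γ≡)) ⟩
    2 * (K₁ * (κ * (κ * (P * suc (suc (n / E)))))) ≡⟨ expand K₁ κ P (n / E) ⟩
    2 * (K₁ * (κ * (κ * P))) * (n / E) + 4 * (K₁ * (κ * (κ * P))) ≤⟨ +-mono-≤ (≤-trans (*-monoˡ-≤ (n / E) E≥) (d*[m/d]≤m n E′)) n≥ ⟩
    n + n ≡⟨ cong (n +_) (sym (+-identityʳ n)) ⟩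
    2 * n ∎)
    where
    open ≤-Reasoning
    expand : ∀ K κ P x → 2 * (K * (κ * (κ * (P * suc (suc x))))) ≡ 2 * (K * (κ * (κ * P))) * x + 4 * (K * (κ * (κ * P)))
    expand = solve-∀

  n≥1 : 1 ≤ n
  n≥1 = ≤-trans (s≤s z≤n) n≥′

  v₀ : Fin n
  v₀ = fromℕ< {0} n≥1

  V-large : ∀ i → n ≤ 2 * s * # (V i)
  V-large = class-large Kb Cls Kb≤K bal Kb≥1 Kb≥

  big≤ : ∀ x → n ≤ 2 * s * (κ * (κ * (κ * x))) → big ≤ x
  big≤ x le = *-cancelˡ-≤ (2 * s * (κ * (κ * κ))) {{>-nonZero (*-mono-≤ {1} {2 * s} (s≤s z≤n) (*-mono-≤ κ≥1 (*-mono-≤ κ≥1 κ≥1)))}} (begin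
    2 * s * (κ * (κ * κ)) * big ≡⟨ eq₁ s κ big ⟩
    2 * s * κ * (κ * (κ * big)) ≤⟨ *-monoˡ-≤ (κ * (κ * big)) (≤-trans (n≤1+n _) K₁≥) ⟩
    K₁ * (κ * (κ * big)) ≤⟨ K₁big≤n ⟩
    n ≤⟨ le ⟩
    2 * s * (κ * (κ * (κ * x))) ≡⟨ eq₂ s κ x ⟩
    2 * s * (κ * (κ * κ)) * x ∎)
    where
    open ≤-Reasoning
    eq₁ : ∀ s κ b → 2 * s * (κ * (κ * κ)) * b ≡ 2 * s * κ * (κ * (κ * b))
    eq₁ = solve-∀
    eq₂ : ∀ s κ x → 2 * s * (κ * (κ * (κ * x))) ≡ 2 * s * (κ * (κ * κ)) * x
    eq₂ = solve-∀

  P≥1 : 1 ≤ P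
  P≥1 = ≤-trans (m^n>0 κ {{κ≢0}} (suc (s + s))) (≤-reflexive (sym P≡))

  γ<big : suc γ ≤ big
  γ<big = ≤-trans (≤-mul (suc γ) P≥1) (≤-reflexive (sym big≡))

  V-big : ∀ i → big ≤ # (V i)
  V-big i = big≤ (# (V i)) (≤-trans (V-large i) (*-monoʳ-≤ (2 * s) (≤-trans (≤-mul _ κ≥1) (≤-trans (≤-mul _ κ≥1) (≤-mul _ κ≥1)))))

  opaque
    few : Bool → Fin s → Fin n → Bool
    few b i y = V i y ∧ ((K * # (λ x → V i x ∧ link G b y x)) ≤ᵗ n)

    few-intro : ∀ b i y → V i y ≡ true → K * # (λ x → V i x ∧ link G b y x) ≤ n → few b i y ≡ true
    few-intro b i y Vy le = ∧-join Vy (does-complete (_ ≤? n) le)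

    few-V : ∀ b i y → few b i y ≡ true → V i y ≡ true
    few-V b i y e = proj₁ (∧-split {V i y} e)

    few-sound : ∀ b i y → few b i y ≡ true → K * # (λ x → V i x ∧ link G b y x) ≤ n
    few-sound b i y e = does-sound (_ ≤? n) (proj₂ (∧-split {V i y} e))

  few-or : ∀ i y → V i y ≡ true → ∃ λ b → few b i y ≡ true
  few-or i y Vy = proj₁ (near i y Vy) , few-intro _ i y Vy (proj₂ (near i y Vy))

  tiny : ∀ w X → K * w ≤ n → γ ≤ X → 8 * suc w ≤ 2 * X
  tiny w X hw hX = *-cancelˡ-≤ E (certificate {Y = Ysum} 0 (+-mono-≤ (+-mono-≤ (*-monoˡ-≤ w K≥E) hw) (+-mono-≤ n≥′ (*-monoʳ-≤ 2 (≤-trans n≤Eγ (*-monoʳ-≤ E hX)))))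
      (identity E w X n (K * w)))
    where
    Ysum : ℕ
    Ysum = K * w + n + (n + 2 * (E * X))
    identity : ∀ E w X n kw → E * (8 * suc w) + (kw + n + (n + 2 * (E * X))) + 0 ≡ E * (2 * X) + (8 * E * w + kw + (8 * E + 2 * n))
    identity = solve-∀

  private
    K≢0 : NonZero K
    K≢0 = >-nonZero (≤-trans (s≤s z≤n) K≥E)

    w : ℕ
    w = _/_ n K {{K≢0}}

    Kw≤n : K * w ≤ n
    Kw≤n = ≤-trans (≤-reflexive (*-comm K w)) (m/n*n≤m n K {{K≢0}})

    ≤w : ∀ x → K * x ≤ n → x ≤ w
    ≤w x le = ≤-trans (≤-reflexive (sym (m*n/n≡m x K {{K≢0}}))) (/-monoˡ-≤ K {{K≢0}} (≤-trans (≤-reflexive (*-comm x K)) le))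

  -- Since `w` ≤ n / K, `suc w` is at most a quarter of either set, and `few-conflicts` would bound
  -- the product of the two sizes by half of itself.
  not-both : ∀ i → γ ≤ # (few true i) → γ ≤ # (few false i) → ⊥
  not-both i ht hf = <⇒≱ (*-mono-≤ (≤-trans γ≥1 ht) (≤-trans γ≥1 hf)) (*-cancelˡ-≤ 4 (certificate (8 * p)
      (+-mono-≤ (*-monoʳ-≤ 8 conflict) (+-mono-≤ (*-monoʳ-≤ p (tiny w f Kw≤n hf)) (*-monoʳ-≤ f (tiny w p Kw≤n ht)))) (identity p f w)))
    where
    p f : ℕ
    p = # (few true i)
    f = # (few false i)
    γ≥1 : 1 ≤ γ
    γ≥1 = ≤-trans (s≤s z≤n) (≤-reflexive (sym γ≡))
    conflict : f * p ≤ p * w + f * suc w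
    conflict = few-conflicts G (few true i) (few false i) w
      (λ z ez → ≤-trans (#-mono (λ y e → let (e₁ , e₂) = ∧-split {few false i y} e in
        ∧-join (few-V false i y e₁) (link-sym G true y z e₂))) (≤w _ (few-sound true i z ez)))
      (λ y ey → ≤-trans (#-mono (λ z e → let (e₁ , e₂) = ∧-split {few true i z} e in
        ∧-join (few-V true i z e₁) e₂)) (≤w _ (few-sound false i y ey)))
    identity : ∀ p f w → 4 * (p * f) + (8 * (p * w + f * suc w) + (p * (2 * f) + f * (2 * p))) + 8 * p
      ≡ 4 * 0 + (8 * (f * p) + (p * (8 * suc w) + f * (8 * suc w)))
    identity = solve-∀

  opaque
    -- The prevailing type: stable as soon as γ vertices have few neighbours in their class. By
    -- `not-both`, fewer than γ vertices then disagree with it in either case.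
    classType : Fin s → Bool
    classType i = not (γ ≤ᵗ # (few true i))

    classType-false : ∀ i → γ ≤ # (few true i) → classType i ≡ false
    classType-false i le = cong not (does-complete (γ ≤? # (few true i)) le)

    classType-cases : ∀ i → (classType i ≡ true × # (few true i) < γ) ⊎ (classType i ≡ false × γ ≤ # (few true i))
    classType-cases i with γ ≤? # (few true i)
    ... | yes le = inj₂ (cong not (does-complete (γ ≤? # (few true i)) le) , le)
    ... | no nle = inj₁ (cong not (dec-false (γ ≤? # (few true i)) nle) , ≰⇒> nle)

  few-wrong : ∀ i → # (few (classType i) i) < γ
  few-wrong i = [ (λ (e , lt) → subst (λ z → # (few z i) < γ) (sym e) lt)
                , (λ (e , le) → subst (λ z → # (few z i) < γ) (sym e) (≰⇒> (not-both i le))) ]′ (classType-cases i)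

  module _ (i : Fin s) (b : Bool) (B : Fin n → Bool) (B⊆V : B ⊆ V i) (γ≤B : γ ≤ # B) (a : Fin n)
    (other : K * # (λ x → V i x ∧ link G (not b) a x) ≤ n) where

    private
      x : ℕ
      x = # (λ p → B p ∧ link G b a p)

      sort : ∀ p → B p ∧ not (a == p) ≡ true → (B p ∧ link G b a p ≡ true) ⊎ (V i p ∧ link G (not b) a p ≡ true)
      sort p e = [ (λ l → inj₁ (∧-join Bp l)) , (λ l → inj₂ (∧-join (B⊆V p Bp) l)) ]′ (either b (link-or G a p a≢p))
        where
        Bp : B p ≡ true
        Bp = proj₁ (∧-split {B p} e)
        a≢p : a ≢ p
        a≢p eq = not-true (proj₂ (∧-split {B p} e)) (trans (cong (a ==_) (sym eq)) (==-refl a))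
        either : ∀ b → (link G true a p ≡ true) ⊎ (link G false a p ≡ true) → (link G b a p ≡ true) ⊎ (link G (not b) a p ≡ true)
        either true  h = h
        either false h = [ inj₂ , inj₁ ]′ h

      cover-B : # B ≤ suc (x + w)
      cover-B = ≤-trans (#-remove B a) (s≤s (≤-trans
        (#-cover (λ p → B p ∧ not (a == p)) (λ p → B p ∧ link G b a p) (λ p → V i p ∧ link G (not b) a p) sort)
        (+-monoʳ-≤ x (≤w _ other))))

    dense-same : # B ≤ κ * # (λ p → B p ∧ link G b a p)
    dense-same = ≤-trans (*-cancelˡ-≤ 2 (certificate {X = 4 * # B + 8 * suc w} {Y = 4 * suc (x + w) + 2 * # B} (4 * suc w)
        (+-mono-≤ (*-monoʳ-≤ 4 cover-B) (tiny w (# B) Kw≤n γ≤B)) (identity (# B) x w)))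
      (*-monoˡ-≤ x κ≥2)
      where
      identity : ∀ B x w → 2 * B + (4 * suc (x + w) + 2 * B) + 4 * suc w ≡ 2 * (2 * x) + (4 * B + 8 * suc w)
      identity = solve-∀

  exceptional-vertex : ∀ i A → A ⊆ V i → γ ≤ # A → ∃ λ a → A a ≡ true × K * # (λ x → V i x ∧ link G (not (classType i)) a x) ≤ n
  exceptional-vertex i A A⊆V γ≤A = [ (λ found → found) , (λ none → ⊥-elim (<⇒≱ (few-wrong i) (≤-trans γ≤A (#-mono (λ a Aa →
      in-few a (A⊆V a Aa) (λ le → none (a , Aa , le))))))) ]′
    (toSum (any? (λ a → (A a ≟ᵇ true) ×-dec (K * # (λ x → V i x ∧ link G (not (classType i)) a x) ≤? n))))
    where
    opposite : ∀ b c → b ≢ not c → b ≡ c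
    opposite true  true  _ = refl
    opposite true  false h = ⊥-elim (h refl)
    opposite false true  h = ⊥-elim (h refl)
    opposite false false _ = refl
    in-few : ∀ a → V i a ≡ true → ¬ (K * # (λ x → V i x ∧ link G (not (classType i)) a x) ≤ n) → few (classType i) i a ≡ true
    in-few a Va none = let (b , fb) = few-or i a Va in
      subst (λ z → few z i a ≡ true) (opposite b (classType i)
        (λ eq → none (subst (λ z → K * # (λ x → V i x ∧ link G z a x) ≤ n) eq (few-sound b i a fb)))) fb

  DensePair : Bool → (Fin n → Bool) → (Fin n → Bool) → Set
  DensePair b A B = ∃ λ a → A a ≡ true × # B ≤ κ * # (λ p → B p ∧ link G b a p)

  densePair? : ∀ b A B → Dec (DensePair b A B)
  densePair? b A B = any? (λ a → (A a ≟ᵇ true) ×-dec (# B ≤? κ * # (λ p → B p ∧ link G b a p)))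

  dense : ∀ i j b → (i ≡ j → b ≡ classType i) → ∀ A B → A ⊆ V i → B ⊆ V j → γ ≤ # A → γ ≤ # B → DensePair b A B
  dense i j b h A B A⊆V B⊆V γ≤A γ≤B = by-equality (i ≟ᶠ j)
    where
    by-equality : Dec (i ≡ j) → DensePair b A B
    by-equality (yes i≡j) = let (a , Aa , le) = exceptional-vertex i A A⊆V γ≤A in
      a , Aa , dense-same i b B (subst (λ z → B ⊆ V z) (sym i≡j) B⊆V) γ≤B a
        (subst (λ z → K * # (λ x → V i x ∧ link G (not z) a x) ≤ n) (sym (h i≡j)) le)
    by-equality (no i≢j) = decidable-stable (densePair? b A B) (λ none →
      regular i j b A B (irregular i≢j A⊆V B⊆V (≤-trans n≤Eγ (*-monoʳ-≤ E γ≤A)) (≤-trans n≤Eγ (*-monoʳ-≤ E γ≤B))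
        (λ a Aa → ≰⇒> (λ le → none (a , Aa , le)))))

  -- The classes themselves form a frame, now with γ about n / E. Between different classes density
  -- is `Regular`; inside a class all but fewer than γ vertices have the prevailing type.
  frame : Frame G s n γ
  frame = record { pt = λ _ p → p ; X = V ; ty = classType ; dense = dense }

  almostConstant? : ∀ u → Dec (∃ λ i → AlmostConstant K₁ Cls i u)
  almostConstant? u = any? (λ i → searchBool (λ β → K₁ * # (λ x → V i x ∧ link G β u x) ≤ n) (λ β → _ ≤? n))

  not-mixed-everywhere : ∀ u → ¬ ¬ (∃ λ i → AlmostConstant K₁ Cls i u)
  not-mixed-everywhere u none = no-star (mixed-everywhere-star frame u
      (λ i b → subst (λ z → κ * (κ * z) ≤ # (λ p → V i p ∧ link G b u p)) (sym starBound≡big)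
        (*-cancelˡ-≤ K₁ {{>-nonZero (≤-trans (s≤s z≤n) K₁≥)}} (≤-trans K₁big≤n (<⇒≤ (≰⇒> (λ le → none (i , b , le)))))))
      (subst (λ z → suc r * 8 * γ < κ * (κ * z)) (sym starBound≡big) room))
    where
    room : suc r * 8 * γ < κ * (κ * big)
    room = ≤-trans (s≤s (*-monoˡ-≤ γ (*-mono-≤ r≤P 8≤κ))) (≤-trans (certificate 0 one (identity P κ γ))
        (≤-trans (≤-mul (κ * (P * suc γ)) κ≥1) (≤-reflexive (cong (λ z → κ * (κ * z)) (sym big≡)))))
      where
      r≤P : suc r ≤ P
      r≤P = ≤-trans (≤-trans (≤-trans (m≤n+m (suc r) 1) (≤-trans (m≤m+n s s) (n≤1+n _))) (≤-trans (n≤2^n _) (^-monoˡ-≤ (suc (s + s)) κ≥2))) (≤-reflexive (sym P≡))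
      8≤κ : 8 ≤ κ
      8≤κ = ≤-trans (m≤m+n 8 56) (≤-reflexive (sym κ≡64))
      one : 1 ≤ P * κ
      one = *-mono-≤ P≥1 κ≥1
      identity : ∀ P κ γ → suc (P * κ * γ) + P * κ + 0 ≡ κ * (P * suc γ) + 1
      identity = solve-∀

  opaque
    -- Exceptional vertices get a colour as well: no vertex is mixed to all classes. This is how the
    -- partition comes to cover all of `G`.
    col : Fin n → Fin s
    col u = proj₁ (decidable-stable (almostConstant? u) (not-mixed-everywhere u))

    constant : ∀ u i → col u ≡ i → AlmostConstant K₁ Cls i u
    constant u i refl = proj₂ (decidable-stable (almostConstant? u) (not-mixed-everywhere u))

  splits₀ : ∀ i j u β → i ≢ j → AlmostConstant K₁ Cls i u → # (V j) ≤ κ ^ 1 * # (λ x → V j x ∧ link G β u x)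
  splits₀ i j u β i≢j cu = refine-large 0 (# (V j)) (cellOf Cls [] [] j) (V j) (link G β u)
    (λ x e → cellOf-intro Cls [] [] j x e (λ ())) (cellOf-V Cls [] [] j) (≤-reflexive (sym (*-identityˡ _)))
    (λ large few → split₀ i j (u ∷ []) [] β (unsplit i≢j (lookup₁-inj u) (λ { zero → cu }) large few))

  -- A vertex of class `i` is almost constant there by `near`, so it splits every other class by
  -- `splits₀` and cannot be almost constant on one of them.
  class-colour : ∀ i y → V i y ≡ true → col y ≡ i
  class-colour i y Vy = decidable-stable (col y ≟ᶠ i) (λ ne → conflict (col y) (ne ∘ sym) (constant y (col y) refl))
    where
    conflict : ∀ j → i ≢ j → ¬ AlmostConstant K₁ Cls j y
    conflict j i≢j (β , few-β) = <⇒≱ n≥1 (≤-trans small (≤-reflexive (trans (cong (2 * s * κ *_) x≡0) (*-zeroʳ (2 * s * κ)))))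
      where
      x : ℕ
      x = # (λ z → V j z ∧ link G β y z)
      small : n ≤ 2 * s * κ * x
      small = ≤-trans (V-large j) (≤-trans (*-monoʳ-≤ (2 * s) (splits₀ i j y β i≢j (proj₁ (near i y Vy) , ≤-trans (*-monoˡ-≤ _ K₁≤K) (proj₂ (near i y Vy)))))
        (≤-reflexive (trans (sym (*-assoc (2 * s) (κ * 1) x)) (cong (λ z → 2 * s * z * x) (*-identityʳ κ)))))
      x≡0 : x ≡ 0
      x≡0 = n≤0⇒n≡0 (+-cancelʳ-≤ (2 * s * κ * x) x 0 (≤-trans (*-monoˡ-≤ x K₁≥) (≤-trans few-β small)))

  module _ (i : Fin s) (u v x : Fin n) (u≢v : u ≢ v) (u≢x : u ≢ x) (v≢x : v ≢ x)
    (cu : AlmostConstant K₁ Cls i u) (cv : AlmostConstant K₁ Cls i v) (cx : AlmostConstant K₁ Cls i x) where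

    private
      F′ : Frame G (suc r) n γ
      F′ = subFrame (punchIn i) (punchIn-injective i) frame

    module _ (j : Fin s) (i≢j : i ≢ j) (τ₀ τ₁ τ₂ : Bool) where

      C₁ C₂ : Fin n → Bool
      C₁ z = V j z ∧ link G τ₀ u z
      C₂ z = C₁ z ∧ link G τ₁ v z

      C₁-large : # (V j) ≤ κ ^ 1 * # C₁
      C₁-large = splits₀ i j u τ₀ i≢j cu

      in-cell₁ : ∀ z → C₁ z ≡ true → cellOf Cls (u ∷ []) (τ₀ ∷ []) j z ≡ true
      in-cell₁ z e = let (e₁ , e₂) = ∧-split {V j z} e in cellOf-intro Cls (u ∷ []) (τ₀ ∷ []) j z e₁ (λ { zero → e₂ })

      from-cell₁ : ∀ z → cellOf Cls (u ∷ []) (τ₀ ∷ []) j z ≡ true → C₁ z ≡ true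
      from-cell₁ z e = ∧-join (cellOf-V Cls (u ∷ []) (τ₀ ∷ []) j z e) (cellOf-links Cls (u ∷ []) (τ₀ ∷ []) j z e zero)

      C₂-large : # (V j) ≤ κ ^ 2 * # C₂
      C₂-large = refine-large 1 (# (V j)) (cellOf Cls (u ∷ []) (τ₀ ∷ []) j) C₁ (link G τ₁ v) in-cell₁ from-cell₁ C₁-large
        (λ large few → split₁ i j (v ∷ u ∷ []) (τ₀ ∷ []) τ₁
          (unsplit i≢j (lookup-∷-inj (λ { zero e → u≢v (sym e) }) (lookup₁-inj u)) (lookup₂ (AlmostConstant K₁ Cls i) cv cu) large few))

      in-cell₂ : ∀ z → C₂ z ≡ true → cellOf Cls (u ∷ v ∷ []) (τ₀ ∷ τ₁ ∷ []) j z ≡ true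
      in-cell₂ z e = let (e₁ , e₂) = ∧-split {C₁ z} e ; (e₃ , e₄) = ∧-split {V j z} e₁ in
        cellOf-intro Cls (u ∷ v ∷ []) (τ₀ ∷ τ₁ ∷ []) j z e₃ (λ { zero → e₄ ; (suc zero) → e₂ })
      from-cell₂ : ∀ z → cellOf Cls (u ∷ v ∷ []) (τ₀ ∷ τ₁ ∷ []) j z ≡ true → C₂ z ≡ true
      from-cell₂ z e = ∧-join (∧-join (cellOf-V Cls (u ∷ v ∷ []) (τ₀ ∷ τ₁ ∷ []) j z e) (links zero)) (links (suc zero))
        where
        links : ∀ l → link G (lookup (τ₀ ∷ τ₁ ∷ []) l) (lookup (u ∷ v ∷ []) l) z ≡ true
        links = cellOf-links Cls (u ∷ v ∷ []) (τ₀ ∷ τ₁ ∷ []) j z e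

      C₃-large : # (V j) ≤ κ ^ 3 * # (λ z → C₂ z ∧ link G τ₂ x z)
      C₃-large = refine-large 2 (# (V j)) (cellOf Cls (u ∷ v ∷ []) (τ₀ ∷ τ₁ ∷ []) j) C₂ (link G τ₂ x) in-cell₂ from-cell₂ C₂-large
        (λ large few → split₂ i j (x ∷ u ∷ v ∷ []) (τ₀ ∷ τ₁ ∷ []) τ₂
          (unsplit i≢j (lookup-∷-inj (lookup₂ (x ≢_) (u≢x ∘ sym) (v≢x ∘ sym)) (lookup-∷-inj (λ { zero e → u≢v e }) (lookup₁-inj v)))
            (lookup₃ (AlmostConstant K₁ Cls i) cx cu cv) large few))

    -- Three vertices of one colour split each other class into eight large cells, and `u`
    -- distinguishes `v` from `x`. The other classes form the frame for `mixed-star`.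
    not-mixed : adj G u v ≡ true → adj G u x ≡ false → ⊥
    not-mixed uv ux = no-star (mixed-star F′ v₀ u v x (link-intro G true u v u≢v uv) (link-intro G false u x u≢x ux)
      (λ j τ₀ τ₁ τ₂ → ≤-trans (≤-reflexive starBound≡big) (≤-trans
        (big≤ _ (≤-trans (V-large (punchIn i j)) (*-monoʳ-≤ (2 * s) (≤-trans (C₃-large (punchIn i j) (punchInᵢ≢i i j ∘ sym) τ₀ τ₁ τ₂) (≤-reflexive (cube κ _))))))
        (#-mono (λ z e → reassoc {V (punchIn i j) z} {link G τ₀ u z} {link G τ₁ v z} e)))))
      where
      cube : ∀ κ x → κ * (κ * (κ * 1)) * x ≡ κ * (κ * (κ * x))
      cube = solve-∀
      reassoc : ∀ {a b c d} → ((a ∧ b) ∧ c) ∧ d ≡ true → a ∧ (b ∧ (c ∧ d)) ≡ true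
      reassoc {true} {true} {true} e = e

  same-link : ∀ i u v x → u ≢ v → u ≢ x → col u ≡ i → col v ≡ i → col x ≡ i → adj G u v ≡ adj G u x
  same-link i u v x u≢v u≢x eu ev ex = decidable-stable (adj G u v ≟ᵇ adj G u x) (λ ne →
    let v≢x : v ≢ x
        v≢x v≡x = ne (cong (adj G u) v≡x)
    in differ _ _ ne
      (not-mixed i u v x u≢v u≢x v≢x (constant u i eu) (constant v i ev) (constant x i ex))
      (λ a b → not-mixed i u x v u≢x u≢v (v≢x ∘ sym) (constant u i eu) (constant x i ex) (constant v i ev) b a))
    where
    differ : ∀ (b c : Bool) → b ≢ c → (b ≡ true → c ≡ false → ⊥) → (b ≡ false → c ≡ true → ⊥) → ⊥
    differ true  true  ne _ _ = ne refl
    differ true  false _  h _ = h refl refl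
    differ false true  _  _ h = h refl refl
    differ false false ne _ _ = ne refl

  same-pair : ∀ i a b u v → a ≢ b → u ≢ v → col a ≡ i → col b ≡ i → col u ≡ i → col v ≡ i → adj G a b ≡ adj G u v
  same-pair i a b u v a≢b u≢v ca cb cu cv = by-equality (a ≟ᶠ u)
    where
    by-equality : Dec (a ≡ u) → adj G a b ≡ adj G u v
    by-equality (yes a≡u) = trans (same-link i a b v a≢b (λ a≡v → u≢v (trans (sym a≡u) a≡v)) ca cb cv) (cong (λ z → adj G z v) a≡u)
    by-equality (no a≢u)  = trans (same-link i a b u a≢b a≢u ca cb cu) (trans (adj-sym G a u) (same-link i u a v (a≢u ∘ sym) u≢v cu ca cv))

  NonEdge : Fin s → Set
  NonEdge i = ∃ λ a → ∃ λ b → a ≢ b × col a ≡ i × col b ≡ i × adj G a b ≡ false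

  nonEdge? : ∀ i → Dec (NonEdge i)
  nonEdge? i = any? λ a → any? λ b → ¬? (a ≟ᶠ b) ×-dec ((col a ≟ᶠ i) ×-dec ((col b ≟ᶠ i) ×-dec (adj G a b ≟ᵇ false)))

  opaque
    colType : Fin s → Bool
    colType i = not (does (nonEdge? i))

    colType-homogeneous : ∀ u v → u ≢ v → col u ≡ col v → adj G u v ≡ colType (col u)
    colType-homogeneous u v u≢v e = by-edge (nonEdge? (col u))
      where
      by-edge : (d : Dec (NonEdge (col u))) → adj G u v ≡ not (does d)
      by-edge (yes (a , b , a≢b , ca , cb , ab)) = trans (sym (same-pair (col u) a b u v a≢b u≢v ca cb refl (sym e))) ab
      by-edge (no none) = ≢false⇒true (λ f → none (u , v , u≢v , refl , sym e , f))

  -- By `class-colour` the colour class contains `V i`, so no vertex of `V i` has a neighbour there.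
  -- This transfers the type of the colouring to that of the frame, where `two-stable` can be
  -- applied.
  stable-type : ∀ i → colType i ≡ false → classType i ≡ false
  stable-type i e = classType-false i (≤-trans (≤-trans (n≤1+n γ) γ<big) (≤-trans (V-big i) (#-mono all-few)))
    where
    stable : ∀ y → V i y ≡ true → ∀ z → V i z ∧ link G true y z ≡ true → ⊥
    stable y Vy z ez =
      let (Vz , l) = ∧-split {V i z} ez
          cy = class-colour i y Vy
      in true≢false (trans (sym (link-adj G true y z l))
        (trans (colType-homogeneous y z (link-≢ G true y z l) (trans cy (sym (class-colour i z Vz)))) (trans (cong colType cy) e)))
      where
      true≢false : true ≢ false
      true≢false ()
    all-few : ∀ y → V i y ≡ true → few true i y ≡ true
    all-few y Vy = few-intro true i y Vy
      (≤-trans (≤-reflexive (trans (cong (K *_) (#-zero _ (stable y Vy))) (*-zeroʳ K))) z≤n)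

  final-structure : HomogeneousColouring G s
  final-structure = record
    { col = col ; ty = colType ; homogeneous = colType-homogeneous
    ; one-stable = λ i j i≢j ei ej → no-star (two-stable frame v₀ i j i≢j (stable-type i ei) (stable-type j ej)
        (λ k → ≤-trans (≤-reflexive starBound≡big) (V-big k))) }

-- Good partitions as homogeneous colourings

colouring⇒good : ∀ {n r} (G : Graph n) → HomogeneousColouring G (2 + r) → GoodPartition (3 + r) G
colouring⇒good {n} {r} G H with any? (λ i → HomogeneousColouring.ty H i ≟ᵇ false)
... | no none = inj₁ (tabulate col , λ i j i≢j e →
    let same = trans (sym (lookup∘tabulate col i)) (trans e (lookup∘tabulate col j))
    in trans (homogeneous i j i≢j same) (case bool-cases (ty (col i)) of λ { (inj₁ t) → t ; (inj₂ f) → ⊥-elim (none (col i , f)) }))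
  where open HomogeneousColouring H
... | yes (z , tz) = inj₂ (tabulate (part′ ∘ col) , λ i j i≢j →
      (λ ei ej → trans (homogeneous i j i≢j (trans (stable i ei) (sym (stable j ej)))) (trans (cong ty (stable i ei)) tz))
    , (λ x ei ej → clique i j x i≢j (trans (sym (lookup∘tabulate (part′ ∘ col) i)) ei) (trans (sym (lookup∘tabulate (part′ ∘ col) j)) ej)))
  where
  open HomogeneousColouring H
  part′ : Fin (2 + r) → Maybe (Fin (1 + r))
  part′ i with z ≟ᶠ i
  ... | yes _ = nothing
  ... | no ne = just (punchOut ne)
  stable : ∀ i → lookup (tabulate (part′ ∘ col)) i ≡ nothing → col i ≡ z
  stable i e with z ≟ᶠ col i | trans (sym (lookup∘tabulate (part′ ∘ col) i)) e
  ... | yes eq | _ = sym eq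
  clique : ∀ i j x → i ≢ j → part′ (col i) ≡ just x → part′ (col j) ≡ just x → adj G i j ≡ true
  clique i j x i≢j ei ej with z ≟ᶠ col i | z ≟ᶠ col j
  clique i j x i≢j refl ej | no ni | no nj = trans (homogeneous i j i≢j (punchOut-injective ni nj (just-inj (sym ej))))
      (case bool-cases (ty (col i)) of λ { (inj₁ t) → t ; (inj₂ f) → ⊥-elim (one-stable z (col i) ni tz f) })
    where
    just-inj : ∀ {A : Set} {a b : A} → just a ≡ just b → a ≡ b
    just-inj refl = refl

good⇒colouring : ∀ {n r} (G : Graph n) → GoodPartition (3 + r) G → HomogeneousColouring G (2 + r)
good⇒colouring G (inj₁ (c , h)) = record
  { col = lookup c ; ty = λ _ → true ; homogeneous = h ; one-stable = λ _ _ _ () }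
good⇒colouring {n} {r} G (inj₂ (c , h)) = record
  { col = number ∘ lookup c ; ty = ty ; homogeneous = hom ; one-stable = one }
  where
  number : Maybe (Fin (1 + r)) → Fin (2 + r)
  number nothing  = zero
  number (just i) = suc i
  ty : Fin (2 + r) → Bool
  ty zero    = false
  ty (suc _) = true
  hom : ∀ u v → u ≢ v → number (lookup c u) ≡ number (lookup c v) → adj G u v ≡ ty (number (lookup c u))
  hom u v u≢v e with lookup c u in eu | lookup c v in ev
  ... | nothing | nothing = proj₁ (h u v u≢v) eu ev
  ... | just i  | just j with sucᶠ-injective e
  ...   | refl = proj₂ (h u v u≢v) i eu ev
  one : ∀ i j → i ≢ j → ty i ≡ false → ty j ≢ false
  one zero zero i≢j _ _ = i≢j refl

-- Without a stable class, the centre and the leaves are s + 1 pairwise non-adjacent vertices in s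
-- cliques. With a stable class, every edge between middle and leaf has an end in a clique; these s
-- ends are pairwise non-adjacent and only s - 1 cliques are available.
no-star-coloured : ∀ {n s} (G : Graph n) → HomogeneousColouring G s → ¬ HasStar s G
no-star-coloured {n} {s} G H (e , links) with any? (λ z → HomogeneousColouring.ty H z ≟ᵇ false)
... | no none = let (i , j , i<j , same) = pigeonhole (n<1+n s) (col ∘ e ∘ outer)
                    i≢j : i ≢ j
                    i≢j eq = n≮n (toℕ j) (subst (λ z → toℕ z < toℕ j) eq i<j)
                    o≢ : outer i ≢ outer j
                    o≢ eq = i≢j (outer-inj i j eq)
                in case trans (sym (clique _ _ (link-≢ G _ _ _ (links _ _ o≢)) same)) (trans (link-adj G _ _ _ (links _ _ o≢)) (outer-stable i j)) of λ ()
  where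
  open HomogeneousColouring H
  outer : Fin (suc s) → SVert s
  outer zero    = centre
  outer (suc i) = leaf i
  outer-inj : ∀ i j → outer i ≡ outer j → i ≡ j
  outer-inj zero    zero    _    = refl
  outer-inj (suc i) (suc j) refl = refl
  outer-stable : ∀ i j → sadj (outer i) (outer j) ≡ false
  outer-stable zero    zero    = refl
  outer-stable zero    (suc j) = refl
  outer-stable (suc i) zero    = refl
  outer-stable (suc i) (suc j) = refl
  clique : ∀ u v → u ≢ v → col u ≡ col v → adj G u v ≡ true
  clique u v u≢v eq = trans (homogeneous u v u≢v eq) (case bool-cases (ty (col u)) of λ { (inj₁ t) → t ; (inj₂ f) → ⊥-elim (none (col u , f)) })
no-star-coloured {n} {suc s} G H (e , links) | yes (z , tz) =
    let (i , j , i<j , same) = pigeonhole (n<1+n s) (λ i → punchOut (clique≢z i))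
        i≢j : i ≢ j
        i≢j eq = n≮n (toℕ j) (subst (λ z → toℕ z < toℕ j) eq i<j)
        o≢ : pick i ≢ pick j
        o≢ eq = i≢j (pick-inj i j eq)
        same-col = punchOut-injective (clique≢z i) (clique≢z j) same
    in case trans (sym (trans (homogeneous _ _ (link-≢ G _ _ _ (links _ _ o≢)) same-col) (pick-clique i)))
         (trans (link-adj G _ _ _ (links _ _ o≢)) (pick-stable i j i≢j)) of λ ()
  where
  open HomogeneousColouring H
  -- One end of every outer edge lies in a clique.
  choice : ∀ i → ∃ λ b → ty (col (e (choose b (mid i) (leaf i)))) ≡ true
  choice i with bool-cases (ty (col (e (mid i)))) | bool-cases (ty (col (e (leaf i))))
  ... | inj₁ a | _ = true , a
  ... | inj₂ _ | inj₁ b = false , b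
  ... | inj₂ a | inj₂ b = ⊥-elim (case trans (sym (link-adj G _ _ _ ml)) (trans (homogeneous _ _ (link-≢ G _ _ _ ml) same) a) of λ eq →
          case trans (sym (==-refl i)) eq of λ ())
    where
    ml : link G (sadj (mid i) (leaf i)) (e (mid i)) (e (leaf i)) ≡ true
    ml = links (mid i) (leaf i) (λ ())
    same : col (e (mid i)) ≡ col (e (leaf i))
    same with col (e (mid i)) ≟ᶠ col (e (leaf i))
    ... | yes eq = eq
    ... | no ne = ⊥-elim (one-stable _ _ ne a b)
  pick : Fin (suc s) → SVert (suc s)
  pick i = choose (proj₁ (choice i)) (mid i) (leaf i)
  pick-clique : ∀ i → ty (col (e (pick i))) ≡ true
  pick-clique i = proj₂ (choice i)
  clique≢z : ∀ i → z ≢ col (e (pick i))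
  clique≢z i eq = case trans (sym (pick-clique i)) (trans (cong ty (sym eq)) tz) of λ ()
  end-inj : ∀ b c (i j : Fin (suc s)) → choose b (mid i) (leaf i) ≡ choose c (mid j) (leaf j) → i ≡ j
  end-inj true  true  i j refl = refl
  end-inj false false i j refl = refl
  end-stable : ∀ b c (i j : Fin (suc s)) → i ≢ j → sadj (choose b (mid i) (leaf i)) (choose c (mid j) (leaf j)) ≡ false
  end-stable true  true  i j ne = refl
  end-stable true  false i j ne = dec-false (i ≟ᶠ j) ne
  end-stable false true  i j ne = dec-false (j ≟ᶠ i) (ne ∘ sym)
  end-stable false false i j ne = refl
  pick-inj : ∀ i j → pick i ≡ pick j → i ≡ j
  pick-inj i j = end-inj (proj₁ (choice i)) (proj₁ (choice j)) i j
  pick-stable : ∀ i j → i ≢ j → sadj (pick i) (pick j) ≡ false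
  pick-stable i j = end-stable (proj₁ (choice i)) (proj₁ (choice j)) i j
no-star-coloured {n} {zero} G H _ | yes (() , _)

-- Extending a homogeneous colouring by a vertex in its smallest class

agreeing : ∀ {m} (D : Fin m → Bool) (β : Bool) → List (Vec Bool m)
agreeing {zero}  D β = [] ∷ []
agreeing {suc m} D β = choose (D zero) (map (β ∷_) tails) (map (true ∷_) tails ++ map (false ∷_) tails)
  where
  tails = agreeing (D ∘ suc) β

opaque
  unfolding sumF #
  agreeing-length : ∀ {m} (D : Fin m → Bool) β → length (agreeing D β) ≡ 2 ^ # (λ x → not (D x))
  agreeing-length {zero}  D β = refl
  agreeing-length {suc m} D β with D zero
  ... | true  = trans (length-map (β ∷_) (agreeing (D ∘ suc) β)) (agreeing-length (D ∘ suc) β)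
  ... | false = trans (length-++ (map (true ∷_) (agreeing (D ∘ suc) β))) (cong₂ _+_
        (trans (length-map (true ∷_) (agreeing (D ∘ suc) β)) (agreeing-length (D ∘ suc) β))
        (trans (trans (length-map (false ∷_) (agreeing (D ∘ suc) β)) (agreeing-length (D ∘ suc) β)) (sym (+-identityʳ _))))

∷-injectiveʳ′ : ∀ {m} {b : Bool} {v w : Vec Bool m} → b ∷ v ≡ b ∷ w → v ≡ w
∷-injectiveʳ′ refl = refl

agreeing-unique : ∀ {m} (D : Fin m → Bool) β → Unique (agreeing D β)
agreeing-unique {zero}  D β = [] ∷ []
agreeing-unique {suc m} D β with D zero
... | true  = UniqueP.map⁺ ∷-injectiveʳ′ (agreeing-unique (D ∘ suc) β)
... | false = UniqueP.++⁺ (UniqueP.map⁺ ∷-injectiveʳ′ (agreeing-unique (D ∘ suc) β)) (UniqueP.map⁺ ∷-injectiveʳ′ (agreeing-unique (D ∘ suc) β))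
      (λ { (a , b) → case ∈-map⁻ _ a of λ { (_ , _ , refl) → case ∈-map⁻ _ b of λ { (_ , _ , ()) } } })

agreeing-sound : ∀ {m} (D : Fin m → Bool) β {v} → v ∈ agreeing D β → ∀ x → D x ≡ true → lookup v x ≡ β
agreeing-sound {suc m} D β v∈ x Dx with D zero in eq
agreeing-sound {suc m} D β v∈ x Dx | true with ∈-map⁻ _ v∈
agreeing-sound {suc m} D β v∈ zero    Dx | true | (w , w∈ , refl) = refl
agreeing-sound {suc m} D β v∈ (suc x) Dx | true | (w , w∈ , refl) = agreeing-sound (D ∘ suc) β w∈ x Dx
agreeing-sound {suc m} D β v∈ zero    Dx | false = case trans (sym eq) Dx of λ ()
agreeing-sound {suc m} D β v∈ (suc x) Dx | false with ∈-++⁻ (map (true ∷_) (agreeing (D ∘ suc) β)) v∈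
... | inj₁ a = case ∈-map⁻ _ a of λ { (w , w∈ , refl) → agreeing-sound (D ∘ suc) β w∈ x Dx }
... | inj₂ a = case ∈-map⁻ _ a of λ { (w , w∈ , refl) → agreeing-sound (D ∘ suc) β w∈ x Dx }

smallest-class : ∀ {n r} (c : Fin n → Fin (suc r)) → ∃ λ i → suc r * # (λ v → c v == i) ≤ n
smallest-class {n} {r} c with any? (λ i → suc r * # (λ v → c v == i) ≤? n)
... | yes found = found
... | no none = ⊥-elim (<⇒≱ (*-monoʳ-< (suc r) (n<1+n n)) (begin
    suc r * suc n ≡⟨ sym (sumF-const (suc r) (suc n)) ⟩
    sumF {suc r} (λ _ → suc n) ≤⟨ sumF-mono (λ i → ≰⇒> (λ le → none (i , le))) ⟩
    sumF (λ i → suc r * # (λ v → c v == i)) ≡⟨ sumF-*ˡ (suc r) (λ i → # (λ v → c v == i)) ⟩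
    suc r * sumF (λ i → # (λ v → c v == i)) ≡⟨ cong (suc r *_) (trans (#-swap (λ i v → c v == i)) (trans (sumF-cong one) (sumF-const n 1))) ⟩
    suc r * (n * 1) ≡⟨ cong (suc r *_) (*-identityʳ n) ⟩
    suc r * n ∎))
  where
  open ≤-Reasoning
  one : ∀ v → # (λ i → c v == i) ≡ 1
  one v = ≤-antisym (#-unique (λ i → c v == i) (λ a b ea eb → trans (sym (==-sound {i = c v} ea)) (==-sound {i = c v} eb)))
    (#-pos (λ i → c v == i) (c v) (==-refl (c v)))

extend-colouring : ∀ {m s} (G : Graph m) (H : HomogeneousColouring G s) i (v : Vec Bool m) →
  (∀ x → HomogeneousColouring.col H x ≡ i → lookup v x ≡ HomogeneousColouring.ty H i) → HomogeneousColouring {suc m} (G , v) s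
extend-colouring {m} {s} G H i v hv = record { col = col⁺ ; ty = ty ; homogeneous = hom ; one-stable = one-stable }
  where
  open HomogeneousColouring H
  col⁺ : Fin (suc m) → Fin s
  col⁺ zero    = i
  col⁺ (suc x) = col x
  hom : ∀ x y → x ≢ y → col⁺ x ≡ col⁺ y → adj {suc m} (G , v) x y ≡ ty (col⁺ x)
  hom zero    zero    ne _ = ⊥-elim (ne refl)
  hom zero    (suc y) ne e = hv y (sym e)
  hom (suc x) zero    ne e = trans (hv x e) (cong ty (sym e))
  hom (suc x) (suc y) ne e = homogeneous x y (ne ∘ cong suc) e

goodCount : ℕ → ℕ → ℕ
goodCount r n = count n (GoodPartition (3 + r)) (goodPartition? (3 + r))

opaque
  good? : ∀ r {n} (G : Graph n) → Dec (GoodPartition {n} (3 + r) G)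
  good? r = goodPartition? (3 + r)

  goodGraphs : ∀ (r n : ℕ) → List (Graph n)
  goodGraphs r n = filter (goodPartition? (3 + r)) (allGraphs n)

  length-goodGraphs : ∀ (r n : ℕ) → length (goodGraphs r n) ≡ goodCount r n
  length-goodGraphs r n = refl

  goodGraphs-complete : ∀ r {n} (G : Graph n) → GoodPartition {n} (3 + r) G → G ∈ goodGraphs r n
  goodGraphs-complete r G = ∈-filter⁺ (goodPartition? (3 + r)) (allGraphs-complete G)

  goodGraphs-sound : ∀ r {n} (G : Graph n) → G ∈ goodGraphs r n → GoodPartition {n} (3 + r) G
  goodGraphs-sound r {n} G G∈ = proj₂ (∈-filter⁻ (goodPartition? (3 + r)) {xs = allGraphs n} G∈)

  goodGraphs-unique : ∀ (r n : ℕ) → Unique (goodGraphs r n)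
  goodGraphs-unique r n = UniqueP.filter⁺ (goodPartition? (3 + r)) (allGraphs-unique n)

good-extends : ∀ r → Extends (suc r) (goodCount r)
good-extends r m = m ∸ m / s , exponent , (begin
    2 ^ (m ∸ m / s) * goodCount r m ≡⟨ *-comm (2 ^ (m ∸ m / s)) (goodCount r m) ⟩
    goodCount r m * 2 ^ (m ∸ m / s) ≡⟨ cong (_* 2 ^ (m ∸ m / s)) (sym (length-goodGraphs r m)) ⟩
    length (goodGraphs r m) * 2 ^ (m ∸ m / s) ≤⟨ length-concatMap-≥ extensions (2 ^ (m ∸ m / s)) (goodGraphs r m) many ⟩
    length (concatMap extensions (goodGraphs r m))
      ≤⟨ unique-length (concatMap-unique extensions (goodGraphs-unique r m)
           (λ G → UniqueP.map⁺ (λ { refl → refl }) (UniqueP.filter⁺ (good⁺? G) (allVecBool-unique m)))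
           (λ a b → case ∈-map⁻ _ a of λ { (_ , _ , refl) → case ∈-map⁻ _ b of λ { (_ , _ , refl) → refl } }))
         included ⟩
    length (goodGraphs r (suc m)) ≡⟨ length-goodGraphs r (suc m) ⟩
    goodCount r (suc m) ∎)
  where
  open ≤-Reasoning
  s = 2 + r
  good⁺? : ∀ (G : Graph m) v → Dec (GoodPartition {suc m} (3 + r) (G , v))
  good⁺? G v = good? r {suc m} (G , v)
  extensions : Graph m → List (Graph (suc m))
  extensions G = map (G ,_) (filter (good⁺? G) (allVecBool m))
  exponent : suc r * m ≤ s * (m ∸ m / s)
  exponent = ≤-trans (certificate {X = s * (m / s)} {Y = m} 0 (d*[m/d]≤m m (suc r)) refl′) (≤-reflexive (sym (*-distribˡ-∸ s m (m / s))))
    where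
    refl′ : suc r * m + m + 0 ≡ (s * m ∸ s * (m / s)) + s * (m / s)
    refl′ = trans (+-identityʳ _) (trans (+-comm (suc r * m) m) (sym (m∸n+n≡m (*-monoʳ-≤ s (≤-trans (m≤n*m (m / s) s) (d*[m/d]≤m m (suc r)))))))
  included : ∀ {G} → G ∈ concatMap extensions (goodGraphs r m) → G ∈ goodGraphs r (suc m)
  included {G} G∈ = let (G₀ , _ , G∈₀) = ∈-concatMap⁻′ extensions (goodGraphs r m) G∈
                        (v , v∈ , eq) = ∈-map⁻ (G₀ ,_) G∈₀
                    in subst (_∈ goodGraphs r (suc m)) (sym eq)
                         (goodGraphs-complete r {suc m} (G₀ , v) (proj₂ (∈-filter⁻ (good⁺? G₀) {xs = allVecBool m} v∈)))
  many : ∀ G → G ∈ goodGraphs r m → 2 ^ (m ∸ m / s) ≤ length (extensions G)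
  many G G∈ = begin
    2 ^ (m ∸ m / s) ≤⟨ ^-monoʳ-≤ 2 (≤-trans (∸-monoʳ-≤ m small) (≤-reflexive (trans (cong (_∸ # D) (sym (#-complement D))) (m+n∸m≡n (# D) _)))) ⟩
    2 ^ # (λ x → not (D x)) ≡⟨ sym (agreeing-length D (ty i)) ⟩
    length (agreeing D (ty i)) ≤⟨ unique-length (agreeing-unique D (ty i)) (λ {v} v∈ → ∈-filter⁺ (good⁺? G) (allVecBool-complete v)
        (colouring⇒good {suc m} (G , v) (extend-colouring G H i v (λ x e → agreeing-sound D (ty i) v∈ x (trans (cong (_== i) e) (==-refl i)))))) ⟩
    length (filter (good⁺? G) (allVecBool m)) ≡⟨ sym (length-map (G ,_) (filter (good⁺? G) (allVecBool m))) ⟩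
    length (extensions G) ∎
    where
    H : HomogeneousColouring G s
    H = good⇒colouring G (goodGraphs-sound r G G∈)
    open HomogeneousColouring H
    smallest : ∃ λ i → s * # (λ v → col v == i) ≤ m
    smallest = smallest-class col
    i : Fin s
    i = proj₁ smallest
    D : Fin m → Bool
    D x = col x == i
    small : # D ≤ m / s
    small = floor-≤ (suc r) (# D) m (proj₂ smallest)

goodCount≥1 : ∀ r n → 1 ≤ goodCount r n
goodCount≥1 r n = nonempty (∈-filter⁺ (goodPartition? (3 + r)) (allGraphs-complete complete-graph)
    (colouring⇒good complete-graph record { col = λ _ → zero ; ty = λ _ → true ; homogeneous = all-adjacent ; one-stable = λ _ _ _ () }))
  where
  nonempty : ∀ {A : Set} {x : A} {xs} → x ∈ xs → 1 ≤ length xs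
  nonempty (here _)  = s≤s z≤n
  nonempty (there _) = s≤s z≤n
  complete-graph : Graph n
  complete-graph = mkGraph n (λ i j → not (i == j))
  all-adjacent : ∀ u v → u ≢ v → zero {suc r} ≡ zero → adj complete-graph u v ≡ true
  all-adjacent u v u≢v _ = trans (adj-mkGraph (λ i j → not (i == j)) (λ i j → cong not (==-sym i j)) (λ i → cong not (==-refl i)) u v)
      (≢true⇒not (u≢v ∘ ==-sound))
    where
    ==-sym : ∀ i j → (i == j) ≡ (j == i)
    ==-sym i j = bool-eq (λ e → trans (cong (_== i) (sym (==-sound {i = i} e))) (==-refl i))
      (λ e → trans (cong (_== j) (sym (==-sound {i = j} e))) (==-refl j))

-- The stability number of a subdivided star

opaque
  unfolding sumF #
  ∣∣≡# : ∀ {n} (S : Subset n) → ∣ S ∣ ≡ # (lookup S)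
  ∣∣≡# []          = refl
  ∣∣≡# (true ∷ S)  = cong suc (∣∣≡# S)
  ∣∣≡# (false ∷ S) = ∣∣≡# S

-- The centre and the s edges between middle and leaf are s + 1 cliques covering the star; the
-- centre and the leaves form a stable set of that size.
star-stability : ∀ {m s a} (T : Graph m) (φ : Fin m → SVert s) → (∀ {i j} → φ i ≡ φ j → i ≡ j) →
  (∀ v → ∃ λ x → φ x ≡ v) → (∀ i j → adj T i j ≡ sadj (φ i) (φ j)) → IsStabilityNumber T a → a ≡ suc s
star-stability {m} {s} {a} T φ φ-inj φ-surj φ-adj ((S , stable , size) , maximal) = ≤-antisym upper lower
  where
  branch : SVert s → Fin (suc s)
  branch centre   = zero
  branch (mid i)  = suc i
  branch (leaf i) = suc i
  branch-inj : ∀ v w → sadj v w ≡ false → branch v ≡ branch w → v ≡ w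
  branch-inj centre   centre   _ _ = refl
  branch-inj (mid i)  (mid j)  _ e = cong mid (sucᶠ-injective e)
  branch-inj (leaf i) (leaf j) _ e = cong leaf (sucᶠ-injective e)
  branch-inj (mid i)  (leaf j) f e = case trans (sym f) (trans (cong (_== j) (sucᶠ-injective e)) (==-refl j)) of λ ()
  branch-inj (leaf i) (mid j)  f e = case trans (sym f) (trans (cong (_== i) (sym (sucᶠ-injective e))) (==-refl i)) of λ ()
  upper : a ≤ suc s
  upper = ≤-trans (≤-reflexive (trans (sym size) (∣∣≡# S))) (≤-trans
    (#-injection (lookup S) (λ _ → true) (branch ∘ φ) (λ _ _ → refl)
      (λ x y ex ey e → φ-inj (branch-inj (φ x) (φ y) (trans (sym (φ-adj x y)) (stable x y (lookup⇒[]= x S ex) (lookup⇒[]= y S ey))) e)))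
    (≤-reflexive (#-all (suc s))))
  outer : SVert s → Bool
  outer centre   = true
  outer (mid _)  = false
  outer (leaf _) = true
  outer-stable : ∀ v w → outer v ≡ true → outer w ≡ true → sadj v w ≡ false
  outer-stable centre   centre   _ _ = refl
  outer-stable centre   (leaf _) _ _ = refl
  outer-stable (leaf _) centre   _ _ = refl
  outer-stable (leaf _) (leaf _) _ _ = refl
  S⁺ : Subset m
  S⁺ = tabulate (outer ∘ φ)
  in-S⁺ : ∀ {x} → S⁺ Data.Vec.[ x ]= true → outer (φ x) ≡ true
  in-S⁺ {x} h = trans (sym (lookup∘tabulate (outer ∘ φ) x)) ([]=⇒lookup h)
  end : Fin (suc s) → SVert s
  end zero    = centre
  end (suc i) = leaf i
  end-outer : ∀ i → outer (end i) ≡ true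
  end-outer zero    = refl
  end-outer (suc i) = refl
  end-inj : ∀ i j → end i ≡ end j → i ≡ j
  end-inj zero    zero    _    = refl
  end-inj (suc i) (suc j) refl = refl
  lower : suc s ≤ a
  lower = ≤-trans (≤-trans (≤-reflexive (sym (#-all (suc s)))) (≤-trans
      (#-injection (λ _ → true) (lookup S⁺) (λ i → proj₁ (φ-surj (end i)))
        (λ i _ → trans (lookup∘tabulate (outer ∘ φ) _) (trans (cong outer (proj₂ (φ-surj (end i)))) (end-outer i)))
        (λ i j _ _ e → end-inj i j (trans (sym (proj₂ (φ-surj (end i)))) (trans (cong φ e) (proj₂ (φ-surj (end j)))))))
      (≤-reflexive (sym (∣∣≡# S⁺)))))
    (maximal S⁺ (λ i j hi hj → trans (φ-adj i j) (outer-stable (φ i) (φ j) (in-S⁺ hi) (in-S⁺ hj))))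

contains⇒star : ∀ {m s} (T : Graph m) (φ : Fin m → SVert s) → (∀ v → ∃ λ x → φ x ≡ v) →
  (∀ i j → adj T i j ≡ sadj (φ i) (φ j)) → ∀ {n} (G : Graph n) → ContainsInduced T G → HasStar s G
contains⇒star T φ φ-surj φ-adj G (f , f-inj , f-adj) = (λ v → lookup f (ψ v)) , λ v w v≢w →
    link-intro G (sadj v w) _ _ (λ e → v≢w (trans (sym (φψ v)) (trans (cong φ (f-inj (ψ v) (ψ w) e)) (φψ w))))
      (trans (f-adj (ψ v) (ψ w)) (trans (φ-adj (ψ v) (ψ w)) (cong₂ sadj (φψ v) (φψ w))))
  where
  ψ = λ v → proj₁ (φ-surj v)
  φψ = λ v → proj₂ (φ-surj v)

-- Choice of the constants and conclusion

module Assembly {k* : ℕ} (T : Graph k*) (r : ℕ) (star : ∀ {n} (G : Graph n) → HasStar (2 + r) G → ContainsInduced T G) where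

  open Typical T (suc r) (goodCount r) (good-extends r)

  Good : Property
  Good G = GoodPartition (3 + r) G

  private
    suc-∸1 : ∀ {x y} → x ≡ y ∸ 1 → 1 ≤ y → suc x ≡ y
    suc-∸1 refl y≥1 = m+[n∸m]≡n y≥1

  -- Every constant depends on earlier ones only: first those for splitting, then those for density
  -- between classes, then the balance `Kb`. The quality `K` of the classes and the number `k₀` of
  -- deletable vertices come last, although the classes are constructed first; this is possible
  -- because `stage-one` accepts any positive `K` and any `k₀`.
  module _ {E₁ b₁ K₁ P E′ q b₃ Kb b₂ K k₀ : ℕ} (E₁≡ : E₁ ≡ 4 * (2 + r) * κ ^ 2) (b₁≡ : b₁ ≡ 4 * 3 * suc (4 * E₁) ∸ 1)
    (K₁≡ : K₁ ≡ 4 * (suc b₁ * suc b₁) + suc (2 * (2 + r) * κ)) (P≡ : P ≡ κ ^ suc ((2 + r) + (2 + r)))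
    (E′≡ : E′ ≡ 2 * (K₁ * (κ * (κ * P)))) (q≡ : q ≡ 4 * suc (4 * suc E′)) (b₃≡ : b₃ ≡ 8 * suc (4 * suc E′) ∸ 1)
    (Kb≡ : Kb ≡ q * (2 + r) + 2 * suc (4 * E₁) * (3 * (2 + r) + 3) + 2 * ((2 + r) * (2 + r)) + 3) (b₂≡ : b₂ ≡ 4 * Kb ∸ 1)
    (K≡ : K ≡ 256 * E₁ + K₁ + 4 * (suc b₂ * suc b₂) + 4 * (suc b₃ * suc b₃) + 8 * suc E′ + Kb) (k₀≡ : k₀ ≡ q + 3) where

    Kb≥3 : 3 ≤ Kb
    Kb≥3 = ≤-trans (m≤n+m 3 _) (≤-reflexive (sym Kb≡))

    Kb≥1 : 1 ≤ Kb
    Kb≥1 = ≤-trans (s≤s z≤n) Kb≥3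

    summand : ∀ {x} a → K ≡ a → x ≤ a → x ≤ K
    summand a refl h = h

    Kb≤K : Kb ≤ K
    Kb≤K = summand _ K≡ (m≤n+m Kb _)

    K≥E : 8 * suc E′ ≤ K
    K≥E = summand _ K≡ (≤-trans (m≤n+m (8 * suc E′) _) (m≤m+n _ Kb))

    K≥b₃ : 4 * (suc b₃ * suc b₃) ≤ K
    K≥b₃ = summand _ K≡ (≤-trans (m≤n+m (4 * (suc b₃ * suc b₃)) _) (≤-trans (m≤m+n _ (8 * suc E′)) (m≤m+n _ Kb)))

    K≥b₂ : 4 * (suc b₂ * suc b₂) ≤ K
    K≥b₂ = summand _ K≡ (≤-trans (m≤n+m (4 * (suc b₂ * suc b₂)) _) (≤-trans (m≤m+n _ (4 * (suc b₃ * suc b₃))) (≤-trans (m≤m+n _ (8 * suc E′)) (m≤m+n _ Kb))))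

    K≥K₁ : K₁ ≤ K
    K≥K₁ = summand _ K≡ (≤-trans (m≤n+m K₁ (256 * E₁)) (≤-trans (m≤m+n _ (4 * (suc b₂ * suc b₂)))
      (≤-trans (m≤m+n _ (4 * (suc b₃ * suc b₃))) (≤-trans (m≤m+n _ (8 * suc E′)) (m≤m+n _ Kb)))))

    K≥E₁ : 256 * E₁ ≤ K
    K≥E₁ = summand _ K≡ (≤-trans (m≤m+n (256 * E₁) K₁) (≤-trans (m≤m+n _ (4 * (suc b₂ * suc b₂)))
      (≤-trans (m≤m+n _ (4 * (suc b₃ * suc b₃))) (≤-trans (m≤m+n _ (8 * suc E′)) (m≤m+n _ Kb)))))

    K≥1 : 1 ≤ K
    K≥1 = ≤-trans Kb≥1 Kb≤K

    K₁≥b₁ : 4 * (suc b₁ * suc b₁) ≤ K₁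
    K₁≥b₁ = ≤-trans (m≤m+n _ _) (≤-reflexive (sym K₁≡))

    b₁≡′ : suc b₁ ≡ 4 * 3 * suc (4 * E₁)
    b₁≡′ = suc-∸1 b₁≡ (s≤s z≤n)

    Kb≥split : 2 * suc (4 * E₁) * (3 * (2 + r) + 3) ≤ Kb
    Kb≥split = ≤-trans (m≤n+m _ (q * (2 + r))) (≤-trans (m≤m+n _ (2 * ((2 + r) * (2 + r)))) (≤-trans (m≤m+n _ 3) (≤-reflexive (sym Kb≡))))

    Kb≥2s² : 2 * ((2 + r) * (2 + r)) ≤ Kb
    Kb≥2s² = ≤-trans (m≤n+m _ (q * (2 + r) + 2 * suc (4 * E₁) * (3 * (2 + r) + 3))) (≤-trans (m≤m+n _ 3) (≤-reflexive (sym Kb≡)))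

    Kb≥q : 4 * suc (4 * suc E′) * (2 + r) ≤ Kb
    Kb≥q = ≤-trans (≤-reflexive (cong (_* (2 + r)) (sym q≡))) (≤-trans (m≤m+n _ _) (≤-trans (m≤m+n _ (2 * ((2 + r) * (2 + r)))) (≤-trans (m≤m+n _ 3) (≤-reflexive (sym Kb≡)))))

    k₀≥3 : 3 ≤ k₀
    k₀≥3 = ≤-trans (m≤n+m 3 q) (≤-reflexive (sym k₀≡))

    E₁≥ : ∀ k → k ≤ 2 → 4 * (2 + r) * κ ^ k ≤ E₁
    E₁≥ k k≤2 = ≤-trans (*-monoʳ-≤ (4 * (2 + r)) (^-monoʳ-≤ κ {{κ≢0}} k≤2)) (≤-reflexive (sym E₁≡))

    module _ (codes : Codes (2 + r)) (e : ℕ) (short : Short codes e) where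

      private
        module Two = StageTwo T r (goodCount r) (good-extends r) K k₀ e codes short
        module Bal = Two.Balance Kb b₂ (suc-∸1 b₂≡ (≤-trans Kb≥1 (m≤n*m Kb 4))) Kb≥1 K≥b₂ (≤-trans (s≤s z≤n) k₀≥3)

        Φ₀ Φ₁ Φ₂ Φ₃ : ∀ {n} {G : Graph n} → Classes G (2 + r) K k₀ codes → Set
        Φ₀ Cls = ⊤
        Φ₁ Cls = Splits K₁ 0 Cls
        Φ₂ Cls = Splits K₁ 0 Cls × Splits K₁ 1 Cls
        Φ₃ Cls = Splits K₁ 0 Cls × Splits K₁ 1 Cls × Splits K₁ 2 Cls

        module Three₀ = StageThree T r (goodCount r) (good-extends r) K k₀ e codes short Kb Kb≤K Kb≥1 Kb≥2s² Φ₀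
        module Three₁ = StageThree T r (goodCount r) (good-extends r) K k₀ e codes short Kb Kb≤K Kb≥1 Kb≥2s² Φ₁
        module Three₂ = StageThree T r (goodCount r) (good-extends r) K k₀ e codes short Kb Kb≤K Kb≥1 Kb≥2s² Φ₂
        split-constants : ∀ k j → suc k ≤ k₀ → k ≤ 2 → 2 ≡ k + j → SplitConstants r K k₀ Kb
        split-constants k j k<k₀ k≤2 2≡k+j = record
          { k = k ; j = j ; E = E₁ ; K₁ = K₁ ; b′ = b₁ ; k<k₀ = k<k₀ ; E≥ = E₁≥ k k≤2
          ; b≡ = subst (λ z → suc b₁ ≡ 4 * suc z * suc (4 * E₁)) 2≡k+j b₁≡′
          ; Kb≥′ = subst (λ z → 2 * suc (4 * E₁) * (suc z * (2 + r) + 3) ≤ Kb) 2≡k+j Kb≥split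
          ; K≥E = K≥E₁ ; K₁≥ = K₁≥b₁ ; K≥K₁ = K≥K₁ }
        module Split₀ = Three₀.Split (split-constants 0 2 (≤-trans (s≤s z≤n) k₀≥3) z≤n refl)
        module Split₁ = Three₁.Split (split-constants 1 1 (≤-trans (s≤s (s≤s z≤n)) k₀≥3) (s≤s z≤n) refl)
        module Split₂ = Three₂.Split (split-constants 2 0 k₀≥3 ≤-refl refl)
        regular-constants : RegularConstants r K k₀ Kb
        regular-constants = record
          { E = suc E′ ; b′ = b₃ ; q = q ; E≥1 = s≤s z≤n ; q≡ = q≡ ; b≡ = suc-∸1 b₃≡ (s≤s z≤n) ; K≥ = K≥b₃ ; Kb≥ = Kb≥q
          ; k₀≥ = ≤-trans (m≤m+n q 3) (≤-reflexive (sym k₀≡)) }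
        module Four = StageFour T r (goodCount r) (good-extends r) K k₀ e codes short Kb Kb≤K Kb≥3 Φ₃ regular-constants

        N : ℕ
        N = 4 * (K₁ * (κ * (κ * P))) + 8 * suc E′

        finish : ∀ {n} → N ≤ n → (G : Graph n) → Free T G → Four.P⁺ G → Good G
        finish {n} N≤n G fr (Cls , bal , (sp₀ , sp₁ , sp₂) , reg) = colouring⇒good G
          (Final.final-structure {Cls = Cls} record
            { no-star = fr ∘ star G ; Kb = Kb ; K₁ = K₁ ; E′ = E′ ; γ = suc (n / suc E′) ; P = P ; big = P * suc (suc (n / suc E′))
            ; γ≡ = refl ; P≡ = P≡ ; big≡ = refl ; Kb≤K = Kb≤K ; Kb≥1 = Kb≥1 ; Kb≥ = Kb≥2s² ; K₁≤K = K≥K₁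
            ; K₁≥ = ≤-trans (m≤n+m _ (4 * (suc b₁ * suc b₁))) (≤-reflexive (sym K₁≡))
            ; E≥ = ≤-trans (≤-reflexive (sym E′≡)) (n≤1+n E′) ; K≥E = K≥E ; n≥ = ≤-trans (m≤m+n _ _) N≤n
            ; n≥′ = ≤-trans (m≤n+m (8 * suc E′) _) N≤n
            ; bal = bal ; split₀ = sp₀ ; split₁ = sp₁ ; split₂ = sp₂ ; regular = reg })

      classes⇒good : Mostly Two.P₀ Good
      classes⇒good = mostly-trans Bal.mostly-balanced
        (mostly-trans (mostly-pure 0 (λ _ G _ (Cls , bal) → Cls , bal , tt))
        (mostly-trans Split₀.mostly-splits
        (mostly-trans (mostly-pure 0 (λ _ G _ (Cls , bal , _ , sp) → Cls , bal , sp))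
        (mostly-trans Split₁.mostly-splits
        (mostly-trans Split₂.mostly-splits
        (mostly-trans (mostly-pure 0 (λ _ G _ (Cls , bal , (sp₀ , sp₁) , sp₂) → Cls , bal , sp₀ , sp₁ , sp₂))
        (mostly-trans Four.mostly-regular (mostly-pure N finish))))))))

    mostly-good-with : Mostly (λ _ → ⊤) Good
    mostly-good-with =
      let (codes , e , short , most) = StageOne.stage-one T r (goodCount r) (good-extends r) star K k₀ K≥1
      in mostly-trans most (classes⇒good codes e short)

  opaque
    mostly-good : Mostly (λ _ → ⊤) Good
    mostly-good = mostly-good-with refl refl refl refl refl refl refl refl refl refl refl

  -- Good graphs are T-free by `no-star-coloured`, so what is negligible against `g` is negligible
  -- against the number of T-free graphs.
  bad-few : (∀ {n} (G : Graph n) → ContainsInduced T G → HasStar (2 + r) G) →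
    ∀ k → ∃ λ N → ∀ n → N ≤ n → suc k * numBad T (3 + r) n ≤ numFree T n
  bad-few contains k =
    let (N , h) = mostly-conclude mostly-good (numBad T (3 + r)) covered free≤ (goodCount≥1 r) (suc k)
    in N , λ n N≤n → ≤-trans (h n N≤n) (good≤free n)
    where
    bad? : ∀ {n} (G : Graph n) → Dec (Free T G × ¬ GoodPartition (3 + r) G)
    bad? G = free? T G ×-dec ¬? (goodPartition? (3 + r) G)
    covered : ∀ n (L : List (Graph n)) → (∀ G → Free T G → G ∈ L ⊎ Good G) → numBad T (3 + r) n ≤ length L
    covered n L cov = unique-length (UniqueP.filter⁺ bad? (allGraphs-unique n)) λ {G} G∈ →
      let (fr , ¬good) = proj₂ (∈-filter⁻ bad? {xs = allGraphs n} G∈)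
      in case cov G fr of λ { (inj₁ G∈L) → G∈L ; (inj₂ good) → ⊥-elim (¬good good) }
    free≤ : ∀ n → numFree T n ≤ goodCount r n + numBad T (3 + r) n
    free≤ n = ≤-trans (unique-length (UniqueP.filter⁺ (free? T) (allGraphs-unique n)) split)
      (≤-reflexive (length-++ (filter (goodPartition? (3 + r)) (allGraphs n))))
      where
      split : ∀ {G} → G ∈ filter (free? T) (allGraphs n) → G ∈ filter (goodPartition? (3 + r)) (allGraphs n) ++ filter bad? (allGraphs n)
      split {G} G∈ with goodPartition? (3 + r) G
      ... | yes good = ∈-++⁺ˡ (∈-filter⁺ (goodPartition? (3 + r)) (allGraphs-complete G) good)
      ... | no ¬good = ∈-++⁺ʳ (filter (goodPartition? (3 + r)) (allGraphs n))
            (∈-filter⁺ bad? (allGraphs-complete G) (proj₂ (∈-filter⁻ (free? T) {xs = allGraphs n} G∈) , ¬good))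
    good≤free : ∀ n → goodCount r n ≤ numFree T n
    good≤free n = unique-length (UniqueP.filter⁺ (goodPartition? (3 + r)) (allGraphs-unique n)) λ {G} G∈ →
      ∈-filter⁺ (free? T) (allGraphs-complete G) (λ c → no-star-coloured G
        (good⇒colouring G (proj₂ (∈-filter⁻ (goodPartition? (3 + r)) {xs = allGraphs n} G∈))) (contains G c))

mainTheorem3 : ∀ {m} (T : Graph m) (a : ℕ) →
    IsSubdividedStar T → IsStabilityNumber T a → 3 ≤ a →
    ∀ (k : ℕ) → ∃ λ (N : ℕ) → ∀ (n : ℕ) → N ≤ n →
    suc k * numBad T a n ≤ numFree T n
mainTheorem3 T a (s , φ , (φ-inj , φ-surj) , φ-adj) stab 3≤a = go s φ φ-inj surj (adj-star T φ φ-adj) (star-stability T φ φ-inj surj (adj-star T φ φ-adj) stab) 3≤a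
  where
  surj : ∀ v → ∃ λ x → φ x ≡ v
  surj v = proj₁ (φ-surj v) , proj₂ (φ-surj v) refl
  go : ∀ s (φ : Fin _ → SVert s) → (∀ {i j} → φ i ≡ φ j → i ≡ j) → (∀ v → ∃ λ x → φ x ≡ v) →
    (∀ i j → adj T i j ≡ sadj (φ i) (φ j)) → a ≡ suc s → 3 ≤ a →
    ∀ k → ∃ λ N → ∀ n → N ≤ n → suc k * numBad T a n ≤ numFree T n
  -- Here a = suc s, so a ≥ 3 leaves at least two branches.
  go (suc (suc r)) φ φ-inj surj φ-adj refl _ = Assembly.bad-few T r (star⇒contains T φ φ-inj φ-adj) (contains⇒star T φ surj φ-adj)
  go zero          φ φ-inj surj φ-adj refl (s≤s ())
  go (suc zero)    φ φ-inj surj φ-adj refl (s≤s (s≤s ()))
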